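{- Let $k,\ell\in \mathbb{N}_{\geq 2}$ be multiplicatively independent. Let $X\subseteq \mathbb{N}^m$ be $k$-recognizable and let $Y\subseteq \mathbb{N}^n$ be $\ell$-recognizable, and suppose that neither $X$ nor $Y$ is first-order definable in $(\mathbb{N},+)$. Then the first-order theory $\mathrm{FO}(\mathbb{N},+,X,Y)$ (the set of first-order sentences true in the structure $(\mathbb{N},+,X,Y)$) is undecidable.
   Context: $\mathbb{N}$ contains $0$. Two integers $k,\ell\geq 2$ are multiplicatively independent if $k^a\neq \ell^b$ for all nonzero $a,b\in\mathbb{Z}$. A set $X\subseteq\mathbb{N}^n$ is $k$-recognizable if the set of (digit-wise padded) base-$k$ representations of the elements of $X$ is accepted by some finite automaton. "Definable" means first-order definable without parameters. -}

module Defs where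

open import Data.Nat using (ℕ; zero; suc; _+_; _*_; _^_; _<_; _≥_)
open import Data.Fin using (Fin; toℕ) renaming (zero to fz; suc to fs)
open import Data.Vec using (Vec; []; _∷_; lookup; replicate; zipWith)
open import Data.List using (List; foldl; length) renaming ([] to []ᴸ; _∷_ to _∷ᴸ_)
open import Data.Bool using (Bool; true)
open import Data.Product using (Σ; ∃; _×_; _,_)
open import Data.Empty using (⊥)
open import Relation.Nullary using (¬_)
open import Relation.Binary.PropositionalEquality using (_≡_; _≢_)
open import Function.Bundles using (_⇔_)

MultIndep : ℕ → ℕ → Set
MultIndep k ℓ = ∀ a b → a ≥ 1 → b ≥ 1 → k ^ a ≢ ℓ ^ b

record DFA (Σ' : Set) : Set where
  field
    nstates   : ℕ
    start     : Fin nstates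
    δ         : Fin nstates → Σ' → Fin nstates
    accepting : Fin nstates → Bool

accepts : ∀ {Σ'} → DFA Σ' → List Σ' → Set
accepts A w = DFA.accepting A (foldl (DFA.δ A) (DFA.start A) w) ≡ true

-- A word over (Fin k)^m, read most-significant digit first, denotes the
-- m-tuple of natural numbers whose base-k digits are the components.
-- Leading zeros (padding) are allowed arbitrarily.
value : (k m : ℕ) → List (Vec (Fin k) m) → Vec ℕ m
value k m = foldl (λ acc d → zipWith (λ a i → a * k + toℕ i) acc d) (replicate m 0)

Recognizable : (k m : ℕ) → (Vec ℕ m → Set) → Set
Recognizable k m X =
  Σ (DFA (Vec (Fin k) m)) λ A →
    ∀ (w : List (Vec (Fin k) m)) → accepts A w ⇔ X (value k m w)

data Term (v : ℕ) : Set where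
  var  : Fin v → Term v
  plus : Term v → Term v → Term v

data Formula (rels : List ℕ) : ℕ → Set where
  eq   : ∀ {v} → Term v → Term v → Formula rels v
  rel  : ∀ {v} (i : Fin (length rels)) → Vec (Term v) (Data.List.lookup rels i) → Formula rels v
  neg  : ∀ {v} → Formula rels v → Formula rels v
  conj : ∀ {v} → Formula rels v → Formula rels v → Formula rels v
  ex   : ∀ {v} → Formula rels (suc v) → Formula rels v

Sentence : List ℕ → Set
Sentence rels = Formula rels 0

evalT : ∀ {v} → Vec ℕ v → Term v → ℕ
evalT ρ (var i)    = lookup ρ i
evalT ρ (plus s t) = evalT ρ s + evalT ρ t

evalTs : ∀ {v n} → Vec ℕ v → Vec (Term v) n → Vec ℕ n
evalTs ρ []       = []
evalTs ρ (t ∷ ts) = evalT ρ t ∷ evalTs ρ ts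

Interp : List ℕ → Set₁
Interp rels = (i : Fin (length rels)) → Vec ℕ (Data.List.lookup rels i) → Set

Sat : ∀ {rels v} → Interp rels → Vec ℕ v → Formula rels v → Set
Sat I ρ (eq s t)   = evalT ρ s ≡ evalT ρ t
Sat I ρ (rel i ts) = I i (evalTs ρ ts)
Sat I ρ (neg φ)    = ¬ Sat I ρ φ
Sat I ρ (conj φ ψ) = Sat I ρ φ × Sat I ρ ψ
Sat I ρ (ex φ)     = ∃ λ x → Sat I (x ∷ ρ) φ

Presburger : List ℕ
Presburger = []ᴸ

noRels : Interp Presburger
noRels ()

DefinableInPresburger : (m : ℕ) → (Vec ℕ m → Set) → Set
DefinableInPresburger m X =
  Σ (Formula Presburger m) λ φ → ∀ (x : Vec ℕ m) → Sat noRels x φ ⇔ X x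

sigXY : ℕ → ℕ → List ℕ
sigXY m n = m ∷ᴸ n ∷ᴸ []ᴸ

interpXY : ∀ {m n} → (Vec ℕ m → Set) → (Vec ℕ n → Set) → Interp (sigXY m n)
interpXY X Y fz      = X
interpXY X Y (fs fz) = Y

-- Gödel numbering (Cantor pairing)

tri : ℕ → ℕ
tri zero    = zero
tri (suc n) = suc n + tri n

pair : ℕ → ℕ → ℕ
pair a b = tri (a + b) + b

codeT : ∀ {v} → Term v → ℕ
codeT (var i)    = pair 0 (toℕ i)
codeT (plus s t) = pair 1 (pair (codeT s) (codeT t))

codeTs : ∀ {v n} → Vec (Term v) n → ℕ
codeTs []       = 0
codeTs (t ∷ ts) = suc (pair (codeT t) (codeTs ts))

codeF : ∀ {rels v} → Formula rels v → ℕ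
codeF (eq s t)   = pair 0 (pair (codeT s) (codeT t))
codeF (rel i ts) = pair 1 (pair (toℕ i) (codeTs ts))
codeF (neg φ)    = pair 2 (codeF φ)
codeF (conj φ ψ) = pair 3 (pair (codeF φ) (codeF ψ))
codeF (ex φ)     = pair 4 (codeF φ)

data Code : ℕ → Set where
  zer  : ∀ {n} → Code n
  succ : Code 1
  proj : ∀ {n} → Fin n → Code n
  comp : ∀ {n k} → Code k → Vec (Code n) k → Code n
  prec : ∀ {n} → Code n → Code (suc (suc n)) → Code (suc n)
  mu   : ∀ {n} → Code (suc n) → Code n

mutual
  data Eval : ∀ {n} → Code n → Vec ℕ n → ℕ → Set where
    e-zer  : ∀ {n} {xs : Vec ℕ n} → Eval zer xs 0
    e-succ : ∀ {x} → Eval succ (x ∷ []) (suc x)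
    e-proj : ∀ {n} {i : Fin n} {xs} → Eval (proj i) xs (lookup xs i)
    e-comp : ∀ {n k} {f : Code k} {gs : Vec (Code n) k} {xs ys y} →
             EvalAll gs xs ys → Eval f ys y → Eval (comp f gs) xs y
    e-prec0 : ∀ {n} {f : Code n} {g xs y} →
              Eval f xs y → Eval (prec f g) (0 ∷ xs) y
    e-precS : ∀ {n} {f : Code n} {g x xs r y} →
              Eval (prec f g) (x ∷ xs) r → Eval g (x ∷ r ∷ xs) y →
              Eval (prec f g) (suc x ∷ xs) y
    e-mu   : ∀ {n} {f : Code (suc n)} {xs y} →
             Eval f (y ∷ xs) 0 →
             (∀ z → z < y → ∃ λ w → Eval f (z ∷ xs) (suc w)) →
             Eval (mu f) xs y

  data EvalAll : ∀ {n k} → Vec (Code n) k → Vec ℕ n → Vec ℕ k → Set where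
    ea-nil  : ∀ {n} {xs : Vec ℕ n} → EvalAll [] xs []
    ea-cons : ∀ {n k} {g : Code n} {gs : Vec (Code n) k} {xs y ys} →
              Eval g xs y → EvalAll gs xs ys → EvalAll (g ∷ gs) xs (y ∷ ys)

ComputablyDecidable : (ℕ → Set) → Set
ComputablyDecidable P =
  Σ (Code 1) λ c → ∀ x → (P x → Eval c (x ∷ []) 1) × (¬ P x → Eval c (x ∷ []) 0)

Theory : ∀ {rels} → Interp rels → ℕ → Set
Theory {rels} I x = Σ (Sentence rels) λ φ → codeF φ ≡ x × Sat {rels} I [] φ

TheoryDecidable : ∀ {rels} → Interp rels → Set
TheoryDecidable {rels} I = ComputablyDecidable (Theory {rels} I)

{-# OPTIONS --safe #-}
module Submission where

-- If every infinite definable set of numbers were syndetic, every definable set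
-- of numbers would be ultimately periodic; then the cells of a k-regular set X
-- repeat along finitely many directions, and induction on the dimension of
-- flats makes X Presburger definable.  So (ℕ,+,X) defines an infinite set of
-- numbers with arbitrarily long gaps.  The elements that come first after gaps
-- of length g form a definable, hence k-regular, set whose gaps tend to
-- infinity; pumping shows that it consists of progressions
-- e + D (1 + K + … + K ^ (q − 1)), and these define the powers of some k ^ a.
-- Thus (ℕ,+,X,Y) defines the powers of two multiplicatively independent numbers
-- K and Λ.  The ratios of their powers are dense, so one pair (K ^ τ , Λ ^ J)
-- can be chosen such that the places where K ^ (τ + s) and some Λ ^ (J + j)
-- nearly coincide, together with how nearly they do, spell any given finite
-- sequence.  Tables of partial recursive computations are therefore definable,
-- and a decision procedure for the theory could be run on the code of a
-- sentence asserting that the procedure rejects it.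

open import Defs
open import Level using (Level; _⊔_)
open import Data.Nat hiding (_⊔_)
open import Data.Nat.Properties
open import Data.Nat.Tactic.RingSolver using (solve-∀; ring)
open import Tactic.RingSolver.NonReflective ring as S using () renaming (_⊕_ to infixl 6 _:+_; _⊗_ to infixl 7 _:*_; Κ to #; _⊜_ to infix 4 _:=_)
open import Data.Bool using (true)
open import Data.Fin using (Fin; toℕ) renaming (zero to fz; suc to fs)
import Data.Fin as Fin
import Data.Fin.Properties as Fin
open import Data.Vec using (Vec; []; _∷_; lookup; head; tail)
import Data.Vec as Vec
import Data.Vec.Properties as Vec
open import Data.List using (List; []; _∷_)
import Data.List as List
import Data.List.Relation.Unary.All as All
import Data.List.Relation.Unary.All.Properties as All
open import Data.List.Relation.Unary.Any using (here; there)
import Data.List.Relation.Unary.Any as Any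
open import Data.List.Membership.Propositional using (_∈_; find)
import Data.List.Membership.Propositional.Properties as Mem
import Data.List.Properties as List
open import Data.Integer using (ℤ; 0ℤ)
import Data.Integer as ℤ
import Data.Integer.Properties as ℤ
import Data.Integer.Tactic.RingSolver as ℤ-Ring
open import Data.Product using (∃; _×_; _,_; proj₁; proj₂)
open import Data.Sum using (_⊎_; inj₁; inj₂)
open import Data.Empty using (⊥; ⊥-elim)
open import Data.Unit using (⊤; tt)
open import Relation.Nullary using (¬_; Dec; yes; no)
open import Relation.Nullary.Decidable using (decidable-stable)
open import Relation.Binary.PropositionalEquality hiding ([_]; J)
open import Relation.Binary.Definitions using (tri<; tri≈; tri>)
open import Function using (_∘_; id; case_of_)
open import Function.Bundles using (mk⇔; Equivalence)

-- The theorem is a negation, so everything is proved up to double negation: `DN` supplies excluded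
-- middle, least witnesses and pigeonholes for arbitrary predicates, and a final `id` discharges it.
-- A regular set can be compared at two places only through cells whose side is a power of k,
-- whereas translation invariance needs sides running through an arithmetic progression. That two
-- cells of side y carry the same pattern is a definable condition on y, so ultimate periodicity
-- turns the powers of k that satisfy it into such a progression. In the coding, a number v is read
-- from how close two powers are relative to a common power t of K. It is therefore represented by
-- the u with u K ^ v = t: zero is t itself, and the successor is division by the constant K, which
-- addition can express. Independence enters twice. It makes the ratios of powers dense, and it
-- forces two successive near coincidences far apart, which leaves room to prescribe the second
-- without disturbing the first.

private
  variable
    ℓ₁ ℓ₂ ℓ₃ : Level
    𝒜 : Set ℓ₁
    ℬ : Set ℓ₂

-- A certificate of linear arithmetic: A ≤ B is a nonnegative combination of
-- known inequalities and s is the slack.  The factor suc μ and the extra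
-- summand μ on the left allow fractional coefficients and rounding.  The
-- multipliers in the many numbered lemmas come from linear programming.
lin : ∀ {A B c d} μ s → A ≤ B → suc μ * d + μ + A ≡ suc μ * c + (B + s) → c ≤ d
lin {A} {B} {c} {d} μ s h e = ≮⇒≥ λ d<c → <-irrefl e (begin-strict
  suc μ * d + μ + A <⟨ +-monoˡ-< A (s≤s (≤-reflexive (+-comm (suc μ * d) μ))) ⟩
  suc μ + suc μ * d + A ≡⟨ cong (_+ A) (sym (*-suc (suc μ) d)) ⟩
  suc μ * suc d + A ≤⟨ +-mono-≤ (*-monoʳ-≤ (suc μ) d<c) (≤-trans h (m≤m+n B s)) ⟩
  suc μ * c + (B + s) ∎) where open ≤-Reasoning

lin₀ : ∀ {A B c d} s → A ≤ B → d + A ≡ c + (B + s) → c ≤ d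
lin₀ {A} {B} {c} {d} s h e = lin 0 s h (trans (cong (_+ A) (trans (+-identityʳ _) (*-identityˡ d))) (trans e (cong (_+ (B + s)) (sym (*-identityˡ c)))))

infixl 5 _⊕_
_⊕_ : ∀ {a b c d} → a ≤ b → c ≤ d → a + c ≤ b + d
_⊕_ = +-mono-≤

infixr 6 _⊗_
_⊗_ : ∀ {a b c d} → a ≤ b → c ≤ d → a * c ≤ b * d
_⊗_ = *-mono-≤

scale : ∀ k {a b} → a ≤ b → k * a ≤ k * b
scale k = *-monoʳ-≤ k

-- Classical reasoning under double negation

DN : Set ℓ₁ → Set ℓ₁
DN 𝒜 = ¬ ¬ 𝒜

ret : 𝒜 → DN 𝒜
ret x k = k x

infixl 1 _>>=_ _>>_
_>>=_ : DN 𝒜 → (𝒜 → DN ℬ) → DN ℬ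
(m >>= f) k = m λ x → f x k

_>>_ : DN 𝒜 → DN ℬ → DN ℬ
(m >> n) k = n k

em : (𝒜 : Set ℓ₁) → DN (Dec 𝒜)
em 𝒜 k = k (no λ x → k (yes x))

Iff : Set ℓ₁ → Set ℓ₂ → Set (ℓ₁ ⊔ ℓ₂)
Iff 𝒜 ℬ = (𝒜 → DN ℬ) × (ℬ → DN 𝒜)

Iff-refl : Iff 𝒜 𝒜
Iff-refl = ret , ret

Iff-sym : Iff 𝒜 ℬ → Iff ℬ 𝒜
Iff-sym (f , g) = g , f

Iff-trans : {C : Set ℓ₃} → Iff 𝒜 ℬ → Iff ℬ C → Iff 𝒜 C
Iff-trans (f , g) (h , i) = (λ x → f x >>= h) , λ z → i z >>= g

Iff-stable : DN (Iff 𝒜 ℬ) → Iff 𝒜 ℬ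
Iff-stable m = (λ x → m >>= λ e → proj₁ e x) , λ y → m >>= λ e → proj₂ e y

Iff-≡ : 𝒜 ≡ ℬ → Iff 𝒜 ℬ
Iff-≡ refl = Iff-refl

dn-map : (𝒜 → ℬ) → DN 𝒜 → DN ℬ
dn-map f m = m >>= λ x → ret (f x)

dn-Fin : ∀ n {P : Fin n → Set ℓ₁} → (∀ i → DN (P i)) → DN (∀ i → P i)
dn-Fin zero h = ret λ ()
dn-Fin (suc n) h = do
  p ← h fz
  q ← dn-Fin n (h ∘ fs)
  ret λ { fz → p ; (fs i) → q i }

dn-< : ∀ n {P : ℕ → Set ℓ₁} → (∀ i → i < n → DN (P i)) → DN (∀ i → i < n → P i)
dn-< zero h = ret λ _ ()
dn-< (suc n) {P} h = do
  p ← h n ≤-refl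
  q ← dn-< n λ i l → h i (m≤n⇒m≤1+n l)
  ret λ i l → case m≤n⇒m<n∨m≡n (≤-pred l) of λ
    { (inj₁ l') → q i l' ; (inj₂ refl) → p }

dn-List : ∀ (xs : List 𝒜) {P : 𝒜 → Set ℓ₂} → (∀ x → x ∈ xs → DN (P x)) → DN (∀ x → x ∈ xs → P x)
dn-List [] h = ret λ _ ()
dn-List (y ∷ xs) h = do
  p ← h y (here refl)
  q ← dn-List xs λ x x∈ → h x (there x∈)
  ret λ { x (here refl) → p ; x (there x∈) → q x x∈ }

least-below : ∀ n {P : ℕ → Set ℓ₁} → DN ((∀ k → k < n → ¬ P k) ⊎ ∃ λ m → m < n × P m × (∀ k → k < m → ¬ P k))
least-below zero = ret (inj₁ λ _ ())
least-below (suc n) {P} = do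
  inj₁ none ← least-below n {P} where
    inj₂ (m , l , r) → ret (inj₂ (m , m≤n⇒m≤1+n l , r))
  yes p ← em (P n) where
    no np → ret (inj₁ λ k l → case m≤n⇒m<n∨m≡n (≤-pred l) of λ
      { (inj₁ l') → none k l' ; (inj₂ refl) → np })
  ret (inj₂ (n , ≤-refl , p , none))

least : ∀ {P : ℕ → Set ℓ₁} n → P n → DN (∃ λ m → P m × (∀ k → k < m → ¬ P k))
least {P = P} n p = do
  inj₁ none ← least-below (suc n) {P} where
    inj₂ (m , _ , r) → ret (m , r)
  ⊥-elim (none n ≤-refl p)

-- Finitely many predicates and their classes

agree : List (𝒜 → Set) → 𝒜 → 𝒜 → Set
agree [] x y = ⊤
agree (p ∷ ps) x y = Iff (p x) (p y) × agree ps x y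

agree-sym : ∀ (ps : List (𝒜 → Set)) {x y} → agree ps x y → agree ps y x
agree-sym [] _ = tt
agree-sym (p ∷ ps) (e , es) = Iff-sym e , agree-sym ps es

agree-trans : ∀ (ps : List (𝒜 → Set)) {x y z} → agree ps x y → agree ps y z → agree ps x z
agree-trans [] _ _ = tt
agree-trans (p ∷ ps) (e , es) (e' , es') = Iff-trans e e' , agree-trans ps es es'

agree-∈ : ∀ {ps : List (𝒜 → Set)} {p x y} → p ∈ ps → agree ps x y → Iff (p x) (p y)
agree-∈ (here refl) (e , _) = e
agree-∈ (there p∈) (_ , es) = agree-∈ p∈ es

agree-intro : ∀ (ps : List (𝒜 → Set)) {x y} → (∀ p → p ∈ ps → Iff (p x) (p y)) → agree ps x y
agree-intro [] h = tt
agree-intro (p ∷ ps) h = h p (here refl) , agree-intro ps λ q q∈ → h q (there q∈)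

-- The relativization to `S` lets the induction split on `p`. A representative obtained for the
-- points with `p` need not have `p` itself, so `refine` exchanges it for a member of its class that
-- does.
representatives-in : ∀ (ps : List (𝒜 → Set)) (S : 𝒜 → Set) →
  DN (∃ λ rs → ∀ x → S x → DN (∃ λ r → r ∈ rs × agree ps x r))
representatives-in {𝒜 = 𝒜} [] S = do
  yes (r , _) ← em (∃ S) where
    no none → ret ([] , λ x s → ⊥-elim (none (x , s)))
  ret (r ∷ [] , λ x _ → ret (r , here refl , tt))
representatives-in (p ∷ ps) S = do
  (rs , cover) ← representatives-in ps (λ x → S x × p x)
  (ss , cover') ← representatives-in ps (λ x → S x × ¬ p x)
  (rs' , inRs') ← refine p rs
  (ss' , inSs') ← refine (λ x → ¬ p x) ss
  ret (rs' List.++ ss' , λ x s → do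
    yes px ← em (p x) where
      no npx → do
        (r , r∈ , e) ← cover' x (s , npx)
        (r' , r'∈ , np' , e') ← inSs' x npx r r∈ e
        ret (r' , Mem.∈-++⁺ʳ rs' r'∈ , ((λ px → ⊥-elim (npx px)) , λ pr → ⊥-elim (np' pr)) , e')
    (r , r∈ , e) ← cover x (s , px)
    (r' , r'∈ , p' , e') ← inRs' x px r r∈ e
    ret (r' , Mem.∈-++⁺ˡ r'∈ , ((λ _ → ret p') , λ _ → ret px) , e'))
  where
    refine : ∀ q rs → DN (∃ λ rs' → ∀ x → q x → ∀ r → r ∈ rs → agree ps x r →
      DN (∃ λ r' → r' ∈ rs' × q r' × agree ps x r'))
    refine q [] = ret ([] , λ _ _ _ ())
    refine q (r ∷ rs) = do
      (rs' , h) ← refine q rs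
      yes (r' , qr' , e') ← em (∃ λ r' → q r' × agree ps r r') where
        no none → ret (rs' , λ where
          x qx .r (here refl) e → ⊥-elim (none (x , qx , agree-sym ps e))
          x qx s (there s∈) e → h x qx s s∈ e)
      ret (r' ∷ rs' , λ where
        x qx .r (here refl) e → ret (r' , here refl , qr' , agree-trans ps e e')
        x qx s (there s∈) e → do
          (t , t∈ , qt , et) ← h x qx s s∈ e
          ret (t , there t∈ , qt , et))

representatives : ∀ (ps : List (𝒜 → Set)) → DN (∃ λ rs → ∀ x → DN (∃ λ r → r ∈ rs × agree ps x r))
representatives ps = do
  (rs , h) ← representatives-in ps (λ _ → ⊤)
  ret (rs , λ x → h x tt)

-- The bound `N` depends on the predicates alone and not on the sequence; pumping uses one `N` for
-- the digits of all numbers.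
pigeonhole-agree : ∀ (ps : List (𝒜 → Set)) →
  DN (∃ λ N → ∀ (f : ℕ → 𝒜) → DN (∃ λ i → ∃ λ j → i < j × j ≤ N × agree ps (f i) (f j)))
pigeonhole-agree ps = do
  (rs , cover) ← representatives ps
  ret (List.length rs , λ f → do
    g ← dn-Fin (suc (List.length rs)) (λ i → cover (f (toℕ i)))
    let (i , j , i<j , e) = Fin.pigeonhole ≤-refl (λ i → Any.index (proj₁ (proj₂ (g i))))
        same = trans (lookup-index (proj₁ (proj₂ (g i))))
                 (trans (cong (List.lookup rs) e) (sym (lookup-index (proj₁ (proj₂ (g j))))))
    ret (toℕ i , toℕ j , i<j , ≤-pred (Fin.toℕ<n j) ,
      agree-trans ps (proj₂ (proj₂ (g i))) (subst (λ r → agree ps r (f (toℕ j))) (sym same)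
        (agree-sym ps (proj₂ (proj₂ (g j)))))))
  where
    lookup-index : ∀ {x : 𝒜} {xs} (x∈ : x ∈ xs) → x ≡ List.lookup xs (Any.index x∈)
    lookup-index (here refl) = refl
    lookup-index (there x∈) = lookup-index x∈

-- Rounded division and bounds for finite families

dc₁ : ∀ u e n → u ≤ e → 1 ≤ n → suc u ≤ n + e
dc₁ u e n h0 h1 =
  lin₀ 0 (h0 ⊕ h1)
    (S.solve 3 (λ u e n → n :+ e :+ (u :+ # 1) :=
      (# 1 :+ u) :+ (e :+ n :+ # 0)) refl u e n)

dc₂ : ∀ u e n → e < suc u → n + e < suc u + n
dc₂ u e n h0 =
  lin₀ 0 h0
    (S.solve 3 (λ u e n → (# 1 :+ u) :+ n :+ (# 1 :+ e) :=
      # 1 :+ n :+ e :+ ((# 1 :+ u) :+ # 0)) refl u e n)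

df₁ : ∀ p q n → q + n ≤ suc p → n + q ≤ suc p
df₁ p q n h0 =
  lin₀ 0 h0
    (S.solve 3 (λ p q n → (# 1 :+ p) :+ (q :+ n) :=
      n :+ q :+ ((# 1 :+ p) :+ # 0)) refl p q n)

df₂ : ∀ p q n → 1 ≤ n → p < q + n → suc p < n + q + n
df₂ p q n h0 h1 =
  lin₀ 0 (h0 ⊕ h1)
    (S.solve 3 (λ p q n → n :+ q :+ n :+ (# 1 :+ (# 1 :+ p)) :=
      # 1 :+ (# 1 :+ p) :+ (n :+ (q :+ n) :+ # 0)) refl p q n)

max-witness : ∀ n {P : ℕ → ℕ → Set} → (∀ i {x y} → x ≤ y → P i x → P i y) →
  (∀ i → i < n → ∃ (P i)) → ∃ λ x → ∀ i → i < n → P i x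
max-witness zero mono h = 0 , λ _ ()
max-witness (suc n) mono h =
  let (x , p) = max-witness n mono (λ i l → h i (m≤n⇒m≤1+n l)) ; (y , q) = h n ≤-refl in
  x + y , λ i l → case m≤n⇒m<n∨m≡n (≤-pred l) of λ
    { (inj₁ l') → mono i (m≤m+n x y) (p i l') ; (inj₂ refl) → mono n (m≤n+m y x) q }

div-ceil : ∀ u n → 1 ≤ n → ∃ λ e → u ≤ e * n × e * n < u + n
div-ceil zero n l = 0 , z≤n , l
div-ceil (suc u) n l with div-ceil u n l
... | e , a , b with suc u ≤? e * n
... | yes p = e , p , m≤n⇒m≤1+n b
... | no q = suc e , dc₁ u (e * n) n a l , dc₂ u (e * n) n (≰⇒> q)

div-floor : ∀ p n → 1 ≤ n → ∃ λ q → q * n ≤ p × p < q * n + n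
div-floor zero n l = 0 , z≤n , l
div-floor (suc p) n l with div-floor p n l
... | q , a , b with suc p <? q * n + n
... | yes r = q , m≤n⇒m≤1+n a , r
... | no r = suc q , df₁ p (q * n) n (≮⇒≥ r) , df₂ p (q * n) n l b

bound-all : ∀ {𝒜 : Set} (xs : List 𝒜) (h : 𝒜 → ℕ) → ∃ λ ℬ → ∀ x → x ∈ xs → h x ≤ ℬ
bound-all [] h = 0 , λ _ ()
bound-all (x ∷ xs) h = let (ℬ , b) = bound-all xs h in
  h x + ℬ , λ { y (here refl) → m≤m+n _ ℬ ; y (there y∈) → ≤-trans (b y y∈) (m≤n+m ℬ (h x)) }

agree-++ : ∀ (ps qs : List (𝒜 → Set)) {x y} → agree (ps List.++ qs) x y → agree ps x y × agree qs x y
agree-++ [] qs h = tt , h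
agree-++ (p ∷ ps) qs (e , h) = let (a , b) = agree-++ ps qs h in (e , a) , b

private
  variable
    v v₁ : ℕ
    rels : List ℕ

-- Substitution and definability

weaken : Term v → Term (suc v)
weaken (var i) = var (fs i)
weaken (plus s t) = plus (weaken s) (weaken t)

eval-weaken : ∀ {x} {ρ : Vec ℕ v} t → evalT (x ∷ ρ) (weaken t) ≡ evalT ρ t
eval-weaken (var i) = refl
eval-weaken (plus s t) = cong₂ _+_ (eval-weaken s) (eval-weaken t)

lift : (Fin v₁ → Term v) → Fin (suc v₁) → Term (suc v)
lift σ fz = var fz
lift σ (fs i) = weaken (σ i)

subT : (Fin v₁ → Term v) → Term v₁ → Term v
subT σ (var i) = σ i
subT σ (plus s t) = plus (subT σ s) (subT σ t)

subTs : ∀ {n} → (Fin v₁ → Term v) → Vec (Term v₁) n → Vec (Term v) n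
subTs σ [] = []
subTs σ (t ∷ ts) = subT σ t ∷ subTs σ ts

subF : (Fin v₁ → Term v) → Formula rels v₁ → Formula rels v
subF σ (eq s t) = eq (subT σ s) (subT σ t)
subF σ (rel i ts) = rel i (subTs σ ts)
subF σ (neg φ) = neg (subF σ φ)
subF σ (conj φ ψ) = conj (subF σ φ) (subF σ ψ)
subF σ (ex φ) = ex (subF (lift σ) φ)

Matches : (Fin v₁ → Term v) → Vec ℕ v → Vec ℕ v₁ → Set
Matches σ ρ ρ' = ∀ i → evalT ρ (σ i) ≡ lookup ρ' i

eval-sub : ∀ (σ : Fin v₁ → Term v) {ρ ρ'} → Matches σ ρ ρ' → ∀ t → evalT ρ (subT σ t) ≡ evalT ρ' t
eval-sub σ m (var i) = m i
eval-sub σ m (plus s t) = cong₂ _+_ (eval-sub σ m s) (eval-sub σ m t)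

evals-sub : ∀ {n} (σ : Fin v₁ → Term v) {ρ ρ'} → Matches σ ρ ρ' → ∀ (ts : Vec (Term v₁) n) →
  evalTs ρ (subTs σ ts) ≡ evalTs ρ' ts
evals-sub σ m [] = refl
evals-sub σ m (t ∷ ts) = cong₂ _∷_ (eval-sub σ m t) (evals-sub σ m ts)

lift-matches : ∀ (σ : Fin v₁ → Term v) {ρ ρ'} x → Matches σ ρ ρ' → Matches (lift σ) (x ∷ ρ) (x ∷ ρ')
lift-matches σ x m fz = refl
lift-matches σ x m (fs i) = trans (eval-weaken (σ i)) (m i)

Sat-sub : ∀ {I : Interp rels} (σ : Fin v₁ → Term v) {ρ ρ'} → Matches σ ρ ρ' → ∀ φ →
  (Sat {rels} I ρ (subF σ φ) → Sat {rels} I ρ' φ) × (Sat {rels} I ρ' φ → Sat {rels} I ρ (subF σ φ))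
Sat-sub σ m (eq s t) = (λ e → trans (sym (eval-sub σ m s)) (trans e (eval-sub σ m t))) ,
  λ e → trans (eval-sub σ m s) (trans e (sym (eval-sub σ m t)))
Sat-sub {I = I} σ m (rel i ts) = subst (I i) (evals-sub σ m ts) , subst (I i) (sym (evals-sub σ m ts))
Sat-sub σ m (neg φ) = (λ n s → n (proj₂ (Sat-sub σ m φ) s)) , λ n s → n (proj₁ (Sat-sub σ m φ) s)
Sat-sub σ m (conj φ ψ) =
  (λ (a , b) → proj₁ (Sat-sub σ m φ) a , proj₁ (Sat-sub σ m ψ) b) ,
  λ (a , b) → proj₂ (Sat-sub σ m φ) a , proj₂ (Sat-sub σ m ψ) b
Sat-sub σ m (ex φ) =
  (λ (x , s) → x , proj₁ (Sat-sub (lift σ) (lift-matches σ x m) φ) s) ,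
  λ (x , s) → x , proj₂ (Sat-sub (lift σ) (lift-matches σ x m) φ) s

pattern v0 = fz
pattern v1 = fs fz
pattern v2 = fs (fs fz)
pattern v3 = fs (fs (fs fz))
pattern v4 = fs (fs (fs (fs fz)))
pattern v5 = fs (fs (fs (fs (fs fz))))

double-fixed : ∀ y → y + y ≡ y → y ≡ 0
double-fixed y e = +-cancelˡ-≡ y y 0 (trans e (sym (+-identityʳ y)))

module Definability (rels : List ℕ) (I : Interp rels) where

  -- Correctness is asked for up to double negation, which makes classical
  -- reasoning available throughout.
  record Def (R : Vec ℕ v → Set) : Set where
    constructor mkDef
    field
      formula : Formula rels v
      sound : ∀ ρ → Sat {rels} I ρ formula → DN (R ρ)
      complete : ∀ ρ → R ρ → DN (Sat {rels} I ρ formula)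
  open Def public

  private
    variable
      R S : Vec ℕ v → Set
      f g : Vec ℕ v → ℕ

  def-map : (∀ ρ → Iff (R ρ) (S ρ)) → Def R → Def S
  def-map e (mkDef φ s c) = mkDef φ (λ ρ x → s ρ x >>= proj₁ (e ρ)) (λ ρ y → proj₂ (e ρ) y >>= c ρ)

  def-∧ : Def R → Def S → Def (λ ρ → R ρ × S ρ)
  def-∧ (mkDef φ s c) (mkDef ψ s' c') = mkDef (conj φ ψ)
    (λ ρ (x , y) → s ρ x >>= λ a → s' ρ y >>= λ b → ret (a , b))
    (λ ρ (x , y) → c ρ x >>= λ a → c' ρ y >>= λ b → ret (a , b))

  def-¬ : Def R → Def (λ ρ → ¬ R ρ)
  def-¬ (mkDef φ s c) = mkDef (neg φ) (λ ρ n → ret λ r → c ρ r n) (λ ρ n → ret λ x → s ρ x n)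

  def-∃ : {R : Vec ℕ (suc v) → Set} → Def R → Def (λ ρ → ∃ λ x → R (x ∷ ρ))
  def-∃ (mkDef φ s c) = mkDef (ex φ)
    (λ ρ (x , y) → s (x ∷ ρ) y >>= λ a → ret (x , a))
    (λ ρ (x , y) → c (x ∷ ρ) y >>= λ a → ret (x , a))

  def-→ : Def R → Def S → Def (λ ρ → R ρ → DN (S ρ))
  def-→ r s = def-map
    (λ ρ → (λ n → ret λ x k → n (x , k)) , λ h → ret λ (x , k) → h x k)
    (def-¬ (def-∧ r (def-¬ s)))

  def-∨ : Def R → Def S → Def (λ ρ → R ρ ⊎ S ρ)
  def-∨ r s = def-map
    (λ ρ → (λ n k → n ((λ x → k (inj₁ x)) , λ y → k (inj₂ y))) ,
      λ { (inj₁ x) → ret λ (n , _) → n x ; (inj₂ y) → ret λ (_ , n) → n y })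
    (def-¬ (def-∧ (def-¬ r) (def-¬ s)))

  def-∀ : {R : Vec ℕ (suc v) → Set} → Def R → Def (λ ρ → ∀ x → DN (R (x ∷ ρ)))
  def-∀ r = def-map
    (λ ρ → (λ n → ret λ x k → n (x , k)) , λ h → ret λ (x , k) → h x k)
    (def-¬ (def-∃ (def-¬ r)))

  def-Iff : Def R → Def S → Def (λ ρ → Iff (R ρ) (S ρ))
  def-Iff r s = def-∧ (def-→ r s) (def-→ s r)

  def-⊥ : Def {v} (λ _ → ⊥)
  def-⊥ = mkDef (ex (neg (eq (var fz) (var fz)))) (λ ρ (x , n) → ⊥-elim (n refl)) (λ ρ ())

  def-⊤ : Def {v} (λ _ → ⊤)
  def-⊤ = def-map (λ ρ → (λ _ → ret tt) , λ _ → ret id) (def-¬ def-⊥)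

  def-any : {A : Set} (xs : List A) {R : A → Vec ℕ v → Set} → (∀ x → x ∈ xs → Def (R x)) →
    Def (λ ρ → ∃ λ x → x ∈ xs × R x ρ)
  def-any [] d = def-map (λ ρ → (λ ()) , λ { (_ , () , _) }) def-⊥
  def-any (y ∷ xs) d = def-map
    (λ ρ → (λ { (inj₁ r) → ret (y , here refl , r) ; (inj₂ (x , x∈ , r)) → ret (x , there x∈ , r) }) ,
      λ { (x , here refl , r) → ret (inj₁ r) ; (x , there x∈ , r) → ret (inj₂ (x , x∈ , r)) })
    (def-∨ (d y (here refl)) (def-any xs λ x x∈ → d x (there x∈)))

  def-every : {A : Set} (xs : List A) {R : A → Vec ℕ v → Set} → (∀ x → x ∈ xs → Def (R x)) →
    Def (λ ρ → ∀ x → x ∈ xs → R x ρ)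
  def-every [] d = def-map (λ ρ → (λ _ → ret λ _ ()) , λ _ → ret tt) def-⊤
  def-every (y ∷ xs) d = def-map
    (λ ρ → (λ (r , rs) → ret λ { x (here refl) → r ; x (there x∈) → rs x x∈ }) ,
      λ h → ret (h y (here refl) , λ x x∈ → h x (there x∈)))
    (def-∧ (d y (here refl)) (def-every xs λ x x∈ → d x (there x∈)))

  def-∀Fin : ∀ m {R : Fin m → Vec ℕ v → Set} → (∀ i → Def (R i)) → Def (λ ρ → ∀ i → R i ρ)
  def-∀Fin m d = def-map
    (λ ρ → (λ h → ret λ i → h i (Mem.∈-allFin i)) , λ h → ret λ i _ → h i)
    (def-every (List.allFin m) λ i _ → d i)

  def-sub : {R : Vec ℕ v₁ → Set} → Def R → (σ : Fin v₁ → Term v) (g : Vec ℕ v → Vec ℕ v₁) →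
    (∀ ρ → Matches σ ρ (g ρ)) → Def (λ ρ → R (g ρ))
  def-sub (mkDef φ s c) σ g m = mkDef (subF σ φ)
    (λ ρ x → s (g ρ) (proj₁ (Sat-sub σ (m ρ) φ) x))
    (λ ρ r → dn-map (proj₂ (Sat-sub σ (m ρ) φ)) (c (g ρ) r))

  def-select : {R : Vec ℕ v₁ → Set} → Def R → (is : Vec (Fin v) v₁) → Def (λ ρ → R (Vec.map (lookup ρ) is))
  def-select r is = def-sub r (λ i → var (lookup is i)) (λ ρ → Vec.map (lookup ρ) is)
    (λ ρ i → sym (Vec.lookup-map i (lookup ρ) is))

  record DefFun (f : Vec ℕ v → ℕ) : Set where
    constructor mkFun
    field graph : Def (λ ρ → lookup ρ fz ≡ f (tail ρ))
  open DefFun public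

  fun-map : (∀ ρ → f ρ ≡ g ρ) → DefFun f → DefFun g
  fun-map e (mkFun d) = mkFun (def-map
    (λ ρ → (λ p → ret (trans p (e (tail ρ)))) , λ p → ret (trans p (sym (e (tail ρ))))) d)

  fun-weaken : DefFun f → DefFun (λ ρ → f (tail ρ))
  fun-weaken {f = f} (mkFun d) = mkFun (def-map (λ { (x ∷ y ∷ ρ) → Iff-refl })
    (def-sub d σ (λ ρ → lookup ρ fz ∷ tail (tail ρ)) λ { (x ∷ y ∷ ρ) fz → refl ; (x ∷ y ∷ ρ) (fs i) → refl }))
    where
      σ : Fin (suc v) → Term (suc (suc v))
      σ fz = var fz
      σ (fs i) = var (fs (fs i))

  def-let : {R : Vec ℕ (suc v) → Set} → DefFun f → Def R → Def (λ ρ → R (f ρ ∷ ρ))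
  def-let {f = f} {R = R} (mkFun d) r = def-map
    (λ ρ → (λ (y , e , x) → ret (subst (λ y → R (y ∷ ρ)) e x)) , λ x → ret (f ρ , refl , x))
    (def-∃ (def-∧ d r))

  fun-term : (t : Term v) → DefFun (λ ρ → evalT ρ t)
  fun-term t = mkFun (mkDef (eq (var fz) (weaken t))
    (λ { (y ∷ ρ) e → ret (trans e (eval-weaken t)) }) (λ { (y ∷ ρ) e → ret (trans e (sym (eval-weaken t))) }))

  fun-var : (i : Fin v) → DefFun (λ ρ → lookup ρ i)
  fun-var i = fun-term (var i)

  def-≡ : DefFun f → DefFun g → Def (λ ρ → f ρ ≡ g ρ)
  def-≡ d (mkFun e) = def-let d e

  fun-+ : DefFun f → DefFun g → DefFun (λ ρ → f ρ + g ρ)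
  fun-+ d e = mkFun (def-let (fun-weaken d) (def-let (fun-weaken (fun-weaken e))
    (mkDef (eq (var v2) (plus (var v1) (var v0))) (λ ρ p → ret p) (λ ρ p → ret p))))

  fun-zero : DefFun {v} (λ _ → 0)
  fun-zero = mkFun (mkDef (eq (plus (var fz) (var fz)) (var fz)) (λ ρ e → ret (double-fixed _ e))
    (λ ρ e → ret (cong₂ _+_ e refl)))

  -- 1 is the only nonzero number that is not a sum of two nonzero numbers.
  fun-one : DefFun {v} (λ _ → 1)
  fun-one = mkFun (def-map
    (λ ρ → (λ (n , i) → ret (one (lookup ρ fz) n i)) , λ e → ret ((λ e' → 1+n≢0 (trans (sym e) e')) , notsum (lookup ρ fz) e))
    (def-∧ (def-¬ (def-≡ (fun-var v0) fun-zero))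
      (def-¬ (def-∃ (def-∃ (def-∧ (def-¬ (def-≡ (fun-var v0) fun-zero)) (def-∧ (def-¬ (def-≡ (fun-var v1) fun-zero))
        (def-≡ (fun-term (plus (var v0) (var v1))) (fun-var v2)))))))))
    where
      Splits : ℕ → Set
      Splits y = ∃ λ a → ∃ λ b → ¬ b ≡ 0 × ¬ a ≡ 0 × b + a ≡ y
      one : ∀ y → ¬ y ≡ 0 → ¬ Splits y → y ≡ 1
      one zero n i = ⊥-elim (n refl)
      one (suc zero) n i = refl
      one (suc (suc y)) n i = ⊥-elim (i (suc y , 1 , (λ ()) , (λ ()) , refl))
      notsum : ∀ y → y ≡ 1 → ¬ Splits y
      notsum .1 refl (a , zero , n , _) = n refl
      notsum .1 refl (zero , suc b , _ , n , _) = n refl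
      notsum .1 refl (suc a , suc b , _ , _ , e) with () ← trans (sym (+-suc b a)) (suc-injective e)

  fun-const : ∀ c → DefFun {v} (λ _ → c)
  fun-const zero = fun-zero
  fun-const (suc c) = fun-+ fun-one (fun-const c)

  fun-scale : ∀ c → DefFun f → DefFun (λ ρ → c * f ρ)
  fun-scale zero d = fun-zero
  fun-scale (suc c) d = fun-+ d (fun-scale c d)

  def-≤ : DefFun f → DefFun g → Def (λ ρ → f ρ ≤ g ρ)
  def-≤ {f = f} {g = g} d e = def-map
    (λ ρ → (λ (z , p) → ret (subst (f ρ ≤_) p (m≤m+n _ z))) , λ l → ret (g ρ ∸ f ρ , m+[n∸m]≡n l))
    (def-∃ (def-≡ (fun-+ (fun-weaken d) (fun-var v0)) (fun-weaken e)))

  def-< : DefFun f → DefFun g → Def (λ ρ → f ρ < g ρ)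
  def-< d e = def-≤ (fun-+ fun-one d) e

  def-∀< : {R : Vec ℕ (suc v) → Set} → DefFun f → Def R → Def (λ ρ → ∀ z → z < f ρ → DN (R (z ∷ ρ)))
  def-∀< d r = def-map
    (λ ρ → (λ h → ret λ z l → h z >>= λ k → k l) , λ h → ret λ z → ret λ l → h z l)
    (def-∀ (def-→ (def-< (fun-var v0) (fun-weaken d)) r))

  def-app₁ : {P : ℕ → Set} → Def (λ ρ → P (lookup ρ v0)) → DefFun f → Def (λ ρ → P (f ρ))
  def-app₁ p d = def-let d (def-select p (v0 ∷ []))

  def-∃Vec : ∀ u {R : Vec ℕ (u + v) → Set} → Def R → Def (λ ρ → ∃ λ (v₁ : Vec ℕ u) → R (v₁ Vec.++ ρ))
  def-∃Vec zero r = def-map (λ ρ → (λ x → ret ([] , x)) , λ { ([] , x) → ret x }) r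
  def-∃Vec (suc u) r = def-map
    (λ ρ → (λ (v₁ , x , p) → ret (x ∷ v₁ , p)) , λ { (x ∷ v₁ , p) → ret (v₁ , x , p) })
    (def-∃Vec u (def-∃ r))

  def-∀Vec : ∀ u {R : Vec ℕ (u + v) → Set} → Def R → Def (λ ρ → ∀ (v₁ : Vec ℕ u) → DN (R (v₁ Vec.++ ρ)))
  def-∀Vec u r = def-map
    (λ ρ → (λ n → ret λ x k → n (x , k)) , λ h → ret λ (x , k) → h x k)
    (def-¬ (def-∃Vec u (def-¬ r)))

-- Sets with long gaps

Expanding : (ℕ → Set) → Set
Expanding L = (∀ b → DN (∃ λ x → b ≤ x × L x)) × (∀ g → DN (∃ λ x → ∀ z → z < g → ¬ L (x + z)))

UltPeriodic : (ℕ → Set) → Set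
UltPeriodic L = ∃ λ p → ∃ λ b → ∀ x → b ≤ x → Iff (L x) (L (suc p + x))

-- Ultimate periodicity when no definable set expands

tu₂ : ∀ et pi pj d u z → pj ≡ pi + suc d → et + pj ≡ suc d + (et + pi)
tu₂ et pi pj d u z h0 =
  ≤-antisym (lin₀ 0 (≤-reflexive h0)
    (S.solve 6 (λ et pi pj d u z → (# 1 :+ d) :+ (et :+ pi) :+ pj :=
      et :+ pj :+ (pi :+ (# 1 :+ d) :+ # 0)) refl et pi pj d u z))
  (lin₀ 0 (≤-reflexive (sym h0))
    (S.solve 6 (λ et pi pj d u z → et :+ pj :+ (pi :+ (# 1 :+ d)) :=
      (# 1 :+ d) :+ (et :+ pi) :+ (pj :+ # 0)) refl et pi pj d u z))

tu₃ : ∀ g n i j → i < j → g * (n + i) + g ≤ g * (n + j)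
tu₃ g n i j h0 =
  lin₀ 0 (scale g h0)
    (S.solve 4 (λ g n i j → g :* (n :+ j) :+ g :* (# 1 :+ i) :=
      g :* (n :+ i) :+ g :+ (g :* j :+ # 0)) refl g n i j)

tu₄ : ∀ g n yi i yj j l → yi < g * (n + i) + g → l ≤ yj → g * (n + i) + g ≤ l → yi < yj
tu₄ g n yi i yj j l h0 h1 h2 =
  lin₀ 0 (h0 ⊕ h1 ⊕ h2)
    (S.solve 7 (λ g n yi i yj j l → yj :+ (# 1 :+ yi :+ l :+ (g :* (n :+ i) :+ g)) :=
      # 1 :+ yi :+ (g :* (n :+ i) :+ g :+ yj :+ l :+ # 0)) refl g n yi i yj j l)

tu₅ : ∀ g c τ y i n → n ≡ 2 * (c * τ) → i ≤ c * τ → y < g * (n + i) + g → 1 ≤ c * τ → y < 4 * g * (c * τ)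
tu₅ g c τ y i n h0 h1 h2 h3 =
  lin₀ 0 (h2 ⊕ scale g h1 ⊕ scale g (≤-reflexive h0) ⊕ scale g h3)
    (S.solve 6 (λ g c τ y i n → # 4 :* g :* (c :* τ) :+ (# 1 :+ y :+ g :* i :+ g :* n :+ g :* # 1) :=
      # 1 :+ y :+ (g :* (n :+ i) :+ g :+ g :* (c :* τ) :+ g :* (# 2 :* (c :* τ)) :+ g :* (c :* τ) :+ # 0)) refl g c τ y i n)

tu₆ : ∀ g t u e c → u < 4 * g * t → e * t < u + t → c ≡ 4 * g + 1 → e * t < c * t
tu₆ g t u e c h0 h1 h2 =
  lin₀ 1 (h0 ⊕ h1 ⊕ scale t (≤-reflexive (sym h2)))
    (S.solve 5 (λ g t u e c → c :* t :+ (# 1 :+ u :+ (# 1 :+ e :* t) :+ t :* (# 4 :* g :+ # 1)) :=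
      # 1 :+ e :* t :+ (# 4 :* g :* t :+ (u :+ t) :+ t :* c :+ # 1)) refl g t u e c)

tu₇ : ∀ g c τ y u p q → u + p ≡ y → y < 4 * g * (c * τ) → q * (4 * g * c) ≤ p → (q * (4 * g * c)) < τ * (4 * g * c)
tu₇ g c τ y u p q h0 h1 h2 =
  lin₀ u (≤-reflexive h0 ⊕ h1 ⊕ h2)
    (S.solve 7 (λ g c τ y u p q → τ :* (# 4 :* g :* c) :+ (u :+ p :+ (# 1 :+ y) :+ q :* (# 4 :* g :* c)) :=
      # 1 :+ (q :* (# 4 :* g :* c)) :+ (y :+ # 4 :* g :* (c :* τ) :+ p :+ u)) refl g c τ y u p q)

tu₈ : ∀ p p' q B d → q * B ≤ p → p' < q * B + B → p' ≡ p + suc d → d < B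
tu₈ p p' q B d h0 h1 h2 =
  lin₀ 1 (h0 ⊕ h1 ⊕ ≤-reflexive (sym h2))
    (S.solve 5 (λ p p' q B d → B :+ (q :* B :+ (# 1 :+ p') :+ (p :+ (# 1 :+ d))) :=
      # 1 :+ d :+ (p :+ (q :* B :+ B) :+ p' :+ # 1)) refl p p' q B d)

tu₉ : ∀ ui uj yi yj p e t → ui + p ≡ yi → uj + p ≡ yj → uj ≤ e → e < ui + t → yi < yj → ui < uj
tu₉ ui uj yi yj p e t h0 h1 h2 h3 h4 =
  lin₀ 0 (≤-reflexive h0 ⊕ ≤-reflexive (sym h1) ⊕ h4)
    (S.solve 7 (λ ui uj yi yj p e t → uj :+ (ui :+ p :+ yj :+ (# 1 :+ yi)) :=
      # 1 :+ ui :+ (yi :+ (uj :+ p) :+ yj :+ # 0)) refl ui uj yi yj p e t)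

tu₁₀ : ∀ ui uj d yi yj p → ui + p ≡ yi → uj + p ≡ yj → ui + d ≡ uj → yi + d ≡ yj
tu₁₀ ui uj d yi yj p h0 h1 h2 =
  ≤-antisym (lin₀ 0 (≤-reflexive (sym h0) ⊕ ≤-reflexive h1 ⊕ ≤-reflexive h2)
    (S.solve 6 (λ ui uj d yi yj p → yj :+ (yi :+ (uj :+ p) :+ (ui :+ d)) :=
      yi :+ d :+ (ui :+ p :+ yj :+ uj :+ # 0)) refl ui uj d yi yj p))
  (lin₀ 0 (≤-reflexive h0 ⊕ ≤-reflexive (sym h1) ⊕ ≤-reflexive (sym h2))
    (S.solve 6 (λ ui uj d yi yj p → yi :+ d :+ (ui :+ p :+ yj :+ uj) :=
      yj :+ (yi :+ (uj :+ p) :+ (ui :+ d) :+ # 0)) refl ui uj d yi yj p))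

tu₁₁ : ∀ ui uj d e t r z → uj ≤ e → e < ui + t → 2 * t ≤ r → r ≤ z → ui + d ≡ uj → d ≤ z
tu₁₁ ui uj d e t r z h0 h1 h2 h3 h4 =
  lin 1 (z + 3) (scale 2 h0 ⊕ scale 2 h1 ⊕ h2 ⊕ h3 ⊕ scale 2 (≤-reflexive h4))
    (S.solve 7 (λ ui uj d e t r z → # 2 :* z :+ # 1 :+ (# 2 :* uj :+ # 2 :* (# 1 :+ e) :+ # 2 :* t :+ r :+ # 2 :* (ui :+ d)) :=
      # 2 :* d :+ (# 2 :* e :+ # 2 :* (ui :+ t) :+ r :+ z :+ # 2 :* uj :+ (z :+ # 3))) refl ui uj d e t r z)

tu₁₂ : ∀ g c τ G → c ≡ 4 * g + 1 → τ ≡ suc G → G ≤ c * τ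
tu₁₂ g c τ G h0 h1 =
  lin₀ (4 * g * τ + 1) (≤-reflexive (sym h1) ⊕ scale τ (≤-reflexive (sym h0)))
    (S.solve 4 (λ g c τ G → c :* τ :+ ((# 1 :+ G) :+ τ :* (# 4 :* g :+ # 1)) :=
      G :+ (τ :+ τ :* c :+ (# 4 :* g :* τ :+ # 1))) refl g c τ G)

tu₁₃ : ∀ g c τ G → c ≡ 4 * g + 1 → τ ≡ suc G → 1 ≤ c * τ
tu₁₃ g c τ G h0 h1 =
  lin₀ (4 * g * τ + G) (≤-reflexive (sym h1) ⊕ scale τ (≤-reflexive (sym h0)))
    (S.solve 4 (λ g c τ G → c :* τ :+ ((# 1 :+ G) :+ τ :* (# 4 :* g :+ # 1)) :=
      # 1 :+ (τ :+ τ :* c :+ (# 4 :* g :* τ :+ G))) refl g c τ G)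

tu₁₄ : ∀ u d ui uj z z' yi → ui + d ≡ uj → d + z' ≡ z → ui + z ≡ uj + z'
tu₁₄ u d ui uj z z' yi h0 h1 =
  ≤-antisym (lin₀ 0 (≤-reflexive h0 ⊕ ≤-reflexive (sym h1))
    (S.solve 7 (λ u d ui uj z z' yi → uj :+ z' :+ (ui :+ d :+ z) :=
      ui :+ z :+ (uj :+ (d :+ z') :+ # 0)) refl u d ui uj z z' yi))
  (lin₀ 0 (≤-reflexive (sym h0) ⊕ ≤-reflexive h1)
    (S.solve 7 (λ u d ui uj z z' yi → ui :+ z :+ (uj :+ (d :+ z')) :=
      uj :+ z' :+ (ui :+ d :+ z :+ # 0)) refl u d ui uj z z' yi))

tu₁₅ : ∀ z z' d r → d + z' ≡ z → z < r → z' < r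
tu₁₅ z z' d r h0 h1 =
  lin₀ d (≤-reflexive h0 ⊕ h1)
    (S.solve 4 (λ z z' d r → r :+ (d :+ z' :+ (# 1 :+ z)) :=
      # 1 :+ z' :+ (z :+ r :+ d)) refl z z' d r)

tu₁₆ : ∀ t w u e → u + w ≡ e → u + (w + t) ≡ e + t
tu₁₆ t w u e h0 =
  ≤-antisym (lin₀ 0 (≤-reflexive h0)
    (S.solve 4 (λ t w u e → e :+ t :+ (u :+ w) :=
      u :+ (w :+ t) :+ (e :+ # 0)) refl t w u e))
  (lin₀ 0 (≤-reflexive (sym h0))
    (S.solve 4 (λ t w u e → u :+ (w :+ t) :+ e :=
      e :+ t :+ (u :+ w :+ # 0)) refl t w u e))

tu₁₇ : ∀ t w u e p y → u + p ≡ y → u + w ≡ e → y + (w + t) ≡ e + p + t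
tu₁₇ t w u e p y h0 h1 =
  ≤-antisym (lin₀ 0 (≤-reflexive (sym h0) ⊕ ≤-reflexive h1)
    (S.solve 6 (λ t w u e p y → e :+ p :+ t :+ (y :+ (u :+ w)) :=
      y :+ (w :+ t) :+ (u :+ p :+ e :+ # 0)) refl t w u e p y))
  (lin₀ 0 (≤-reflexive h0 ⊕ ≤-reflexive (sym h1))
    (S.solve 6 (λ t w u e p y → y :+ (w :+ t) :+ (u :+ p :+ e) :=
      e :+ p :+ t :+ (y :+ (u :+ w) :+ # 0)) refl t w u e p y))

tu₁₉ : ∀ g n i y → g * (n + i) ≤ y → g * n ≤ y
tu₁₉ g n i y h0 =
  lin₀ (g * i) h0
    (S.solve 4 (λ g n i y → y :+ g :* (n :+ i) :=
      g :* n :+ (y :+ g :* i)) refl g n i y)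

tu₂₀ : ∀ g n y y' z → g * suc n ≤ y → y' ≡ g * n + z → z < g → y' < y
tu₂₀ g n y y' z h0 h1 h2 =
  lin₀ 0 (h0 ⊕ ≤-reflexive h1 ⊕ h2)
    (S.solve 5 (λ g n y y' z → y :+ (g :* (# 1 :+ n) :+ y' :+ (# 1 :+ z)) :=
      # 1 :+ y' :+ (y :+ (g :* n :+ z) :+ g :+ # 0)) refl g n y y' z)

tu₂₁ : ∀ w t z u e → u ≤ e → e < u + t → u + w ≡ e → z < t → w + z < 2 * t
tu₂₁ w t z u e h0 h1 h2 h3 =
  lin₀ 1 (h1 ⊕ ≤-reflexive h2 ⊕ h3)
    (S.solve 5 (λ w t z u e → # 2 :* t :+ (# 1 :+ e :+ (u :+ w) :+ (# 1 :+ z)) :=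
      # 1 :+ w :+ z :+ (u :+ t :+ e :+ t :+ # 1)) refl w t z u e)

tu₂₂ : ∀ g c → 1 ≤ g → c ≡ 4 * g + 1 → 1 ≤ 4 * g * c
tu₂₂ g c h0 h1 =
  lin₀ (3 * c * g + 4 * g * g) (h0 ⊕ scale g (≤-reflexive (sym h1)))
    (S.solve 2 (λ g c → # 4 :* g :* c :+ (# 1 :+ g :* (# 4 :* g :+ # 1)) :=
      # 1 :+ (g :+ g :* c :+ (# 3 :* c :* g :+ # 4 :* g :* g))) refl g c)

tu₂₃ : ∀ g y z → z < g → 1 ≤ g
tu₂₃ g y z h0 =
  lin₀ z h0
    (S.solve 3 (λ g y z → g :+ (# 1 :+ z) :=
      # 1 :+ (g :+ z)) refl g y z)

module Periodicity (rels : List ℕ) (I : Interp rels) where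
  open Definability rels I public

  DefSet : (ℕ → Set) → Set
  DefSet L = Def {v = 1} (λ ρ → L (lookup ρ v0))

  Tame : Set₁
  Tame = ∀ L → DefSet L → ¬ Expanding L

  syndetic : Tame → ∀ {L} → DefSet L → (∀ b → DN (∃ λ x → b ≤ x × L x)) →
    DN (∃ λ g → ∀ x → DN (∃ λ z → z < g × L (x + z)))
  syndetic tame {L} d inf k =
    tame L d (inf , λ g k' → k (g , λ x k'' → k' (x , λ z z<g l → k'' (z , z<g , l))))

  module _ (tame : Tame) (L : ℕ → Set) (dL : DefSet L) where

    private
      Same : ℕ → ℕ → Set
      Same x y = Iff (L x) (L y)

      -- `L` is regarded as an infinite word; its factors of length r at u and at v coincide.
      Factor : ℕ → ℕ → ℕ → Set
      Factor r u v = ∀ z → z < r → DN (Same (u + z) (v + z))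

      Repeat : ℕ → ℕ → Set
      Repeat r y = ∃ λ u → u < y × Factor r u y

      -- y is the end of the first repetition of length r
      First : ℕ → ℕ → Set
      First r y = Repeat r y × (∀ y' → y' < y → DN (¬ Repeat r y'))

      Record : ℕ → Set
      Record y = ∃ λ r → First r y

      def-Same : ∀ {v} {f g : Vec ℕ v → ℕ} → DefFun f → DefFun g → Def (λ ρ → Same (f ρ) (g ρ))
      def-Same f g = def-Iff (def-app₁ {P = L} dL f) (def-app₁ {P = L} dL g)

      def-Repeat : Def {v = 2} (λ ρ → Repeat (lookup ρ v0) (lookup ρ v1))
      def-Repeat = def-∃ (def-∧ (def-< (fun-var v0) (fun-var v2))
        (def-∀< (fun-var v1) (def-Same (fun-term (plus (var v1) (var v0))) (fun-term (plus (var v3) (var v0))))))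

      def-Record : DefSet Record
      def-Record = def-∃ (def-∧ (def-select def-Repeat (v0 ∷ v1 ∷ []))
        (def-∀< (fun-var v1) (def-¬ (def-select def-Repeat (v1 ∷ v0 ∷ [])))))

      Break : ℕ → ℕ → Set
      Break d x = ¬ Same x (suc d + x)

      def-Break : ∀ d → DefSet (Break d)
      def-Break d = def-¬ (def-Same (fun-var v0) (fun-+ (fun-const (suc d)) (fun-var v0)))

      restrict : ∀ {r r' y} → r ≤ r' → Repeat r' y → Repeat r y
      restrict l (u , u<y , f) = u , u<y , λ z z<r → f z (≤-trans z<r l)

    module _ (np : ¬ UltPeriodic L) where
      -- If the breaks of the shift `suc d` were bounded, this shift would be an ultimate period.
      -- Hence they are infinite in number, and `syndetic` applies.
      breaks : ∀ d → DN (∃ λ g → ∀ x → DN (∃ λ z → z < g × Break d (x + z)))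
      breaks d = syndetic tame (def-Break d)
        λ b k → np (d , b , λ x b≤x → Iff-stable λ n → k (x , b≤x , n))

      breaks-below : ∀ B → DN (∃ λ G → ∀ d → d < B → ∀ x → DN (∃ λ z → z < G × Break d (x + z)))
      breaks-below B = do
        h ← dn-< B λ d _ → breaks d
        ret (max-witness B (λ d x≤y h x → dn-map (λ (z , l , b) → z , ≤-trans l x≤y , b) (h x)) h)

      no-period : ∀ {d G u v} → (∀ x → DN (∃ λ z → z < G × Break d (x + z))) → ∀ {r} → G ≤ r →
        v ≡ suc d + u → ¬ Factor r u v
      no-period {d} {G} {u} h G≤r refl f = h u λ (z , z<G , b) → f z (≤-trans z<G G≤r)
        λ e → b (subst (λ w → Same (u + z) w) (+-assoc (suc d) u z) e)

      repeats : ∀ r → DN (∃ λ y → Repeat r y)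
      repeats r = do
        (N , h) ← pigeonhole-agree (List.map (λ z u → L (u + z)) (List.upTo r))
        (i , j , i<j , _ , e) ← h id
        ret (j , i , i<j , λ z z<r → ret (agree-∈ (Mem.∈-map⁺ (λ z u → L (u + z)) (Mem.∈-upTo⁺ z<r)) e))

      -- Long repetitions occur late: a first repetition of length G at some y < b would have a
      -- shift below b, and all those shifts are broken within length G. So records are unbounded,
      -- and `syndetic` makes their gaps bounded.
      records : DN (∃ λ g → ∀ x → DN (∃ λ z → z < g × Record (x + z)))
      records = syndetic tame def-Record λ b → do
        (G , h) ← breaks-below b
        (y₀ , rep) ← repeats G
        (y , rep' , min) ← least {P = Repeat G} y₀ rep
        let big : b ≤ y
            big = ≮⇒≥ λ y<b → let (u , u<y , f) = rep' in
              no-period (h (y ∸ suc u) (≤-trans (s≤s (m∸n≤m y (suc u))) y<b)) ≤-refl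
                (sym (trans (sym (+-suc (y ∸ suc u) u)) (m∸n+n≡m u<y))) f
        ret (y , big , G , rep' , λ y' l → ret (min y' l))

      -- Record lengths increase strictly with the position, because an earlier repetition of length
      -- at least r would contradict that y is first for r. Every interval of length g contains a
      -- record, so the lengths grow at least linearly.
      length-bound : ∀ {g} → (∀ x → DN (∃ λ z → z < g × Record (x + z))) →
        ∀ n {y r} → g * n ≤ y → First r y → n ≤ r
      length-bound h zero _ _ = z≤n
      length-bound {g} h (suc n) {y} {r} l (rep , min) = decidable-stable (suc n ≤? r) do
        (z , z<g , r' , first') ← h (g * n)
        let n≤r' = length-bound {g} h n (m≤m+n (g * n) z) first'
        ret (≤-trans (s≤s n≤r') (≰⇒> λ r≤r' →
          min (g * n + z) (tu₂₀ g n y (g * n + z) z l refl z<g) λ nr → nr (restrict r≤r' (proj₁ first'))))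

      record Window (g n i : ℕ) : Set where
        field
          y r u : ℕ
          low : g * (n + i) ≤ y
          high : y < g * (n + i) + g
          u<y : u < y
          factor : Factor r u y
          minimal : ∀ y' → y' < y → DN (¬ Repeat r y')

      window : ∀ {g} → (∀ x → DN (∃ λ z → z < g × Record (x + z))) → ∀ n i → DN (Window g n i)
      window {g} h n i = do
        (z , z<g , r , (u , u<y , f) , min) ← h (g * (n + i))
        ret (record { low = m≤m+n _ z ; high = +-monoʳ-< (g * (n + i)) z<g ; u<y = u<y
                    ; factor = f ; minimal = min })

      -- A pigeonhole argument on the t + 1 records found in the windows 0, ..., t. They satisfy y <
      -- 4 g t, and their length is at least n = 2 t. The key of a record consists of the multiple e
      -- t reached from u by rounding up, with at most c = 4 g + 1 possibilities, and of the block
      -- of length 4 g c containing the shift p, with at most τ possibilities; this makes t = c τ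
      -- keys. The block length does not depend on τ, so G can be found first, and τ = suc G then
      -- ensures t ≥ G.
      module Collide {g c τ G : ℕ} (hrec : ∀ x → DN (∃ λ z → z < g × Record (x + z))) (g≥1 : 1 ≤ g)
        (c≡ : c ≡ 4 * g + 1) (τ≡ : τ ≡ suc G)
        (hG : ∀ d → d < 4 * g * c → ∀ x → DN (∃ λ z → z < G × Break d (x + z))) where
        private
          t n : ℕ
          t = c * τ
          n = 2 * t

          t≥1 : 1 ≤ t
          t≥1 = tu₁₃ g c τ G c≡ τ≡

          module Cell (i : ℕ) (i≤t : i ≤ t) (w : Window g n i) where
            open Window w public
            p : ℕ
            p = y ∸ u
            u+p : u + p ≡ y
            u+p = m+[n∸m]≡n (<⇒≤ u<y)
            y<4gt : y < 4 * g * t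
            y<4gt = tu₅ g c τ y i n refl i≤t high t≥1
            n≤r : n ≤ r
            n≤r = length-bound {g} hrec n (tu₁₉ g n i y low) ((u , u<y , factor) , minimal)
            e : ℕ
            e = proj₁ (div-ceil u t t≥1)
            u≤et : u ≤ e * t
            u≤et = proj₁ (proj₂ (div-ceil u t t≥1))
            et<u+t : e * t < u + t
            et<u+t = proj₂ (proj₂ (div-ceil u t t≥1))
            e<c : e < c
            e<c = *-cancelʳ-< t e c (tu₆ g t u e c (<-trans u<y y<4gt) et<u+t c≡)
            q : ℕ
            q = proj₁ (div-floor p (4 * g * c) (tu₂₂ g c g≥1 c≡))
            qB≤p : q * (4 * g * c) ≤ p
            qB≤p = proj₁ (proj₂ (div-floor p (4 * g * c) (tu₂₂ g c g≥1 c≡)))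
            p<qB+B : p < q * (4 * g * c) + 4 * g * c
            p<qB+B = proj₂ (proj₂ (div-floor p (4 * g * c) (tu₂₂ g c g≥1 c≡)))
            q<τ : q < τ
            q<τ = *-cancelʳ-< (4 * g * c) q τ (tu₇ g c τ y u p q u+p y<4gt qB≤p)
            -- As e t < u + t, the interval of length t from e t lies within the first 2 t ≤ r
            -- places of the repeated factor, so it is repeated with the same shift p.
            cell-factor : Factor t (e * t) (e * t + p)
            cell-factor z z<t = subst₂ (λ a b → DN (Same a b))
              (tu₁₆ z w₀ u (e * t) u+w₀) (tu₁₇ z w₀ u (e * t) p y u+p u+w₀)
              (factor (w₀ + z) (<-≤-trans (tu₂₁ w₀ t z u (e * t) u≤et et<u+t u+w₀ z<t) n≤r))
              where
                w₀ = e * t ∸ u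
                u+w₀ : u + w₀ ≡ e * t
                u+w₀ = m+[n∸m]≡n u≤et

        -- Distinct shifts would give a long period of bounded length; equal
        -- shifts would let the later repetition be found earlier.
        clash : ∀ {i j} (i≤t : i ≤ t) (j≤t : j ≤ t) (wi : Window g n i) (wj : Window g n j) → i < j →
          Cell.e i i≤t wi ≡ Cell.e j j≤t wj → Cell.q i i≤t wi ≡ Cell.q j j≤t wj → ⊥
        clash {i} {j} i≤t j≤t wi wj i<j e≡ q≡ = by-cases (<-cmp Ci.p Cj.p)
          where
            module Ci = Cell i i≤t wi
            module Cj = Cell j j≤t wj
            fj : Factor t (Ci.e * t) (Ci.e * t + Cj.p)
            fj = subst (λ e → Factor t (e * t) (e * t + Cj.p)) (sym e≡) Cj.cell-factor
            Bq : Cj.p < Ci.q * (4 * g * c) + 4 * g * c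
            Bq = subst (λ q → Cj.p < q * (4 * g * c) + 4 * g * c) (sym q≡) Cj.p<qB+B
            Bq' : Cj.q * (4 * g * c) ≤ Cj.p
            Bq' = Cj.qB≤p
            apart : ∀ {p p'} → Factor t (Ci.e * t) (Ci.e * t + p) → Factor t (Ci.e * t) (Ci.e * t + p') →
              p < p' → Ci.q * (4 * g * c) ≤ p → p' < Ci.q * (4 * g * c) + 4 * g * c → ⊥
            apart {p} {p'} f f' p<p' l l' =
              no-period {d} (hG d (tu₈ p p' (Ci.q) (4 * g * c) d l l' p'≡)) (tu₁₂ g c τ G c≡ τ≡)
                (tu₂ (Ci.e * t) p p' d 0 0 p'≡)
                λ z z<t → f z z<t >>= λ a → f' z z<t >>= λ b → ret (Iff-trans (Iff-sym a) b)
              where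
                d = p' ∸ suc p
                p'≡ : p' ≡ p + suc d
                p'≡ = sym (trans (+-suc p d) (m+[n∸m]≡n p<p'))
            by-cases : _ → ⊥
            by-cases (tri< l _ _) = apart Ci.cell-factor fj l Ci.qB≤p Bq
            by-cases (tri> _ _ l) = apart fj Ci.cell-factor l
              (subst (λ q → q * (4 * g * c) ≤ Cj.p) (sym q≡) Bq') Ci.p<qB+B
            by-cases (tri≈ _ p≡ _) = Cj.minimal Ci.y yi<yj λ no → no (Ci.u , Ci.u<y , longer)
              where
                yi<yj : Ci.y < Cj.y
                yi<yj = tu₄ g n Ci.y i Cj.y j (g * (n + j)) Ci.high Cj.low (tu₃ g n i j i<j)
                uj+p : Cj.u + Ci.p ≡ Cj.y
                uj+p = trans (cong (Cj.u +_) p≡) Cj.u+p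
                uj≤et : Cj.u ≤ Ci.e * t
                uj≤et = subst (λ e → Cj.u ≤ e * t) (sym e≡) Cj.u≤et
                ui<uj : Ci.u < Cj.u
                ui<uj = tu₉ Ci.u Cj.u Ci.y Cj.y Ci.p (Ci.e * t) t Ci.u+p uj+p uj≤et Ci.et<u+t yi<yj
                d = Cj.u ∸ Ci.u
                d≡ : Ci.u + d ≡ Cj.u
                d≡ = m+[n∸m]≡n (<⇒≤ ui<uj)
                -- Both repeated factors begin less than t before e t, and the earlier one has
                -- length at least 2 t, so they overlap. Having the same shift, they join into one
                -- repetition.
                longer : Factor Cj.r Ci.u Ci.y
                longer z z<r with z <? Ci.r
                ... | yes l = Ci.factor z l
                ... | no ¬l = subst₂ (λ a b → DN (Same a b))
                    (sym (tu₁₄ Ci.u d Ci.u Cj.u z z' Ci.y d≡ z'≡))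
                    (sym (tu₁₄ Ci.y d Ci.y Cj.y z z' Ci.y (tu₁₀ Ci.u Cj.u d Ci.y Cj.y Ci.p Ci.u+p uj+p d≡) z'≡))
                    (Cj.factor z' (tu₁₅ z z' d Cj.r z'≡ z<r))
                  where
                    z' = z ∸ d
                    z'≡ : d + z' ≡ z
                    z'≡ = m+[n∸m]≡n (tu₁₁ Ci.u Cj.u d (Ci.e * t) t Ci.r z uj≤et Ci.et<u+t Ci.n≤r (≮⇒≥ ¬l) d≡)

        untoFin : ∀ {m a b} (a<m : a < m) (b<m : b < m) → Fin.fromℕ< a<m ≡ Fin.fromℕ< b<m → a ≡ b
        untoFin a<m b<m e = trans (sym (Fin.toℕ-fromℕ< a<m)) (trans (cong toℕ e) (Fin.toℕ-fromℕ< b<m))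

        impossible : ⊥
        impossible = dn-Fin (suc t) (λ i → window hrec n (toℕ i)) λ ws →
          let le : ∀ i → toℕ i ≤ t
              le i = ≤-pred (Fin.toℕ<n i)
              e< : ∀ i → Cell.e (toℕ i) (le i) (ws i) < c
              e< i = Cell.e<c (toℕ i) (le i) (ws i)
              q< : ∀ i → Cell.q (toℕ i) (le i) (ws i) < τ
              q< i = Cell.q<τ (toℕ i) (le i) (ws i)
              key : Fin (suc t) → Fin t
              key i = Fin.combine (Fin.fromℕ< (e< i)) (Fin.fromℕ< (q< i))
              (i , j , i<j , k≡) = Fin.pigeonhole ≤-refl key
              (e≡ , q≡) = Fin.combine-injective {m = c} {n = τ} _ _ _ _ k≡
          in clash (le i) (le j) (ws i) (ws j) i<j (untoFin (e< i) (e< j) e≡) (untoFin (q< i) (q< j) q≡)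

    ultimately-periodic : DN (UltPeriodic L)
    ultimately-periodic np =
      (do (g , hrec) ← records np
          (z , z<g , _) ← hrec 0
          (G , hG) ← breaks-below np (4 * g * (4 * g + 1))
          ret (Collide.impossible np {g} {4 * g + 1} {suc G} {G} hrec (tu₂₃ g 0 z z<g) refl refl hG)) id

-- Vectors and regular sets

private
  variable
    m : ℕ

vl₁ : ∀ a x p q y → a * (x + y) + (p + q) ≡ a * x + p + (a * y + q)
vl₁ = S.solve 5 (λ a x p q y → a :* (x :+ y) :+ (p :+ q) := a :* x :+ p :+ (a :* y :+ q)) refl
vl₂ : ∀ a c x p → a * (c * x) + c * p ≡ c * (a * x + p)
vl₂ = S.solve 4 (λ a c x p → a :* (c :* x) :+ c :* p := c :* (a :* x :+ p)) refl

infixl 6 _⊞_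
infixr 7 _⊠_
_⊞_ : Vec ℕ m → Vec ℕ m → Vec ℕ m
_⊞_ = Vec.zipWith _+_

_⊠_ : ℕ → Vec ℕ m → Vec ℕ m
c ⊠ x = Vec.map (c *_) x

dot : Vec ℕ m → Vec ℕ m → ℕ
dot [] [] = 0
dot (a ∷ α) (x ∷ xs) = a * x + dot α xs

zeros ones : Vec ℕ m
zeros = Vec.replicate _ 0
ones = Vec.replicate _ 1

single : Fin m → ℕ → Vec ℕ m
single fz c = c ∷ zeros
single (fs i) c = 0 ∷ single i c

infix 4 _≪_
_≪_ : Vec ℕ m → ℕ → Set
w ≪ q = ∀ i → lookup w i < q

lookup-⊞ : ∀ (x y : Vec ℕ m) i → lookup (x ⊞ y) i ≡ lookup x i + lookup y i
lookup-⊞ x y i = Vec.lookup-zipWith _+_ i x y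

lookup-⊠ : ∀ c (x : Vec ℕ m) i → lookup (c ⊠ x) i ≡ c * lookup x i
lookup-⊠ c x i = Vec.lookup-map i (c *_) x

lookup-blk : ∀ q (n w : Vec ℕ m) i → lookup (q ⊠ n ⊞ w) i ≡ q * lookup n i + lookup w i
lookup-blk q n w i = trans (lookup-⊞ (q ⊠ n) w i) (cong (_+ lookup w i) (lookup-⊠ q n i))

vec-ext : ∀ {A : Set} {x y : Vec A m} → (∀ i → lookup x i ≡ lookup y i) → x ≡ y
vec-ext {x = []} {[]} h = refl
vec-ext {x = a ∷ x} {b ∷ y} h = cong₂ _∷_ (h fz) (vec-ext (h ∘ fs))

dot-⊞ : ∀ (α x y : Vec ℕ m) → dot α (x ⊞ y) ≡ dot α x + dot α y
dot-⊞ [] [] [] = refl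
dot-⊞ (a ∷ α) (x ∷ xs) (y ∷ ys) = trans (cong (a * (x + y) +_) (dot-⊞ α xs ys)) (vl₁ a x (dot α xs) (dot α ys) y)

dot-⊠ : ∀ (α : Vec ℕ m) c x → dot α (c ⊠ x) ≡ c * dot α x
dot-⊠ [] c [] = sym (*-zeroʳ c)
dot-⊠ (a ∷ α) c (x ∷ xs) = trans (cong (a * (c * x) +_) (dot-⊠ α c xs)) (vl₂ a c x (dot α xs))

dot-blk : ∀ (α : Vec ℕ m) q n w → dot α (q ⊠ n ⊞ w) ≡ q * dot α n + dot α w
dot-blk α q n w = trans (dot-⊞ α (q ⊠ n) w) (cong (_+ dot α w) (dot-⊠ α q n))

dot-zeros : ∀ (x : Vec ℕ m) → dot zeros x ≡ 0
dot-zeros [] = refl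
dot-zeros (x ∷ xs) = dot-zeros xs

dot-single : ∀ i c (x : Vec ℕ m) → dot (single i c) x ≡ c * lookup x i
dot-single fz c (x ∷ xs) = trans (cong (c * x +_) (dot-zeros xs)) (+-identityʳ (c * x))
dot-single (fs i) c (x ∷ xs) = dot-single i c xs

dot-bound : ∀ (α w : Vec ℕ m) {B} → (∀ i → lookup w i ≤ B) → dot α w ≤ B * dot α ones
dot-bound [] [] {B} h = z≤n
dot-bound (a ∷ α) (x ∷ xs) {B} h = ≤-trans (+-mono-≤ (*-monoʳ-≤ a (h fz)) (dot-bound α xs (h ∘ fs)))
  (≤-reflexive (db a B (dot α ones)))
  where
    db : ∀ a B d → a * B + B * d ≡ B * (a * 1 + d)
    db = solve-∀

lookup≤sum : ∀ (x : Vec ℕ m) i → lookup x i ≤ dot ones x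
lookup≤sum (x ∷ xs) fz = ≤-trans (≤-reflexive (sym (*-identityˡ x))) (m≤m+n (1 * x) _)
lookup≤sum (x ∷ xs) (fs i) = ≤-trans (lookup≤sum xs i) (m≤n+m _ (1 * x))

allVecs : ∀ m → ℕ → List (Vec ℕ m)
allVecs zero B = [] ∷ []
allVecs (suc m) B = List.cartesianProductWith _∷_ (List.upTo B) (allVecs m B)

∈-allVecs : ∀ {B} (x : Vec ℕ m) → x ≪ B → x ∈ allVecs m B
∈-allVecs [] h = here refl
∈-allVecs (x ∷ xs) h = Mem.∈-cartesianProductWith⁺ _∷_ (Mem.∈-upTo⁺ (h fz)) (∈-allVecs xs (h ∘ fs))

split-vec : ∀ q c → 1 ≤ q → (w : Vec ℕ m) → w ≪ c * q →
  ∃ λ ε → ∃ λ w' → w ≡ q ⊠ ε ⊞ w' × ε ≪ c × w' ≪ q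
split-vec q c q≥1 [] h = [] , [] , refl , (λ ()) , λ ()
split-vec q c q≥1 (x ∷ w) h with div-floor x q q≥1 | split-vec q c q≥1 w (h ∘ fs)
... | e , lo , hi | ε , w' , w≡ , ε< , w'< = e ∷ ε , x ∸ e * q ∷ w' ,
  cong₂ _∷_ (trans (sym (m+[n∸m]≡n lo)) (cong (_+ (x ∸ e * q)) (*-comm e q))) w≡ ,
  (λ { fz → *-cancelʳ-< q e c (≤-<-trans lo (h fz)) ; (fs i) → ε< i }) ,
  λ { fz → +-cancelˡ-< (e * q) (x ∸ e * q) q (subst (_< e * q + q) (sym (m+[n∸m]≡n lo)) hi) ; (fs i) → w'< i }

argmax : ∀ (x : Vec ℕ m) → Fin m → ∃ λ i → ∀ j → lookup x j ≤ lookup x i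
argmax (x ∷ []) _ = fz , λ { fz → ≤-refl }
argmax (x ∷ y ∷ ys) _ with argmax (y ∷ ys) fz
... | i , h with ≤-total x (lookup (y ∷ ys) i)
... | inj₁ l = fs i , λ { fz → l ; (fs j) → h j }
... | inj₂ l = fz , λ { fz → ≤-refl ; (fs j) → ≤-trans (h j) l }

blk-⊞ : ∀ q (n ε w : Vec ℕ m) → q ⊠ n ⊞ (q ⊠ ε ⊞ w) ≡ q ⊠ (n ⊞ ε) ⊞ w
blk-⊞ q [] [] [] = refl
blk-⊞ q (n ∷ ns) (e ∷ ε) (w ∷ ws) = cong₂ _∷_ (be q n e w) (blk-⊞ q ns ε ws)
  where
    be : ∀ q n e w → q * n + (q * e + w) ≡ q * (n + e) + w
    be = solve-∀

sel : ∀ {v} → Vec ℕ v → (Fin m → Fin v) → Vec ℕ m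
sel ρ ι = Vec.tabulate λ i → lookup ρ (ι i)

lookup-sel : ∀ {v} (ρ : Vec ℕ v) (ι : Fin m → Fin v) i → lookup (sel ρ ι) i ≡ lookup ρ (ι i)
lookup-sel ρ ι i = Vec.lookup∘tabulate (λ i → lookup ρ (ι i)) i

sel-↑ˡ : ∀ {v} (w : Vec ℕ m) (ρ : Vec ℕ v) → sel (w Vec.++ ρ) (Fin._↑ˡ v) ≡ w
sel-↑ˡ w ρ = vec-ext λ i → trans (lookup-sel (w Vec.++ ρ) _ i) (Vec.lookup-++ˡ w ρ i)

-- A set is k-regular when finitely many predicates of the leading digits n
-- determine which continuations of n lie in it.
record Regular (k : ℕ) (X : Vec ℕ m → Set) : Set₁ where
  field
    preds : List (Vec ℕ m → Set)
    nerode : ∀ n n' → agree preds n n' → ∀ r w → w ≪ k ^ r →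
      Iff (X (k ^ r ⊠ n ⊞ w)) (X (k ^ r ⊠ n' ⊞ w))

-- Triangular systems of linear forms

infixl 7 _·_
_·_ : Vec ℤ m → Vec ℤ m → ℤ
[] · [] = 0ℤ
(a ∷ α) · (x ∷ xs) = a ℤ.* x ℤ.+ α · xs

-- The vector a x − b y.
combine : ℤ → Vec ℤ m → ℤ → Vec ℤ m → Vec ℤ m
combine a x b y = Vec.zipWith (λ p q → a ℤ.* p ℤ.- b ℤ.* q) x y

·-combine : ∀ (h : Vec ℤ m) a x b y → h · combine a x b y ≡ a ℤ.* (h · x) ℤ.- b ℤ.* (h · y)
·-combine [] a [] b [] = sym (e a b)
  where
    e : ∀ a b → a ℤ.* 0ℤ ℤ.- b ℤ.* 0ℤ ≡ 0ℤ
    e = ℤ-Ring.solve-∀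
·-combine (c ∷ h) a (x ∷ xs) b (y ∷ ys) = trans (cong (λ z → c ℤ.* (a ℤ.* x ℤ.- b ℤ.* y) ℤ.+ z) (·-combine h a xs b ys))
  (e a b c x y (h · xs) (h · ys))
  where
    e : ∀ a b c x y p q → c ℤ.* (a ℤ.* x ℤ.- b ℤ.* y) ℤ.+ (a ℤ.* p ℤ.- b ℤ.* q) ≡
      a ℤ.* (c ℤ.* x ℤ.+ p) ℤ.- b ℤ.* (c ℤ.* y ℤ.+ q)
    e = ℤ-Ring.solve-∀

-- Pairs (h , v), newest first, with h · v ≢ 0 and every older h' killing v.
Kills : List (Vec ℤ m × Vec ℤ m) → Vec ℤ m → Set
Kills [] v = ⊤
Kills ((h , _) ∷ L) v = h · v ≡ 0ℤ × Kills L v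

Triangular : List (Vec ℤ m × Vec ℤ m) → Set
Triangular [] = ⊤
Triangular ((h , v) ∷ L) = h · v ≢ 0ℤ × Kills L v × Triangular L

private
  ·-tail : ∀ (h v : Vec ℤ (suc m)) → head v ≡ 0ℤ → h · v ≡ tail h · tail v
  ·-tail (a ∷ h) (.0ℤ ∷ v) refl = trans (cong (λ z → z ℤ.+ h · v) (ℤ.*-zeroʳ a)) (ℤ.+-identityˡ (h · v))

  reduce : Vec ℤ (suc m) → Vec ℤ (suc m) → Vec ℤ (suc m)
  reduce v w = combine (head v) w (head w) v

  head-reduce : ∀ (v w : Vec ℤ (suc m)) → head (reduce v w) ≡ 0ℤ
  head-reduce (a ∷ v) (b ∷ w) = e a b
    where
      e : ∀ a b → a ℤ.* b ℤ.- b ℤ.* a ≡ 0ℤ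
      e = ℤ-Ring.solve-∀

  ·-reduce : ∀ (h v w : Vec ℤ (suc m)) → h · v ≡ 0ℤ → h · reduce v w ≡ head v ℤ.* (h · w)
  ·-reduce h v w hv = trans (·-combine h (head v) w (head w) v)
    (trans (cong (λ z → head v ℤ.* (h · w) ℤ.- head w ℤ.* z) hv) (e (head v ℤ.* (h · w)) (head w)))
    where
      e : ∀ a b → a ℤ.- b ℤ.* 0ℤ ≡ a
      e = ℤ-Ring.solve-∀

  shrink : Vec ℤ (suc m) → Vec ℤ (suc m) × Vec ℤ (suc m) → Vec ℤ m × Vec ℤ m
  shrink v (h , w) = tail h , tail (reduce v w)

  kills-shrink : ∀ v (L : List (Vec ℤ (suc m) × Vec ℤ (suc m))) u → head u ≡ 0ℤ → Kills L u →
    Kills (List.map (shrink v) L) (tail u)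
  kills-shrink v [] u e _ = tt
  kills-shrink v ((h , w) ∷ L) u e (p , ps) = trans (sym (·-tail h u e)) p , kills-shrink v L u e ps

  kills-reduce : ∀ v w (L : List (Vec ℤ (suc m) × Vec ℤ (suc m))) → Kills L v → Kills L w → Kills L (reduce v w)
  kills-reduce v w [] _ _ = tt
  kills-reduce v w ((h , _) ∷ L) (p , ps) (q , qs) =
    trans (·-reduce h v w p) (trans (cong (head v ℤ.*_) q) (ℤ.*-zeroʳ (head v))) , kills-reduce v w L ps qs

  triangular-shrink : ∀ v → head v ≢ 0ℤ → (L : List (Vec ℤ (suc m) × Vec ℤ (suc m))) → Kills L v →
    Triangular L → Triangular (List.map (shrink v) L)
  triangular-shrink v nz [] _ _ = tt
  triangular-shrink v nz ((h , w) ∷ L) (p , ps) (q , ks , t) =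
    (λ z → case ℤ.i*j≡0⇒i≡0∨j≡0 (head v) (trans (sym (·-reduce h v w p))
        (trans (·-tail h (reduce v w) (head-reduce v w)) z)) of λ
      { (inj₁ a) → nz a ; (inj₂ b) → q b }) ,
    kills-shrink v L (reduce v w) (head-reduce v w) (kills-reduce v w L ps ks) ,
    triangular-shrink v nz L ps t

  -- One coordinate is eliminated using the newest vector that involves it.
  eliminate : ∀ (L : List (Vec ℤ (suc m) × Vec ℤ (suc m))) → Triangular L →
    ∃ λ (L' : List (Vec ℤ m × Vec ℤ m)) → Triangular L' × List.length L ≤ suc (List.length L') ×
      (∀ u → head u ≡ 0ℤ → Kills L u → Kills L' (tail u))
  eliminate [] _ = [] , tt , z≤n , λ _ _ _ → tt
  eliminate ((h , v) ∷ L) (p , ks , t) with head v ℤ.≟ 0ℤ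
  ... | no nz = List.map (shrink v) L , triangular-shrink v nz L ks t ,
    s≤s (≤-reflexive (sym (List.length-map (shrink v) L))) ,
    λ u e (_ , ku) → kills-shrink v L u e ku
  ... | yes z with eliminate L t
  ... | L' , t' , len , k = (tail h , tail v) ∷ L' , ((λ q → p (trans (·-tail h v z) q)) , k v z ks , t') ,
    s≤s len , λ u e (q , ku) → trans (sym (·-tail h u e)) q , k u e ku

-- Eliminating one coordinate costs at most one pair. The bound by the dimension is what ends the
-- induction over flats.
triangular-length : ∀ m (L : List (Vec ℤ m × Vec ℤ m)) → Triangular L → List.length L ≤ m
triangular-length m [] _ = z≤n
triangular-length zero (([] , []) ∷ L) (p , _) = ⊥-elim (p refl)
triangular-length (suc m) (x ∷ L) t with eliminate (x ∷ L) t
... | L' , t' , len , _ = ≤-trans len (s≤s (triangular-length m L' t'))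

-- Cones and cells

interp₁ : (Vec ℕ m → Set) → Interp (m ∷ [])
interp₁ X fz = X

times : ∀ {v} → ℕ → Term v → Term v → Term v
times zero t s = s
times (suc c) t s = plus t (times c t s)

eval-times : ∀ {v} {ρ : Vec ℕ v} c t s → evalT ρ (times c t s) ≡ c * evalT ρ t + evalT ρ s
eval-times zero t s = refl
eval-times {ρ = ρ} (suc c) t s = trans (cong (evalT ρ t +_) (eval-times c t s)) (sym (+-assoc (evalT ρ t) (c * evalT ρ t) (evalT ρ s)))

evalTs-tabulate : ∀ {v} (ρ : Vec ℕ v) (ts : Fin m → Term v) →
  evalTs ρ (Vec.tabulate ts) ≡ Vec.tabulate (λ i → evalT ρ (ts i))
evalTs-tabulate {m = zero} ρ ts = refl
evalTs-tabulate {m = suc m} ρ ts = cong (evalT ρ (ts fz) ∷_) (evalTs-tabulate ρ (ts ∘ fs))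

1≤^ : ∀ k r → 1 ≤ k → 1 ≤ k ^ r
1≤^ k zero l = ≤-refl
1≤^ k (suc r) l = l ⊗ 1≤^ k r l

nk : ∀ n q → n < q → suc n < 2 * q
nk n q h0 =
  lin₀ n (scale 2 h0)
    (S.solve 2 (λ n q → # 2 :* q :+ # 2 :* (# 1 :+ n) :=
      # 1 :+ (# 1 :+ n) :+ (# 2 :* q :+ n)) refl n q)

n<k^n : ∀ k n → 2 ≤ k → n < k ^ n
n<k^n k zero l = ≤-refl
n<k^n k (suc n) l = ≤-trans (nk n (k ^ n) (n<k^n k n l)) (l ⊗ ≤-refl {k ^ n})

-- The sections l z_j ≤ u z_i of a cone and the bound on the sum of coordinates.
record Ineq (m : ℕ) : Set where
  constructor ineq
  field
    big small : Vec ℕ m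
    gap : ℕ
open Ineq

Holds : Ineq m → Vec ℕ m → Set
Holds q z = dot (small q) z + gap q ≤ dot (big q) z

In : List (Ineq m) → Vec ℕ m → Set
In Γ z = ∀ q → q ∈ Γ → Holds q z

-- At scale q the leading part n stands for the coordinates between `lo n * q` and `hi n * q`. For n
-- > 0 such a coordinate is at least one full side q above q n; this margin pays for a change of
-- scale. At n = 0 no margin is available and none is asked for.
lo hi : ℕ → ℕ
lo zero = 0
lo (suc n) = suc (suc n)
hi n = 2 + n

section : Vec ℕ m → Fin m → Fin m → Ineq m
section n i j = ineq (single i (hi (lookup n j))) (single j (lo (lookup n i))) 0

coordinate : Fin m → Ineq m
coordinate i = ineq (single i 1) zeros 0

-- The sections result from eliminating q from the bounds `lo` and `hi` of two coordinates, so they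
-- no longer depend on the scale. The inequalities `coordinate i` hold at every point of ℕ ^ m; they
-- are listed so that a translation which would make a coordinate negative counts as leaving the
-- region.
cone : Vec ℕ m → ℕ → List (Ineq m)
cone {m} n T = ineq ones zeros T ∷ List.map coordinate (List.allFin m) List.++
  List.cartesianProductWith (section n) (List.allFin m) (List.allFin m)

coordinate∈cone : ∀ (n : Vec ℕ m) T i → coordinate i ∈ cone n T
coordinate∈cone n T i = there (Mem.∈-++⁺ˡ (Mem.∈-map⁺ coordinate (Mem.∈-allFin i)))

in-cone-sum : ∀ {n : Vec ℕ m} {T z} → In (cone n T) z → T ≤ dot ones z
in-cone-sum {z = z} h = subst (_≤ dot ones z) (cong (_+ _) (dot-zeros z)) (h _ (here refl))

in-cone-section : ∀ {n : Vec ℕ m} {T z} → In (cone n T) z → ∀ i j →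
  lo (lookup n i) * lookup z j ≤ hi (lookup n j) * lookup z i
in-cone-section {n = n} {z = z} h i j = subst₂ _≤_
  (trans (+-identityʳ _) (dot-single j (lo (lookup n i)) z)) (dot-single i (hi (lookup n j)) z)
  (h _ (there (Mem.∈-++⁺ʳ (List.map coordinate (List.allFin _))
    (Mem.∈-cartesianProductWith⁺ (section n) (Mem.∈-allFin i) (Mem.∈-allFin j)))))

in-cone : ∀ {n : Vec ℕ m} {T z} → T ≤ dot ones z →
  (∀ i j → lo (lookup n i) * lookup z j ≤ hi (lookup n j) * lookup z i) → In (cone n T) z
in-cone {m} {n} {T} {z} s h q (here refl) = subst (_≤ dot ones z) (sym (cong (_+ T) (dot-zeros z))) s
in-cone {m} {n} {T} {z} s h q (there q∈) with Mem.∈-++⁻ (List.map coordinate (List.allFin m)) q∈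
... | inj₁ a with Mem.∈-map⁻ coordinate a
... | i , _ , refl = subst (_≤ dot (single i 1) z) (sym (trans (+-identityʳ _) (dot-zeros z))) z≤n
in-cone {m} {n} {T} {z} s h q (there q∈) | inj₂ b
  with Mem.∈-cartesianProductWith⁻ (section n) (List.allFin m) (List.allFin m) b
... | i , j , _ , _ , refl = subst₂ _≤_ (sym (trans (+-identityʳ _) (dot-single j (lo (lookup n i)) z)))
  (sym (dot-single i (hi (lookup n j)) z)) (h i j)

cn₁ : ∀ l u y z0 zi → l * z0 ≤ u * zi → u * y < z0 → u * (l * y) ≤ u * zi
cn₁ l u y z0 zi h0 h1 =
  lin₀ l (h0 ⊕ scale l h1)
    (S.solve 5 (λ l u y z0 zi → u :* zi :+ (l :* z0 :+ l :* (# 1 :+ u :* y)) :=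
      u :* (l :* y) :+ (u :* zi :+ l :* z0 :+ l)) refl l u y z0 zi)

cn₂ : ∀ n n' p y z → suc n * y ≤ z → (n + n') * p ≤ y → n' * p + n * (p + y) ≤ z
cn₂ n n' p y z h0 h1 =
  lin₀ 0 (h0 ⊕ h1)
    (S.solve 5 (λ n n' p y z → z :+ ((# 1 :+ n) :* y :+ (n :+ n') :* p) :=
      n' :* p :+ n :* (p :+ y) :+ (z :+ y :+ # 0)) refl n n' p y z)

cn₃ : ∀ n y z → z ≤ (2 + n) * y → 1 ≤ y → z < 3 * y + n * y
cn₃ n y z h0 h1 =
  lin₀ 0 (h0 ⊕ h1)
    (S.solve 3 (λ n y z → # 3 :* y :+ n :* y :+ (z :+ # 1) :=
      # 1 :+ z :+ ((# 2 :+ n) :* y :+ y :+ # 0)) refl n y z)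

cn₄ : ∀ n y w z → n * y + w ≡ z → z < 3 * y + n * y → w < 3 * y
cn₄ n y w z h0 h1 =
  lin₀ 0 (≤-reflexive h0 ⊕ h1)
    (S.solve 4 (λ n y w z → # 3 :* y :+ (n :* y :+ w :+ (# 1 :+ z)) :=
      # 1 :+ w :+ (z :+ (# 3 :* y :+ n :* y) :+ # 0)) refl n y w z)

cn₅ : ∀ n p y w z n' z' w' → n * (p + y) + w ≡ z → z' + p * n' ≡ z + p * n → p * n' + w' ≡ w → (p + (p + y)) * n + w' ≡ z'
cn₅ n p y w z n' z' w' h0 h1 h2 =
  ≤-antisym (lin₀ 0 (≤-reflexive h0 ⊕ ≤-reflexive (sym h1) ⊕ ≤-reflexive h2)
    (S.solve 8 (λ n p y w z n' z' w' → z' :+ (n :* (p :+ y) :+ w :+ (z :+ p :* n) :+ (p :* n' :+ w')) :=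
      (p :+ (p :+ y)) :* n :+ w' :+ (z :+ (z' :+ p :* n') :+ w :+ # 0)) refl n p y w z n' z' w'))
  (lin₀ 0 (≤-reflexive (sym h0) ⊕ ≤-reflexive h1 ⊕ ≤-reflexive (sym h2))
    (S.solve 8 (λ n p y w z n' z' w' → (p :+ (p :+ y)) :* n :+ w' :+ (z :+ (z' :+ p :* n') :+ w) :=
      z' :+ (n :* (p :+ y) :+ w :+ (z :+ p :* n) :+ (p :* n' :+ w') :+ # 0)) refl n p y w z n' z' w'))

cn₆ : ∀ n' p y w w' → p * n' + w' ≡ w → (p + y) * n' + w ≡ (p + (p + y)) * n' + w'
cn₆ n' p y w w' h0 =
  ≤-antisym (lin₀ 0 (≤-reflexive (sym h0))
    (S.solve 5 (λ n' p y w w' → (p :+ (p :+ y)) :* n' :+ w' :+ w :=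
      (p :+ y) :* n' :+ w :+ (p :* n' :+ w' :+ # 0)) refl n' p y w w'))
  (lin₀ 0 (≤-reflexive h0)
    (S.solve 5 (λ n' p y w w' → (p :+ y) :* n' :+ w :+ (p :* n' :+ w') :=
      (p :+ (p :+ y)) :* n' :+ w' :+ (w :+ # 0)) refl n' p y w w'))

cn₇ : ∀ p y w w' n' → p * n' + w' ≡ w → w < 3 * (p + y) → w' < 3 * (p + (p + y))
cn₇ p y w w' n' h0 h1 =
  lin₀ (n' * p + 3 * p) (≤-reflexive h0 ⊕ h1)
    (S.solve 5 (λ p y w w' n' → # 3 :* (p :+ (p :+ y)) :+ (p :* n' :+ w' :+ (# 1 :+ w)) :=
      # 1 :+ w' :+ (w :+ # 3 :* (p :+ y) :+ (n' :* p :+ # 3 :* p))) refl p y w w' n')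

cn₈ : ∀ n p y w z n' → n' * p + n * (p + y) ≤ z → n * (p + y) + w ≡ z → p * n' ≤ w
cn₈ n p y w z n' h0 h1 =
  lin₀ 0 (h0 ⊕ ≤-reflexive (sym h1))
    (S.solve 6 (λ n p y w z n' → w :+ (n' :* p :+ n :* (p :+ y) :+ z) :=
      p :* n' :+ (z :+ (n :* (p :+ y) :+ w) :+ # 0)) refl n p y w z n')

cn₉ : ∀ n p y z n' → n' * p + n * (p + y) ≤ z → n * (p + y) ≤ z
cn₉ n p y z n' h0 =
  lin₀ (n' * p) h0
    (S.solve 5 (λ n p y z n' → z :+ (n' :* p :+ n :* (p :+ y)) :=
      n :* (p :+ y) :+ (z :+ n' :* p)) refl n p y z n')

cn₁₀ : ∀ s p y a → 1 ≤ p → s ≤ (2 + a) * (s * p + y)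
cn₁₀ s p y a h0 =
  lin₀ (a * p * s + a * y + p * s + 2 * y) (scale s h0)
    (S.solve 4 (λ s p y a → (# 2 :+ a) :* (s :* p :+ y) :+ s :* # 1 :=
      s :+ (s :* p :+ (a :* p :* s :+ a :* y :+ p :* s :+ # 2 :* y))) refl s p y a)

module Cell (k : ℕ) (k≥2 : k ≥ 2) (X : Vec ℕ m → Set) (reg : Regular k X) where
  open Regular reg
  open Periodicity (m ∷ []) (interp₁ X)

  private
    k≥1 : 1 ≤ k
    k≥1 = ≤-trans (s≤s z≤n) k≥2

  -- The cells at n' and n of side 3 y carry translated copies of X.
  Alike : Vec ℕ m → Vec ℕ m → ℕ → Set
  Alike n' n y = ∀ w → DN (w ≪ 3 * y → DN (Iff (X (y ⊠ n' ⊞ w)) (X (y ⊠ n ⊞ w))))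

  def-X : ∀ {v} (ts : Fin m → Term v) {g : Vec ℕ v → Vec ℕ m} →
    (∀ ρ i → evalT ρ (ts i) ≡ lookup (g ρ) i) → Def (λ ρ → X (g ρ))
  def-X ts {g} e = mkDef (rel fz (Vec.tabulate ts))
    (λ ρ x → ret (subst X (same ρ) x)) (λ ρ x → ret (subst X (sym (same ρ)) x))
    where
      same : ∀ ρ → evalTs ρ (Vec.tabulate ts) ≡ g ρ
      same ρ = trans (evalTs-tabulate ρ ts) (vec-ext λ i → trans (Vec.lookup∘tabulate _ i) (e ρ i))

  def-Alike : ∀ n' n → DefSet (Alike n' n)
  def-Alike n' n = def-map
    (λ { (y ∷ []) → (λ h → ret λ w → h w >>= proj₁ (same y w)) , λ h → ret λ w → h w >>= proj₂ (same y w) })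
    (def-∀Vec m (def-→ (def-∀Fin m (λ i → def-< (fun-var (i Fin.↑ˡ 1)) (fun-scale 3 (fun-var (m Fin.↑ʳ fz)))))
      (def-Iff (at n') (at n))))
    where
      cell : Vec ℕ m → Vec ℕ (m + 1) → Vec ℕ m
      cell n ρ = lookup ρ (m Fin.↑ʳ fz) ⊠ n ⊞ sel ρ (Fin._↑ˡ 1)
      at : ∀ n → Def (λ ρ → X (cell n ρ))
      at n = def-X (λ i → times (lookup n i) (var (m Fin.↑ʳ fz)) (var (i Fin.↑ˡ 1))) λ ρ i →
        trans (eval-times (lookup n i) (var (m Fin.↑ʳ fz)) (var (i Fin.↑ˡ 1)))
          (trans (cong₂ _+_ (*-comm (lookup n i) _) (sym (lookup-sel ρ (Fin._↑ˡ 1) i)))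
            (sym (lookup-blk (lookup ρ (m Fin.↑ʳ fz)) n (sel ρ (Fin._↑ˡ 1)) i)))
      body : ∀ {Y W} {c : Fin m → ℕ} y w → Y ≡ y → W ≡ w → (∀ i → c i ≡ lookup w i) →
        Iff ((∀ i → c i < 3 * Y) → DN (Iff (X (Y ⊠ n' ⊞ W)) (X (Y ⊠ n ⊞ W))))
            (w ≪ 3 * y → DN (Iff (X (y ⊠ n' ⊞ w)) (X (y ⊠ n ⊞ w))))
      body y w refl refl e = (λ h → ret λ l → h λ i → subst (_< 3 * y) (sym (e i)) (l i)) ,
        λ h → ret λ l → h λ i → subst (_< 3 * y) (e i) (l i)
      same : ∀ y w → _
      same y w = body y w (Vec.lookup-++ʳ w (y ∷ []) fz) (sel-↑ˡ w (y ∷ [])) (Vec.lookup-++ˡ w (y ∷ []))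

  -- A cell of side 3 k ^ r consists of cells of side k ^ r with leading parts n ⊞ ε, ε ≪ 3, and
  -- these are governed by `nerode`.
  alike-powers : ∀ n' n → (∀ ε → ε ≪ 3 → agree preds (n' ⊞ ε) (n ⊞ ε)) → ∀ r → Alike n' n (k ^ r)
  alike-powers n' n h r w = ret λ w< →
    let (ε , w' , w≡ , ε< , w'<) = split-vec (k ^ r) 3 (1≤^ k r k≥1) w w<
    in ret (subst₂ (λ a b → Iff (X a) (X b)) (sym (place n' ε w' w≡)) (sym (place n ε w' w≡))
         (nerode (n' ⊞ ε) (n ⊞ ε) (h ε ε<) r w' w'<))
    where
      place : ∀ n ε w' → w ≡ k ^ r ⊠ ε ⊞ w' → k ^ r ⊠ n ⊞ w ≡ k ^ r ⊠ (n ⊞ ε) ⊞ w'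
      place n ε w' refl = blk-⊞ (k ^ r) n ε w'

  -- n' is a partner of n: all cells at n and n' of side y₀ + j p are alike.
  record Partner (n : Vec ℕ m) : Set where
    field
      n' : Vec ℕ m
      p y₀ : ℕ
      p≥1 : 1 ≤ p
      y₀≥1 : 1 ≤ y₀
      alike : ∀ j → Alike n' n (j * p + y₀)
      wide : ∀ i → (lookup n i + lookup n' i) * p ≤ y₀
      zero' : ∀ i → lookup n i ≡ 0 → lookup n' i ≡ 0

  -- `Alike n' n` is a definable set of sides that contains every power of k. Its ultimate period,
  -- started at a power of k past the preperiod, gives the progression. The exponent `y₁` is also
  -- large enough for `wide`.
  partner : Tame → ∀ n n' → (∀ ε → ε ≪ 3 → agree preds (n' ⊞ ε) (n ⊞ ε)) →
    (∀ i → lookup n i ≡ 0 → lookup n' i ≡ 0) → DN (∃ λ (P : Partner n) → Partner.n' P ≡ n')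
  partner tame n n' h z = do
    (p , b , per) ← ultimately-periodic tame (Alike n' n) (def-Alike n' n)
    let y₁ = b + dot ones (suc p ⊠ (n ⊞ n'))
        large : ∀ j → b ≤ j * suc p + k ^ y₁
        large j = ≤-trans (m≤m+n b _) (≤-trans (<⇒≤ (n<k^n k y₁ k≥2)) (m≤n+m (k ^ y₁) (j * suc p)))
        wide : ∀ i → (lookup n i + lookup n' i) * suc p ≤ k ^ y₁
        wide i = ≤-trans (≤-trans (≤-trans (≤-reflexive (trans (*-comm _ (suc p))
            (sym (trans (lookup-⊠ (suc p) (n ⊞ n') i) (cong (suc p *_) (lookup-⊞ n n' i))))))
            (lookup≤sum (suc p ⊠ (n ⊞ n')) i)) (m≤n+m _ b)) (<⇒≤ (n<k^n k y₁ k≥2))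
    ret (record { n' = n' ; p = suc p ; y₀ = k ^ y₁ ; p≥1 = s≤s z≤n ; y₀≥1 = 1≤^ k y₁ k≥1
                ; alike = λ j w → progression p y₁ (λ j → per (j * suc p + k ^ y₁) (large j)) j >>= λ a → a w
                ; wide = wide ; zero' = z } , refl)
    where
      progression : ∀ p y₁ → (∀ j → Iff (Alike n' n (j * suc p + k ^ y₁)) (Alike n' n (suc p + (j * suc p + k ^ y₁)))) →
        ∀ j → DN (Alike n' n (j * suc p + k ^ y₁))
      progression p y₁ per zero = ret (alike-powers n' n h y₁)
      progression p y₁ per (suc j) = progression p y₁ per j >>= λ a →
        subst (λ y → DN (Alike n' n y)) (sym (+-assoc (suc p) (j * suc p) (k ^ y₁))) (proj₁ (per j) a)

  -- With so large a coordinate sum a point cannot fit at scale y₀, so the least fitting scale has a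
  -- predecessor in the progression.
  threshold : ∀ {n} → Partner n → ℕ
  threshold {n} P = suc ((2 + dot ones n) * Partner.y₀ P * dot ones (ones {m}))

  module Invariance {n : Vec ℕ m} (P : Partner n) where
    open Partner P

    Fits : Vec ℕ m → ℕ → Set
    Fits z j = ∀ i → lookup z i ≤ hi (lookup n i) * (j * p + y₀)

    fits-some : ∀ z → Fits z (dot ones z)
    fits-some z i = ≤-trans (lookup≤sum z i) (cn₁₀ (dot ones z) p y₀ (lookup n i) p≥1)

    fits-not-0 : ∀ z → threshold P ≤ dot ones z → ¬ Fits z 0
    fits-not-0 z t f = <⇒≱ t (dot-bound ones z λ i → ≤-trans (f i) (*-monoˡ-≤ y₀ (+-monoʳ-≤ 2 (lookup≤sum n i))))

    -- Write z as (p + y) n + w. Alikeness at side p + y moves it to (p + y) n' + w. This same point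
    -- is (2 p + y) n' + w' with w' = w - p n', and alikeness at side 2 p + y moves it back to (2 p
    -- + y) n + w', which is z + p n - p n'.
    invariant : ∀ {T} → threshold P ≤ T → ∀ z z' → In (cone n T) z →
      (∀ i → lookup z' i + p * lookup n' i ≡ lookup z i + p * lookup n i) → Iff (X z) (X z')
    invariant {T} t≤T z z' hz shift = Iff-stable do
      (suc j , fit , min) ← least {P = Fits z} (dot ones z) (fits-some z) where
        (zero , fit , _) → ⊥-elim (fits-not-0 z (≤-trans t≤T (in-cone-sum {n = n} hz)) fit)
      -- Minimality of the scale yields a coordinate i₀ too large for y; the sections of the cone
      -- convert this into lower bounds for all coordinates.
      let (i₀ , nfit) = Fin.¬∀⟶∃¬ m (λ i → lookup z i ≤ hi (lookup n i) * (j * p + y₀)) (λ i → lookup z i ≤? _) (min j ≤-refl)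
          open Translate j fit i₀ (≰⇒> nfit)
      a ← alike (suc j) w
      b ← alike (suc (suc j)) w'
      a' ← a w<
      b' ← b w'<
      ret (Iff-trans (Iff-sym (subst₂ (λ u v → Iff (X u) (X v)) e₁ e₂ a')) (subst₂ (λ u v → Iff (X u) (X v)) e₃ e₄ b'))
      where
        module Translate j (fit : Fits z (suc j)) i₀ (tight : hi (lookup n i₀) * (j * p + y₀) < lookup z i₀) where
          y : ℕ
          y = j * p + y₀
          -- The margin of one side y covers (n_i + n'_i) p by `wide`. Where n_i = 0 also n'_i = 0,
          -- and nothing has to be covered.
          low : ∀ i → lookup n' i * p + lookup n i * (p + y) ≤ lookup z i
          low i = go (lookup n i) refl
            where
              go : ∀ a → lookup n i ≡ a → lookup n' i * p + lookup n i * (p + y) ≤ lookup z i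
              go zero e = subst₂ (λ a b → b * p + a * (p + y) ≤ lookup z i) (sym e) (sym (zero' i e)) z≤n
              go (suc a) e = cn₂ (lookup n i) (lookup n' i) p y (lookup z i)
                (*-cancelˡ-≤ (hi (lookup n i₀)) (cn₁ (suc (lookup n i)) (hi (lookup n i₀)) y (lookup z i₀) (lookup z i)
                  (subst (λ b → b * lookup z i₀ ≤ hi (lookup n i₀) * lookup z i) (trans (cong lo e) (cong suc (sym e)))
                    (in-cone-section {n = n} hz i i₀)) tight))
                (≤-trans (wide i) (m≤n+m y₀ (j * p)))
          w w' : Vec ℕ m
          w = Vec.tabulate λ i → lookup z i ∸ lookup n i * (p + y)
          w' = Vec.tabulate λ i → lookup w i ∸ p * lookup n' i
          w≡ : ∀ i → lookup n i * (p + y) + lookup w i ≡ lookup z i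
          w≡ i = trans (cong (lookup n i * (p + y) +_) (Vec.lookup∘tabulate _ i))
            (m+[n∸m]≡n (cn₉ (lookup n i) p y (lookup z i) (lookup n' i) (low i)))
          w'≡ : ∀ i → p * lookup n' i + lookup w' i ≡ lookup w i
          w'≡ i = trans (cong (p * lookup n' i +_) (Vec.lookup∘tabulate _ i))
            (m+[n∸m]≡n (cn₈ (lookup n i) p y (lookup w i) (lookup z i) (lookup n' i) (low i) (w≡ i)))
          assoc₁ : suc j * p + y₀ ≡ p + y
          assoc₁ = +-assoc p (j * p) y₀
          assoc₂ : suc (suc j) * p + y₀ ≡ p + (p + y)
          assoc₂ = trans (+-assoc p (suc j * p) y₀) (cong (p +_) assoc₁)
          w<' : w ≪ 3 * (p + y)
          w<' i = cn₄ (lookup n i) (p + y) (lookup w i) (lookup z i) (w≡ i)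
            (cn₃ (lookup n i) (p + y) (lookup z i) (subst (λ y → lookup z i ≤ hi (lookup n i) * y) assoc₁ (fit i))
              (≤-trans p≥1 (m≤m+n p y)))
          w< : w ≪ 3 * (suc j * p + y₀)
          w< = subst (λ y → w ≪ 3 * y) (sym assoc₁) w<'
          w'< : w' ≪ 3 * (suc (suc j) * p + y₀)
          w'< i = subst (λ y → lookup w' i < 3 * y) (sym assoc₂)
            (cn₇ p y (lookup w i) (lookup w' i) (lookup n' i) (w'≡ i) (w<' i))
          e₁ : (suc j * p + y₀) ⊠ n' ⊞ w ≡ (suc (suc j) * p + y₀) ⊠ n' ⊞ w'
          e₁ = subst₂ (λ a b → a ⊠ n' ⊞ w ≡ b ⊠ n' ⊞ w') (sym assoc₁) (sym assoc₂) (vec-ext λ i →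
            trans (lookup-blk (p + y) n' w i) (trans (cn₆ (lookup n' i) p y (lookup w i) (lookup w' i) (w'≡ i))
              (sym (lookup-blk (p + (p + y)) n' w' i))))
          e₂ : (suc j * p + y₀) ⊠ n ⊞ w ≡ z
          e₂ = subst (λ a → a ⊠ n ⊞ w ≡ z) (sym assoc₁) (vec-ext λ i → trans (lookup-blk (p + y) n w i)
            (trans (cong (_+ lookup w i) (*-comm (p + y) (lookup n i))) (w≡ i)))
          e₃ : (suc (suc j) * p + y₀) ⊠ n' ⊞ w' ≡ (suc (suc j) * p + y₀) ⊠ n' ⊞ w'
          e₃ = refl
          e₄ : (suc (suc j) * p + y₀) ⊠ n ⊞ w' ≡ z'
          e₄ = subst (λ a → a ⊠ n ⊞ w' ≡ z') (sym assoc₂) (vec-ext λ i → trans (lookup-blk (p + (p + y)) n w' i)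
            (cn₅ (lookup n i) p y (lookup w i) (lookup z i) (lookup n' i) (lookup z' i) (lookup w' i) (w≡ i) (shift i) (w'≡ i)))

-- Translation along one direction inside a convex region

sl₂ : ∀ b bf bg a af ag c b' a' → b' + bg ≡ b + bf → a' + ag ≡ a + af → b + bf + ag + c ≤ a + af + bg → b' + c ≤ a'
sl₂ b bf bg a af ag c b' a' h0 h1 h2 =
  lin₀ 0 (≤-reflexive h0 ⊕ ≤-reflexive (sym h1) ⊕ h2)
    (S.solve 9 (λ b bf bg a af ag c b' a' → a' :+ (b' :+ bg :+ (a :+ af) :+ (b :+ bf :+ ag :+ c)) :=
      b' :+ c :+ (b :+ bf :+ (a' :+ ag) :+ (a :+ af :+ bg) :+ # 0)) refl b bf bg a af ag c b' a')

sl₃ : ∀ b bf bg a af ag c b' a' j → b' + suc j * bg ≡ b + suc j * bf → a' + suc j * ag ≡ a + suc j * af → b + c ≤ a → b' + c ≤ a' → bf + ag ≤ af + bg → b + bf + ag + c ≤ a + af + bg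
sl₃ b bf bg a af ag c b' a' j h0 h1 h2 h3 h4 =
  lin₀ 0 (h2 ⊕ h4)
    (S.solve 10 (λ b bf bg a af ag c b' a' j → a :+ af :+ bg :+ (b :+ c :+ (bf :+ ag)) :=
      b :+ bf :+ ag :+ c :+ (a :+ (af :+ bg) :+ # 0)) refl b bf bg a af ag c b' a' j)

sl₄ : ∀ b bf bg a af ag c b' a' j → b' + suc j * bg ≡ b + suc j * bf → a' + suc j * ag ≡ a + suc j * af → b + c ≤ a → b' + c ≤ a' → af + bg < bf + ag → b + bf + ag + c ≤ a + af + bg
sl₄ b bf bg a af ag c b' a' j h0 h1 h2 h3 h4 =
  lin₀ j (≤-reflexive (sym h0) ⊕ ≤-reflexive h1 ⊕ h3 ⊕ scale j h4)
    (S.solve 10 (λ b bf bg a af ag c b' a' j → a :+ af :+ bg :+ (b :+ (# 1 :+ j) :* bf :+ (a' :+ (# 1 :+ j) :* ag) :+ (b' :+ c) :+ j :* (# 1 :+ af :+ bg)) :=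
      b :+ bf :+ ag :+ c :+ (b' :+ (# 1 :+ j) :* bg :+ (a :+ (# 1 :+ j) :* af) :+ a' :+ j :* (bf :+ ag) :+ j)) refl b bf bg a af ag c b' a' j)

sl₅ : ∀ z' z'' z g f j → z' + suc j * g ≡ z + suc j * f → z'' + g ≡ z + f → z' + j * g ≡ z'' + j * f
sl₅ z' z'' z g f j h0 h1 =
  ≤-antisym (lin₀ 0 (≤-reflexive h0 ⊕ ≤-reflexive (sym h1))
    (S.solve 6 (λ z' z'' z g f j → z'' :+ j :* f :+ (z' :+ (# 1 :+ j) :* g :+ (z :+ f)) :=
      z' :+ j :* g :+ (z :+ (# 1 :+ j) :* f :+ (z'' :+ g) :+ # 0)) refl z' z'' z g f j))
  (lin₀ 0 (≤-reflexive (sym h0) ⊕ ≤-reflexive h1)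
    (S.solve 6 (λ z' z'' z g f j → z' :+ j :* g :+ (z :+ (# 1 :+ j) :* f :+ (z'' :+ g)) :=
      z'' :+ j :* f :+ (z' :+ (# 1 :+ j) :* g :+ (z :+ f) :+ # 0)) refl z' z'' z g f j))

sl₆ : ∀ z' z'' z g f j → z' + j * g ≡ z'' + j * f → z'' + g ≡ z + f → z' + suc j * g ≡ z + suc j * f
sl₆ z' z'' z g f j h0 h1 =
  ≤-antisym (lin₀ 0 (≤-reflexive h0 ⊕ ≤-reflexive h1)
    (S.solve 6 (λ z' z'' z g f j → z :+ (# 1 :+ j) :* f :+ (z' :+ j :* g :+ (z'' :+ g)) :=
      z' :+ (# 1 :+ j) :* g :+ (z'' :+ j :* f :+ (z :+ f) :+ # 0)) refl z' z'' z g f j))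
  (lin₀ 0 (≤-reflexive (sym h0) ⊕ ≤-reflexive (sym h1))
    (S.solve 6 (λ z' z'' z g f j → z' :+ (# 1 :+ j) :* g :+ (z'' :+ j :* f :+ (z :+ f)) :=
      z :+ (# 1 :+ j) :* f :+ (z' :+ j :* g :+ (z'' :+ g) :+ # 0)) refl z' z'' z g f j))

sl₇ : ∀ z'' z g f n → z'' + g ≡ z + f → f < g → z < suc n → z'' < n
sl₇ z'' z g f n h0 h1 h2 =
  lin₀ 0 (≤-reflexive h0 ⊕ h1 ⊕ h2)
    (S.solve 5 (λ z'' z g f n → n :+ (z'' :+ g :+ (# 1 :+ f) :+ (# 1 :+ z)) :=
      # 1 :+ z'' :+ (z :+ f :+ g :+ (# 1 :+ n) :+ # 0)) refl z'' z g f n)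

sl₈ : ∀ a af b bf ag bg c e → a + af + bg < b + bf + ag + c → b + c + e ≡ a → e < bf + ag
sl₈ a af b bf ag bg c e h0 h1 =
  lin₀ (af + bg) (h0 ⊕ ≤-reflexive h1)
    (S.solve 8 (λ a af b bf ag bg c e → bf :+ ag :+ (# 1 :+ a :+ af :+ bg :+ (b :+ c :+ e)) :=
      # 1 :+ e :+ (b :+ bf :+ ag :+ c :+ a :+ (af :+ bg))) refl a af b bf ag bg c e)

sl₁₀ : ∀ a af a' ag b bf b' bg c j → a' + j * ag ≡ a + j * af → b' + j * bg ≡ b + j * bf → a ≡ b + c → af + bg ≡ bf + ag → a' ≡ b' + c
sl₁₀ a af a' ag b bf b' bg c j h0 h1 h2 h3 =
  ≤-antisym (lin₀ 0 (≤-reflexive h0 ⊕ ≤-reflexive (sym h1) ⊕ ≤-reflexive h2 ⊕ scale j (≤-reflexive h3))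
    (S.solve 10 (λ a af a' ag b bf b' bg c j → b' :+ c :+ (a' :+ j :* ag :+ (b :+ j :* bf) :+ a :+ j :* (af :+ bg)) :=
      a' :+ (a :+ j :* af :+ (b' :+ j :* bg) :+ (b :+ c) :+ j :* (bf :+ ag) :+ # 0)) refl a af a' ag b bf b' bg c j))
  (lin₀ 0 (≤-reflexive (sym h0) ⊕ ≤-reflexive h1 ⊕ ≤-reflexive (sym h2) ⊕ scale j (≤-reflexive (sym h3)))
    (S.solve 10 (λ a af a' ag b bf b' bg c j → a' :+ (a :+ j :* af :+ (b' :+ j :* bg) :+ (b :+ c) :+ j :* (bf :+ ag)) :=
      b' :+ c :+ (a' :+ j :* ag :+ (b :+ j :* bf) :+ a :+ j :* (af :+ bg) :+ # 0)) refl a af a' ag b bf b' bg c j))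

dot-shift : ∀ (α : Vec ℕ m) {z z' f g} j → (∀ i → lookup z' i + j * lookup g i ≡ lookup z i + j * lookup f i) →
  dot α z' + j * dot α g ≡ dot α z + j * dot α f
dot-shift α {z} {z'} {f} {g} j h = trans (cong (dot α z' +_) (sym (dot-⊠ α j g))) (trans (sym (dot-⊞ α z' (j ⊠ g)))
  (trans (cong (dot α) (vec-ext λ i → trans (at z' g i) (trans (h i) (sym (at z f i)))))
    (trans (dot-⊞ α z (j ⊠ f)) (cong (dot α z +_) (dot-⊠ α j f)))))
  where
    at : ∀ x y i → lookup (x ⊞ j ⊠ y) i ≡ lookup x i + j * lookup y i
    at x y i = trans (lookup-⊞ x (j ⊠ y) i) (cong (lookup x i +_) (lookup-⊠ j y i))

module Sliding (X : Vec ℕ m → Set) (Γ : List (Ineq m)) (coord : ∀ i → coordinate i ∈ Γ) (f g : Vec ℕ m)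
  (i₀ : Fin m) (f<g : lookup f i₀ < lookup g i₀)
  (inv : ∀ z z' → In Γ z → In Γ z' → (∀ i → lookup z' i + lookup g i ≡ lookup z i + lookup f i) → Iff (X z) (X z')) where

  open Ineq

  Shift : ℕ → Vec ℕ m → Vec ℕ m → Set
  Shift j z z' = ∀ i → lookup z' i + j * lookup g i ≡ lookup z i + j * lookup f i

  one : ∀ {z z'} → (∀ i → lookup z' i + lookup g i ≡ lookup z i + lookup f i) → Shift 1 z z'
  one {z} {z'} h i = trans (cong (lookup z' i +_) (+-identityʳ _)) (trans (h i) (cong (lookup z i +_) (sym (+-identityʳ _))))

  one⁻ : ∀ {z z'} → Shift 1 z z' → ∀ i → lookup z' i + lookup g i ≡ lookup z i + lookup f i
  one⁻ {z} {z'} h i = trans (cong (lookup z' i +_) (sym (+-identityʳ _))) (trans (h i) (cong (lookup z i +_) (+-identityʳ _)))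

  -- The inequality q at z + f - g, with the subtraction moved to the other side.
  Stays : Vec ℕ m → Ineq m → Set
  Stays z q = dot (small q) z + dot (small q) f + dot (big q) g + gap q ≤ dot (big q) z + dot (big q) f + dot (small q) g

  stays? : ∀ z q → Dec (Stays z q)
  stays? z q = _ ≤? _

  dot₁ : ∀ α {z z'} → Shift 1 z z' → dot α z' + dot α g ≡ dot α z + dot α f
  dot₁ α {z} {z'} h = trans (cong (dot α z' +_) (sym (+-identityʳ _))) (trans (dot-shift α {z} {z'} {f} {g} 1 h) (cong (dot α z +_) (+-identityʳ _)))

  move : ∀ z → (∀ q → q ∈ Γ → Stays z q) → ∃ λ z' → Shift 1 z z' × In Γ z'
  move z st = z' , sh , λ q q∈ → sl₂ (dot (small q) z) (dot (small q) f) (dot (small q) g) (dot (big q) z) (dot (big q) f)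
      (dot (big q) g) (gap q) (dot (small q) z') (dot (big q) z') (dot₁ (small q) {z} {z'} sh) (dot₁ (big q) {z} {z'} sh) (st q q∈)
    where
      z' : Vec ℕ m
      z' = Vec.tabulate λ i → lookup z i + lookup f i ∸ lookup g i
      -- `Stays` for `coordinate i` says precisely that the subtraction in ℕ is not truncated.
      g≤ : ∀ i → lookup g i ≤ lookup z i + lookup f i
      g≤ i = subst₂ _≤_ (trans (+-identityʳ _) (trans (cong₂ _+_ (cong₂ _+_ (dot-zeros z) (dot-zeros f)) (dot-single i 1 g)) (*-identityˡ _)))
        (trans (cong₂ _+_ (cong₂ _+_ (dot-single i 1 z) (dot-single i 1 f)) (dot-zeros g))
          (trans (+-identityʳ _) (cong₂ _+_ (*-identityˡ (lookup z i)) (*-identityˡ (lookup f i))))) (st (coordinate i) (coord i))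
      sh : Shift 1 z z'
      sh = one {z} {z'} λ i → trans (cong (_+ lookup g i) (Vec.lookup∘tabulate _ i)) (m∸n+n≡m (g≤ i))

  Exit : Vec ℕ m → Set
  Exit z = ∃ λ q → q ∈ Γ × ¬ Stays z q

  -- Each move lowers coordinate i₀, so it serves as fuel; the region has to be left eventually.
  slide : ∀ n z → lookup z i₀ < n → In Γ z → ∃ λ j → ∃ λ z' → Shift j z z' × In Γ z' × Iff (X z) (X z') × Exit z'
  slide (suc n) z l hz with All.all? (stays? z) Γ
  ... | no ¬a with find (All.¬All⇒Any¬ (stays? z) Γ ¬a)
  ... | q , q∈ , nq = 0 , z , (λ i → refl) , hz , Iff-refl , q , q∈ , nq
  slide (suc n) z l hz | yes a with move z (λ q q∈ → All.lookup a q∈)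
  ... | z'' , sh , hz'' with slide n z'' (sl₇ (lookup z'' i₀) (lookup z i₀) (lookup g i₀) (lookup f i₀) n (one⁻ {z} {z''} sh i₀) f<g l) hz''
  ... | j , z' , sh' , hz' , e , out = suc j , z' ,
    (λ i → sl₆ (lookup z' i) (lookup z'' i) (lookup z i) (lookup g i) (lookup f i) j (sh' i) (one⁻ {z} {z''} sh i)) ,
    hz' , Iff-trans (inv z z'' hz hz'' (one⁻ {z} {z''} sh)) e , out

  -- The region is convex, so the moves between two of its points stay inside.
  connect : ∀ j z z' → In Γ z → In Γ z' → Shift j z z' → Iff (X z) (X z')
  connect zero z z' hz hz' sh = Iff-≡ (cong X (vec-ext λ i → +-cancelʳ-≡ 0 _ _ (sym (sh i))))
  connect (suc j) z z' hz hz' sh with move z stays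
    where
      stays : ∀ q → q ∈ Γ → Stays z q
      -- The form big - small is monotone along the line: if it does not decrease, the bound at the
      -- first point suffices, otherwise the bound at the last point.
      stays q q∈ with ≤-<-connex (dot (small q) f + dot (big q) g) (dot (big q) f + dot (small q) g)
      ... | inj₁ l = sl₃ (dot (small q) z) (dot (small q) f) (dot (small q) g) (dot (big q) z) (dot (big q) f) (dot (big q) g) (gap q)
        (dot (small q) z') (dot (big q) z') j (dot-shift (small q) {z} {z'} {f} {g} (suc j) sh) (dot-shift (big q) {z} {z'} {f} {g} (suc j) sh)
        (hz q q∈) (hz' q q∈) l
      ... | inj₂ l = sl₄ (dot (small q) z) (dot (small q) f) (dot (small q) g) (dot (big q) z) (dot (big q) f) (dot (big q) g) (gap q)
        (dot (small q) z') (dot (big q) z') j (dot-shift (small q) {z} {z'} {f} {g} (suc j) sh) (dot-shift (big q) {z} {z'} {f} {g} (suc j) sh)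
        (hz q q∈) (hz' q q∈) l
  ... | z'' , sh₁ , hz'' = Iff-trans (inv z z'' hz hz'' (one⁻ {z} {z''} sh₁)) (connect j z'' z' hz'' hz'
    λ i → sl₅ (lookup z' i) (lookup z'' i) (lookup z i) (lookup g i) (lookup f i) j (sh i) (one⁻ {z} {z''} sh₁ i))

ps₁ : ∀ q A → 1 ≤ A → q ≤ q * A
ps₁ q A h0 =
  lin₀ 0 (scale q h0)
    (S.solve 2 (λ q A → q :* A :+ q :* # 1 :=
      q :+ (q :* A :+ # 0)) refl q A)

ps₂ : ∀ k q A → k * q * A ≡ q * (k * A)
ps₂ = S.solve 3 (λ k q A → k :* q :* A := q :* (k :* A)) refl

power-scale : ∀ k A M → 2 ≤ k → 1 ≤ A → A ≤ M → ∃ λ r → k ^ r * A ≤ M × M < k ^ r * (k * A)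
power-scale k A M k≥2 A≥1 A≤M = go M (≤-trans (n<k^n k M k≥2) (ps₁ (k ^ M) A A≥1))
  where
    go : ∀ r → M < k ^ r * A → ∃ λ r → k ^ r * A ≤ M × M < k ^ r * (k * A)
    go zero l = ⊥-elim (<⇒≱ l (≤-trans (≤-reflexive (*-identityˡ A)) A≤M))
    go (suc r) l with k ^ r * A ≤? M
    ... | yes a = r , a , subst (M <_) (ps₂ k (k ^ r) A) l
    ... | no ¬a = go r (≰⇒> ¬a)

-- Büchi’s theorem

size : Term v → ℕ
size (var i) = 1
size (plus s t) = size s + size t

eval-blk : ∀ (t : Term v) q n w → evalT (q ⊠ n ⊞ w) t ≡ q * evalT n t + evalT w t
eval-blk (var i) q n w = lookup-blk q n w i
eval-blk (plus s t) q n w = trans (cong₂ _+_ (eval-blk s q n w) (eval-blk t q n w))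
  (rg₁ q (evalT n s) (evalT w s) (evalT n t) (evalT w t))
  where
    rg₁ : ∀ q a b c d → q * a + b + (q * c + d) ≡ q * (a + c) + (b + d)
    rg₁ = solve-∀

eval-< : ∀ (t : Term v) {w q} → w ≪ q → evalT w t < size t * q
eval-< (var i) {w} {q} h = ≤-trans (h i) (≤-reflexive (sym (*-identityˡ q)))
eval-< (plus s t) {w} {q} h = rg₂ (evalT w s) (evalT w t) (size s) (size t) q (eval-< s h) (eval-< t h)
  where
    rg₂ : ∀ a b c d q → a < c * q → b < d * q → a + b < (c + d) * q
    rg₂ a b c d q h0 h1 = subst (a + b <_) (sym (*-distribʳ-+ q c d)) (+-mono-< h0 h1)

rg₃ : ∀ q sn tn sw tw S T → q * sn + sw ≡ q * tn + tw → tw < T * q → 1 ≤ q → q * sn ≤ q * (tn + (S + T))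
rg₃ q sn tn sw tw S T h0 h1 h2 =
  lin₀ (S * q + sw + 1) (≤-reflexive h0 ⊕ h1)
    (S.solve 7 (λ q sn tn sw tw S T → q :* (tn :+ (S :+ T)) :+ (q :* sn :+ sw :+ (# 1 :+ tw)) :=
      q :* sn :+ (q :* tn :+ tw :+ T :* q :+ (S :* q :+ sw :+ # 1))) refl q sn tn sw tw S T)

rg₄ : ∀ q sn tn sw tw S T → q * sn + sw ≡ q * tn + tw → sw < S * q → 1 ≤ q → q * tn ≤ q * (sn + (S + T))
rg₄ q sn tn sw tw S T h0 h1 h2 =
  lin₀ (T * q + tw + 1) (≤-reflexive (sym h0) ⊕ h1)
    (S.solve 7 (λ q sn tn sw tw S T → q :* (sn :+ (S :+ T)) :+ (q :* tn :+ tw :+ (# 1 :+ sw)) :=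
      q :* tn :+ (q :* sn :+ sw :+ S :* q :+ (T :* q :+ tw :+ # 1))) refl q sn tn sw tw S T)

rg₅ : ∀ sn tn e S → sn + e ≡ tn + S → tn ≤ sn + S → e < suc (2 * S)
rg₅ sn tn e S h0 h1 =
  lin₀ 0 (≤-reflexive h0 ⊕ h1)
    (S.solve 4 (λ sn tn e S → (# 1 :+ (# 2 :* S)) :+ (sn :+ e :+ tn) :=
      # 1 :+ e :+ (tn :+ S :+ (sn :+ S) :+ # 0)) refl sn tn e S)

rg₆ : ∀ q sn tn sn' tn' e S sw tw → sn + e ≡ tn + S → sn' + e ≡ tn' + S → q * sn + sw ≡ q * tn + tw → q * sn' + sw ≡ q * tn' + tw
rg₆ q sn tn sn' tn' e S sw tw h0 h1 h2 =
  ≤-antisym (lin₀ 0 (≤-reflexive h2 ⊕ scale q (≤-reflexive (sym h0)) ⊕ scale q (≤-reflexive h1))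
    (S.solve 9 (λ q sn tn sn' tn' e S sw tw → q :* tn' :+ tw :+ (q :* sn :+ sw :+ q :* (tn :+ S) :+ q :* (sn' :+ e)) :=
      q :* sn' :+ sw :+ (q :* tn :+ tw :+ q :* (sn :+ e) :+ q :* (tn' :+ S) :+ # 0)) refl q sn tn sn' tn' e S sw tw))
  (lin₀ 0 (≤-reflexive (sym h2) ⊕ scale q (≤-reflexive h0) ⊕ scale q (≤-reflexive (sym h1)))
    (S.solve 9 (λ q sn tn sn' tn' e S sw tw → q :* sn' :+ sw :+ (q :* tn :+ tw :+ q :* (sn :+ e) :+ q :* (tn' :+ S)) :=
      q :* tn' :+ tw :+ (q :* sn :+ sw :+ q :* (tn :+ S) :+ q :* (sn' :+ e) :+ # 0)) refl q sn tn sn' tn' e S sw tw))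

-- The difference t - s at the leading digits n, shifted into ℕ. A continuation contributes less
-- than `size s * q` and `size t * q`, so the equation can hold after n only if the difference is at
-- most `size s + size t` in absolute value: finitely many values of e decide it.
difference : Term v → Term v → ℕ → Vec ℕ v → Set
difference s t e n = evalT n s + e ≡ evalT n t + (size s + size t)

module _ (k : ℕ) (k≥2 : k ≥ 2) where
  private
    q≥1 : ∀ r → 1 ≤ k ^ r
    q≥1 r = 1≤^ k r (≤-trans (s≤s z≤n) k≥2)

  transfer-equation : ∀ (s t : Term v) n n' r w → w ≪ k ^ r →
    agree (List.map (difference s t) (List.upTo (suc (2 * (size s + size t))))) n n' →
    evalT (k ^ r ⊠ n ⊞ w) s ≡ evalT (k ^ r ⊠ n ⊞ w) t → DN (evalT (k ^ r ⊠ n' ⊞ w) s ≡ evalT (k ^ r ⊠ n' ⊞ w) t)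
  transfer-equation s t n n' r w w< ag e = do
    p' ← proj₁ (agree-∈ (Mem.∈-map⁺ (difference s t) (Mem.∈-upTo⁺ (rg₅ (evalT n s) (evalT n t) d (size s + size t) p b))) ag) p
    ret (trans (eval-blk s q n' w) (trans (rg₆ q (evalT n s) (evalT n t) (evalT n' s) (evalT n' t) d (size s + size t) _ _ p p' e')
      (sym (eval-blk t q n' w))))
    where
      q = k ^ r
      e' : q * evalT n s + evalT w s ≡ q * evalT n t + evalT w t
      e' = trans (sym (eval-blk s q n w)) (trans e (eval-blk t q n w))
      cancel : ∀ {a b} → q * a ≤ q * b → a ≤ b
      cancel {a} {b} l with q | q≥1 r
      ... | suc q' | _ = *-cancelˡ-≤ (suc q') l
      a : evalT n s ≤ evalT n t + (size s + size t)
      a = cancel (rg₃ q (evalT n s) (evalT n t) (evalT w s) (evalT w t) (size s) (size t) e' (eval-< t w<) (q≥1 r))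
      b : evalT n t ≤ evalT n s + (size s + size t)
      b = cancel (rg₄ q (evalT n s) (evalT n t) (evalT w s) (evalT w t) (size s) (size t) e' (eval-< s w<) (q≥1 r))
      d = evalT n t + (size s + size t) ∸ evalT n s
      p : difference s t d n
      p = m+[n∸m]≡n a

  sizes : ∀ {u} → Vec (Term v) u → ℕ
  sizes [] = 1
  sizes (t ∷ ts) = size t + sizes ts

  evalTs-blk : ∀ {u} (ts : Vec (Term v) u) q n w → evalTs (q ⊠ n ⊞ w) ts ≡ q ⊠ evalTs n ts ⊞ evalTs w ts
  evalTs-blk [] q n w = refl
  evalTs-blk (t ∷ ts) q n w = cong₂ _∷_ (eval-blk t q n w) (evalTs-blk ts q n w)

  evalTs-< : ∀ {u} (ts : Vec (Term v) u) {w q} → w ≪ q → evalTs w ts ≪ sizes ts * q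
  evalTs-< (t ∷ ts) {q = q} h fz = ≤-trans (eval-< t h) (*-monoˡ-≤ q (m≤m+n (size t) (sizes ts)))
  evalTs-< (t ∷ ts) {q = q} h (fs i) = ≤-trans (evalTs-< ts h i) (*-monoˡ-≤ q (m≤n+m (sizes ts) (size t)))

  module _ {m} (X : Vec ℕ m → Set) (reg : Regular k X) where
    open Regular

    agree-shift : ∀ (ps : List (Vec ℕ m → Set)) (ts : Vec (Term v) m) {n n'} →
      agree (List.cartesianProductWith (λ ε p n → p (evalTs n ts ⊞ ε)) (allVecs m (sizes ts)) ps) n n' →
      ∀ ε → ε ≪ sizes ts → agree ps (evalTs n ts ⊞ ε) (evalTs n' ts ⊞ ε)
    agree-shift ps ts ag ε ε< = agree-intro ps λ p p∈ →
      agree-∈ (Mem.∈-cartesianProductWith⁺ (λ ε p n → p (evalTs n ts ⊞ ε)) (∈-allVecs ε ε<) p∈) ag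

    -- Büchi: first-order definable sets over (ℕ,+,X) are k-regular.  The class
    -- of n for ∃ y φ is the set of classes of (j , n) for φ as j varies.
    regular-formula : ∀ (φ : Formula (m ∷ []) v) →
      DN (∃ λ (ps : List (Vec ℕ v → Set)) → ∀ n n' → agree ps n n' → ∀ r w → w ≪ k ^ r →
        Sat {m ∷ []} (interp₁ X) (k ^ r ⊠ n ⊞ w) φ → DN (Sat {m ∷ []} (interp₁ X) (k ^ r ⊠ n' ⊞ w) φ))
    regular-formula (eq s t) = ret (_ , λ n n' ag r w w< → transfer-equation s t n n' r w w< ag)
    regular-formula (rel fz ts) = ret (_ , λ n n' ag r w w< x →
      let q = k ^ r
          (ε , w' , w≡ , ε< , w'<) = split-vec q (sizes ts) (q≥1 r) (evalTs w ts) (evalTs-< ts w<)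
          place : ∀ n → evalTs (q ⊠ n ⊞ w) ts ≡ q ⊠ (evalTs n ts ⊞ ε) ⊞ w'
          place n = trans (evalTs-blk ts q n w) (trans (cong (q ⊠ evalTs n ts ⊞_) w≡) (blk-⊞ q (evalTs n ts) ε w'))
      in dn-map (subst X (sym (place n')))
        (proj₁ (nerode reg _ _ (agree-shift (preds reg) ts ag ε ε<) r w' w'<) (subst X (place n) x)))
    regular-formula (neg φ) = do
      (ps , h) ← regular-formula φ
      ret (ps , λ n n' ag r w w< ns → ret λ s → h n' n (agree-sym ps ag) r w w< s ns)
    regular-formula (conj φ ψ) = do
      (ps , h) ← regular-formula φ
      (qs , h') ← regular-formula ψ
      ret (ps List.++ qs , λ n n' ag r w w< (a , b) → do
        a' ← h n n' (proj₁ (agree-++ ps qs ag)) r w w< a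
        b' ← h' n n' (proj₂ (agree-++ ps qs ag)) r w w< b
        ret (a' , b'))
    regular-formula (ex φ) = do
      (ps , h) ← regular-formula φ
      (rs , cover) ← representatives ps
      ret (List.map (λ r n → ∃ λ j → agree ps (j ∷ n) r) rs , λ n n' ag r w w< (y , s) → do
        let (j , l , hgh) = div-floor y (k ^ r) (q≥1 r)
            y₀ = y ∸ j * k ^ r
            y≡ : y ≡ k ^ r * j + y₀
            y≡ = trans (sym (m+[n∸m]≡n l)) (cong (_+ y₀) (*-comm j (k ^ r)))
            y₀< : y₀ < k ^ r
            y₀< = +-cancelˡ-< (j * k ^ r) y₀ (k ^ r) (subst (_< j * k ^ r + k ^ r) (sym (m+[n∸m]≡n l)) hgh)
        (t , t∈ , a) ← cover (j ∷ n)
        (j' , a') ← proj₁ (agree-∈ (Mem.∈-map⁺ (λ r n → ∃ λ j → agree ps (j ∷ n) r) t∈) ag) (j , a)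
        s' ← h (j ∷ n) (j' ∷ n') (agree-trans ps a (agree-sym ps a')) r (y₀ ∷ w) (λ { fz → y₀< ; (fs i) → w< i })
          (subst (λ y → Sat {m ∷ []} (interp₁ X) (y ∷ k ^ r ⊠ n ⊞ w) φ) y≡ s)
        ret (k ^ r * j' + y₀ , s'))

    regular-definable : ∀ {R : Vec ℕ v → Set} → Definability.Def (m ∷ []) (interp₁ X) R → DN (Regular k R)
    regular-definable {R = R} d = do
      (ps , h) ← regular-formula (Definability.formula d)
      let one : ∀ n n' → agree ps n n' → ∀ r w → w ≪ k ^ r → R (k ^ r ⊠ n ⊞ w) → DN (R (k ^ r ⊠ n' ⊞ w))
          one n n' ag r w w< x = Definability.complete d _ x >>= λ s → h n n' ag r w w< s >>= Definability.sound d _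
      ret (record { preds = ps ; nerode = λ n n' ag r w w< →
        one n n' ag r w w< , one n' n (agree-sym ps ag) r w w< })

digits-step : (k : ℕ) → Vec ℕ m → Vec (Fin k) m → Vec ℕ m
digits-step k = Vec.zipWith λ a i → a * k + toℕ i

value-from : ∀ (k : ℕ) → Vec ℕ m → List (Vec (Fin k) m) → Vec ℕ m
value-from k = List.foldl (digits-step k)

rg₇ : ∀ k q a d w → q * (a * k + d) + w ≡ k * q * a + (q * d + w)
rg₇ = S.solve 5 (λ k q a d w → q :* (a :* k :+ d) :+ w := k :* q :* a :+ (q :* d :+ w)) refl

word : ∀ (k : ℕ) → 1 ≤ k → ∀ r (w : Vec ℕ m) → w ≪ k ^ r →
  ∃ λ u → ∀ a → value-from k a u ≡ k ^ r ⊠ a ⊞ w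
word k k≥1 zero w w< = [] , λ a → sym (vec-ext λ i → trans (lookup-blk 1 a w i)
  (trans (cong (1 * lookup a i +_) (n<1⇒n≡0 (w< i))) (trans (+-identityʳ _) (*-identityˡ (lookup a i)))))
word {m} k k≥1 (suc r) w w< with split-vec (k ^ r) k (1≤^ k r k≥1) w w<
... | d , w' , refl , d< , w'< with word k k≥1 r w' w'<
... | u , h = ds ∷ u , λ a → trans (h (digits-step k a ds)) (vec-ext λ i →
    trans (lookup-blk (k ^ r) (digits-step k a ds) w' i) (trans (cong (λ z → k ^ r * z + lookup w' i)
      (trans (Vec.lookup-zipWith _ i a ds) (cong (lookup a i * k +_) (digit i))))
      (trans (rg₇ k (k ^ r) (lookup a i) (lookup d i) (lookup w' i))
        (sym (trans (lookup-blk (k * k ^ r) a (k ^ r ⊠ d ⊞ w') i) (cong (k * k ^ r * lookup a i +_) (lookup-blk (k ^ r) d w' i)))))))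
  where
    ds : Vec (Fin k) m
    ds = Vec.tabulate λ i → Fin.fromℕ< (d< i)
    digit : ∀ i → toℕ (lookup ds i) ≡ lookup d i
    digit i = trans (cong toℕ (Vec.lookup∘tabulate _ i)) (Fin.toℕ-fromℕ< (d< i))

-- The predicates of n are the states reached by words denoting n. Leading zeros allow several such
-- words, but any one of them can be continued.
regular-recognizable : ∀ k → k ≥ 2 → ∀ (X : Vec ℕ m → Set) → Recognizable k m X → Regular k X
regular-recognizable {m} k k≥2 X (A , acc) = record
  { preds = List.map reach-state (List.allFin nstates)
  ; nerode = λ n n' ag r w w< → one n n' ag r w w< , one n' n (agree-sym _ ag) r w w< }
  where
    open DFA A
    k≥1 : 1 ≤ k
    k≥1 = ≤-trans (s≤s z≤n) k≥2
    run : Fin nstates → List (Vec (Fin k) m) → Fin nstates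
    run = List.foldl δ
    reach-state : Fin nstates → Vec ℕ m → Set
    reach-state q n = ∃ λ u → value k m u ≡ n × run start u ≡ q
    value-++ : ∀ u u' → value k m (u List.++ u') ≡ value-from k (value k m u) u'
    value-++ u u' = List.foldl-++ (digits-step k) (Vec.replicate m 0) u u'
    spell : ∀ n → ∃ λ u → value k m u ≡ n
    spell n with word k k≥1 (dot ones n) n (λ i → ≤-<-trans (lookup≤sum n i) (n<k^n k (dot ones n) k≥2))
    ... | u , h = u , trans (h zeros) (vec-ext λ i → trans (lookup-blk (k ^ dot ones n) zeros n i)
      (trans (cong (λ z → k ^ dot ones n * z + lookup n i) (Vec.lookup-replicate i 0)) (cong (_+ lookup n i) (*-zeroʳ (k ^ dot ones n)))))
    one : ∀ n n' → agree (List.map reach-state (List.allFin nstates)) n n' → ∀ r w → w ≪ k ^ r →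
      X (k ^ r ⊠ n ⊞ w) → DN (X (k ^ r ⊠ n' ⊞ w))
    one n n' ag r w w< x with spell n | word k k≥1 r w w<
    ... | u , refl | u' , h' = do
      (t , t≡ , same) ← proj₁ (agree-∈ (Mem.∈-map⁺ reach-state (Mem.∈-allFin (run start u))) ag) (u , refl , refl)
      let x' : X (value k m (u List.++ u'))
          x' = subst X (sym (trans (value-++ u u') (h' (value k m u)))) x
          a' : accepts A (u List.++ u')
          a' = Equivalence.from (acc (u List.++ u')) x'
          state≡ : run start (t List.++ u') ≡ run start (u List.++ u')
          state≡ = trans (List.foldl-++ δ start t u') (trans (cong (λ q → run q u') same) (sym (List.foldl-++ δ start u u')))
      ret (subst X (trans (value-++ t u') (trans (cong (λ a → value-from k a u') t≡) (h' n')))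
        (Equivalence.to (acc (t List.++ u')) (trans (cong accepting state≡) a')))

-- Acceptance is a decidable equation of Booleans. Stability is what later turns definability up to
-- double negation into genuine definability.
recognizable-stable : ∀ k → k ≥ 2 → ∀ (X : Vec ℕ m → Set) → Recognizable k m X → ∀ x → DN (X x) → X x
recognizable-stable {m} k k≥2 X (A , acc) x nn
  with word k (≤-trans (s≤s z≤n) k≥2) (dot ones x) x (λ i → ≤-<-trans (lookup≤sum x i) (n<k^n k (dot ones x) k≥2))
... | u , h = subst X value≡ (Equivalence.to (acc u) (decidable-stable (_ Data.Bool.≟ true)
    (nn >>= λ xx → ret (Equivalence.from (acc u) (subst X (sym value≡) xx)))))
  where
    value≡ : value k m u ≡ x
    value≡ = trans (h zeros) (vec-ext λ i → trans (lookup-blk (k ^ dot ones x) zeros x i)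
      (trans (cong (λ z → k ^ dot ones x * z + lookup x i) (Vec.lookup-replicate i 0)) (cong (_+ lookup x i) (*-zeroʳ (k ^ dot ones x)))))

sp₂ : ∀ y Y g G y' → Y + g ≡ y' → y < Y → G < g → y + G < y'
sp₂ y Y g G y' h0 h1 h2 =
  lin₀ 1 (≤-reflexive h0 ⊕ h1 ⊕ h2)
    (S.solve 5 (λ y Y g G y' → y' :+ (Y :+ g :+ (# 1 :+ y) :+ (# 1 :+ G)) :=
      # 1 :+ y :+ G :+ (y' :+ Y :+ g :+ # 1)) refl y Y g G y')

sp₄ : ∀ y Y g y' → Y + g ≡ y' → y < y' → Y ≤ y → y < Y + g
sp₄ y Y g y' h0 h1 h2 =
  lin₀ 0 (≤-reflexive (sym h0) ⊕ h1)
    (S.solve 4 (λ y Y g y' → Y :+ g :+ (y' :+ (# 1 :+ y)) :=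
      # 1 :+ y :+ (Y :+ g :+ y' :+ # 0)) refl y Y g y')

-- Sparse regular sets

Gaps-grow : (ℕ → Set) → Set
Gaps-grow R = ∀ G → DN (∃ λ b → ∀ y y' → R y → R y' → y < y' → b ≤ y' → y + G < y')

module First-after-gap (rels : List ℕ) (I : Interp rels) (L : ℕ → Set)
  (dL : Periodicity.DefSet rels I L) (expanding : Expanding L) where
  open Periodicity rels I

  Preceded : ℕ → ℕ → Set
  Preceded g x = ∃ λ y → y + g ≡ x × (∀ z → z < g → DN (¬ L (y + z)))

  Candidate : ℕ → ℕ → Set
  Candidate g x = L x × Preceded g x

  First : ℕ → Set
  First x = ∃ λ g → Candidate g x × (∀ x' → x' < x → DN (¬ Candidate g x'))

  def-Candidate : Def {v = 2} (λ ρ → Candidate (lookup ρ v0) (lookup ρ v1))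
  def-Candidate = def-∧ (def-app₁ {P = L} dL (fun-var v1))
    (def-∃ (def-∧ (def-≡ (fun-term (plus (var v0) (var v1))) (fun-var v2))
      (def-∀< (fun-var v1) (def-¬ (def-app₁ {P = L} dL (fun-term (plus (var v1) (var v0))))))))

  def-First : DefSet First
  def-First = def-∃ (def-∧ (def-select def-Candidate (v0 ∷ v1 ∷ []))
    (def-∀< (fun-var v1) (def-¬ (def-select def-Candidate (v1 ∷ v0 ∷ [])))))

  candidate : ∀ g → DN (∃ λ x → g ≤ x × Candidate g x)
  candidate g = do
    (y , free) ← proj₂ expanding g
    (x , l , Lx) ← proj₁ expanding (y + g)
    (d , Ld , min) ← least {P = λ d → L (y + d + g)} (x ∸ (y + g)) (subst L (sym (shuffle y g x l)) Lx)
    ret (y + d + g , m≤n+m g (y + d) , Ld , y + d , refl , λ z z<g → clear y d free min z z<g)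
    where
      shuffle : ∀ y g x → y + g ≤ x → y + (x ∸ (y + g)) + g ≡ x
      shuffle y g x l = trans (trans (+-assoc y _ g) (trans (cong (y +_) (+-comm _ g)) (sym (+-assoc y g _)))) (m+[n∸m]≡n l)
      clear : ∀ y d → (∀ z → z < g → ¬ L (y + z)) → (∀ d' → d' < d → ¬ L (y + d' + g)) → ∀ z → z < g → DN (¬ L (y + d + z))
      clear y d free min z z<g with d + z <? g
      ... | yes l = ret λ Lz → free (d + z) l (subst L (+-assoc y d z) Lz)
      ... | no nl = ret λ Lz → min (d + z ∸ g) (+-cancelʳ-< g _ _ (subst (_< d + g) (sym (m∸n+n≡m (≮⇒≥ nl))) (+-monoʳ-< d z<g)))
        (subst L (trans (+-assoc y d z) (trans (cong (y +_) (sym (m∸n+n≡m (≮⇒≥ nl)))) (sym (+-assoc y _ g)))) Lz)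

  first : ∀ g → DN (∃ λ x → g ≤ x × Candidate g x × (∀ x' → x' < x → ¬ Candidate g x'))
  first g = do
    (x , _ , c) ← candidate g
    (x' , c'@(_ , y , e , _) , min) ← least {P = Candidate g} x c
    ret (x' , subst (g ≤_) e (m≤n+m g y) , c' , min)

  first-infinite : ∀ b → DN (∃ λ x → b ≤ x × First x)
  first-infinite b = do
    (x , l , c , min) ← first b
    ret (x , l , b , c , λ x' l' → ret (min x' l'))

  -- Past the first candidates for all g ≤ G, an element can be first only for some g > G. The g
  -- places before it are free of `L`, whereas y lies in `L`.
  first-gaps : Gaps-grow First
  first-gaps G = do
    h ← dn-< (suc G) λ g _ → first g
    let (b , below) = max-witness (suc G) {P = λ g b → ∃ λ x → x < b × Candidate g x}
          (λ _ l (x , x< , c) → x , ≤-trans x< l , c) (λ g l → suc (proj₁ (h g l)) , proj₁ (h g l) , ≤-refl , proj₁ (proj₂ (proj₂ (h g l))))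
    ret (b , λ { y y' (_ , (Ly , _) , _) (g , (_ , Y , e , free) , min) y<y' b≤y' →
      let G<g = ≰⇒> λ g≤G → let (x , x<b , c) = below g (s≤s g≤G) in min x (<-≤-trans x<b b≤y') λ n → n c
          y<Y = ≰⇒> λ Y≤y → free (y ∸ Y) (+-cancelˡ-< Y _ _ (subst (_< Y + g) (sym (m+[n∸m]≡n Y≤y)) (sp₄ y Y g y' e y<y' Y≤y)))
                  λ n → n (subst L (sym (m+[n∸m]≡n Y≤y)) Ly)
      in sp₂ y Y g G y' e y<Y G<g })

-- Pumping: q ↦ k ^ e q + w appends a block of digits.
rep : ℕ → ℕ → ℕ
rep K zero = 0
rep K (suc q) = rep K q + K ^ q

Nerode : ℕ → (ℕ → Set) → ℕ → ℕ → Set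
Nerode k R n n' = ∀ r w → w < k ^ r → Iff (R (k ^ r * n + w)) (R (k ^ r * n' + w))

-- The factorial: a common multiple of all loop lengths e ≤ N, so that the single base K = k ^
-- `all-div N` serves every loop.
all-div : ℕ → ℕ
all-div zero = 1
all-div (suc n) = suc n * all-div n

all-div≥1 : ∀ n → 1 ≤ all-div n
all-div≥1 zero = ≤-refl
all-div≥1 (suc n) = s≤s (z≤n {n}) ⊗ all-div≥1 n

divides-all : ∀ n e → 1 ≤ e → e ≤ n → ∃ λ c → c * e ≡ all-div n
divides-all zero e l l' = ⊥-elim (<⇒≱ l l')
divides-all (suc n) e l l' with m≤n⇒m<n∨m≡n l'
... | inj₂ refl = all-div n , *-comm (all-div n) (suc n)
... | inj₁ e<n = let (c , h) = divides-all n e l (≤-pred e<n) in suc n * c , trans (*-assoc (suc n) c e) (cong (suc n *_) h)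

nd₁ : ∀ a b n w w' → a * (b * n + w) + w' ≡ a * b * n + (a * w + w')
nd₁ = S.solve 5 (λ a b n w w' → a :* (b :* n :+ w) :+ w' := a :* b :* n :+ (a :* w :+ w')) refl
nd₂ : ∀ a b w w' → w < b → w' < a → a * w + w' < a * b
nd₂ a b w w' h0 h1 =
  lin₀ 0 (h1 ⊕ scale a h0)
    (S.solve 4 (λ a b w w' → a :* b :+ (# 1 :+ w' :+ a :* (# 1 :+ w)) :=
      # 1 :+ a :* w :+ w' :+ (a :+ a :* b :+ # 0)) refl a b w w')

nd₄ : ∀ q e → 1 ≤ q → 2 ≤ e → suc q ≤ e * q
nd₄ q e h0 h1 =
  lin₀ 0 (h0 ⊕ scale q h1)
    (S.solve 2 (λ q e → e :* q :+ (# 1 :+ q :* # 2) :=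
      (# 1 :+ q) :+ (q :+ q :* e :+ # 0)) refl q e)

nd₅ : ∀ a b n x y w → n ≡ a * x + y → y < a → a * b ≤ n → a * b < a * suc x
nd₅ a b n x y w h0 h1 h2 =
  lin₀ 0 (≤-reflexive h0 ⊕ h1 ⊕ h2)
    (S.solve 6 (λ a b n x y w → a :* (# 1 :+ x) :+ (n :+ (# 1 :+ y) :+ a :* b) :=
      # 1 :+ a :* b :+ (a :* x :+ y :+ a :+ n :+ # 0)) refl a b n x y w)

module Pump (k : ℕ) (k≥2 : k ≥ 2) (R : ℕ → Set) where
  infix 4 _~_
  _~_ : ℕ → ℕ → Set
  _~_ = Nerode k R

  k≥1 : 1 ≤ k
  k≥1 = ≤-trans (s≤s z≤n) k≥2

  ~-refl : ∀ {n} → n ~ n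
  ~-refl r w _ = Iff-refl

  ~-sym : ∀ {n n'} → n ~ n' → n' ~ n
  ~-sym h r w l = Iff-sym (h r w l)

  ~-trans : ∀ {a b c} → a ~ b → b ~ c → a ~ c
  ~-trans h h' r w l = Iff-trans (h r w l) (h' r w l)

  ~-append : ∀ {n n'} e w → w < k ^ e → n ~ n' → k ^ e * n + w ~ k ^ e * n' + w
  ~-append {n} {n'} e w w< h r w' w'< = subst₂ (λ a b → Iff (R a) (R b)) (at n) (at n')
    (h (r + e) (k ^ r * w + w') (subst (k ^ r * w + w' <_) (sym (^-distribˡ-+-* k r e)) (nd₂ (k ^ r) (k ^ e) w w' w< w'<)))
    where
      at : ∀ n → k ^ (r + e) * n + (k ^ r * w + w') ≡ k ^ r * (k ^ e * n + w) + w'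
      at n = trans (cong (λ q → q * n + (k ^ r * w + w')) (^-distribˡ-+-* k r e)) (sym (nd₁ (k ^ r) (k ^ e) n w w'))

  -- m = k ^ e m' + w is Nerode equivalent to its proper prefix m'.
  record Loop (N m : ℕ) : Set where
    field
      m' e w : ℕ
      m'≥1 : 1 ≤ m'
      e≥1 : 1 ≤ e
      e≤N : e ≤ N
      w< : w < k ^ e
      m≡ : m ≡ k ^ e * m' + w
      same : m' ~ m

    pump : ℕ → ℕ
    pump zero = m
    pump (suc i) = k ^ e * pump i + w

    k^e≥2 : 2 ≤ k ^ e
    k^e≥2 with e | e≥1
    ... | suc e | _ = ≤-trans k≥2 (≤-trans (≤-reflexive (sym (*-identityʳ k))) (*-monoʳ-≤ k (1≤^ k e k≥1)))

    m≥1 : 1 ≤ m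
    m≥1 = subst (1 ≤_) (sym m≡) (≤-trans (≤-trans m'≥1 (≤-trans (n≤1+n m') (nd₄ m' (k ^ e) m'≥1 k^e≥2))) (m≤m+n _ w))

    pump≥ : ∀ i → i < pump i
    pump≥ zero = m≥1
    pump≥ (suc i) = ≤-trans (s≤s (pump≥ i)) (≤-trans (nd₄ (pump i) (k ^ e) (≤-trans (s≤s z≤n) (pump≥ i)) k^e≥2) (m≤m+n _ w))

    pump~ : ∀ i → pump i ~ m
    pump~ zero = ~-refl
    pump~ (suc i) = ~-trans (~-append e w w< (~-trans (pump~ i) (~-sym same))) (subst (k ^ e * m' + w ~_) (sym m≡) ~-refl)

    pump-block : ∀ i → ∃ λ v → v < k ^ (i * e) × pump i ≡ k ^ (i * e) * m + v
    pump-block zero = 0 , ≤-refl , sym (trans (+-identityʳ _) (*-identityˡ m))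
    pump-block (suc i) with pump-block i
    ... | v , v< , eq' = k ^ e * v + w , subst (k ^ e * v + w <_) (sym (^-distribˡ-+-* k e (i * e))) (nd₂ (k ^ e) (k ^ (i * e)) v w v< w<) ,
      trans (cong (λ p → k ^ e * p + w) eq') (trans (nd₁ (k ^ e) (k ^ (i * e)) m v w)
        (cong (λ q → q * m + (k ^ e * v + w)) (sym (^-distribˡ-+-* k e (i * e)))))

  prefix : ℕ → ℕ → ℕ
  prefix n zero = n
  prefix n (suc j) = proj₁ (div-floor (prefix n j) k k≥1)

  prefix-step : ∀ n j → ∃ λ w → w < k × prefix n j ≡ k * prefix n (suc j) + w
  prefix-step n j with div-floor (prefix n j) k k≥1
  ... | q , lo , hi = prefix n j ∸ q * k , +-cancelˡ-< (q * k) _ _ (subst (_< q * k + k) (sym (m+[n∸m]≡n lo)) hi) ,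
    trans (sym (m+[n∸m]≡n lo)) (cong (_+ (prefix n j ∸ q * k)) (*-comm q k))

  prefix-split : ∀ n i d → ∃ λ w → w < k ^ d × prefix n i ≡ k ^ d * prefix n (d + i) + w
  prefix-split n i zero = 0 , ≤-refl , sym (trans (+-identityʳ _) (*-identityˡ _))
  prefix-split n i (suc d) with prefix-split n i d | prefix-step n (d + i)
  ... | w , w< , eq₁ | v , v< , eq₂ = k ^ d * v + w , subst (k ^ d * v + w <_) (*-comm (k ^ d) k) (nd₂ (k ^ d) k v w v< w<) ,
    trans eq₁ (trans (cong (λ p → k ^ d * p + w) eq₂) (trans (nd₁ (k ^ d) k (prefix n (suc d + i)) v w)
      (cong (λ q → q * prefix n (suc d + i) + (k ^ d * v + w)) (*-comm (k ^ d) k))))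

  prefix-large : ∀ n j b → k ^ j * b ≤ n → b ≤ prefix n j
  prefix-large n j b l with prefix-split n 0 j
  ... | w , w< , e = ≤-pred (*-cancelˡ-< (k ^ j) b (suc (prefix n j))
    (nd₅ (k ^ j) b n (prefix n j) w 0 (subst (λ i → n ≡ k ^ j * prefix n i + w) (+-identityʳ j) e) w< l))

  prefix≤ : ∀ n j → prefix n j ≤ n
  prefix≤ n zero = ≤-refl
  prefix≤ n (suc j) with prefix-step n j
  ... | w , _ , e = ≤-trans (≤-trans (≤-trans (≤-reflexive (sym (*-identityˡ _))) (*-monoˡ-≤ (prefix n (suc j)) k≥1))
      (≤-trans (m≤m+n _ w) (≤-reflexive (sym e)))) (prefix≤ n j)

  module Structure (N : ℕ) (finite : ∀ (f : ℕ → ℕ) → DN (∃ λ i → ∃ λ j → i < j × j ≤ N × f i ~ f j)) (gaps : Gaps-grow R) where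

    -- Among n and its prefixes obtained by deleting up to N digits, two are equivalent. The
    -- assumption k ^ N ≤ n keeps them positive.
    find-loop : ∀ n → k ^ N ≤ n → DN (∃ λ i → i ≤ N × Loop N (prefix n i))
    find-loop n l = do
      (i , j , i<j , j≤N , s) ← finite (prefix n)
      let d = j ∸ i
          d+i : d + i ≡ j
          d+i = m∸n+n≡m (<⇒≤ i<j)
          (w , w< , e) = prefix-split n i d
          big : k ^ j * 1 ≤ n
          big = ≤-trans (≤-reflexive (*-identityʳ _)) (≤-trans (^-monoʳ-≤ k {{>-nonZero k≥1}} j≤N) l)
      ret (i , ≤-trans (<⇒≤ i<j) j≤N , record { m' = prefix n j ; e = d ; w = w ; m'≥1 = prefix-large n j 1 big
        ; e≥1 = m<n⇒0<n∸m i<j ; e≤N = ≤-trans (m∸n≤m j i) j≤N ; w< = w<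
        ; m≡ = subst (λ t → prefix n i ≡ k ^ d * prefix n t + w) d+i e ; same = ~-sym s })

    -- The loop replaces n by arbitrarily large equivalent numbers. The two elements keep their
    -- distance meanwhile, which contradicts that the gaps grow.
    no-pair : ∀ n → k ^ N ≤ n → ∀ r x x' → x < x' → x' < k ^ r → R (k ^ r * n + x) → R (k ^ r * n + x') → ⊥
    no-pair n l r x x' x<x' x'< h h' = (do
      (i , _ , loop) ← find-loop n l
      let open Loop loop
          (v , v< , e₀) = prefix-split n 0 i
      (b , gap) ← gaps x'
      let n₁ = k ^ i * pump b + v
          n≡ : n ≡ k ^ i * prefix n i + v
          n≡ = subst (λ t → n ≡ k ^ i * prefix n t + v) (+-identityʳ i) e₀
          n₁~n : n ~ n₁
          n₁~n = subst (_~ n₁) (sym n≡) (~-append i v v< (~-sym (pump~ b)))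
          b≤ : b ≤ k ^ r * n₁ + x'
          b≤ = ≤-trans (<⇒≤ (pump≥ b)) (≤-trans (≤-trans (grow (k ^ i) (pump b) (1≤^ k i k≥1)) (m≤m+n _ v))
            (≤-trans (grow (k ^ r) n₁ (1≤^ k r k≥1)) (m≤m+n _ x')))
      p ← proj₁ (n₁~n r x (<-trans x<x' x'<)) h
      p' ← proj₁ (n₁~n r x' x'<) h'
      ret (<⇒≱ (gap _ _ p p' (+-monoʳ-< (k ^ r * n₁) x<x') b≤) (+-monoˡ-≤ x' (m≤m+n (k ^ r * n₁) x)))) id
      where
        grow : ∀ a p → 1 ≤ a → p ≤ a * p
        grow a p l = ≤-trans (≤-reflexive (sym (*-identityˡ p))) (*-monoˡ-≤ p l)

    isolated : ∀ n → k ^ N ≤ n → ∀ r x x' → x < k ^ r → x' < k ^ r → R (k ^ r * n + x) → R (k ^ r * n + x') → x ≡ x'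
    isolated n l r x x' x< x'< h h' with <-cmp x x'
    ... | tri< a _ _ = ⊥-elim (no-pair n l r x x' a x'< h h')
    ... | tri≈ _ e _ = e
    ... | tri> _ _ a = ⊥-elim (no-pair n l r x' x a x< h' h)

-- Sparse regular sets as finite unions of progressions

pg₁ : ∀ K m v p → 2 ≤ K → p ≡ K * m + v → 1 ≤ m → m < p
pg₁ K m v p h0 h1 h2 =
  lin₀ v (≤-reflexive (sym h1) ⊕ h2 ⊕ scale m h0)
    (S.solve 4 (λ K m v p → p :+ (K :* m :+ v :+ # 1 :+ m :* # 2) :=
      # 1 :+ m :+ (p :+ m :+ m :* K :+ v)) refl K m v p)

pg₂ : ∀ r m D w → r * (m + D) + w ≡ r * m + w + D * r
pg₂ = S.solve 4 (λ r m D w → r :* (m :+ D) :+ w := r :* m :+ w :+ D :* r) refl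
pg₃ : ∀ r K m v w → r * (K * m + v) + w ≡ r * K * m + (r * v + w)
pg₃ = S.solve 5 (λ r K m v w → r :* (K :* m :+ v) :+ w := r :* K :* m :+ (r :* v :+ w)) refl
pg₄ : ∀ e D P Q → e + D * (P + Q) ≡ e + D * P + D * Q
pg₄ = S.solve 4 (λ e D P Q → e :+ D :* (P :+ Q) := e :+ D :* P :+ D :* Q) refl
pg₅ : ∀ a m w b → w < a → a ≤ b → a * m + w < b * suc m
pg₅ a m w b h0 h1 =
  lin₀ 0 (h0 ⊕ h1 ⊕ scale m h1)
    (S.solve 4 (λ a m w b → b :* (# 1 :+ m) :+ (# 1 :+ w :+ a :+ m :* a) :=
      # 1 :+ a :* m :+ w :+ (a :+ b :+ m :* b :+ # 0)) refl a m w b)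

pg₇ : ∀ q n w A x → x ≡ q * n + w → w < q → q * A ≤ x → q * A < q * suc n
pg₇ q n w A x h0 h1 h2 =
  lin₀ 0 (≤-reflexive h0 ⊕ h1 ⊕ h2)
    (S.solve 5 (λ q n w A x → q :* (# 1 :+ n) :+ (x :+ (# 1 :+ w) :+ q :* A) :=
      # 1 :+ q :* A :+ (q :* n :+ w :+ q :+ x :+ # 0)) refl q n w A x)

pg₈ : ∀ q n w B x → x ≡ q * n + w → x < q * B → q * n < q * B
pg₈ q n w B x h0 h1 =
  lin₀ w (≤-reflexive (sym h0) ⊕ h1)
    (S.solve 5 (λ q n w B x → q :* B :+ (q :* n :+ w :+ (# 1 :+ x)) :=
      # 1 :+ q :* n :+ (x :+ q :* B :+ w)) refl q n w B x)

pg₁₀ : ∀ D r Q → D * (r * Q) ≡ D * r * Q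
pg₁₀ = S.solve 3 (λ D r Q → D :* (r :* Q) := D :* r :* Q) refl
pg₁₁ : ∀ p s M q → p + (s + q) * M ≡ p + s * M + q * M
pg₁₁ = S.solve 4 (λ p s M q → p :+ (s :+ q) :* M := p :+ s :* M :+ q :* M) refl
pg₁₂ : ∀ r q M → r + (M + q * M) ≡ r + q * M + M
pg₁₂ = S.solve 3 (λ r q M → r :+ (M :+ q :* M) := r :+ q :* M :+ M) refl

div-rem : ∀ x n → 1 ≤ n → ∃ λ q → ∃ λ w → w < n × x ≡ n * q + w
div-rem x n l with div-floor x n l
... | q , lo , hi = q , x ∸ q * n , +-cancelˡ-< (q * n) _ _ (subst (_< q * n + n) (sym (m+[n∸m]≡n lo)) hi) ,
  trans (sym (m+[n∸m]≡n lo)) (cong (_+ (x ∸ q * n)) (*-comm q n))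

module Progressions (k : ℕ) (k≥2 : k ≥ 2) (R : ℕ → Set) (N : ℕ)
  (finite : ∀ (f : ℕ → ℕ) → DN (∃ λ i → ∃ λ j → i < j × j ≤ N × Nerode k R (f i) (f j))) (gaps : Gaps-grow R) where
  open Pump k k≥2 R
  open Structure N finite gaps

  M K : ℕ
  M = all-div N
  K = k ^ M

  K≥2 : 2 ≤ K
  K≥2 = ≤-trans k≥2 (≤-trans (≤-reflexive (sym (*-identityʳ k))) (^-monoʳ-≤ k {{>-nonZero k≥1}} (all-div≥1 N)))

  -- Pumping c blocks of e digits appends M digits in all, so `pump c` is K m + v₀, and it is
  -- equivalent to m. If k ^ s m + w' lies in `R`, so does k ^ s `pump c` + w', which is larger by D
  -- k ^ s. It again has the prefix m, now followed by M more digits, so the step can be repeated;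
  -- the increments add up to D k ^ r `rep K q`.
  module Orbit {m : ℕ} (loop : Loop N m) (m≥ : k ^ N ≤ m) (r w : ℕ) (w<r : w < k ^ r) (Rx : R (k ^ r * m + w)) where
    open Loop loop hiding (w; m≡; w<)

    private
      c : ℕ
      c = proj₁ (divides-all N e e≥1 e≤N)
      ce : c * e ≡ M
      ce = proj₂ (divides-all N e e≥1 e≤N)
      v₀ : ℕ
      v₀ = proj₁ (pump-block c)
      v< : v₀ < K
      v< = subst (λ t → v₀ < k ^ t) ce (proj₁ (proj₂ (pump-block c)))
      p≡ : pump c ≡ K * m + v₀
      p≡ = trans (proj₂ (proj₂ (pump-block c))) (cong (λ t → k ^ t * m + v₀) ce)
      m<p : m < pump c
      m<p = pg₁ K m v₀ (pump c) K≥2 p≡ m≥1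

    D : ℕ
    D = pump c ∸ m

    D≥1 : 1 ≤ D
    D≥1 = m<n⇒0<n∸m m<p

    private
      m+D : m + D ≡ pump c
      m+D = m+[n∸m]≡n (<⇒≤ m<p)

    x₀ : ℕ
    x₀ = k ^ r * m + w

    orbit : ℕ → ℕ
    orbit q = x₀ + D * k ^ r * rep K q

    place : ∀ q → ∃ λ w → w < k ^ (r + q * M) × orbit q ≡ k ^ (r + q * M) * m + w × DN (R (orbit q))
    place zero = w , subst (λ t → w < k ^ t) (sym (+-identityʳ r)) w<r ,
      trans x₀≡ (cong (λ t → k ^ t * m + w) (sym (+-identityʳ r))) , subst (λ x → DN (R x)) (sym x₀≡) (ret Rx)
      where
        x₀≡ : x₀ + D * k ^ r * 0 ≡ x₀
        x₀≡ = trans (cong (x₀ +_) (*-zeroʳ (D * k ^ r))) (+-identityʳ x₀)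
    place (suc q) with place q
    ... | w' , w'< , e' , Rq = k ^ s * v₀ + w' , subst (k ^ s * v₀ + w' <_) (sym pow) (nd₂ (k ^ s) K v₀ w' v< w'<) ,
        trans next (trans (cong (λ p → k ^ s * p + w') p≡) (trans (pg₃ (k ^ s) K m v₀ w') (cong (λ t → t * m + (k ^ s * v₀ + w')) (sym pow)))) ,
        (Rq >>= λ Rq → dn-map (subst R (sym next)) (proj₂ (pump~ c s w' w'<) (subst R e' Rq)))
      where
        s = r + q * M
        pow : k ^ (r + suc q * M) ≡ k ^ s * K
        pow = trans (cong (k ^_) (pg₁₂ r q M)) (^-distribˡ-+-* k s M)
        K^q : k ^ s ≡ k ^ r * K ^ q
        K^q = trans (^-distribˡ-+-* k r (q * M)) (cong (k ^ r *_) (trans (cong (k ^_) (*-comm q M)) (sym (^-*-assoc k M q))))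
        next : orbit (suc q) ≡ k ^ s * pump c + w'
        next = trans (pg₄ x₀ (D * k ^ r) (rep K q) (K ^ q)) (trans (cong₂ _+_ e' (trans (sym (pg₁₀ D (k ^ r) (K ^ q))) (cong (D *_) (sym K^q))))
          (trans (sym (pg₂ (k ^ s) m D w')) (cong (λ p → k ^ s * p + w') m+D)))

    reached : ∀ q w' → w' < k ^ (r + q * M) → R (k ^ (r + q * M) * m + w') → k ^ (r + q * M) * m + w' ≡ orbit q
    reached q w' w'< Rx' = decidable-stable (_ ≟ _) do
      let (w'' , w''< , e' , Rq) = place q
      Rq ← Rq
      ret (trans (cong (k ^ (r + q * M) * m +_) (isolated m m≥ (r + q * M) w' w'' w'< w''< Rx' (subst R e' Rq))) (sym e'))

  In-family : List (ℕ × ℕ) → ℕ → Set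
  In-family fam x = ∃ λ e → ∃ λ D → (e , D) ∈ fam × ∃ λ q → x ≡ e + D * rep K q

  Sound : List (ℕ × ℕ) → Set
  Sound fam = ∀ e D → (e , D) ∈ fam → 1 ≤ D × (∀ q → DN (R (e + D * rep K q)))

  Covers : ℕ × ℕ → List (ℕ × ℕ) → ℕ → Set
  Covers (m , ρ) fam bound = ∀ s w → DN (Loop N m) → k ^ N ≤ m → w < k ^ (ρ + s * M) → R (k ^ (ρ + s * M) * m + w) →
    bound ≤ k ^ (ρ + s * M) * m + w → DN (In-family fam (k ^ (ρ + s * M) * m + w))

  -- Concerns the elements with leading part m whose number of further digits is congruent to ρ
  -- modulo M. If there is one, its orbit contains every such element with at least as many digits,
  -- since `isolated` allows only one for each length; those with fewer digits lie below the bound.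
  entry : ∀ a → DN (∃ λ fam → ∃ λ bound → Sound fam × Covers a fam bound)
  entry (m , ρ) = do
    yes (loop , m≥ , s , w , w< , Rx) ← em (Loop N m × k ^ N ≤ m × ∃ λ s → ∃ λ w → w < k ^ (ρ + s * M) × R (k ^ (ρ + s * M) * m + w)) where
      no none → ret ([] , 0 , (λ _ _ ()) , λ s w loop m≥ w< Rx _ → loop >>= λ loop → ⊥-elim (none (loop , m≥ , s , w , w< , Rx)))
    ret (known loop m≥ s w w< Rx)
    where
      known : Loop N m → k ^ N ≤ m → ∀ s w → w < k ^ (ρ + s * M) → R (k ^ (ρ + s * M) * m + w) →
        ∃ λ fam → ∃ λ bound → Sound fam × Covers (m , ρ) fam bound
      known loop m≥ s w w< Rx = (x₀ , D * k ^ (ρ + s * M)) ∷ [] , k ^ (ρ + s * M) * suc m , sound , covers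
        where
          open Orbit loop m≥ (ρ + s * M) w w< Rx
          sound : Sound ((x₀ , D * k ^ (ρ + s * M)) ∷ [])
          sound _ _ (here refl) = D≥1 ⊗ 1≤^ k (ρ + s * M) k≥1 , λ q → proj₂ (proj₂ (proj₂ (place q)))
          covers : Covers (m , ρ) ((x₀ , D * k ^ (ρ + s * M)) ∷ []) (k ^ (ρ + s * M) * suc m)
          covers s' w' _ _ w'< Rx' big with s ≤? s'
          ... | no ¬l = ⊥-elim (<⇒≱ (pg₅ (k ^ (ρ + s' * M)) m w' (k ^ (ρ + s * M)) w'<
            (^-monoʳ-≤ k {{>-nonZero k≥1}} (+-monoʳ-≤ ρ (*-monoˡ-≤ M (<⇒≤ (≰⇒> ¬l)))))) big)
          ... | yes l = ret (x₀ , D * k ^ (ρ + s * M) , here refl , q ,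
              trans (cong (λ t → k ^ t * m + w') exponent)
                (reached q w' (subst (λ t → w' < k ^ t) exponent w'<) (subst (λ t → R (k ^ t * m + w')) exponent Rx')))
            where
              q = s' ∸ s
              exponent : ρ + s' * M ≡ ρ + s * M + q * M
              exponent = trans (cong (λ t → ρ + t * M) (sym (m+[n∸m]≡n l))) (pg₁₁ ρ s M q)

  entries : ∀ (as : List (ℕ × ℕ)) → DN (∃ λ fam → ∃ λ bound → Sound fam × (∀ a → a ∈ as → Covers a fam bound))
  entries [] = ret ([] , 0 , (λ _ _ ()) , λ _ ())
  entries (a ∷ as) = do
    (fam , bound , sound , covers) ← entry a
    (fam' , bound' , sound' , covers') ← entries as
    ret (fam List.++ fam' , bound + bound' ,
      (λ e D ∈++ → case Mem.∈-++⁻ fam ∈++ of λ { (inj₁ i) → sound e D i ; (inj₂ i) → sound' e D i }) , λ where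
        _ (here refl) s w loop m≥ w< Rx big → covers s w loop m≥ w< Rx (≤-trans (m≤m+n bound bound') big) >>=
          λ (e , D , i , r) → ret (e , D , Mem.∈-++⁺ˡ i , r)
        b (there b∈) s w loop m≥ w< Rx big → covers' b b∈ s w loop m≥ w< Rx (≤-trans (m≤n+m bound' bound) big) >>=
          λ (e , D , i , r) → ret (e , D , Mem.∈-++⁺ʳ fam i , r))

  private
    A : ℕ
    -- A factor k ^ N is lost to the at most N digits deleted by `find-loop`; the other one keeps
    -- the remaining prefix at least k ^ N.
    A = k ^ (N + N)
    A≡ : A ≡ k ^ N * k ^ N
    A≡ = ^-distribˡ-+-* k N N
    Box : List (ℕ × ℕ)
    Box = List.cartesianProduct (List.upTo (k * A)) (List.upTo M)

  Located : ℕ → Set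
  Located x = ∃ λ m → ∃ λ ρ → (m , ρ) ∈ Box × Loop N m × k ^ N ≤ m ×
    ∃ λ s → ∃ λ w → w < k ^ (ρ + s * M) × k ^ (ρ + s * M) * m + w ≡ x

  at-loop : ∀ {x} r n i w₀ v₀ s ρ → n < k * A → A ≤ n → i ≤ N → Loop N (prefix n i) → n ≡ k ^ i * prefix n i + v₀ → v₀ < k ^ i →
    x ≡ k ^ r * n + w₀ → w₀ < k ^ r → r + i ≡ M * s + ρ → ρ < M → Located x
  at-loop {x} r n i w₀ v₀ s ρ n< A≤n i≤N loop n≡ v< x≡ w₀< ρ≡ ρ< =
    prefix n i , ρ , Mem.∈-cartesianProduct⁺ (Mem.∈-upTo⁺ (≤-<-trans (prefix≤ n i) n<)) (Mem.∈-upTo⁺ ρ<) , loop ,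
    prefix-large n i (k ^ N) (≤-trans (*-monoˡ-≤ (k ^ N) (^-monoʳ-≤ k {{>-nonZero k≥1}} i≤N)) (≤-trans (≤-reflexive (sym A≡)) A≤n)) ,
    s , k ^ r * v₀ + w₀ , subst (λ t → k ^ r * v₀ + w₀ < k ^ t) exponent w< , trans (cong (λ t → k ^ t * prefix n i + (k ^ r * v₀ + w₀)) (sym exponent)) here≡
    where
      exponent : r + i ≡ ρ + s * M
      exponent = trans ρ≡ (trans (+-comm (M * s) ρ) (cong (ρ +_) (*-comm M s)))
      w< : k ^ r * v₀ + w₀ < k ^ (r + i)
      w< = subst (k ^ r * v₀ + w₀ <_) (sym (^-distribˡ-+-* k r i)) (nd₂ (k ^ r) (k ^ i) v₀ w₀ v< w₀<)
      here≡ : k ^ (r + i) * prefix n i + (k ^ r * v₀ + w₀) ≡ x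
      here≡ = trans (cong (λ q → q * prefix n i + (k ^ r * v₀ + w₀)) (^-distribˡ-+-* k r i))
        (trans (sym (pg₃ (k ^ r) (k ^ i) (prefix n i) v₀ w₀)) (trans (cong (λ n → k ^ r * n + w₀) (sym n≡)) (sym x≡)))

  near-leading : ∀ x r n w → x ≡ k ^ r * n + w → w < k ^ r → k ^ r * A ≤ x → x < k ^ r * (k * A) → A ≤ n × n < k * A
  near-leading x r n w x≡ w< lo hi = ≤-pred (*-cancelˡ-< (k ^ r) A (suc n) (pg₇ (k ^ r) n w A x x≡ w< lo)) ,
    *-cancelˡ-< (k ^ r) n (k * A) (pg₈ (k ^ r) n w (k * A) x x≡ hi)

  located : ∀ x → A ≤ x → DN (Located x)
  located x A≤x with power-scale k A x k≥2 (1≤^ k (N + N) k≥1) A≤x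
  ... | r , lo , hi with div-rem x (k ^ r) (1≤^ k r k≥1)
  ... | n , w₀ , w₀< , x≡ with near-leading x r n w₀ x≡ w₀< lo hi
  ... | A≤n , n< = do
    (i , i≤N , loop) ← find-loop n (≤-trans (^-monoʳ-≤ k {{>-nonZero k≥1}} (m≤m+n N N)) A≤n)
    ret (finish i i≤N loop (prefix-split n 0 i) (div-rem (r + i) M (all-div≥1 N)))
    where
      finish : ∀ i → i ≤ N → Loop N (prefix n i) → (∃ λ v₀ → v₀ < k ^ i × n ≡ k ^ i * prefix n (i + 0) + v₀) →
        (∃ λ s → ∃ λ ρ → ρ < M × r + i ≡ M * s + ρ) → Located x
      finish i i≤N loop (v₀ , v< , n≡) (s , ρ , ρ< , ρ≡) =
        at-loop r n i w₀ v₀ s ρ n< A≤n i≤N loop (subst (λ t → n ≡ k ^ i * prefix n t + v₀) (+-identityʳ i) n≡) v< x≡ w₀< ρ≡ ρ<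

  progressions : DN (∃ λ fam → ∃ λ bound → Sound fam × (∀ x → R x → bound ≤ x → DN (In-family fam x)))
  progressions = do
    (fam , bound , sound , covers) ← entries Box
    ret (fam , bound + A , sound , λ x Rx big → do
      (m , ρ , a∈ , loop , m≥ , s , w , w< , x≡) ← located x (≤-trans (m≤n+m A bound) big)
      f ← covers (m , ρ) a∈ s w (ret loop) m≥ w< (subst R (sym x≡) Rx) (≤-trans (m≤m+n bound A) (subst (bound + A ≤_) (sym x≡) big))
      ret (subst (In-family fam) x≡ f))

dn₁ : ∀ b Y n x ks f → n * x < (1 + b) * Y → b * (f * Y) ≤ n * (ks * x) → 1 ≤ ks → b * f * Y < (1 + b) * ks * Y
dn₁ b Y n x ks f h0 h1 h2 =
  lin₀ 0 (h1 ⊕ h2 ⊕ scale ks h0)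
    (S.solve 6 (λ b Y n x ks f → (# 1 :+ b) :* ks :* Y :+ (b :* (f :* Y) :+ # 1 :+ ks :* (# 1 :+ n :* x)) :=
      # 1 :+ b :* f :* Y :+ (n :* (ks :* x) :+ ks :+ ks :* ((# 1 :+ b) :* Y) :+ # 0)) refl b Y n x ks f)

dn₂ : ∀ b Y n x ks f → b * Y ≤ n * x → n * (ks * x) < (1 + b) * (f * Y) → b * ks * Y < (1 + b) * f * Y
dn₂ b Y n x ks f h0 h1 =
  lin₀ 0 (h1 ⊕ scale ks h0)
    (S.solve 6 (λ b Y n x ks f → (# 1 :+ b) :* f :* Y :+ (# 1 :+ n :* (ks :* x) :+ ks :* (b :* Y)) :=
      # 1 :+ b :* ks :* Y :+ ((# 1 :+ b) :* (f :* Y) :+ ks :* (n :* x) :+ # 0)) refl b Y n x ks f)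

dn₃ : ∀ b n ks d → b * (ks + d) < (1 + b) * ks → n ≤ b → n * (ks + d) < (1 + n) * ks
dn₃ b n ks d h0 h1 =
  lin₀ 0 (h0 ⊕ scale d h1)
    (S.solve 4 (λ b n ks d → (# 1 :+ n) :* ks :+ (# 1 :+ b :* (ks :+ d) :+ d :* n) :=
      # 1 :+ n :* (ks :+ d) :+ ((# 1 :+ b) :* ks :+ d :* b :+ # 0)) refl b n ks d)

dn₅ : ∀ a b P e Q → 1 + b ≤ a → P * (b + e) ≤ b * Q → b * P * (b + (1 + e)) ≤ b * (a * Q)
dn₅ a b P e Q h0 h1 =
  lin₀ (P * e) (scale a h1 ⊕ scale (P * (b + e)) h0)
    (S.solve 5 (λ a b P e Q → b :* (a :* Q) :+ (a :* (P :* (b :+ e)) :+ P :* (b :+ e) :* (# 1 :+ b)) :=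
      b :* P :* (b :+ (# 1 :+ e)) :+ (a :* (b :* Q) :+ P :* (b :+ e) :* a :+ P :* e)) refl a b P e Q)

dn₆ : ∀ b e P Q C → P * (b + e) ≤ b * Q → e ≡ b * C → 1 ≤ b → 1 ≤ P → b * (C * P) < b * Q
dn₆ b e P Q C h0 h1 h2 h3 =
  lin₀ 0 (h0 ⊕ h3 ⊕ scale P (≤-reflexive (sym h1)) ⊕ scale P h2)
    (S.solve 5 (λ b e P Q C → b :* Q :+ (P :* (b :+ e) :+ # 1 :+ P :* (b :* C) :+ P :* # 1) :=
      # 1 :+ b :* (C :* P) :+ (b :* Q :+ P :+ P :* e :+ P :* b :+ # 0)) refl b e P Q C)

dn₇ : ∀ Q u P v n a b A B Q' P' → Q * (u * A) ≤ P * (v * B) → n * a < (1 + n) * b → n ≡ P * Q' → P * Q' < P' * Q → 1 ≤ Q' * (Q * (u * A)) → n * Q * (Q' * (u * (a * A))) < n * Q * (P' * (v * (b * B)))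
dn₇ Q u P v n a b A B Q' P' h0 h1 h2 h3 h4 =
  lin₀ 0 (h4 ⊕ scale (Q' * (1 + n) * b) h0 ⊕ scale (Q' * Q * u * A) h1 ⊕ scale ((1 + n) * v * b * B) (≤-reflexive (sym h2)) ⊕ scale (n * v * b * B) (≤-reflexive h2) ⊕ scale (n * v * b * B) h3)
    (S.solve 11 (λ Q u P v n a b A B Q' P' → n :* Q :* (P' :* (v :* (b :* B))) :+ (# 1 :+ Q' :* (# 1 :+ n) :* b :* (Q :* (u :* A)) :+ Q' :* Q :* u :* A :* (# 1 :+ n :* a) :+ (# 1 :+ n) :* v :* b :* B :* (P :* Q') :+ n :* v :* b :* B :* n :+ n :* v :* b :* B :* (# 1 :+ P :* Q')) :=
      # 1 :+ n :* Q :* (Q' :* (u :* (a :* A))) :+ (Q' :* (Q :* (u :* A)) :+ Q' :* (# 1 :+ n) :* b :* (P :* (v :* B)) :+ Q' :* Q :* u :* A :* ((# 1 :+ n) :* b) :+ (# 1 :+ n) :* v :* b :* B :* n :+ n :* v :* b :* B :* (P :* Q') :+ n :* v :* b :* B :* (P' :* Q) :+ # 0)) refl Q u P v n a b A B Q' P')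

-- Ratios of powers

bernoulli : ∀ a b → 1 + b ≤ a → ∀ e → b ^ e * (b + e) ≤ b * a ^ e
bernoulli a b l zero = ≤-reflexive (trans (+-identityʳ _) (trans (+-identityʳ b) (sym (*-identityʳ b))))
bernoulli a b l (suc e) = dn₅ a b (b ^ e) e (a ^ e) l (bernoulli a b l e)

outgrow : ∀ a b → 1 ≤ b → b < a → ∀ C → ∃ λ e → C * b ^ e < a ^ e
outgrow a b b≥1 l C = b * C , *-cancelˡ-< b _ _ (dn₆ b (b * C) (b ^ (b * C)) (a ^ (b * C)) C (bernoulli a b l (b * C)) refl b≥1 (1≤^ b (b * C) b≥1))

least-ℕ : ∀ (P : ℕ → Set) → (∀ n → Dec (P n)) → ∀ n → P n → ∃ λ m → P m × (∀ k → k < m → ¬ P k)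
least-ℕ P P? zero p = zero , p , λ _ ()
least-ℕ P P? (suc n) p with P? 0
... | yes p₀ = 0 , p₀ , λ _ ()
... | no ¬p₀ with least-ℕ (P ∘ suc) (P? ∘ suc) n p
... | m , q , min = suc m , q , λ { zero _ → ¬p₀ ; (suc k) l → min k (≤-pred l) }

-- Multiplying by a ratio a / b slightly above 1 must at some point land in the
-- interval from P / Q to P' / Q'.
climb : ∀ a b P Q P' Q' u v → 1 ≤ b → b < a → 1 ≤ Q → 1 ≤ Q' → 1 ≤ u → 1 ≤ P → P * Q' < P' * Q →
  P * Q' * a < (1 + P * Q') * b → Q * u ≤ P * v →
  ∃ λ e → P * (v * b ^ e) < Q * (u * a ^ e) × Q' * (u * a ^ e) < P' * (v * b ^ e)
climb a b P Q P' Q' u v b≥1 b<a Q≥1 Q'≥1 u≥1 P≥1 gap close start = from-least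
    (least-ℕ Above (λ e → P * (v * b ^ e) <? Q * (u * a ^ e)) (proj₁ grown) (above grown))
  where
    Above : ℕ → Set
    Above e = P * (v * b ^ e) < Q * (u * a ^ e)
    grown : ∃ λ e → P * v * b ^ e < a ^ e
    grown = outgrow a b b≥1 b<a (P * v)
    above : ((e , _) : ∃ λ e → P * v * b ^ e < a ^ e) → P * (v * b ^ e) < Q * (u * a ^ e)
    above (e , l) = ≤-trans (≤-trans (≤-reflexive (cong suc (sym (*-assoc P v (b ^ e))))) l)
      (≤-trans (≤-reflexive (sym (*-identityˡ (a ^ e)))) (≤-trans (*-monoˡ-≤ (a ^ e) (Q≥1 ⊗ u≥1)) (≤-reflexive (*-assoc Q u (a ^ e)))))
    from-least : (∃ λ e → Above e × (∀ k → k < e → ¬ Above k)) → ∃ λ e → Above e × Q' * (u * a ^ e) < P' * (v * b ^ e)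
    from-least (zero , l , _) = ⊥-elim (<⇒≱ l (subst₂ (λ x y → Q * x ≤ P * y) (sym (*-identityʳ u)) (sym (*-identityʳ v)) start))
    from-least (suc e , l , min) = suc e , l , *-cancelˡ-< (P * Q' * Q) _ _
      (dn₇ Q u P v (P * Q') a b (a ^ e) (b ^ e) Q' P' (≮⇒≥ (min e ≤-refl)) close refl gap (Q'≥1 ⊗ Q≥1 ⊗ u≥1 ⊗ 1≤^ a e (≤-trans (s≤s z≤n) b<a)))

floor-power : ∀ Λ x → 2 ≤ Λ → 1 ≤ x → ∃ λ j → Λ ^ j ≤ x × x < Λ * Λ ^ j
floor-power Λ x Λ≥2 x≥1 with power-scale Λ 1 x Λ≥2 ≤-refl x≥1
... | j , a , b = j , subst (_≤ x) (*-identityʳ (Λ ^ j)) a , subst (x <_) (trans (*-comm (Λ ^ j) _) (cong (_* Λ ^ j) (*-identityʳ Λ))) b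

dq₁ : ∀ n x Λ Y b → n * x < Λ * n * Y → b * Y ≤ n * x → b * Y < Λ * n * Y
dq₁ n x Λ Y b h0 h1 =
  lin₀ 0 (h0 ⊕ h1)
    (S.solve 5 (λ n x Λ Y b → Λ :* n :* Y :+ (# 1 :+ n :* x :+ b :* Y) :=
      # 1 :+ b :* Y :+ (Λ :* n :* Y :+ n :* x :+ # 0)) refl n x Λ Y b)

dq₂ : ∀ x Λ Y n → x < Λ * Y → 1 ≤ n → n * x < Λ * n * Y
dq₂ x Λ Y n h0 h1 =
  lin₀ 0 (h1 ⊕ scale n h0)
    (S.solve 4 (λ x Λ Y n → Λ :* n :* Y :+ (# 1 :+ n :* (# 1 :+ x)) :=
      # 1 :+ n :* x :+ (n :+ n :* (Λ :* Y) :+ # 0)) refl x Λ Y n)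

pigeonhole-ℕ : ∀ m (f : ℕ → ℕ) → (∀ i → f i < m) → ∃ λ i → ∃ λ j → i < j × f i ≡ f j
pigeonhole-ℕ m f h =
  let (i , j , i<j , e) = Fin.pigeonhole ≤-refl (λ (i : Fin (suc m)) → Fin.fromℕ< (h (toℕ i)))
  in toℕ i , toℕ j , i<j , trans (sym (Fin.toℕ-fromℕ< (h (toℕ i)))) (trans (cong toℕ e) (Fin.toℕ-fromℕ< (h (toℕ j))))

module Dense (K Λ : ℕ) (K≥2 : 2 ≤ K) (Λ≥2 : 2 ≤ Λ) (indep : ∀ a b → 1 ≤ a → 1 ≤ b → K ^ a ≢ Λ ^ b) where
  private
    K≥1 : 1 ≤ K
    K≥1 = ≤-trans (s≤s z≤n) K≥2
    Λ≥1 : 1 ≤ Λ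
    Λ≥1 = ≤-trans (s≤s z≤n) Λ≥2

  -- Ratios K ^ s / Λ ^ f arbitrarily close to 1, by the pigeonhole principle
  -- applied to the mantissas of the powers of K in base Λ.
  close-ratio : ∀ n → 1 ≤ n → ∃ λ s → ∃ λ f →
    (Λ ^ f < K ^ s × n * K ^ s < (1 + n) * Λ ^ f) ⊎ (K ^ s < Λ ^ f × n * Λ ^ f < (1 + n) * K ^ s)
  close-ratio n n≥1 = result (pigeonhole-ℕ (Λ * n) b b<)
    where
      J : ℕ → ℕ
      J i = proj₁ (floor-power Λ (K ^ i) Λ≥2 (1≤^ K i K≥1))
      J≤ : ∀ i → Λ ^ J i ≤ K ^ i
      J≤ i = proj₁ (proj₂ (floor-power Λ (K ^ i) Λ≥2 (1≤^ K i K≥1)))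
      J> : ∀ i → K ^ i < Λ * Λ ^ J i
      J> i = proj₂ (proj₂ (floor-power Λ (K ^ i) Λ≥2 (1≤^ K i K≥1)))
      Y≥1 : ∀ i → 1 ≤ Λ ^ J i
      Y≥1 i = 1≤^ Λ (J i) Λ≥1
      bin : ∀ i → ∃ λ b → b * Λ ^ J i ≤ n * K ^ i × n * K ^ i < b * Λ ^ J i + Λ ^ J i
      bin i = div-floor (n * K ^ i) (Λ ^ J i) (Y≥1 i)
      b : ℕ → ℕ
      b i = proj₁ (bin i)
      b< : ∀ i → b i < Λ * n
      b< i = *-cancelʳ-< (Λ ^ J i) _ _ (dq₁ n (K ^ i) Λ (Λ ^ J i) (b i) (dq₂ (K ^ i) Λ (Λ ^ J i) n (J> i) n≥1) (proj₁ (proj₂ (bin i))))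
      b≥ : ∀ i → n ≤ b i
      b≥ i = ≤-pred (*-cancelʳ-< (Λ ^ J i) _ _ (≤-<-trans (*-monoʳ-≤ n (J≤ i)) (subst (n * K ^ i <_) (+-comm _ (Λ ^ J i)) (proj₂ (proj₂ (bin i))))))
      J-mono : ∀ i s → J i ≤ J (s + i)
      J-mono i s = ≮⇒≥ λ l → <⇒≱ (J> (s + i)) (≤-trans (^-monoʳ-≤ Λ {{>-nonZero Λ≥1}} l)
        (≤-trans (J≤ i) (^-monoʳ-≤ K {{>-nonZero K≥1}} (m≤n+m i s))))
      from-pair : ∀ i s → 1 ≤ s → b i ≡ b (s + i) → ∃ λ s → ∃ λ f →
        (Λ ^ f < K ^ s × n * K ^ s < (1 + n) * Λ ^ f) ⊎ (K ^ s < Λ ^ f × n * Λ ^ f < (1 + n) * K ^ s)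
      from-pair i s s≥1 same = s , f , compared (<-cmp (K ^ s) (Λ ^ f))
        where
          f = J (s + i) ∸ J i
          Y = Λ ^ J i
          Y' : Λ ^ J (s + i) ≡ Λ ^ f * Y
          Y' = trans (cong (Λ ^_) (sym (m∸n+n≡m (J-mono i s)))) (^-distribˡ-+-* Λ f (J i))
          X' : K ^ (s + i) ≡ K ^ s * K ^ i
          X' = ^-distribˡ-+-* K s i
          lo₁ : b i * Y ≤ n * K ^ i
          lo₁ = proj₁ (proj₂ (bin i))
          hi₁ : n * K ^ i < (1 + b i) * Y
          hi₁ = subst (n * K ^ i <_) (+-comm _ Y) (proj₂ (proj₂ (bin i)))
          lo₂ : b i * (Λ ^ f * Y) ≤ n * (K ^ s * K ^ i)
          lo₂ = subst₂ (λ y x → b i * y ≤ n * x) Y' X' (subst (λ b → b * Λ ^ J (s + i) ≤ n * K ^ (s + i)) (sym same) (proj₁ (proj₂ (bin (s + i)))))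
          hi₂ : n * (K ^ s * K ^ i) < (1 + b i) * (Λ ^ f * Y)
          hi₂ = subst₂ (λ y x → n * x < (1 + b i) * y) Y' X' (subst (λ b → n * K ^ (s + i) < (1 + b) * Λ ^ J (s + i)) (sym same)
            (subst (n * K ^ (s + i) <_) (+-comm _ (Λ ^ J (s + i))) (proj₂ (proj₂ (bin (s + i))))))
          not-equal : K ^ s ≢ Λ ^ f
          not-equal e with f
          ... | zero = <⇒≢ (≤-trans (s≤s s≥1) (n<k^n K s K≥2)) (sym e)
          ... | suc f' = indep s (suc f') s≥1 (s≤s z≤n) e
          tighten : ∀ {x y} → x ≤ y → b i * y < (1 + b i) * x → n * y < (1 + n) * x
          tighten {x} {y} l h = subst (λ y → n * y < (1 + n) * x) (m+[n∸m]≡n l)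
            (dn₃ (b i) n x (y ∸ x) (subst (λ y → b i * y < (1 + b i) * x) (sym (m+[n∸m]≡n l)) h) (b≥ i))
          compared : _ → _
          compared (tri< l _ _) = inj₂ (l , tighten (<⇒≤ l)
            (*-cancelʳ-< Y _ _ (dn₁ (b i) Y n (K ^ i) (K ^ s) (Λ ^ f) hi₁ lo₂ (1≤^ K s K≥1))))
          compared (tri≈ _ e _) = ⊥-elim (not-equal e)
          compared (tri> _ _ l) = inj₁ (l , tighten (<⇒≤ l)
            (*-cancelʳ-< Y _ _ (dn₂ (b i) Y n (K ^ i) (K ^ s) (Λ ^ f) lo₁ hi₂)))
      result : (∃ λ i → ∃ λ j → i < j × b i ≡ b j) → ∃ λ s → ∃ λ f →
        (Λ ^ f < K ^ s × n * K ^ s < (1 + n) * Λ ^ f) ⊎ (K ^ s < Λ ^ f × n * Λ ^ f < (1 + n) * K ^ s)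
      result (i , j , i<j , e) = from-pair i (j ∸ i) (m<n⇒0<n∸m i<j) (trans e (cong b (sym (m∸n+n≡m (<⇒≤ i<j)))))

  -- If K ^ s exceeds Λ ^ f slightly, their ratio climbs from K ^ S / Λ ^ J, where J is large enough
  -- to start below the interval. In the opposite case the interval is inverted and the ratio Λ ^ f
  -- / K ^ s climbs from 1 / K ^ S'; in S' = S + P' the summand P' makes the start low and S makes
  -- the exponent large.
  dense-from : ∀ P Q P' Q' S → 1 ≤ P → 1 ≤ Q → 1 ≤ P' → 1 ≤ Q' → P * Q' < P' * Q →
    (∃ λ s → ∃ λ f → (Λ ^ f < K ^ s × P * Q' * K ^ s < (1 + P * Q') * Λ ^ f) ⊎ (K ^ s < Λ ^ f × P * Q' * Λ ^ f < (1 + P * Q') * K ^ s)) →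
    ∃ λ s → ∃ λ j → S ≤ s × P * Λ ^ j < Q * K ^ s × Q' * K ^ s < P' * Λ ^ j
  dense-from P Q P' Q' S P≥1 Q≥1 P'≥1 Q'≥1 gap (s , f , inj₁ (l , close)) = up (climb (K ^ s) (Λ ^ f) P Q P' Q' (K ^ S) (Λ ^ J) (1≤^ Λ f Λ≥1) l Q≥1 Q'≥1 (1≤^ K S K≥1) P≥1 gap close start)
    where
      J = Q * K ^ S
      start : Q * K ^ S ≤ P * Λ ^ J
      start = ≤-trans (<⇒≤ (n<k^n Λ J Λ≥2)) (≤-trans (≤-reflexive (sym (*-identityˡ (Λ ^ J)))) (*-monoˡ-≤ (Λ ^ J) P≥1))
      pow : ∀ B S s e → B ^ S * (B ^ s) ^ e ≡ B ^ (S + s * e)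
      pow B S s e = trans (cong (B ^ S *_) (^-*-assoc B s e)) (sym (^-distribˡ-+-* B S (s * e)))
      up : _ → _
      up (e , l₁ , l₂) = S + s * e , J + f * e , m≤m+n S _ ,
        subst₂ (λ x y → P * x < Q * y) (pow Λ J f e) (pow K S s e) l₁ , subst₂ (λ x y → Q' * y < P' * x) (pow Λ J f e) (pow K S s e) l₂
  dense-from P Q P' Q' S P≥1 Q≥1 P'≥1 Q'≥1 gap (s , f , inj₂ (l , close)) = down (climb (Λ ^ f) (K ^ s) Q' P' Q P 1 (K ^ S') (1≤^ K s K≥1) l P'≥1 P≥1 ≤-refl Q'≥1
      (subst₂ _<_ (*-comm P Q') (*-comm P' Q) gap)
      (subst (λ n → n * Λ ^ f < (1 + n) * K ^ s) (*-comm P Q') close) start)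
    where
      S' = S + P'
      start : P' * 1 ≤ Q' * K ^ S'
      start = ≤-trans (≤-reflexive (*-identityʳ P')) (≤-trans (m≤n+m P' S) (≤-trans (<⇒≤ (n<k^n K S' K≥2))
        (≤-trans (≤-reflexive (sym (*-identityˡ (K ^ S')))) (*-monoˡ-≤ (K ^ S') Q'≥1))))
      powK : ∀ e → K ^ S' * (K ^ s) ^ e ≡ K ^ (S' + s * e)
      powK e = trans (cong (K ^ S' *_) (^-*-assoc K s e)) (sym (^-distribˡ-+-* K S' (s * e)))
      powΛ : ∀ e → 1 * (Λ ^ f) ^ e ≡ Λ ^ (f * e)
      powΛ e = trans (*-identityˡ _) (^-*-assoc Λ f e)
      down : _ → _
      down (e , l₁ , l₂) = S' + s * e , f * e , ≤-trans (m≤m+n S P') (m≤m+n S' _) ,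
        subst₂ (λ x y → P * x < Q * y) (powΛ e) (powK e) l₂ , subst₂ (λ x y → Q' * y < P' * x) (powΛ e) (powK e) l₁

  dense : ∀ P Q P' Q' S → 1 ≤ P → 1 ≤ Q → 1 ≤ P' → 1 ≤ Q' → P * Q' < P' * Q →
    ∃ λ s → ∃ λ j → S ≤ s × P * Λ ^ j < Q * K ^ s × Q' * K ^ s < P' * Λ ^ j
  dense P Q P' Q' S P≥1 Q≥1 P'≥1 Q'≥1 gap = dense-from P Q P' Q' S P≥1 Q≥1 P'≥1 Q'≥1 gap (close-ratio (P * Q') (P≥1 ⊗ Q'≥1))

-- Prescribing successive near coincidences of powers

ph₁ : ∀ A b y0 x0 kv → b * y0 + 2 * A ≤ A * x0 → 4 * (kv * (A * x0)) < 4 * (kv * (b * y0)) + 7 * A → 1 ≤ kv → ⊥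
ph₁ A b y0 x0 kv h0 h1 h2 =
  1+n≰n {0} (lin 7 (8 * A * kv + 7) (scale 8 h1 ⊕ scale 8 (scale (4 * kv) h0) ⊕ scale 7 (scale (8 * A) h2))
    (S.solve 5 (λ A b y0 x0 kv → # 8 :* # 0 :+ # 7 :+ (# 8 :* (# 1 :+ # 4 :* (kv :* (A :* x0))) :+ # 8 :* (# 4 :* kv :* (b :* y0 :+ # 2 :* A)) :+ # 7 :* (# 8 :* A :* # 1)) :=
      # 8 :* # 1 :+ (# 8 :* (# 4 :* (kv :* (b :* y0)) :+ # 7 :* A) :+ # 8 :* (# 4 :* kv :* (A :* x0)) :+ # 7 :* (# 8 :* A :* kv) :+ (# 8 :* A :* kv :+ # 7))) refl A b y0 x0 kv))

ph₂ : ∀ A b y0 x0 kv → A * x0 ≤ b * y0 → 5 * A + 4 * (kv * (b * y0)) < 4 * (kv * (A * x0)) → ⊥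
ph₂ A b y0 x0 kv h0 h1 =
  1+n≰n {0} (lin₀ (5 * A) (h1 ⊕ scale (4 * kv) h0)
    (S.solve 5 (λ A b y0 x0 kv → # 0 :+ (# 1 :+ # 5 :* A :+ # 4 :* (kv :* (b :* y0)) :+ # 4 :* kv :* (A :* x0)) :=
      # 1 :+ (# 4 :* (kv :* (A :* x0)) :+ # 4 :* kv :* (b :* y0) :+ # 5 :* A)) refl A b y0 x0 kv))

ph₃ : ∀ A b y1 h x0 E K → 2 ≤ h → b * (y1 * h) < A * x0 → A * (x0 * E) < b * y1 + 5 * A * K → K ≤ E → 16 ≤ x0 → 2 ≤ K → ⊥
ph₃ A b y1 h x0 E K h0 h1 h2 h3 h4 h5 =
  1+n≰n {0} (lin 37 (14 * b * h * y1 + 37) (scale 22 h1 ⊕ scale 16 h2 ⊕ scale 8 (scale (b * y1) h0) ⊕ scale 16 (scale (A * x0) h3) ⊕ scale 5 (scale (A * K) h4) ⊕ scale 11 (scale (A * x0) h5))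
    (S.solve 7 (λ A b y1 h x0 E K → # 38 :* # 0 :+ # 37 :+ (# 22 :* (# 1 :+ b :* (y1 :* h)) :+ # 16 :* (# 1 :+ A :* (x0 :* E)) :+ # 8 :* (b :* y1 :* # 2) :+ # 16 :* (A :* x0 :* K) :+ # 5 :* (A :* K :* # 16) :+ # 11 :* (A :* x0 :* # 2)) :=
      # 38 :* # 1 :+ (# 22 :* (A :* x0) :+ # 16 :* (b :* y1 :+ # 5 :* A :* K) :+ # 8 :* (b :* y1 :* h) :+ # 16 :* (A :* x0 :* E) :+ # 5 :* (A :* K :* x0) :+ # 11 :* (A :* x0 :* K) :+ (# 14 :* b :* h :* y1 :+ # 37))) refl A b y1 h x0 E K))

ph₄ : ∀ A b y0 f g x0 K kv → b * y0 < A * x0 → A * (x0 * (f + suc g)) < b * (y0 * f) + 5 * A * K → 55 * (kv * K) ≤ x0 → 1 ≤ kv → ⊥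
ph₄ A b y0 f g x0 K kv h0 h1 h2 h3 =
  1+n≰n {0} (lin 20 (11 * A * g * x0 + 10 * b * y0 + 11 * f + 20) (scale 10 h0 ⊕ scale 11 h1 ⊕ scale 11 (scale f h0) ⊕ scale A h2 ⊕ scale 55 (scale (A * K) h3))
    (S.solve 8 (λ A b y0 f g x0 K kv → # 21 :* # 0 :+ # 20 :+ (# 10 :* (# 1 :+ b :* y0) :+ # 11 :* (# 1 :+ A :* (x0 :* (f :+ (# 1 :+ g)))) :+ # 11 :* (f :* (# 1 :+ b :* y0)) :+ A :* (# 55 :* (kv :* K)) :+ # 55 :* (A :* K :* # 1)) :=
      # 21 :* # 1 :+ (# 10 :* (A :* x0) :+ # 11 :* (b :* (y0 :* f) :+ # 5 :* A :* K) :+ # 11 :* (f :* (A :* x0)) :+ A :* x0 :+ # 55 :* (A :* K :* kv) :+ (# 11 :* A :* g :* x0 :+ # 10 :* b :* y0 :+ # 11 :* f :+ # 20))) refl A b y0 f g x0 K kv))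

ph₅ : ∀ A b y0 E g x0 K kv → b * (y0 * (E + suc g)) < A * (x0 * E) + 5 * A * K → A * x0 < b * y0 + 2 * A → 55 * (kv * K) ≤ x0 → 1 ≤ kv → E < 24 * kv * K → ⊥
ph₅ A b y0 E g x0 K kv h0 h1 h2 h3 h4 =
  1+n≰n {0} (lin 109 (55 * b * g * y0 + 2 * A * x0 + 55 * E + 109) (scale 55 h0 ⊕ scale 55 h1 ⊕ scale 55 (scale E h1) ⊕ scale 53 (scale A h2) ⊕ scale 110 (scale A h4) ⊕ scale 275 (scale (A * K) h3))
    (S.solve 8 (λ A b y0 E g x0 K kv → # 110 :* # 0 :+ # 109 :+ (# 55 :* (# 1 :+ b :* (y0 :* (E :+ (# 1 :+ g)))) :+ # 55 :* (# 1 :+ A :* x0) :+ # 55 :* (E :* (# 1 :+ A :* x0)) :+ # 53 :* (A :* (# 55 :* (kv :* K))) :+ # 110 :* (A :* (# 1 :+ E)) :+ # 275 :* (A :* K :* # 1)) :=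
      # 110 :* # 1 :+ (# 55 :* (A :* (x0 :* E) :+ # 5 :* A :* K) :+ # 55 :* (b :* y0 :+ # 2 :* A) :+ # 55 :* (E :* (b :* y0 :+ # 2 :* A)) :+ # 53 :* (A :* x0) :+ # 110 :* (A :* (# 24 :* kv :* K)) :+ # 275 :* (A :* K :* kv) :+ (# 55 :* b :* g :* y0 :+ # 2 :* A :* x0 :+ # 55 :* E :+ # 109))) refl A b y0 E g x0 K kv))

ph₆ : ∀ p q f A kv K → p * f < q * f + 6 * A * K → 24 * kv * K ≤ f → 4 * (kv * q) + A ≤ 4 * (kv * p) → 1 ≤ kv → ⊥
ph₆ p q f A kv K h0 h1 h2 h3 =
  1+n≰n {0} (lin 3 3 (scale 4 h3 ⊕ scale (4 * kv) h0 ⊕ scale A h1 ⊕ scale f h2)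
    (S.solve 6 (λ p q f A kv K → # 4 :* # 0 :+ # 3 :+ (# 4 :* # 1 :+ # 4 :* kv :* (# 1 :+ p :* f) :+ A :* (# 24 :* kv :* K) :+ f :* (# 4 :* (kv :* q) :+ A)) :=
      # 4 :* # 1 :+ (# 4 :* kv :+ # 4 :* kv :* (q :* f :+ # 6 :* A :* K) :+ A :* f :+ f :* (# 4 :* (kv :* p)) :+ # 3)) refl p q f A kv K))

ph₇ : ∀ A kv p q X → 5 * A + 4 * (kv * p) < 4 * (kv * X) → 4 * (kv * q) < 4 * (kv * p) + A → A + kv * q < kv * X
ph₇ A kv p q X h0 h1 =
  lin 3 1 (h0 ⊕ h1)
    (S.solve 5 (λ A kv p q X → # 4 :* (kv :* X) :+ # 3 :+ (# 1 :+ # 5 :* A :+ # 4 :* (kv :* p) :+ (# 1 :+ # 4 :* (kv :* q))) :=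
      # 4 :* (# 1 :+ A :+ kv :* q) :+ (# 4 :* (kv :* X) :+ (# 4 :* (kv :* p) :+ A) :+ # 1)) refl A kv p q X)

ph₈ : ∀ A kv p q X K → 4 * (kv * X) < 4 * (kv * p) + 7 * A → 4 * (kv * p) < 4 * (kv * q) + A → 2 ≤ K → kv * X < kv * q + A * K
ph₈ A kv p q X K h0 h1 h2 =
  lin 3 1 (h0 ⊕ h1 ⊕ scale 4 (scale A h2))
    (S.solve 6 (λ A kv p q X K → # 4 :* (kv :* q :+ A :* K) :+ # 3 :+ (# 1 :+ # 4 :* (kv :* X) :+ (# 1 :+ # 4 :* (kv :* p)) :+ # 4 :* (A :* # 2)) :=
      # 4 :* (# 1 :+ kv :* X) :+ (# 4 :* (kv :* p) :+ # 7 :* A :+ (# 4 :* (kv :* q) :+ A) :+ # 4 :* (A :* K) :+ # 1)) refl A kv p q X K)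

ph₉ : ∀ b c y h A K → b * (y * h) < c * (y * h) + 6 * A * K → 2 ≤ h → c * y + 3 * A * K ≤ b * y → ⊥
ph₉ b c y h A K h0 h1 h2 =
  1+n≰n {0} (lin₀ 0 (h0 ⊕ scale h h2 ⊕ scale (3 * A * K) h1)
    (S.solve 6 (λ b c y h A K → # 0 :+ (# 1 :+ b :* (y :* h) :+ h :* (c :* y :+ # 3 :* A :* K) :+ # 3 :* A :* K :* # 2) :=
      # 1 :+ (c :* (y :* h) :+ # 6 :* A :* K :+ h :* (b :* y) :+ # 3 :* A :* K :* h :+ # 0)) refl b c y h A K))

ph₁₀ : ∀ Ax p q A K → Ax < p + A * K → p < q + 3 * A * K → Ax < q + 5 * A * K
ph₁₀ Ax p q A K h0 h1 =
  lin₀ (A * K + 1) (h0 ⊕ h1)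
    (S.solve 5 (λ Ax p q A K → q :+ # 5 :* A :* K :+ (# 1 :+ Ax :+ (# 1 :+ p)) :=
      # 1 :+ Ax :+ (p :+ A :* K :+ (q :+ # 3 :* A :* K) :+ (A :* K :+ # 1))) refl Ax p q A K)

ph₁₁ : ∀ Ax p q A K → p < Ax → q < p + 3 * A * K → q < Ax + 5 * A * K
ph₁₁ Ax p q A K h0 h1 =
  lin₀ (2 * A * K + 1) (h0 ⊕ h1)
    (S.solve 5 (λ Ax p q A K → Ax :+ # 5 :* A :* K :+ (# 1 :+ p :+ (# 1 :+ q)) :=
      # 1 :+ q :+ (Ax :+ (p :+ # 3 :* A :* K) :+ (# 2 :* A :* K :+ # 1))) refl Ax p q A K)

ph₁₂ : ∀ A b y1 h x x1 K → 1 ≤ h → b * (y1 * h) < A * x → A * x1 < b * y1 + A * K → K * x ≤ x1 → 2 ≤ x → 2 ≤ K → ⊥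
ph₁₂ A b y1 h x x1 K h0 h1 h2 h3 h4 h5 =
  1+n≰n {0} (lin 3 3 (scale 2 h1 ⊕ scale 2 h2 ⊕ scale 2 (scale (b * y1) h0) ⊕ scale 2 (scale A h3) ⊕ scale (A * K) h4 ⊕ scale (A * x) h5)
    (S.solve 7 (λ A b y1 h x x1 K → # 4 :* # 0 :+ # 3 :+ (# 2 :* (# 1 :+ b :* (y1 :* h)) :+ # 2 :* (# 1 :+ A :* x1) :+ # 2 :* (b :* y1 :* # 1) :+ # 2 :* (A :* (K :* x)) :+ A :* K :* # 2 :+ A :* x :* # 2) :=
      # 4 :* # 1 :+ (# 2 :* (A :* x) :+ # 2 :* (b :* y1 :+ A :* K) :+ # 2 :* (b :* y1 :* h) :+ # 2 :* (A :* x1) :+ A :* K :* x :+ A :* x :* K :+ # 3)) refl A b y1 h x x1 K))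

ph₁₃ : ∀ p q Ax A K → p < Ax + 5 * A * K → Ax < q + A * K → p < q + 6 * A * K
ph₁₃ p q Ax A K h0 h1 =
  lin₀ 1 (h0 ⊕ h1)
    (S.solve 5 (λ p q Ax A K → q :+ # 6 :* A :* K :+ (# 1 :+ p :+ (# 1 :+ Ax)) :=
      # 1 :+ p :+ (Ax :+ # 5 :* A :* K :+ (q :+ A :* K) :+ # 1)) refl p q Ax A K)

ph₁₄ : ∀ p q Ax A K → q < Ax → Ax < p + 5 * A * K → q < p + 6 * A * K
ph₁₄ p q Ax A K h0 h1 =
  lin₀ (A * K + 1) (h0 ⊕ h1)
    (S.solve 5 (λ p q Ax A K → p :+ # 6 :* A :* K :+ (# 1 :+ q :+ (# 1 :+ Ax)) :=
      # 1 :+ q :+ (Ax :+ (p :+ # 5 :* A :* K) :+ (A :* K :+ # 1))) refl p q Ax A K)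

ph₁₅ : ∀ n y a b kv x m → 7 + m ≡ n → m * a < 4 * kv * y * b → n ≡ 4 * kv * x → 4 * (kv * (a * x)) < 4 * (kv * (b * y)) + 7 * a
ph₁₅ n y a b kv x m h0 h1 h2 =
  lin₀ 0 (h1 ⊕ scale a (≤-reflexive (sym h0)) ⊕ scale a (≤-reflexive (sym h2)))
    (S.solve 7 (λ n y a b kv x m → # 4 :* (kv :* (b :* y)) :+ # 7 :* a :+ (# 1 :+ m :* a :+ a :* n :+ a :* (# 4 :* kv :* x)) :=
      # 1 :+ # 4 :* (kv :* (a :* x)) :+ (# 4 :* kv :* y :* b :+ a :* (# 7 :+ m) :+ a :* n :+ # 0)) refl n y a b kv x m)

ph₁₆ : ∀ n y a b kv x m → 5 + m ≡ n → 4 * kv * y * b < m * a → n ≡ 4 * kv * x → 5 * a + 4 * (kv * (b * y)) < 4 * (kv * (a * x))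
ph₁₆ n y a b kv x m h0 h1 h2 =
  lin₀ 0 (h1 ⊕ scale a (≤-reflexive h0) ⊕ scale a (≤-reflexive h2))
    (S.solve 7 (λ n y a b kv x m → # 4 :* (kv :* (a :* x)) :+ (# 1 :+ # 4 :* kv :* y :* b :+ a :* (# 5 :+ m) :+ a :* n) :=
      # 1 :+ # 5 :* a :+ # 4 :* (kv :* (b :* y)) :+ (m :* a :+ a :* n :+ a :* (# 4 :* kv :* x) :+ # 0)) refl n y a b kv x m)

ph₁₇ : ∀ X A K kv q → A + kv * q < kv * X → X ≤ q → ⊥
ph₁₇ X A K kv q h0 h1 =
  1+n≰n {0} (lin₀ A (h0 ⊕ scale kv h1)
    (S.solve 5 (λ X A K kv q → # 0 :+ (# 1 :+ A :+ kv :* q :+ kv :* X) :=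
      # 1 :+ (kv :* X :+ kv :* q :+ A)) refl X A K kv q))

ph₁₈ : ∀ X A K kv q → kv * X < kv * q + A * K → q + A * K ≤ X → 1 ≤ kv → ⊥
ph₁₈ X A K kv q h0 h1 h2 =
  1+n≰n {0} (lin₀ 0 (h0 ⊕ scale kv h1 ⊕ scale (A * K) h2)
    (S.solve 5 (λ X A K kv q → # 0 :+ (# 1 :+ kv :* X :+ kv :* (q :+ A :* K) :+ A :* K :* # 1) :=
      # 1 :+ (kv :* q :+ A :* K :+ kv :* X :+ A :* K :* kv :+ # 0)) refl X A K kv q))

ph₂₀ : ∀ c kv a b y x → 1 ≤ c → a + kv * (b * y) < kv * (a * x) → c * a + kv * (c * b * y) < kv * (c * a * x)
ph₂₀ c kv a b y x h0 h1 =
  lin₀ 0 (h0 ⊕ scale c h1)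
    (S.solve 6 (λ c kv a b y x → kv :* (c :* a :* x) :+ (# 1 :+ c :* (# 1 :+ a :+ kv :* (b :* y))) :=
      # 1 :+ c :* a :+ kv :* (c :* b :* y) :+ (c :+ c :* (kv :* (a :* x)) :+ # 0)) refl c kv a b y x)

ph₂₁ : ∀ c kv a b y x K → 1 ≤ c → kv * (a * x) < kv * (b * y) + a * K → kv * (c * a * x) < kv * (c * b * y) + c * a * K
ph₂₁ c kv a b y x K h0 h1 =
  lin₀ 0 (h0 ⊕ scale c h1)
    (S.solve 7 (λ c kv a b y x K → kv :* (c :* b :* y) :+ c :* a :* K :+ (# 1 :+ c :* (# 1 :+ kv :* (a :* x))) :=
      # 1 :+ kv :* (c :* a :* x) :+ (c :+ c :* (kv :* (b :* y) :+ a :* K) :+ # 0)) refl c kv a b y x K)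

ph₂₂ : ∀ c kv a b y x → c * a + kv * (c * b * y) < kv * (c * a * x) → c * (a + kv * (b * y)) < c * (kv * (a * x))
ph₂₂ c kv a b y x h0 =
  lin₀ 0 h0
    (S.solve 6 (λ c kv a b y x → c :* (kv :* (a :* x)) :+ (# 1 :+ c :* a :+ kv :* (c :* b :* y)) :=
      # 1 :+ c :* (a :+ kv :* (b :* y)) :+ (kv :* (c :* a :* x) :+ # 0)) refl c kv a b y x)

ph₂₃ : ∀ c kv a b y x K → kv * (c * a * x) < kv * (c * b * y) + c * a * K → c * (kv * (a * x)) < c * (kv * (b * y) + a * K)
ph₂₃ c kv a b y x K h0 =
  lin₀ 0 h0
    (S.solve 7 (λ c kv a b y x K → c :* (kv :* (b :* y) :+ a :* K) :+ (# 1 :+ kv :* (c :* a :* x)) :=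
      # 1 :+ c :* (kv :* (a :* x)) :+ (kv :* (c :* b :* y) :+ c :* a :* K :+ # 0)) refl c kv a b y x K)

ph₂₄ : ∀ c kv a b y x → 1 ≤ c → 5 * a + 4 * (kv * (b * y)) < 4 * (kv * (a * x)) → 5 * (c * a) + 4 * (kv * (c * b * y)) < 4 * (kv * (c * a * x))
ph₂₄ c kv a b y x h0 h1 =
  lin₀ 0 (h0 ⊕ scale c h1)
    (S.solve 6 (λ c kv a b y x → # 4 :* (kv :* (c :* a :* x)) :+ (# 1 :+ c :* (# 1 :+ # 5 :* a :+ # 4 :* (kv :* (b :* y)))) :=
      # 1 :+ # 5 :* (c :* a) :+ # 4 :* (kv :* (c :* b :* y)) :+ (c :+ c :* (# 4 :* (kv :* (a :* x))) :+ # 0)) refl c kv a b y x)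

ph₂₅ : ∀ c kv a b y x → 1 ≤ c → 4 * (kv * (a * x)) < 4 * (kv * (b * y)) + 7 * a → 4 * (kv * (c * a * x)) < 4 * (kv * (c * b * y)) + 7 * (c * a)
ph₂₅ c kv a b y x h0 h1 =
  lin₀ 0 (h0 ⊕ scale c h1)
    (S.solve 6 (λ c kv a b y x → # 4 :* (kv :* (c :* b :* y)) :+ # 7 :* (c :* a) :+ (# 1 :+ c :* (# 1 :+ # 4 :* (kv :* (a :* x)))) :=
      # 1 :+ # 4 :* (kv :* (c :* a :* x)) :+ (c :+ c :* (# 4 :* (kv :* (b :* y)) :+ # 7 :* a) :+ # 0)) refl c kv a b y x)

ph₂₆ : ∀ c a b y x K → 1 ≤ c → b * y < a * x → c * b * y < c * a * x
ph₂₆ c a b y x K h0 h1 =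
  lin₀ 0 (h0 ⊕ scale c h1)
    (S.solve 6 (λ c a b y x K → c :* a :* x :+ (# 1 :+ c :* (# 1 :+ b :* y)) :=
      # 1 :+ c :* b :* y :+ (c :+ c :* (a :* x) :+ # 0)) refl c a b y x K)

ph₂₇ : ∀ c a b y x K l → 1 ≤ c → a * x < b * y + l * a * K → c * a * x < c * b * y + l * (c * a) * K
ph₂₇ c a b y x K l h0 h1 =
  lin₀ 0 (h0 ⊕ scale c h1)
    (S.solve 7 (λ c a b y x K l → c :* b :* y :+ l :* (c :* a) :* K :+ (# 1 :+ c :* (# 1 :+ a :* x)) :=
      # 1 :+ c :* a :* x :+ (c :+ c :* (b :* y :+ l :* a :* K) :+ # 0)) refl c a b y x K l)

ph₂₈ : ∀ c a b y x K l → 1 ≤ c → b * y < a * x + l * a * K → c * b * y < c * a * x + l * (c * a) * K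
ph₂₈ c a b y x K l h0 h1 =
  lin₀ 0 (h0 ⊕ scale c h1)
    (S.solve 7 (λ c a b y x K l → c :* a :* x :+ l :* (c :* a) :* K :+ (# 1 :+ c :* (# 1 :+ b :* y)) :=
      # 1 :+ c :* b :* y :+ (c :+ c :* (a :* x :+ l :* a :* K) :+ # 0)) refl c a b y x K l)

ph₂₉ : ∀ c a b y x K → 1 ≤ c → a * x < b * y + a * K → c * a * x < c * b * y + c * a * K
ph₂₉ c a b y x K h0 h1 =
  lin₀ 0 (h0 ⊕ scale c h1)
    (S.solve 6 (λ c a b y x K → c :* b :* y :+ c :* a :* K :+ (# 1 :+ c :* (# 1 :+ a :* x)) :=
      # 1 :+ c :* a :* x :+ (c :+ c :* (b :* y :+ a :* K) :+ # 0)) refl c a b y x K)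

-- A phase (a , b) stands for the ratio b / a of a power of Λ to a power of K.
module Phases (K Λ : ℕ) (K≥2 : 2 ≤ K) (Λ≥2 : 2 ≤ Λ) (indep : ∀ a b → 1 ≤ a → 1 ≤ b → K ^ a ≢ Λ ^ b) where
  open Dense K Λ K≥2 Λ≥2 indep

  K≥1 : 1 ≤ K
  K≥1 = ≤-trans (s≤s z≤n) K≥2
  Λ≥1 : 1 ≤ Λ
  Λ≥1 = ≤-trans (s≤s z≤n) Λ≥2

  -- With β = b / a: 0 < K ^ s - β Λ ^ j < K.
  record Hit (a b s j : ℕ) : Set where
    constructor hit
    field
      below : b * Λ ^ j < a * K ^ s
      close : a * K ^ s < b * Λ ^ j + a * K

  -- The difference of the s-th and j-th powers lies strictly between
  -- K ^ − v and K ^ (1 − v).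
  record At (a b s j v : ℕ) : Set where
    constructor at
    field
      above : a + K ^ v * (b * Λ ^ j) < K ^ v * (a * K ^ s)
      under : K ^ v * (a * K ^ s) < K ^ v * (b * Λ ^ j) + a * K

  -- The difference lies between 5/4 and 7/4 of K ^ - v. A change by less than a quarter of K ^ - v
  -- leaves it between 1 and 2 ≤ K times K ^ - v, hence within `At`.
  record Middle (a b s j v : ℕ) : Set where
    constructor middle
    field
      above : 5 * a + 4 * (K ^ v * (b * Λ ^ j)) < 4 * (K ^ v * (a * K ^ s))
      under : 4 * (K ^ v * (a * K ^ s)) < 4 * (K ^ v * (b * Λ ^ j)) + 7 * a

  -- The factor 5 closes the argument on itself. If β₀ is nearby and β is a hit at (s₁ , j₁), their
  -- multiples of Λ ^ j₁ differ by less than 5 K + K. For j < j₁ the multiples of Λ ^ j differ by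
  -- less than half of that, as Λ ≥ 2; so a hit of β at j is within K + 3 K ≤ 5 K for β₀.
  record Nearby (a b s j : ℕ) : Set where
    constructor near
    field
      left : a * K ^ s < b * Λ ^ j + 5 * a * K
      right : b * Λ ^ j < a * K ^ s + 5 * a * K

  at→hit : ∀ {a b s j v} → At a b s j v → Hit a b s j
  at→hit {a} {b} {s} {j} {v} (at p q) = hit (≰⇒> λ l → ph₁₇ (a * K ^ s) a K (K ^ v) (b * Λ ^ j) p l)
    (≰⇒> λ l → ph₁₈ (a * K ^ s) a K (K ^ v) (b * Λ ^ j) q l (1≤^ K v K≥1))

  module Step (s₀ j₀ v₀ : ℕ) (wide : v₀ + 7 ≤ s₀) where
    private
      x₀ y₀ kv : ℕ
      x₀ = K ^ s₀
      y₀ = Λ ^ j₀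
      kv = K ^ v₀
      kv≥1 : 1 ≤ kv
      kv≥1 = 1≤^ K v₀ K≥1
      mono : ∀ {a b} → a ≤ b → K ^ a ≤ K ^ b
      mono = ^-monoʳ-≤ K {{>-nonZero K≥1}}
      -- The factor 55 is what the comparison of E and f below consumes; `wide` supplies K ^ 6 ≥ 64.
      x₀≥ : 55 * (kv * K) ≤ x₀
      x₀≥ = ≤-trans (≤-trans (m≤n+m (55 * (kv * K)) (9 * (kv * K))) (≤-trans (≤-reflexive (c64 (kv * K))) (≤-trans (*-monoʳ-≤ (kv * K) (^-monoˡ-≤ 6 K≥2))
          (≤-reflexive (trans (cong (_* K ^ 6) (*-comm kv K)) (trans (*-assoc K kv (K ^ 6)) (cong (K *_) (sym (^-distribˡ-+-* K v₀ 6))))))))) (mono (≤-trans (≤-reflexive (sym (+-suc v₀ 6))) wide))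
        where
          c64 : ∀ a → 9 * a + 55 * a ≡ a * 64
          c64 = solve-∀
      x₀≥16 : 16 ≤ x₀
      x₀≥16 = ≤-trans (m≤m+n 16 39) (≤-trans (*-monoʳ-≤ 55 (kv≥1 ⊗ K≥1)) x₀≥)

    Candidate : ℕ → Set
    Candidate s = ∃ λ j → ∃ λ a → ∃ λ b → 1 ≤ a × Middle a b s₀ j₀ v₀ × Nearby a b s j

    -- For the phase K ^ s / Λ ^ j the powers with exponents s and j coincide exactly, so it is
    -- nearby there; density puts it between (n - 7) / Q and (n - 5) / Q, the middle range at s₀.
    candidate : ∃ λ s → s₀ < s × Candidate s
    candidate = from-dense (dense (n ∸ 7) Q (n ∸ 5) Q (suc s₀) (m<n⇒0<n∸m n≥8) Q≥1 (m<n⇒0<n∸m (≤-trans (m≤m+n 6 2) n≥8)) Q≥1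
        (*-monoˡ-< Q {{>-nonZero Q≥1}} (∸-monoʳ-< (m≤m+n 6 1) (≤-trans (n≤1+n 7) n≥8))))
      where
        n Q : ℕ
        n = 4 * kv * x₀
        Q = 4 * kv * y₀
        Q≥1 : 1 ≤ Q
        Q≥1 = (s≤s (z≤n {3}) ⊗ kv≥1) ⊗ 1≤^ Λ j₀ Λ≥1
        n≥8 : 8 ≤ n
        n≥8 = ≤-trans (m≤m+n 8 8) (≤-trans x₀≥16 (≤-trans (≤-reflexive (sym (*-identityˡ x₀))) (*-monoˡ-≤ x₀ (s≤s (z≤n {3}) ⊗ kv≥1))))
        from-dense : (∃ λ s → ∃ λ j → suc s₀ ≤ s × (n ∸ 7) * Λ ^ j < Q * K ^ s × Q * K ^ s < (n ∸ 5) * Λ ^ j) → ∃ λ s → s₀ < s × Candidate s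
        from-dense (s , j , l , p , q) = s , l , j , Λ ^ j , K ^ s , 1≤^ Λ j Λ≥1 ,
          middle (ph₁₆ n y₀ (Λ ^ j) (K ^ s) kv x₀ (n ∸ 5) (m+[n∸m]≡n (≤-trans (m≤m+n 5 3) n≥8)) q refl)
            (ph₁₅ n y₀ (Λ ^ j) (K ^ s) kv x₀ (n ∸ 7) (m+[n∸m]≡n (≤-trans (n≤1+n 7) n≥8)) p refl) ,
          near (≤-<-trans (≤-reflexive (*-comm (Λ ^ j) (K ^ s))) (m<m+n _ pos)) (≤-<-trans (≤-reflexive (*-comm (K ^ s) (Λ ^ j))) (m<m+n _ pos))
          where
            pos : 0 < 5 * Λ ^ j * K
            pos = (s≤s (z≤n {4}) ⊗ 1≤^ Λ j Λ≥1) ⊗ K≥1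

    module Common (A : ℕ) {b₀ b s₁ j₁ v₁ : ℕ} (s₀<s₁ : s₀ < s₁) (mid : Middle A b₀ s₀ j₀ v₀)
      (nr : Nearby A b₀ s₁ j₁) (t : At A b s₁ j₁ v₁) where
      private
        x₁ y₁ e E : ℕ
        x₁ = K ^ s₁
        y₁ = Λ ^ j₁
        e = s₁ ∸ s₀
        E = K ^ e
        x₁≡ : x₁ ≡ x₀ * E
        x₁≡ = trans (cong (K ^_) (sym (m+[n∸m]≡n (<⇒≤ s₀<s₁)))) (^-distribˡ-+-* K s₀ e)
        e≥1 : 1 ≤ e
        e≥1 = m<n⇒0<n∸m s₀<s₁
        K≤E : K ≤ E
        K≤E = ≤-trans (≤-reflexive (sym (*-identityʳ K))) (mono e≥1)
        lo₀ : A * x₀ < b₀ * y₀ + 2 * A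
        lo₀ = ≰⇒> λ l → ph₁ A b₀ y₀ x₀ kv l (Middle.under mid) kv≥1
        hi₀ : b₀ * y₀ < A * x₀
        hi₀ = ≰⇒> λ l → ph₂ A b₀ y₀ x₀ kv l (Middle.above mid)
        j₀≤j₁ : j₀ ≤ j₁
        j₀≤j₁ = ≮⇒≥ λ l → ph₃ A b₀ y₁ (Λ ^ (j₀ ∸ j₁)) x₀ E K
          (≤-trans Λ≥2 (≤-trans (≤-reflexive (sym (*-identityʳ Λ))) (^-monoʳ-≤ Λ {{>-nonZero Λ≥1}} (m<n⇒0<n∸m l))))
          (subst (λ y → b₀ * y < A * x₀) (trans (cong (Λ ^_) (sym (m+[n∸m]≡n (<⇒≤ l)))) (^-distribˡ-+-* Λ j₁ (j₀ ∸ j₁))) hi₀)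
          (subst (λ x → A * x < b₀ * y₁ + 5 * A * K) x₁≡ (Nearby.left nr)) K≤E x₀≥16 K≥2
        f : ℕ
        f = Λ ^ (j₁ ∸ j₀)
        y₁≡ : y₁ ≡ y₀ * f
        y₁≡ = trans (cong (Λ ^_) (sym (m+[n∸m]≡n j₀≤j₁))) (^-distribˡ-+-* Λ j₀ (j₁ ∸ j₀))
        E≢f : E ≢ f
        E≢f p with j₁ ∸ j₀
        ... | zero = <⇒≢ (≤-trans K≥2 K≤E) (sym p)
        ... | suc d = indep e (suc d) e≥1 (s≤s z≤n) p
        left₁ : A * (x₀ * E) < b₀ * (y₀ * f) + 5 * A * K
        left₁ = subst₂ (λ x y → A * x < b₀ * y + 5 * A * K) x₁≡ y₁≡ (Nearby.left nr)
        right₁ : b₀ * (y₀ * f) < A * (x₀ * E) + 5 * A * K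
        right₁ = subst₂ (λ x y → b₀ * y < A * x + 5 * A * K) x₁≡ y₁≡ (Nearby.right nr)
        -- At s₀ the numbers x₀ and β₀ y₀ differ by less than 2; at s₁ the numbers x₀ E and β₀ y₀ f
        -- differ by less than 5 K. Independence gives E ≠ f, so a mismatch of about x₀ has to be
        -- made up by errors of size 2 E and 5 K. This rules out E > f, and for E < f it makes E
        -- large. The factor 24 = 4 · 6 reduces the discrepancy 6 K of the phases at s₁ to a quarter
        -- of K ^ - v₀ at s₀.
        f-large : 24 * kv * K ≤ f
        f-large with <-cmp E f
        ... | tri≈ _ p _ = ⊥-elim (E≢f p)
        ... | tri> _ _ l = ⊥-elim (ph₄ A b₀ y₀ f (E ∸ suc f) x₀ K kv hi₀
            (subst (λ E → A * (x₀ * E) < b₀ * (y₀ * f) + 5 * A * K) (sym (trans (+-suc f _) (m+[n∸m]≡n l))) left₁) x₀≥ kv≥1)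
        ... | tri< l _ _ = ≤-trans (≮⇒≥ λ small → ph₅ A b₀ y₀ E (f ∸ suc E) x₀ K kv
            (subst (λ f → b₀ * (y₀ * f) < A * (x₀ * E) + 5 * A * K) (sym (trans (+-suc E _) (m+[n∸m]≡n l))) right₁) lo₀ x₀≥ kv≥1 small) (<⇒≤ l)
        ht : Hit A b s₁ j₁
        ht = at→hit t
        far₁ : b₀ * y₁ < b * y₁ + 6 * A * K
        far₁ = ph₁₃ (b₀ * y₁) (b * y₁) (A * x₁) A K (Nearby.right nr) (Hit.close ht)
        far₂ : b * y₁ < b₀ * y₁ + 6 * A * K
        far₂ = ph₁₄ (b₀ * y₁) (b * y₁) (A * x₁) A K (Hit.below ht) (Nearby.left nr)
        shift : ∀ {p q} → p * y₁ < q * y₁ + 6 * A * K → 4 * (kv * (p * y₀)) < 4 * (kv * (q * y₀)) + A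
        shift {p} {q} h = ≰⇒> λ l → ph₆ (p * y₀) (q * y₀) f A kv K
          (subst₂ (λ u w → u < w + 6 * A * K) (trans (cong (p *_) y₁≡) (sym (*-assoc p y₀ f))) (trans (cong (q *_) y₁≡) (sym (*-assoc q y₀ f))) h)
          f-large l kv≥1

      inside : At A b s₀ j₀ v₀
      inside = at (ph₇ A kv (b₀ * y₀) (b * y₀) (A * x₀) (Middle.above mid) (shift {b} {b₀} far₂))
        (ph₈ A kv (b₀ * y₀) (b * y₀) (A * x₀) K (Middle.under mid) (shift {b₀} {b} far₁) K≥2)

      near-hit : ∀ {s j} → s₀ < s → s < s₁ → Hit A b s j → Nearby A b₀ s j
      near-hit {s} {j} s₀<s s<s₁ h with j <? j₁
      ... | no ¬l = ⊥-elim (ph₁₂ A b y₁ (Λ ^ (j ∸ j₁)) (K ^ s) x₁ K (1≤^ Λ (j ∸ j₁) Λ≥1)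
          (subst (λ y → b * y < A * K ^ s) (trans (cong (Λ ^_) (sym (m+[n∸m]≡n (≮⇒≥ ¬l)))) (^-distribˡ-+-* Λ j₁ (j ∸ j₁))) (Hit.below h))
          (Hit.close ht) (mono {suc s} s<s₁) (≤-trans (m≤m+n 2 14) (≤-trans x₀≥16 (mono (<⇒≤ s₀<s)))) K≥2)
      ... | yes l = near (ph₁₀ (A * K ^ s) (b * Λ ^ j) (b₀ * Λ ^ j) A K (Hit.close h) (≰⇒> (close-by {b} {b₀} far₂)))
          (ph₁₁ (A * K ^ s) (b * Λ ^ j) (b₀ * Λ ^ j) A K (Hit.below h) (≰⇒> (close-by {b₀} {b} far₁)))
        where
          h' = Λ ^ (j₁ ∸ j)
          y₁≡' : y₁ ≡ Λ ^ j * h'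
          y₁≡' = trans (cong (Λ ^_) (sym (m+[n∸m]≡n (<⇒≤ l)))) (^-distribˡ-+-* Λ j (j₁ ∸ j))
          close-by : ∀ {p q} → p * y₁ < q * y₁ + 6 * A * K → ¬ q * Λ ^ j + 3 * A * K ≤ p * Λ ^ j
          close-by {p} {q} far = ph₉ p q (Λ ^ j) h' A K (subst (λ y → p * y < q * y + 6 * A * K) y₁≡' far)
            (≤-trans Λ≥2 (≤-trans (≤-reflexive (sym (*-identityʳ Λ))) (^-monoʳ-≤ Λ {{>-nonZero Λ≥1}} (m<n⇒0<n∸m l))))

    -- Choosing s₁ least among the candidates excludes hits in between: a hit of the new phase at s
    -- would be nearby for the candidate's phase, which makes s an earlier candidate.
    step : ∀ v₁ → DN (∃ λ s₁ → ∃ λ j₁ → s₀ < s₁ × (∀ a b → 1 ≤ a → At a b s₁ j₁ v₁ →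
      At a b s₀ j₀ v₀ × (∀ s j → s₀ < s → s < s₁ → ¬ Hit a b s j)))
    step v₁ = do
      let (s , s₀<s , c) = candidate
      (s₁ , (s₀<s₁ , j₁ , a₀ , b₀ , a₀≥1 , mid , nr) , min) ← least {P = λ s → s₀ < s × Candidate s} s (s₀<s , c)
      ret (s₁ , j₁ , s₀<s₁ , λ a b a≥1 t → conclude s₁ j₁ a₀ b₀ a b s₀<s₁ a₀≥1 mid nr min a≥1 t)
      where
        conclude : ∀ s₁ j₁ a₀ b₀ a b → s₀ < s₁ → 1 ≤ a₀ → Middle a₀ b₀ s₀ j₀ v₀ → Nearby a₀ b₀ s₁ j₁ →
          (∀ s → s < s₁ → ¬ (s₀ < s × Candidate s)) → 1 ≤ a → At a b s₁ j₁ v₁ →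
          At a b s₀ j₀ v₀ × (∀ s j → s₀ < s → s < s₁ → ¬ Hit a b s j)
        conclude s₁ j₁ a₀ b₀ a b s₀<s₁ a₀≥1 (middle m₁ m₂) (near n₁ n₂) min a≥1 (at t₁ t₂) =
          at (*-cancelˡ-< a₀ _ _ (ph₂₂ a₀ kv a b y₀ x₀ (At.above inside))) (*-cancelˡ-< a₀ _ _ (ph₂₃ a₀ kv a b y₀ x₀ K (At.under inside))) ,
          λ s j l l' h → min s l' (l , j , a₀ * a , a * b₀ , a₀≥1 ⊗ a≥1 , mid' , near-hit l l' (scale-hit s j h))
          where
            swap : a * a₀ ≡ a₀ * a
            swap = *-comm a a₀
            -- The phases b₀ / a₀ and b / a are brought to the common denominator a₀ a, since
            -- `Common` compares phases with equal first component.
            mid' : Middle (a₀ * a) (a * b₀) s₀ j₀ v₀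
            mid' = subst (λ A → Middle A (a * b₀) s₀ j₀ v₀) swap (middle (ph₂₄ a kv a₀ b₀ y₀ x₀ a≥1 m₁) (ph₂₅ a kv a₀ b₀ y₀ x₀ a≥1 m₂))
            nr' : Nearby (a₀ * a) (a * b₀) s₁ j₁
            nr' = subst (λ A → Nearby A (a * b₀) s₁ j₁) swap (near (ph₂₇ a a₀ b₀ (Λ ^ j₁) (K ^ s₁) K 5 a≥1 n₁) (ph₂₈ a a₀ b₀ (Λ ^ j₁) (K ^ s₁) K 5 a≥1 n₂))
            t' : At (a₀ * a) (a₀ * b) s₁ j₁ v₁
            t' = at (ph₂₀ a₀ (K ^ v₁) a b (Λ ^ j₁) (K ^ s₁) a₀≥1 t₁) (ph₂₁ a₀ (K ^ v₁) a b (Λ ^ j₁) (K ^ s₁) K a₀≥1 t₂)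
            scale-hit : ∀ s j → Hit a b s j → Hit (a₀ * a) (a₀ * b) s j
            scale-hit s j (hit p q) = hit (ph₂₆ a₀ a b (Λ ^ j) (K ^ s) K a₀≥1 p) (ph₂₉ a₀ a b (Λ ^ j) (K ^ s) K a₀≥1 q)
            open Common (a₀ * a) s₀<s₁ mid' nr' t'

-- Isolating the powers of one number

pw₁ : ∀ κ r P → κ * (r + P) + 1 ≡ κ * r + 1 + κ * P
pw₁ = S.solve 3 (λ κ r P → κ :* (r :+ P) :+ # 1 := κ :* r :+ # 1 :+ κ :* P) refl
pw₂ : ∀ κ x D e C ea Da r Q z → κ * x + D ≡ κ * e + D * (C * z) → x ≡ ea + Da * r → κ * r + 1 ≡ Q → κ * e + Da + D * (C * z) ≡ κ * ea + D + Da * Q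
pw₂ κ x D e C ea Da r Q z h0 h1 h2 =
  ≤-antisym (lin₀ 0 (≤-reflexive (sym h0) ⊕ scale κ (≤-reflexive h1) ⊕ scale Da (≤-reflexive h2))
    (S.solve 10 (λ κ x D e C ea Da r Q z → κ :* ea :+ D :+ Da :* Q :+ (κ :* e :+ D :* (C :* z) :+ κ :* x :+ Da :* (κ :* r :+ # 1)) :=
      κ :* e :+ Da :+ D :* (C :* z) :+ (κ :* x :+ D :+ κ :* (ea :+ Da :* r) :+ Da :* Q :+ # 0)) refl κ x D e C ea Da r Q z))
  (lin₀ 0 (≤-reflexive h0 ⊕ scale κ (≤-reflexive (sym h1)) ⊕ scale Da (≤-reflexive (sym h2)))
    (S.solve 10 (λ κ x D e C ea Da r Q z → κ :* e :+ Da :+ D :* (C :* z) :+ (κ :* x :+ D :+ κ :* (ea :+ Da :* r) :+ Da :* Q) :=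
      κ :* ea :+ D :+ Da :* Q :+ (κ :* e :+ D :* (C :* z) :+ κ :* x :+ Da :* (κ :* r :+ # 1) :+ # 0)) refl κ x D e C ea Da r Q z))

pw₃ : ∀ p B a a' p' → p + B * a ≡ p' + B * a' → p' < B → a' < a → ⊥
pw₃ p B a a' p' h0 h1 h2 =
  1+n≰n {0} (lin₀ p (≤-reflexive h0 ⊕ h1 ⊕ scale B h2)
    (S.solve 5 (λ p B a a' p' → # 0 :+ (p :+ B :* a :+ (# 1 :+ p') :+ B :* (# 1 :+ a')) :=
      # 1 :+ (p' :+ B :* a' :+ B :+ B :* a :+ p)) refl p B a a' p'))

pw₄ : ∀ P S Q Da C D z P' → P' + D * (C * z) ≡ P + Da * Q → P < S → Da < S → 1 ≤ Q → 1 ≤ z → 1 ≤ D → 2 * (S * Q) ≤ C → ⊥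
pw₄ P S Q Da C D z P' h0 h1 h2 h3 h4 h5 h6 =
  1+n≰n {0} (lin 1 (P' + 1) (≤-reflexive h0 ⊕ h1 ⊕ h3 ⊕ h6 ⊕ scale Q h2 ⊕ scale S h3 ⊕ scale C h4 ⊕ scale (C * z) h5)
    (S.solve 8 (λ P S Q Da C D z P' → # 2 :* # 0 :+ # 1 :+ (P' :+ D :* (C :* z) :+ (# 1 :+ P) :+ # 1 :+ # 2 :* (S :* Q) :+ Q :* (# 1 :+ Da) :+ S :* # 1 :+ C :* # 1 :+ C :* z :* # 1) :=
      # 2 :* # 1 :+ (P :+ Da :* Q :+ S :+ Q :+ C :+ Q :* S :+ S :* Q :+ C :* z :+ C :* z :* D :+ (P' :+ # 1))) refl P S Q Da C D z P'))

pw₅ : ∀ D S B z → D * (S * B * z) ≡ B * (D * S * z)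
pw₅ = S.solve 4 (λ D S B z → D :* (S :* B :* z) := B :* (D :* S :* z)) refl
pw₆ : ∀ D B I → D * (B * I) ≡ B * (D * I)
pw₆ = S.solve 3 (λ D B I → D :* (B :* I) := B :* (D :* I)) refl
pw₇ : ∀ a w μ → a * (1 + w * μ) ≡ a + μ * (a * w)
pw₇ = S.solve 3 (λ a w μ → a :* (# 1 :+ w :* μ) := a :+ μ :* (a :* w)) refl
pw₈ : ∀ Da I S μ → Da < S → I ≤ S * S → μ + 1 ≡ S * S * S * S * S → 2 ≤ S → Da * I < μ
pw₈ Da I S μ h0 h1 h2 h3 =
  lin 30 (31 * I + 22 * μ + 30) (scale 9 (≤-reflexive (sym h2)) ⊕ scale 20 h3 ⊕ scale 31 (scale I h0) ⊕ scale 31 (scale S h1) ⊕ scale 10 (scale S h3) ⊕ scale 5 (scale (S * S) h3) ⊕ scale 18 (scale (S * S * S) h3) ⊕ scale 9 (scale (S * S * S * S) h3))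
    (S.solve 4 (λ Da I S μ → # 31 :* μ :+ # 30 :+ (# 9 :* (S :* S :* S :* S :* S) :+ # 20 :* # 2 :+ # 31 :* (I :* (# 1 :+ Da)) :+ # 31 :* (S :* I) :+ # 10 :* (S :* # 2) :+ # 5 :* (S :* S :* # 2) :+ # 18 :* (S :* S :* S :* # 2) :+ # 9 :* (S :* S :* S :* S :* # 2)) :=
      # 31 :* (# 1 :+ Da :* I) :+ (# 9 :* (μ :+ # 1) :+ # 20 :* S :+ # 31 :* (I :* S) :+ # 31 :* (S :* (S :* S)) :+ # 10 :* (S :* S) :+ # 5 :* (S :* S :* S) :+ # 18 :* (S :* S :* S :* S) :+ # 9 :* (S :* S :* S :* S :* S) :+ (# 31 :* I :+ # 22 :* μ :+ # 30))) refl Da I S μ)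

pw₉ : ∀ D I S μ → D < S → I ≤ S * S * S → μ + 1 ≡ S * S * S * S * S → 2 ≤ S → 1 ≤ I → D * (S * I) < μ
pw₉ D I S μ h0 h1 h2 h3 h4 =
  lin₀ 0 (≤-reflexive (sym h2) ⊕ h3 ⊕ scale (S * I) h0 ⊕ scale (S * S) h1 ⊕ scale S h4)
    (S.solve 4 (λ D I S μ → μ :+ (S :* S :* S :* S :* S :+ # 2 :+ S :* I :* (# 1 :+ D) :+ S :* S :* I :+ S :* # 1) :=
      # 1 :+ D :* (S :* I) :+ (μ :+ # 1 :+ S :+ S :* I :* S :+ S :* S :* (S :* S :* S) :+ S :* I :+ # 0)) refl D I S μ)

pw₁₀ : ∀ D S I Da → 1 ≤ D → 1 ≤ I → Da < S → D * (S * I) ≡ Da → ⊥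
pw₁₀ D S I Da h0 h1 h2 h3 =
  1+n≰n {0} (lin₀ 0 (h2 ⊕ ≤-reflexive h3 ⊕ scale (S * I) h0 ⊕ scale S h1)
    (S.solve 4 (λ D S I Da → # 0 :+ (# 1 :+ Da :+ D :* (S :* I) :+ S :* I :* # 1 :+ S :* # 1) :=
      # 1 :+ (S :+ Da :+ S :* I :* D :+ S :* I :+ # 0)) refl D S I Da))

pw₁₁ : ∀ D S I2 z → D * (S * I2) * z ≡ I2 * (D * S * z)
pw₁₁ = S.solve 4 (λ D S I2 z → D :* (S :* I2) :* z := I2 :* (D :* S :* z)) refl
pw₁₂ : ∀ Da W I I2 → I2 * (Da * (W * I)) ≡ Da * (W * (I * I2))
pw₁₂ = S.solve 4 (λ Da W I I2 → I2 :* (Da :* (W :* I)) := Da :* (W :* (I :* I2))) refl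
pw₁₃ : ∀ w μ → (μ + 1) * (1 + w * μ) ≡ 1 + (1 + w * (μ + 1)) * μ
pw₁₃ = S.solve 2 (λ w μ → (μ :+ # 1) :* (# 1 :+ w :* μ) := # 1 :+ (# 1 :+ w :* (μ :+ # 1)) :* μ) refl
pw₁₄ : ∀ κ x D e C z b → κ * x + D ≡ κ * e + D * (C * z) → κ * b < C → x < b → 1 ≤ z → 1 ≤ D → 1 ≤ κ → ⊥
pw₁₄ κ x D e C z b h0 h1 h2 h3 h4 h5 =
  1+n≰n {0} (lin₀ (e * κ) (≤-reflexive (sym h0) ⊕ h5 ⊕ scale (D * C) h3 ⊕ scale D h1 ⊕ scale κ h2 ⊕ scale (κ * b) h4)
    (S.solve 7 (λ κ x D e C z b → # 0 :+ (κ :* e :+ D :* (C :* z) :+ # 1 :+ D :* C :* # 1 :+ D :* (# 1 :+ κ :* b) :+ κ :* (# 1 :+ x) :+ κ :* b :* # 1) :=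
      # 1 :+ (κ :* x :+ D :+ κ :+ D :* C :* z :+ D :* C :+ κ :* b :+ κ :* b :* D :+ e :* κ)) refl κ x D e C z b))

pw₁₅ : ∀ κ e D r → κ * (e + D * r) + D ≡ κ * e + D * (κ * r + 1)
pw₁₅ = S.solve 4 (λ κ e D r → κ :* (e :+ D :* r) :+ D := κ :* e :+ D :* (κ :* r :+ # 1)) refl
pw₁₆ : ∀ j μ → 1 + j * μ ≡ 1 + μ * j
pw₁₆ = S.solve 2 (λ j μ → # 1 :+ j :* μ := # 1 :+ μ :* j) refl

mod-unique : ∀ {B p p' a a'} → p < B → p' < B → p + B * a ≡ p' + B * a' → a ≡ a' × p ≡ p'
mod-unique {B} {p} {p'} {a} {a'} l l' e with <-cmp a a'
... | tri< h _ _ = ⊥-elim (pw₃ p' B a' a p (sym e) l h)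
... | tri> _ _ h = ⊥-elim (pw₃ p B a a' p' e l' h)
... | tri≈ _ refl _ = refl , +-cancelʳ-≡ (B * a) p p' e

rep-power : ∀ κ q → κ * rep (suc κ) q + 1 ≡ suc κ ^ q
rep-power κ zero = cong (_+ 1) (*-zeroʳ κ)
rep-power κ (suc q) = trans (pw₁ κ (rep (suc κ) q) (suc κ ^ q)) (cong (_+ κ * suc κ ^ q) (rep-power κ q))

power-mod : ∀ μ w → ∃ λ w' → (μ + 1) ^ w ≡ 1 + w' * μ
power-mod μ zero = 0 , refl
power-mod μ (suc w) with power-mod μ w
... | w' , e = 1 + w' * (μ + 1) , trans (cong ((μ + 1) *_) e) (pw₁₃ w' μ)

*-cancelˡ-≡' : ∀ {a b c} → 1 ≤ a → a * b ≡ a * c → b ≡ c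
*-cancelˡ-≡' {suc a} {b} {c} _ e = *-cancelˡ-≡ b c (suc a) e

-- K ^ s exceeds all coefficients of the family. By `rep-power`, membership of x in the progression
-- (ea , Da) becomes κ e + Da + D K ^ c z = κ ea + D + Da K ^ q. One s in c forces q ≥ s + c₁.
-- Modulo K ^ (s + c₁) the low parts then agree and cancel, and D K ^ s z = Da K ^ i remains.
module Isolate (κ : ℕ) (κ≥1 : 1 ≤ κ) (s c₁ : ℕ) (s≥1 : 1 ≤ s) (μ : ℕ) where
  private
    K S L c : ℕ
    K = suc κ
    S = K ^ s
    L = s + (s + (s + (s + s)))
    c = s + (s + c₁)
    K≥1 : 1 ≤ K
    K≥1 = s≤s z≤n
    S≥2 : 2 ≤ S
    S≥2 = ≤-trans (s≤s s≥1) (n<k^n K s (s≤s κ≥1))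

  module _ (μ≡ : μ + 1 ≡ K ^ L) where
    private
      L≡ : K ^ L ≡ S * S * S * S * S
      L≡ = trans (^-distribˡ-+-* K s _) (trans (cong (S *_) (trans (^-distribˡ-+-* K s _) (cong (S *_)
        (trans (^-distribˡ-+-* K s _) (cong (S *_) (^-distribˡ-+-* K s s)))))) (assoc S))
        where
          assoc : ∀ S → S * (S * (S * (S * S))) ≡ S * S * S * S * S
          assoc = solve-∀
      μS : μ + 1 ≡ S * S * S * S * S
      μS = trans μ≡ L≡
      two : K ^ (s + s) ≡ S * S
      two = ^-distribˡ-+-* K s s
      three : K ^ (s + s + s) ≡ S * S * S
      three = trans (^-distribˡ-+-* K (s + s) s) (cong (_* S) two)
      mono : ∀ {a b} → a ≤ b → K ^ a ≤ K ^ b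
      mono = ^-monoʳ-≤ K

    -- D K ^ s z = Da K ^ i with z ≡ 1 modulo K ^ L − 1 forces z to be a power
    -- of K ^ L: compare both sides modulo K ^ L − 1.
    power-of : ∀ D Da z j i → 1 ≤ D → D < S → Da < S → z ≡ 1 + j * μ → D * S * z ≡ Da * K ^ i → ∃ λ w → z ≡ (K ^ L) ^ w
    power-of D Da z j i' D≥1 D< Da< z≡ e with div-rem i' L (≤-trans s≥1 (m≤m+n s _))
    -- Modulo μ the power K ^ L is 1, so the exponent may be reduced to i < L. For i ≤ 2 s both
    -- residues are below μ and hence equal as numbers.
    ... | w , i , i< , i'≡ with i ≤? s + s
    ... | yes small = w , trans (*-cancelˡ-≡' b≥1 (trans e (trans (cong (Da *_) split) (trans (sym (x∙yz Da (K ^ i) ((K ^ L) ^ w))) (cong (_* (K ^ L) ^ w) a≡b))))) refl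
      where
        x∙yz : ∀ a b c → a * b * c ≡ a * (c * b)
        x∙yz = solve-∀
        split : K ^ i' ≡ (K ^ L) ^ w * K ^ i
        split = trans (cong (K ^_) i'≡) (trans (^-distribˡ-+-* K (L * w) i) (cong (_* K ^ i) (sym (^-*-assoc K L w))))
        b≥1 : 1 ≤ D * S
        b≥1 = D≥1 ⊗ ≤-trans (s≤s z≤n) S≥2
        I≤ : K ^ i ≤ S * S
        I≤ = ≤-trans (mono small) (≤-reflexive two)
        S≤ : S ≤ S * S
        S≤ = ≤-trans (≤-reflexive (sym (*-identityʳ S))) (*-monoʳ-≤ S (≤-trans (s≤s z≤n) S≥2))
        w' = proj₁ (power-mod μ w)
        W≡ : (K ^ L) ^ w ≡ 1 + w' * μ
        W≡ = trans (cong (_^ w) (sym μ≡)) (proj₂ (power-mod μ w))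
        both : D * S + μ * (D * S * j) ≡ Da * K ^ i + μ * (Da * K ^ i * w')
        both = trans (sym (pw₇ (D * S) j μ)) (trans (cong (D * S *_) (sym z≡)) (trans e (trans (cong (Da *_) split)
          (trans (sym (x∙yz Da (K ^ i) ((K ^ L) ^ w))) (trans (cong (Da * K ^ i *_) W≡) (pw₇ (Da * K ^ i) w' μ))))))
        a≡b : Da * K ^ i ≡ D * S
        a≡b = sym (proj₂ (mod-unique (pw₈ D S S μ D< S≤ μS S≥2) (pw₈ Da (K ^ i) S μ Da< I≤ μS S≥2) both))
    -- Multiplication by K ^ (L - i), where L - i ≤ 3 s, leaves Da alone on the right. With L = 5 s
    -- both sides are still below μ, so they are equal, which is absurd because Da < K ^ s.
    ... | no big = ⊥-elim (pw₁₀ D S I₂ Da D≥1 I₂≥1 Da< (proj₂ (mod-unique (pw₉ D I₂ S μ D< I₂≤ μS S≥2 I₂≥1) Da<μ both)))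
      where
        i₂ = L ∸ i
        i+i₂ : i + i₂ ≡ L
        i+i₂ = m+[n∸m]≡n (<⇒≤ i<)
        I₂ = K ^ i₂
        I₂≥1 : 1 ≤ I₂
        I₂≥1 = 1≤^ K i₂ K≥1
        i₂≤ : i₂ ≤ s + s + s
        i₂≤ = +-cancelˡ-≤ (s + s) _ _ (≤-trans (+-monoˡ-≤ i₂ (<⇒≤ (≰⇒> big))) (≤-trans (≤-reflexive i+i₂) (≤-reflexive (as s))))
          where
            as : ∀ s → s + (s + (s + (s + s))) ≡ s + s + (s + s + s)
            as = solve-∀
        I₂≤ : I₂ ≤ S * S * S
        I₂≤ = ≤-trans (mono i₂≤) (≤-reflexive three)
        Da<μ : Da < μ
        Da<μ = subst (_< μ) (*-identityʳ Da) (pw₈ Da 1 S μ Da< (≤-trans (s≤s z≤n) (S≥2 ⊗ S≥2)) μS S≥2)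
        split : K ^ i' ≡ (K ^ L) ^ w * K ^ i
        split = trans (cong (K ^_) i'≡) (trans (^-distribˡ-+-* K (L * w) i) (cong (_* K ^ i) (sym (^-*-assoc K L w))))
        w' = proj₁ (power-mod μ (suc w))
        W≡ : (K ^ L) ^ suc w ≡ 1 + w' * μ
        W≡ = trans (cong (_^ suc w) (sym μ≡)) (proj₂ (power-mod μ (suc w)))
        both : D * (S * I₂) + μ * (D * (S * I₂) * j) ≡ Da + μ * (Da * w')
        both = trans (sym (pw₇ (D * (S * I₂)) j μ)) (trans (cong (D * (S * I₂) *_) (sym z≡)) (trans (pw₁₁ D S I₂ z) (trans (cong (I₂ *_) (trans e (cong (Da *_) split)))
          (trans (pw₁₂ Da ((K ^ L) ^ w) (K ^ i) I₂) (trans (cong (λ t → Da * ((K ^ L) ^ w * t)) (trans (sym (^-distribˡ-+-* K i i₂)) (cong (K ^_) i+i₂)))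
            (trans (cong (Da *_) (trans (*-comm _ (K ^ L)) W≡)) (pw₇ Da w' μ)))))))

    power-if : ∀ {D e Da ea x q z j} → 1 ≤ D → D < S → Da < S → κ * ea + D < S → κ * e + Da < S →
      z ≡ 1 + j * μ → x ≡ ea + Da * rep K q → κ * x + D ≡ κ * e + D * (K ^ c * z) → ∃ λ w → z ≡ (K ^ L) ^ w
    power-if {D} {e} {Da} {ea} {x} {q} {z} {j} D≥1 D< Da< P< P'< z≡ x≡ lin≡ = power-of D Da z j i D≥1 D< Da< z≡ (proj₁ cancelled)
      where
        z≥1 : 1 ≤ z
        z≥1 = subst (1 ≤_) (sym z≡) (s≤s z≤n)
        e₁ : κ * e + Da + D * (K ^ c * z) ≡ κ * ea + D + Da * K ^ q
        e₁ = pw₂ κ x D e (K ^ c) ea Da (rep K q) (K ^ q) z lin≡ x≡ (rep-power κ q)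
        q≥ : s + c₁ ≤ q
        q≥ = ≮⇒≥ λ q< → pw₄ (κ * ea + D) S (K ^ q) Da (K ^ c) D z (κ * e + Da) e₁ P< Da< (1≤^ K q K≥1) z≥1 D≥1
          (≤-trans (s≤s κ≥1 ⊗ ≤-reflexive (sym (^-distribˡ-+-* K s q))) (mono {suc (s + q)} (subst (_≤ c) (+-suc s q) (+-monoʳ-≤ s q<))))
        i = q ∸ (s + c₁)
        B = K ^ (s + c₁)
        S≤B : S ≤ B
        S≤B = mono (m≤m+n s c₁)
        cancelled : D * S * z ≡ Da * K ^ i × κ * e + Da ≡ κ * ea + D
        cancelled = mod-unique (<-≤-trans P'< S≤B) (<-≤-trans P< S≤B) (subst₂ (λ a b → κ * e + Da + a ≡ κ * ea + D + b)
          (trans (cong (λ t → D * (t * z)) (^-distribˡ-+-* K s (s + c₁))) (pw₅ D S B z))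
          (trans (cong (λ t → Da * K ^ t) (sym (m+[n∸m]≡n q≥))) (trans (cong (Da *_) (^-distribˡ-+-* K (s + c₁) i)) (pw₆ Da B (K ^ i)))) e₁)

Power : ℕ → ℕ → Set
Power K z = ∃ λ w → z ≡ K ^ w

-- The powers of K ^ L are the z ≡ 1 modulo K ^ L − 1 for which
-- (e + D rep q) with K ^ q = K ^ c z lies in R.
module Define-powers (rels : List ℕ) (I : Interp rels) (R : ℕ → Set) (dR : Periodicity.DefSet rels I R)
  (κ : ℕ) (κ≥1 : 1 ≤ κ) (fam : List (ℕ × ℕ)) (bound : ℕ)
  (members : ∀ e D → (e , D) ∈ fam → 1 ≤ D × (∀ q → DN (R (e + D * rep (suc κ) q))))
  (cover : ∀ x → R x → bound ≤ x → DN (∃ λ e → ∃ λ D → (e , D) ∈ fam × ∃ λ q → x ≡ e + D * rep (suc κ) q))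
  (e D : ℕ) (eD∈ : (e , D) ∈ fam) where
  open Periodicity rels I

  private
    K B s c₁ L c μ : ℕ
    K = suc κ
    B = proj₁ (bound-all fam λ (e , D) → κ * e + D)
    s = suc (B + (κ * e + D))
    -- Makes K ^ c larger than κ `bound`, so that x lies above `bound` and `cover` applies to it.
    c₁ = κ * bound
    L = s + (s + (s + (s + s)))
    c = s + (s + c₁)
    μ = pred (K ^ L)
    K≥2 : 2 ≤ K
    K≥2 = s≤s κ≥1
    μ≡ : μ + 1 ≡ K ^ L
    μ≡ = trans (+-comm μ 1) (suc-pred (K ^ L) {{>-nonZero (1≤^ K L (s≤s z≤n))}})
    S> : ∀ {a} → a ≤ B + (κ * e + D) → a < K ^ s
    S> l = ≤-<-trans l (<-trans ≤-refl (n<k^n K s K≥2))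
    B≥ : ∀ {e D} → (e , D) ∈ fam → κ * e + D ≤ B
    B≥ i = proj₂ (bound-all fam λ (e , D) → κ * e + D) _ i
    D≥1 : 1 ≤ D
    D≥1 = proj₁ (members e D eD∈)

  Scale : ℕ → Set
  Scale z = (∃ λ j → z ≡ 1 + μ * j) × ∃ λ x → R x × κ * x + D ≡ κ * e + D * (K ^ c * z)

  def-Scale : DefSet Scale
  def-Scale = def-∧ (def-∃ (def-≡ (fun-var v1) (fun-+ fun-one (fun-scale μ (fun-var v0)))))
    (def-∃ (def-∧ (def-app₁ {P = R} dR (fun-var v0)) (def-≡ (fun-+ (fun-scale κ (fun-var v0)) (fun-const D))
      (fun-+ (fun-const (κ * e)) (fun-scale D (fun-scale (K ^ c) (fun-var v1)))))))

  scale-power : ∀ z → Scale z → DN (Power (K ^ L) z)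
  scale-power z ((j , z≡) , x , Rx , lin≡) = do
    (ea , Da , i , q , x≡) ← cover x Rx (≮⇒≥ λ x<b → pw₁₄ κ x D e (K ^ c) z bound lin≡
      (≤-<-trans (≤-trans (m≤n+m c₁ s) (m≤n+m (s + c₁) s)) (n<k^n K c K≥2)) x<b (subst (1 ≤_) (sym z≡) (s≤s z≤n)) D≥1 κ≥1)
    ret (Isolate.power-if κ κ≥1 s c₁ (s≤s z≤n) μ μ≡ {D} {e} {Da} {ea} {x} {q} {z} {j} D≥1
      (S> (≤-trans (m≤n+m D (κ * e)) (m≤n+m _ B)))
      (S> (≤-trans (≤-trans (m≤n+m Da (κ * ea)) (B≥ i)) (m≤m+n B _)))
      (S> (+-mono-≤ (≤-trans (m≤m+n (κ * ea) Da) (B≥ i)) (m≤n+m D (κ * e))))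
      (S> (≤-trans (≤-reflexive (+-comm (κ * e) Da)) (+-mono-≤ (≤-trans (m≤n+m Da (κ * ea)) (B≥ i)) (m≤m+n (κ * e) D))))
      (trans z≡ (sym (pw₁₆ j μ))) x≡ lin≡)

  power-scale' : ∀ z → Power (K ^ L) z → DN (Scale z)
  power-scale' z (w , z≡) = do
    Rx ← proj₂ (members e D eD∈) (c + L * w)
    let (w' , e') = power-mod μ w
    ret ((w' , trans z≡ (trans (cong (_^ w) (sym μ≡)) (trans e' (pw₁₆ w' μ)))) , _ , Rx ,
      trans (pw₁₅ κ e D (rep K (c + L * w))) (cong (λ t → κ * e + D * t) (trans (rep-power κ (c + L * w))
        (trans (^-distribˡ-+-* K c (L * w)) (cong (K ^ c *_) (trans (sym (^-*-assoc K L w)) (sym z≡)))))))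

  exponent : ℕ
  exponent = L

  exponent≥1 : 1 ≤ exponent
  exponent≥1 = s≤s z≤n

  def-powers : DefSet (Power (K ^ exponent))
  def-powers = def-map (λ ρ → scale-power (lookup ρ v0) , power-scale' (lookup ρ v0)) def-Scale

-- Finite sequences coded by near coincidences

Below : ℕ → List ℕ → Set
Below V vs = ∀ v → v ∈ vs → v ≤ V

se₁ : ∀ a b y x → a + (b * y + 0) < a * x + 0 → x < 2 * y → a + b * y < a * x
se₁ a b y x h0 h1 =
  lin₀ 0 h0
    (S.solve 4 (λ a b y x → a :* x :+ (# 1 :+ a :+ (b :* y :+ # 0)) :=
      # 1 :+ a :+ b :* y :+ (a :* x :+ # 0 :+ # 0)) refl a b y x)

se₂ : ∀ a b y x → a + b * y < a * x → x < 2 * y → 2 * a ≤ b → ⊥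
se₂ a b y x h0 h1 h2 =
  1+n≰n {0} (lin₀ (2 * a) (h0 ⊕ scale a h1 ⊕ scale y h2)
    (S.solve 4 (λ a b y x → # 0 :+ (# 1 :+ a :+ b :* y :+ a :* (# 1 :+ x) :+ y :* (# 2 :* a)) :=
      # 1 :+ (a :* x :+ a :* (# 2 :* y) :+ y :* b :+ # 2 :* a)) refl a b y x))

se₃ : ∀ a b kv y x m → kv * y * b < m * a → 1 + m ≡ kv * x → a + kv * (b * y) < kv * (a * x)
se₃ a b kv y x m h0 h1 =
  lin₀ 0 (h0 ⊕ scale a (≤-reflexive h1))
    (S.solve 6 (λ a b kv y x m → kv :* (a :* x) :+ (# 1 :+ kv :* y :* b :+ a :* (# 1 :+ m)) :=
      # 1 :+ a :+ kv :* (b :* y) :+ (m :* a :+ a :* (kv :* x) :+ # 0)) refl a b kv y x m)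

se₄ : ∀ a b kv y x m K → m * a < kv * y * b → K + m ≡ kv * x → kv * (a * x) < kv * (b * y) + a * K
se₄ a b kv y x m K h0 h1 =
  lin₀ 0 (h0 ⊕ scale a (≤-reflexive (sym h1)))
    (S.solve 7 (λ a b kv y x m K → kv :* (b :* y) :+ a :* K :+ (# 1 :+ m :* a :+ a :* (kv :* x)) :=
      # 1 :+ kv :* (a :* x) :+ (kv :* y :* b :+ a :* (K :+ m) :+ # 0)) refl a b kv y x m K)

se₅ : ∀ a x y u K b → x < y + K * u → u ≤ a → 2 * y ≤ b → b < 2 * a → a * (1 + K) ≤ x → ⊥
se₅ a x y u K b h0 h1 h2 h3 h4 =
  1+n≰n {0} (lin 2 2 (scale 2 h0 ⊕ h2 ⊕ h3 ⊕ scale 2 h4 ⊕ scale 2 (scale K h1))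
    (S.solve 6 (λ a x y u K b → # 3 :* # 0 :+ # 2 :+ (# 2 :* (# 1 :+ x) :+ # 2 :* y :+ (# 1 :+ b) :+ # 2 :* (a :* (# 1 :+ K)) :+ # 2 :* (K :* u)) :=
      # 3 :* # 1 :+ (# 2 :* (y :+ K :* u) :+ b :+ # 2 :* a :+ # 2 :* x :+ # 2 :* (K :* a) :+ # 2)) refl a x y u K b))

se₆ : ∀ a b y h x K → b * (y * h) < a * x → a * x < b * y + a * K → 2 ≤ h → 2 * K ≤ x → ⊥
se₆ a b y h x K h0 h1 h2 h3 =
  1+n≰n {0} (lin 2 2 (h0 ⊕ scale 2 h1 ⊕ scale (b * y) h2 ⊕ scale a h3)
    (S.solve 6 (λ a b y h x K → # 3 :* # 0 :+ # 2 :+ (# 1 :+ b :* (y :* h) :+ # 2 :* (# 1 :+ a :* x) :+ b :* y :* # 2 :+ a :* (# 2 :* K)) :=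
      # 3 :* # 1 :+ (a :* x :+ # 2 :* (b :* y :+ a :* K) :+ b :* y :* h :+ a :* x :+ # 2)) refl a b y h x K))

se₇ : ∀ y u x K u₁ → y + u ≤ x → x < y + u₁ * K → u < u₁ * K
se₇ y u x K u₁ h0 h1 =
  lin₀ 0 (h0 ⊕ h1)
    (S.solve 5 (λ y u x K u₁ → u₁ :* K :+ (y :+ u :+ (# 1 :+ x)) :=
      # 1 :+ u :+ (x :+ (y :+ u₁ :* K) :+ # 0)) refl y u x K u₁)

se₈ : ∀ y u x K u₁ → u₁ + y < x → x < y + K * u → u₁ < u * K
se₈ y u x K u₁ h0 h1 =
  lin₀ 1 (h0 ⊕ h1)
    (S.solve 5 (λ y u x K u₁ → u :* K :+ (# 1 :+ u₁ :+ y :+ (# 1 :+ x)) :=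
      # 1 :+ u₁ :+ (x :+ (y :+ K :* u) :+ # 1)) refl y u x K u₁)

se₉ : ∀ u kv y x → u * kv + kv * y < kv * x → kv * (u + y) < kv * x
se₉ u kv y x h0 =
  lin₀ 0 h0
    (S.solve 4 (λ u kv y x → kv :* x :+ (# 1 :+ u :* kv :+ kv :* y) :=
      # 1 :+ kv :* (u :+ y) :+ (kv :* x :+ # 0)) refl u kv y x)

se₁₀ : ∀ u kv y x K → kv * x < kv * y + u * kv * K → kv * x < kv * (y + u * K)
se₁₀ u kv y x K h0 =
  lin₀ 0 h0
    (S.solve 5 (λ u kv y x K → kv :* (y :+ u :* K) :+ (# 1 :+ kv :* x) :=
      # 1 :+ kv :* x :+ (kv :* y :+ u :* kv :* K :+ # 0)) refl u kv y x K)

se₁₁ : ∀ y u x → u + y < x → y + u ≤ x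
se₁₁ y u x h0 =
  lin₀ 1 h0
    (S.solve 3 (λ y u x → x :+ (# 1 :+ u :+ y) :=
      y :+ u :+ (x :+ # 1)) refl y u x)

se₁₂ : ∀ K → 2 ≤ K → 1 + K ≤ K * (K * 1)
se₁₂ K h0 =
  lin 3 (K * K + 3) (scale 2 h0 ⊕ scale 3 (scale K h0))
    (S.solve 1 (λ K → # 4 :* (K :* (K :* # 1)) :+ # 3 :+ (# 2 :* # 2 :+ # 3 :* (K :* # 2)) :=
      # 4 :* (# 1 :+ K) :+ (# 2 :* K :+ # 3 :* (K :* K) :+ (K :* K :+ # 3))) refl K)

se₁₃ : ∀ K → 2 ≤ K → 2 * K ≤ K * (K * 1)
se₁₃ K h0 =
  lin₀ 0 (scale K h0)
    (S.solve 1 (λ K → K :* (K :* # 1) :+ K :* # 2 :=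
      # 2 :* K :+ (K :* K :+ # 0)) refl K)

se₁₄ : ∀ y u x a K → x < y + K * u → u ≤ a → x < y + a * K
se₁₄ y u x a K h0 h1 =
  lin₀ 0 (h0 ⊕ scale K h1)
    (S.solve 5 (λ y u x a K → y :+ a :* K :+ (# 1 :+ x :+ K :* u) :=
      # 1 :+ x :+ (y :+ K :* u :+ K :* a :+ # 0)) refl y u x a K)

se₁₅ : ∀ y u x → y + u ≤ x → 1 ≤ u → y < x
se₁₅ y u x h0 h1 =
  lin₀ 0 (h0 ⊕ h1)
    (S.solve 3 (λ y u x → x :+ (y :+ u :+ # 1) :=
      # 1 :+ y :+ (x :+ u :+ # 0)) refl y u x)

-- Numbers are represented downwards from t: u represents v when u K ^ v ≡ t.
module Sequences (K Λ : ℕ) (K≥2 : 2 ≤ K) (Λ≥2 : 2 ≤ Λ) (indep : ∀ a b → 1 ≤ a → 1 ≤ b → K ^ a ≢ Λ ^ b) where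
  open Phases K Λ K≥2 Λ≥2 indep
  open Dense K Λ K≥2 Λ≥2 indep

  private
    mono : ∀ {a b} → a ≤ b → K ^ a ≤ K ^ b
    mono = ^-monoʳ-≤ K {{>-nonZero K≥1}}

  PhaseSeg : ℕ → ℕ → ℕ → List ℕ → ℕ → Set
  PhaseSeg a b s₀ [] s' = s₀ ≡ s'
  PhaseSeg a b s₀ (v ∷ vs) s' = ∃ λ s₁ → ∃ λ j₁ → s₀ < s₁ × (∀ s j → s₀ < s → s < s₁ → ¬ Hit a b s j) ×
    At a b s₁ j₁ v × PhaseSeg a b s₁ vs s'

  -- The conditions are pulled back from the end: every phase that satisfies the last `At` satisfies
  -- all earlier ones, so only a single condition remains to be realised by powers.
  sequence : ∀ V vs s₀ j₀ v₀ → Below V vs → v₀ ≤ V → V + 7 ≤ s₀ → DN (∃ λ s' → ∃ λ j' → ∃ λ v' → s₀ ≤ s' ×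
    (∀ a b → 1 ≤ a → At a b s' j' v' → At a b s₀ j₀ v₀ × PhaseSeg a b s₀ vs s'))
  sequence V [] s₀ j₀ v₀ _ _ _ = ret (s₀ , j₀ , v₀ , ≤-refl , λ a b _ t → t , refl)
  sequence V (v ∷ vs) s₀ j₀ v₀ below v₀≤V wide = do
    (s₁ , j₁ , s₀<s₁ , h) ← Step.step s₀ j₀ v₀ (≤-trans (+-monoˡ-≤ 7 v₀≤V) wide) v
    (s' , j' , v' , s₁≤s' , h') ← sequence V vs s₁ j₁ v (λ u u∈ → below u (there u∈)) (below v (here refl)) (≤-trans wide (<⇒≤ s₀<s₁))
    ret (s' , j' , v' , ≤-trans (<⇒≤ s₀<s₁) s₁≤s' , λ a b a≥1 t →
      let (t₁ , seg) = h' a b a≥1 t ; (t₀ , none) = h a b a≥1 t₁ in t₀ , s₁ , j₁ , s₀<s₁ , none , t₁ , seg)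

  -- `At` describes the open interval of phases from (n - K) / P to (n - 1) / P, which contains a
  -- ratio of powers by density.
  realise : ∀ s j v B → 2 ≤ s → ∃ λ τ → ∃ λ J → B ≤ τ × At (K ^ τ) (Λ ^ J) s j v
  realise s j v B s≥2 = finish (dense P (n ∸ 1) P (n ∸ K) B P≥1 (m<n⇒0<n∸m n>1) P≥1 (m<n⇒0<n∸m n>K)
      (*-monoʳ-< P {{>-nonZero P≥1}} (∸-monoʳ-< K≥2 (<⇒≤ n>K))))
    where
      kv P n : ℕ
      kv = K ^ v
      P = kv * Λ ^ j
      n = kv * K ^ s
      P≥1 : 1 ≤ P
      P≥1 = 1≤^ K v K≥1 ⊗ 1≤^ Λ j Λ≥1
      n>K : K < n
      n>K = ≤-trans (≤-trans (se₁₂ K K≥2) (mono s≥2)) (≤-trans (≤-reflexive (sym (*-identityˡ (K ^ s)))) (*-monoˡ-≤ (K ^ s) (1≤^ K v K≥1)))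
      n>1 : 1 < n
      n>1 = ≤-trans K≥2 (<⇒≤ n>K)
      finish : (∃ λ τ → ∃ λ J → B ≤ τ × P * Λ ^ J < (n ∸ 1) * K ^ τ × (n ∸ K) * K ^ τ < P * Λ ^ J) →
        ∃ λ τ → ∃ λ J → B ≤ τ × At (K ^ τ) (Λ ^ J) s j v
      finish (τ , J , l , p , q) = τ , J , l , at
        (se₃ (K ^ τ) (Λ ^ J) kv (Λ ^ j) (K ^ s) (n ∸ 1) p (m+[n∸m]≡n (<⇒≤ n>1)))
        (se₄ (K ^ τ) (Λ ^ J) kv (Λ ^ j) (K ^ s) (n ∸ K) K q (m+[n∸m]≡n (<⇒≤ n>K)))

  Coded-phase : ℕ → List ℕ → Set
  Coded-phase B vs = ∃ λ τ → ∃ λ J → ∃ λ s₀ → ∃ λ s' → B ≤ τ × 2 ≤ s₀ × Λ ^ J < 2 * K ^ τ × PhaseSeg (K ^ τ) (Λ ^ J) s₀ vs s'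

  -- The bound β < 2 ensures later that the relevant powers of Λ are not below Λ ^ J.
  small-phase : ∀ {a b s j} → Λ ^ j < K ^ s → K ^ s < 2 * Λ ^ j → At a b s j 0 → b < 2 * a
  small-phase {a} {b} {s} {j} p q t = ≰⇒> λ m → se₂ a b (Λ ^ j) (K ^ s) (se₁ a b (Λ ^ j) (K ^ s) (At.above t) q) q m

  assemble : ∀ B vs s₀ s' j₀ → 2 ≤ s₀ → Λ ^ j₀ < K ^ s₀ → K ^ s₀ < 2 * Λ ^ j₀ → ∀ j' v' →
    (∀ a b → 1 ≤ a → At a b s' j' v' → At a b s₀ j₀ 0 × PhaseSeg a b s₀ vs s') →
    (∃ λ τ → ∃ λ J → B ≤ τ × At (K ^ τ) (Λ ^ J) s' j' v') → Coded-phase B vs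
  assemble B vs s₀ s' j₀ s₀≥2 p q j' v' h (τ , J , B≤τ , t) = τ , J , s₀ , s' , B≤τ , s₀≥2 ,
    small-phase {s = s₀} {j₀} p q (proj₁ (h (K ^ τ) (Λ ^ J) (1≤^ K τ K≥1) t)) , proj₂ (h (K ^ τ) (Λ ^ J) (1≤^ K τ K≥1) t)

  from-base : ∀ V vs B → Below V vs → (∃ λ s → ∃ λ j → V + 7 ≤ s × 1 * Λ ^ j < 1 * K ^ s × 1 * K ^ s < 2 * Λ ^ j) → DN (Coded-phase B vs)
  from-base V vs B below (s₀ , j₀ , l , p , q) = do
    (s' , j' , v' , s₀≤s' , h) ← sequence V vs s₀ j₀ 0 below z≤n l
    ret (assemble B vs s₀ s' j₀ s₀≥2 (subst₂ _<_ (*-identityˡ (Λ ^ j₀)) (*-identityˡ (K ^ s₀)) p)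
      (subst (_< 2 * Λ ^ j₀) (*-identityˡ (K ^ s₀)) q) j' v' h (realise s' j' v' B (≤-trans s₀≥2 s₀≤s')))
    where
      s₀≥2 : 2 ≤ s₀
      s₀≥2 = ≤-trans (≤-trans (m≤m+n 2 5) (m≤n+m 7 V)) l

  phase-sequence : ∀ V vs B → Below V vs → DN (Coded-phase B vs)
  phase-sequence V vs B below = from-base V vs B below (dense 1 1 2 1 (V + 7) ≤-refl ≤-refl (s≤s z≤n) ≤-refl ≤-refl)

  -- For x = K ^ (τ + s) and y = Λ ^ (J + j), division by t = K ^ τ turns y + u ≤ x < y + K u into K
  -- ^ - v ≤ K ^ s - β Λ ^ j < K ^ (1 - v) with β = Λ ^ J / t. The exponent J is not mentioned: t is
  -- the only parameter of the code.
  Value : ℕ → ℕ → ℕ → Set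
  Value t x u = Power K u × u ≤ t × ∃ λ y → Power Λ y × y + u ≤ x × x < y + K * u

  Position : ℕ → ℕ → Set
  Position t x = Power K x × ∃ λ u → Value t x u

  Represents : ℕ → ℕ → ℕ → Set
  Represents t v u = u * K ^ v ≡ t

  Seg : ℕ → ℕ → List ℕ → ℕ → Set
  Seg t x₀ [] x' = x₀ ≡ x'
  Seg t x₀ (v ∷ vs) x' = ∃ λ x₁ → x₀ < x₁ × (∀ x → x₀ < x → x < x₁ → ¬ Position t x) ×
    Power K x₁ × (∃ λ u → Value t x₁ u × Represents t v u) × (∀ u → Value t x₁ u → Represents t v u) × Seg t x₁ vs x'

  module Realised (τ J : ℕ) (J< : Λ ^ J < 2 * K ^ τ) where
    private
      t b : ℕ
      t = K ^ τ
      b = Λ ^ J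

    place : ∀ s → K ^ (τ + s) ≡ t * K ^ s
    place s = ^-distribˡ-+-* K τ s

    power< : ∀ {s s'} → K ^ s < K ^ s' → s < s'
    power< {s} {s'} l = ≰⇒> λ m → <⇒≱ l (mono m)

    -- A power y below Λ ^ J would satisfy 2 y ≤ Λ ^ J < 2 t, and then y + K u < (1 + K) t ≤ K ^ 2 t
    -- ≤ x, too small.
    value→hit : ∀ s u → 2 ≤ s → 1 ≤ u → u ≤ t → ∀ y → Power Λ y → y + u ≤ K ^ (τ + s) → K ^ (τ + s) < y + K * u →
      ∃ λ j → y ≡ b * Λ ^ j × Hit t b s j
    value→hit s u s≥2 u≥1 u≤t .(Λ ^ J') (J' , refl) lo hi with J ≤? J'
    ... | yes l = J' ∸ J , y≡ , hit
        (subst₂ _<_ y≡ (place s) (se₁₅ (Λ ^ J') u (K ^ (τ + s)) lo u≥1))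
        (subst₂ (λ y x → x < y + t * K) y≡ (place s) (se₁₄ (Λ ^ J') u (K ^ (τ + s)) t K hi u≤t))
      where
        y≡ : Λ ^ J' ≡ b * Λ ^ (J' ∸ J)
        y≡ = trans (cong (Λ ^_) (sym (m+[n∸m]≡n l))) (^-distribˡ-+-* Λ J (J' ∸ J))
    ... | no ¬l = ⊥-elim (se₅ t (K ^ (τ + s)) (Λ ^ J') u K b hi u≤t
        (≤-trans (*-monoˡ-≤ (Λ ^ J') Λ≥2) (^-monoʳ-≤ Λ {{>-nonZero Λ≥1}} (≰⇒> ¬l))) J<
        (≤-trans (*-monoʳ-≤ t (≤-trans (se₁₂ K K≥2) (mono s≥2))) (≤-reflexive (sym (place s)))))

    two-hits : ∀ s {j j'} → 2 ≤ s → j < j' → Hit t b s j → Hit t b s j' → ⊥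
    two-hits s {j} {j'} s≥2 l h h' = se₆ t b (Λ ^ j) (Λ ^ (j' ∸ j)) (K ^ s) K
      (subst (λ y → b * y < t * K ^ s) (trans (cong (Λ ^_) (sym (m+[n∸m]≡n (<⇒≤ l)))) (^-distribˡ-+-* Λ j (j' ∸ j))) (Hit.below h'))
      (Hit.close h) (≤-trans Λ≥2 (≤-trans (≤-reflexive (sym (*-identityʳ Λ))) (^-monoʳ-≤ Λ {{>-nonZero Λ≥1}} (m<n⇒0<n∸m l))))
      (≤-trans (se₁₃ K K≥2) (mono s≥2))

    hit-unique : ∀ s j j' → 2 ≤ s → Hit t b s j → Hit t b s j' → j ≡ j'
    hit-unique s j j' s≥2 h h' with <-cmp j j'
    ... | tri≈ _ e _ = e
    ... | tri< l _ _ = ⊥-elim (two-hits s s≥2 l h h')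
    ... | tri> _ _ l = ⊥-elim (two-hits s s≥2 l h' h)

    represent : ∀ v → v ≤ τ → K ^ (τ ∸ v) * K ^ v ≡ t
    represent v l = trans (sym (^-distribˡ-+-* K (τ ∸ v) v)) (cong (K ^_) (m∸n+n≡m l))

    at-bounds : ∀ s j v → v ≤ τ → At t b s j v → let u = K ^ (τ ∸ v) ; y = b * Λ ^ j ; x = K ^ (τ + s) in
      u + y < x × x < y + u * K
    at-bounds s j v l (at p q) =
      *-cancelˡ-< (K ^ v) _ _ (se₉ (K ^ (τ ∸ v)) (K ^ v) (b * Λ ^ j) (K ^ (τ + s))
        (subst₂ (λ t' x → t' + K ^ v * (b * Λ ^ j) < K ^ v * x) (sym (represent v l)) (sym (place s)) p)) ,
      *-cancelˡ-< (K ^ v) _ _ (se₁₀ (K ^ (τ ∸ v)) (K ^ v) (b * Λ ^ j) (K ^ (τ + s)) K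
        (subst₂ (λ t' x → K ^ v * x < K ^ v * (b * Λ ^ j) + t' * K) (sym (represent v l)) (sym (place s)) q))

    at-value : ∀ s j v → v ≤ τ → At t b s j v → Value t (K ^ (τ + s)) (K ^ (τ ∸ v)) × Represents t v (K ^ (τ ∸ v))
    at-value s j v l a = ((τ ∸ v , refl) , mono (m∸n≤m τ v) , b * Λ ^ j , (J + j , sym (^-distribˡ-+-* Λ J j)) ,
        se₁₁ (b * Λ ^ j) (K ^ (τ ∸ v)) (K ^ (τ + s)) (proj₁ (at-bounds s j v l a)) ,
        subst (λ z → K ^ (τ + s) < b * Λ ^ j + z) (*-comm (K ^ (τ ∸ v)) K) (proj₂ (at-bounds s j v l a))) , represent v l

    at-unique : ∀ s j v → 2 ≤ s → v ≤ τ → At t b s j v → ∀ u → Value t (K ^ (τ + s)) u → Represents t v u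
    at-unique s j v s≥2 l a .(K ^ i) ((i , refl) , u≤t , y , py , lo , hi) with value→hit s (K ^ i) s≥2 (1≤^ K i K≥1) u≤t y py lo hi
    ... | j' , y≡ , h = subst (λ i → K ^ i * K ^ v ≡ t) (≤-antisym
        (≤-pred (power< {τ ∸ v} {suc i} (subst (K ^ (τ ∸ v) <_) (*-comm (K ^ i) K)
          (se₈ (b * Λ ^ j) (K ^ i) (K ^ (τ + s)) K (K ^ (τ ∸ v)) (proj₁ (at-bounds s j v l a)) (subst (λ y → K ^ (τ + s) < y + K * K ^ i) y≡' hi)))))
        (≤-pred (power< {i} {suc (τ ∸ v)} (subst (K ^ i <_) (*-comm (K ^ (τ ∸ v)) K)
          (se₇ (b * Λ ^ j) (K ^ i) (K ^ (τ + s)) K (K ^ (τ ∸ v)) (subst (λ y → y + K ^ i ≤ K ^ (τ + s)) y≡' lo) (proj₂ (at-bounds s j v l a))))))) (represent v l)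
      where
        y≡' : y ≡ b * Λ ^ j
        y≡' = trans y≡ (cong (λ j → b * Λ ^ j) (hit-unique s j' j s≥2 h (at→hit a)))

    segment : ∀ s₀ vs s' → 2 ≤ s₀ → Below τ vs → PhaseSeg t b s₀ vs s' → Seg t (K ^ (τ + s₀)) vs (K ^ (τ + s'))
    segment s₀ [] .s₀ _ _ refl = refl
    segment s₀ (v ∷ vs) s' s₀≥2 below (s₁ , j₁ , s₀<s₁ , none , a , rest) =
      K ^ (τ + s₁) , ^-monoʳ-< K K≥2 (+-monoʳ-< τ s₀<s₁) , no-position , (τ + s₁ , refl) ,
      (K ^ (τ ∸ v) , at-value s₁ j₁ v v≤ a) , at-unique s₁ j₁ v s₁≥2 v≤ a ,
      segment s₁ vs s' s₁≥2 (λ u u∈ → below u (there u∈)) rest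
      where
        v≤ : v ≤ τ
        v≤ = below v (here refl)
        s₁≥2 : 2 ≤ s₁
        s₁≥2 = ≤-trans s₀≥2 (<⇒≤ s₀<s₁)
        no-position : ∀ x → K ^ (τ + s₀) < x → x < K ^ (τ + s₁) → ¬ Position t x
        no-position .(K ^ i) l l' ((i , refl) , .(K ^ i') , (i' , refl) , u≤t , y , py , lo , hi) =
          let s = i ∸ τ
              i≡ : τ + s ≡ i
              i≡ = m+[n∸m]≡n (≤-trans (m≤m+n τ s₀) (<⇒≤ (power< {τ + s₀} {i} l)))
              s₀<s = +-cancelˡ-< τ s₀ s (subst (τ + s₀ <_) (sym i≡) (power< {τ + s₀} {i} l))
              s<s₁ = +-cancelˡ-< τ s s₁ (subst (_< τ + s₁) (sym i≡) (power< {i} {τ + s₁} l'))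
              (j , _ , h) = value→hit s (K ^ i') (≤-trans s₀≥2 (<⇒≤ s₀<s)) (1≤^ K i' K≥1) u≤t y py
                (subst (λ i → y + K ^ i' ≤ K ^ i) (sym i≡) lo) (subst (λ i → K ^ i < y + K * K ^ i') (sym i≡) hi)
          in none s j s₀<s s<s₁ h

  coded : ∀ vs B → DN (∃ λ τ → B ≤ τ × ∃ λ x₀ → ∃ λ x' → Seg (K ^ τ) x₀ vs x')
  coded vs B = do
    let (V , below) = bound-all vs id
    (τ , J , s₀ , s' , l , s₀≥2 , J< , seg) ← phase-sequence V vs (B + V) below
    ret (τ , ≤-trans (m≤m+n B V) l , K ^ (τ + s₀) , K ^ (τ + s') ,
      Realised.segment τ J J< s₀ vs s' s₀≥2 (λ v v∈ → ≤-trans (below v v∈) (≤-trans (m≤n+m V B) l)) seg)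

pr₁ : ∀ a K P t u → a * P ≡ t → K * u ≡ a → u * (K * P) ≡ t
pr₁ a K P t u h0 h1 =
  ≤-antisym (lin₀ 0 (≤-reflexive h0 ⊕ scale P (≤-reflexive h1))
    (S.solve 5 (λ a K P t u → t :+ (a :* P :+ P :* (K :* u)) :=
      u :* (K :* P) :+ (t :+ P :* a :+ # 0)) refl a K P t u))
  (lin₀ 0 (≤-reflexive (sym h0) ⊕ scale P (≤-reflexive (sym h1)))
    (S.solve 5 (λ a K P t u → u :* (K :* P) :+ (t :+ P :* a) :=
      t :+ (a :* P :+ P :* (K :* u) :+ # 0)) refl a K P t u))

pr₂ : ∀ t P → t * P ≡ t → 1 ≤ t → 2 ≤ P → ⊥
pr₂ t P h0 h1 h2 =
  1+n≰n {0} (lin₀ 0 (≤-reflexive h0 ⊕ h1 ⊕ scale t h2)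
    (S.solve 2 (λ t P → # 0 :+ (t :* P :+ # 1 :+ t :* # 2) :=
      # 1 :+ (t :+ t :+ t :* P :+ # 0)) refl t P))

pr₃ : ∀ i K i' P t → i * (K * P) ≡ t → K * i ≡ i' → i' * P ≡ t
pr₃ i K i' P t h0 h1 =
  ≤-antisym (lin₀ 0 (≤-reflexive h0 ⊕ scale P (≤-reflexive (sym h1)))
    (S.solve 5 (λ i K i' P t → t :+ (i :* (K :* P) :+ P :* i') :=
      i' :* P :+ (t :+ P :* (K :* i) :+ # 0)) refl i K i' P t))
  (lin₀ 0 (≤-reflexive (sym h0) ⊕ scale P (≤-reflexive h1))
    (S.solve 5 (λ i K i' P t → i' :* P :+ (t :+ P :* (K :* i)) :=
      t :+ (i :* (K :* P) :+ P :* i' :+ # 0)) refl i K i' P t))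

pr₄ : ∀ i K t → K * t ≡ i → i ≤ t → 1 ≤ t → 2 ≤ K → ⊥
pr₄ i K t h0 h1 h2 h3 =
  1+n≰n {0} (lin₀ 0 (≤-reflexive h0 ⊕ h1 ⊕ h2 ⊕ scale t h3)
    (S.solve 3 (λ i K t → # 0 :+ (K :* t :+ i :+ # 1 :+ t :* # 2) :=
      # 1 :+ (i :+ t :+ t :+ t :* K :+ # 0)) refl i K t))

map-shift : ∀ {n v v'} {ρ : Vec ℕ v} {ρ' : Vec ℕ v'} (φ : Fin v → Fin v') → (∀ i → lookup ρ' (φ i) ≡ lookup ρ i) →
  (is : Vec (Fin v) n) → Vec.map (lookup ρ') (Vec.map φ is) ≡ Vec.map (lookup ρ) is
map-shift φ h [] = refl
map-shift {ρ = ρ} {ρ'} φ h (i ∷ is) = cong₂ _∷_ (h i) (map-shift {ρ = ρ} {ρ'} φ h is)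

-- Definability of recursive computations

encode : List (ℕ × ℕ) → List ℕ
encode [] = []
encode ((x , y) ∷ w) = 0 ∷ suc x ∷ suc y ∷ encode w

module Programs (rels : List ℕ) (I : Interp rels) (K Λ : ℕ) (K≥2 : 2 ≤ K) (Λ≥2 : 2 ≤ Λ)
  (indep : ∀ a b → 1 ≤ a → 1 ≤ b → K ^ a ≢ Λ ^ b)
  (dK : Periodicity.DefSet rels I (Power K)) (dΛ : Periodicity.DefSet rels I (Power Λ)) where
  open Definability rels I
  open Sequences K Λ K≥2 Λ≥2 indep

  private
    K≥1 : 1 ≤ K
    K≥1 = ≤-trans (s≤s z≤n) K≥2
    mono : ∀ {a b} → a ≤ b → K ^ a ≤ K ^ b
    mono = ^-monoʳ-≤ K {{>-nonZero K≥1}}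
    power<' : ∀ {s s'} → K ^ s < K ^ s' → s < s'
    power<' l = ≰⇒> λ m → <⇒≱ l (mono m)
    power≤ : ∀ {s s'} → K ^ s ≤ K ^ s' → s ≤ s'
    power≤ l = ≮⇒≥ λ m → <⇒≱ (^-monoʳ-< K K≥2 m) l

  Next : ℕ → ℕ → ℕ → Set
  Next t p q = p < q × (∀ z → z < q → DN (¬ (p < z × Position t z)))

  Shifted : ℕ → ℕ → ℕ → Set
  Shifted t p i = ∃ λ i⁺ → K * i⁺ ≡ i × Value t p i⁺

  -- The pair (i , r) is written between lo and hi as a marker followed by the
  -- successors of i and r.
  Pair : ℕ → ℕ → ℕ → ℕ → ℕ → Set
  Pair t lo hi i r = i ≤ t × ∃ λ p₁ → ∃ λ p₂ → ∃ λ p₃ → lo < p₁ × Next t p₁ p₂ × Next t p₂ p₃ × p₃ ≤ hi ×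
    (Power K p₁ × Value t p₁ t) × (Power K p₂ × Shifted t p₂ i) × (Power K p₃ × Shifted t p₃ r)

  -- All subcomputations share one t, so all tables are stretches of one coded sequence. A table for
  -- `prec` is any stretch from lo to hi in which every pair is justified by the base case or by
  -- another pair. Representations reverse the order: in `mu`, u < z means that z represents a
  -- smaller number, and w < t means that w represents a positive one.
  H : ∀ {n} → Code n → ℕ → Vec ℕ n → ℕ → Set
  Hs : ∀ {n k} → Vec (Code n) k → ℕ → Vec ℕ n → Vec ℕ k → Set
  H zer t us u = u ≡ t
  H succ t us u = Power K u × K * u ≡ head us
  H (proj i) t us u = u ≡ lookup us i
  H (comp {k = k} f gs) t us u = ∃ λ (ws : Vec ℕ k) → Hs gs t us ws × H f t ws u
  H (prec f g) t us u = ∃ λ lo → ∃ λ hi → Pair t lo hi (head us) u × (∀ i → DN (∀ r → DN (Pair t lo hi i r →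
    DN ((i ≡ t × H f t (tail us) r) ⊎ ∃ λ i' → ∃ λ r' → K * i ≡ i' × Pair t lo hi i' r' × H g t (i' ∷ r' ∷ tail us) r))))
  H (mu f) t us u = (Power K u × u ≤ t) × H f t (u ∷ us) t ×
    (∀ z → DN ((Power K z × z ≤ t) × u < z → DN (∃ λ w → w < t × H f t (z ∷ us) w)))
  Hs [] t us ws = ⊤
  Hs (g ∷ gs) t us ws = H g t us (head ws) × Hs gs t us (tail ws)

  private
    def-K : ∀ {v} (i : Fin v) → Def (λ ρ → Power K (lookup ρ i))
    def-K i = def-app₁ {P = Power K} dK (fun-var i)

  def-Value : ∀ {v} (t x u : Fin v) → Def (λ ρ → Value (lookup ρ t) (lookup ρ x) (lookup ρ u))
  def-Value t x u = def-∧ (def-K u) (def-∧ (def-≤ (fun-var u) (fun-var t)) (def-∃ (def-∧ (def-app₁ {P = Power Λ} dΛ (fun-var v0))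
    (def-∧ (def-≤ (fun-+ (fun-var v0) (fun-var (fs u))) (fun-var (fs x)))
      (def-< (fun-var (fs x)) (fun-+ (fun-var v0) (fun-scale K (fun-var (fs u)))))))))

  def-Next : ∀ {v} (t p q : Fin v) → Def (λ ρ → Next (lookup ρ t) (lookup ρ p) (lookup ρ q))
  def-Next t p q = def-∧ (def-< (fun-var p) (fun-var q)) (def-∀< (fun-var q) (def-¬ (def-∧ (def-< (fun-var (fs p)) (fun-var v0))
    (def-∧ (def-K v0) (def-∃ (def-Value (fs (fs t)) v1 v0))))))

  def-Shifted : ∀ {v} (t p i : Fin v) → Def (λ ρ → Shifted (lookup ρ t) (lookup ρ p) (lookup ρ i))
  def-Shifted t p i = def-∃ (def-∧ (def-≡ (fun-scale K (fun-var v0)) (fun-var (fs i))) (def-Value (fs t) (fs p) v0))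

  def-Pair : ∀ {v} (t lo hi i r : Fin v) → Def (λ ρ → Pair (lookup ρ t) (lookup ρ lo) (lookup ρ hi) (lookup ρ i) (lookup ρ r))
  def-Pair {v} t lo hi i r = def-∧ (def-≤ (fun-var i) (fun-var t)) (def-∃ (def-∃ (def-∃ (def-∧ (def-< (fun-var (s lo)) (fun-var v2))
    (def-∧ (def-Next (s t) v2 v1) (def-∧ (def-Next (s t) v1 v0) (def-∧ (def-≤ (fun-var v0) (fun-var (s hi)))
    (def-∧ (def-∧ (def-K v2) (def-Value (s t) v2 (s t))) (def-∧ (def-∧ (def-K v1) (def-Shifted (s t) v1 (s i)))
      (def-∧ (def-K v0) (def-Shifted (s t) v0 (s r))))))))))))
    where
      s : Fin v → Fin (suc (suc (suc v)))
      s i = fs (fs (fs i))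

  def-H : ∀ {n} (f : Code n) {v} (t : Fin v) (us : Vec (Fin v) n) (u : Fin v) →
    Def (λ ρ → H f (lookup ρ t) (Vec.map (lookup ρ) us) (lookup ρ u))
  def-Hs : ∀ {n k} (gs : Vec (Code n) k) {v} (t : Fin v) (us : Vec (Fin v) n) (ws : Vec (Fin v) k) →
    Def (λ ρ → Hs gs (lookup ρ t) (Vec.map (lookup ρ) us) (Vec.map (lookup ρ) ws))
  def-H zer t us u = def-≡ (fun-var u) (fun-var t)
  def-H succ t (a ∷ []) u = def-∧ (def-K u) (def-≡ (fun-scale K (fun-var u)) (fun-var a))
  def-H (proj i) t us u = def-map (λ ρ → Iff-≡ (cong (lookup ρ u ≡_) (sym (Vec.lookup-map i (lookup ρ) us))))
    (def-≡ (fun-var u) (fun-var (lookup us i)))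
  def-H (comp {k = k} f gs) {v} t us u = def-map (λ ρ → (λ (w , h) → proj₁ (conv ρ w) h >>= λ h' → ret (w , h')) , λ (w , h) → proj₂ (conv ρ w) h >>= λ h' → ret (w , h'))
    (def-∃Vec k (def-∧ (def-Hs gs (k Fin.↑ʳ t) (Vec.map (k Fin.↑ʳ_) us) ws) (def-H f (k Fin.↑ʳ t) ws (k Fin.↑ʳ u))))
    where
      ws : Vec (Fin (k + v)) k
      ws = Vec.tabulate (Fin._↑ˡ v)
      body≡ : ∀ {t t' us us' ws ws' u u'} → t ≡ t' → us ≡ us' → ws ≡ ws' → u ≡ u' →
        Iff (Hs gs t us ws × H f t ws u) (Hs gs t' us' ws' × H f t' ws' u')
      body≡ refl refl refl refl = Iff-refl
      conv : ∀ ρ w → Iff (Hs gs (lookup (w Vec.++ ρ) (k Fin.↑ʳ t)) (Vec.map (lookup (w Vec.++ ρ)) (Vec.map (k Fin.↑ʳ_) us)) (Vec.map (lookup (w Vec.++ ρ)) ws)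
          × H f (lookup (w Vec.++ ρ) (k Fin.↑ʳ t)) (Vec.map (lookup (w Vec.++ ρ)) ws) (lookup (w Vec.++ ρ) (k Fin.↑ʳ u)))
        (Hs gs (lookup ρ t) (Vec.map (lookup ρ) us) w × H f (lookup ρ t) w (lookup ρ u))
      conv ρ w = body≡ (Vec.lookup-++ʳ w ρ t) (map-shift {ρ = ρ} {w Vec.++ ρ} (k Fin.↑ʳ_) (Vec.lookup-++ʳ w ρ) us)
        (trans (sym (Vec.tabulate-∘ (lookup (w Vec.++ ρ)) (Fin._↑ˡ v))) (sel-↑ˡ w ρ)) (Vec.lookup-++ʳ w ρ u)
  def-H (prec f g) {v} t (a ∷ us) u = def-∃ (def-∃ (def-∧ (def-Pair (fs (fs t)) v1 v0 (fs (fs a)) (fs (fs u)))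
    (def-∀ (def-∀ (def-→ (def-Pair (s₄ t) v3 v2 v1 v0) (def-∨
      (def-∧ (def-≡ (fun-var v1) (fun-var (s₄ t))) (def-map {S = λ ρ → H f (lookup ρ (s₄ t)) (Vec.map (λ i → lookup ρ (s₄ i)) us) (lookup ρ v0)} (λ ρ → H-cong f (sym (Vec.map-∘ (lookup ρ) s₄ us)))
        (def-H f (s₄ t) (Vec.map s₄ us) v0)))
      (def-∃ (def-∃ (def-∧ (def-≡ (fun-scale K (fun-var v3)) (fun-var v1)) (def-∧ (def-Pair (s₆ t) v5 v4 v1 v0)
        (def-map {S = λ ρ → H g (lookup ρ (s₆ t)) (lookup ρ v1 ∷ lookup ρ v0 ∷ Vec.map (λ i → lookup ρ (s₆ i)) us) (lookup ρ v2)}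
          (λ ρ → H-cong g (cong (λ us → lookup ρ v1 ∷ lookup ρ v0 ∷ us) (sym (Vec.map-∘ (lookup ρ) s₆ us))))
          (def-H g (s₆ t) (v1 ∷ v0 ∷ Vec.map s₆ us) v2))))))))))))
    where
      s₄ : Fin v → Fin (4 + v)
      s₄ i = fs (fs (fs (fs i)))
      s₆ : Fin v → Fin (6 + v)
      s₆ i = fs (fs (fs (fs (fs (fs i)))))
      H-cong : ∀ {n} (f : Code n) {t us us' u} → us ≡ us' → Iff (H f t us u) (H f t us' u)
      H-cong f refl = Iff-refl
  def-H (mu f) t us u = def-∧ (def-∧ (def-K u) (def-≤ (fun-var u) (fun-var t))) (def-∧ (def-H f t (u ∷ us) t)
    (def-∀ (def-→ (def-∧ (def-∧ (def-K v0) (def-≤ (fun-var v0) (fun-var (fs t)))) (def-< (fun-var (fs u)) (fun-var v0)))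
      (def-∃ (def-∧ (def-< (fun-var v0) (fun-var (fs (fs t))))
        (def-map {S = λ ρ → H f (lookup ρ (fs (fs t))) (lookup ρ v1 ∷ Vec.map (λ i → lookup ρ (fs (fs i))) us) (lookup ρ v0)}
          (λ ρ → H-cong (cong (lookup ρ v1 ∷_) (sym (Vec.map-∘ (lookup ρ) (λ i → fs (fs i)) us))))
          (def-H f (fs (fs t)) (v1 ∷ Vec.map (λ i → fs (fs i)) us) v0)))))))
    where
      H-cong : ∀ {t us us' u} → us ≡ us' → Iff (H f t us u) (H f t us' u)
      H-cong refl = Iff-refl
  def-Hs [] t us ws = def-⊤
  def-Hs (g ∷ gs) t us (w ∷ ws) = def-∧ (def-H g t us w) (def-Hs gs t us ws)

  module Semantics (τ : ℕ) where
    private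
      t : ℕ
      t = K ^ τ
      t≥1 : 1 ≤ t
      t≥1 = 1≤^ K τ K≥1

    Rep : ℕ → ℕ → Set
    Rep = Represents t

    Reps : ∀ {n} → Vec ℕ n → Vec ℕ n → Set
    Reps [] [] = ⊤
    Reps (x ∷ xs) (u ∷ us) = Rep x u × Reps xs us

    reps-lookup : ∀ {n} (xs us : Vec ℕ n) → Reps xs us → ∀ i → Rep (lookup xs i) (lookup us i)
    reps-lookup (x ∷ xs) (u ∷ us) (r , _) fz = r
    reps-lookup (x ∷ xs) (u ∷ us) (_ , rs) (fs i) = reps-lookup xs us rs i

    rep-top : ∀ {y} → Rep y t → y ≡ 0
    rep-top {zero} _ = refl
    rep-top {suc y} r = ⊥-elim (pr₂ t (K ^ suc y) r t≥1 (≤-trans K≥2 (≤-trans (≤-reflexive (sym (*-identityʳ K))) (*-monoʳ-≤ K (1≤^ K y K≥1)))))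

    rep-exact : ∀ x → x ≤ τ → Rep x (K ^ (τ ∸ x))
    rep-exact x l = trans (sym (^-distribˡ-+-* K (τ ∸ x) x)) (cong (K ^_) (m∸n+n≡m l))

    rep≤ : ∀ {x u} → Rep x u → x ≤ τ
    rep≤ {x} {zero} r = ⊥-elim (<⇒≢ t≥1 r)
    rep≤ {x} {suc u} r = power≤ (≤-trans (m≤m+n (K ^ x) (u * K ^ x)) (≤-reflexive r))

    rep-unique : ∀ {x u} → Rep x u → u ≡ K ^ (τ ∸ x)
    rep-unique {x} {u} r = *-cancelʳ-≡ u (K ^ (τ ∸ x)) (K ^ x) {{>-nonZero (1≤^ K x K≥1)}} (trans r (sym (rep-exact x (rep≤ {x} {u} r))))

    num-rep : ∀ u → Power K u → u ≤ t → ∃ λ x → x ≤ τ × u ≡ K ^ (τ ∸ x) × Rep x u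
    num-rep .(K ^ i) (i , refl) l = τ ∸ i , m∸n≤m τ i , e , subst (Rep (τ ∸ i)) (sym e) (rep-exact (τ ∸ i) (m∸n≤m τ i))
      where
        e : K ^ i ≡ K ^ (τ ∸ (τ ∸ i))
        e = cong (K ^_) (sym (m∸[m∸n]≡n (power≤ {i} {τ} l)))

    Result : ∀ {n} → Code n → Vec ℕ n → ℕ → Set
    Result f xs u = ∃ λ y → Rep y u × Eval f xs y

    -- Nothing is assumed about the sequence that t codes. A pair in the stretch must be justified,
    -- and the justifications descend in the first component until it is zero.
    H-sound : ∀ {n} (f : Code n) xs us u → Reps xs us → H f t us u → DN (Result f xs u)
    Hs-sound : ∀ {n k} (gs : Vec (Code n) k) xs us ws → Reps xs us → Hs gs t us ws → DN (∃ λ ys → Reps ys ws × EvalAll gs xs ys)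
    H-sound zer xs us u rs refl = ret (0 , *-identityʳ t , e-zer)
    H-sound succ (x ∷ []) (a ∷ []) u (r , _) (_ , e) = ret (suc x , pr₁ a K (K ^ x) t u r e , e-succ)
    H-sound (proj i) xs us u rs refl = ret (lookup xs i , reps-lookup xs us rs i , e-proj)
    H-sound (comp f gs) xs us u rs (ws , hs , h) = do
      (ys , rs' , es) ← Hs-sound gs xs us ws rs hs
      (y , r , e) ← H-sound f ys ws u rs' h
      ret (y , r , e-comp es e)
    H-sound (prec f g) (x ∷ xs) (a ∷ us) u (r , rs) (lo , hi , p , just) = go x a u r p
      where
        go : ∀ x i r → Rep x i → Pair t lo hi i r → DN (Result (prec f g) (x ∷ xs) r)
        go x i r rep p = do
          just₁ ← just i
          just₂ ← just₁ r
          inj₂ (i' , r' , e , p' , h) ← just₂ p where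
            inj₁ (refl , h) → do
              (y , ry , ev) ← H-sound f xs us r rs h
              ret (y , ry , subst (λ x → Eval (prec f g) (x ∷ xs) y) (sym (rep-top rep)) (e-prec0 ev))
          succ-case x rep i' r' e p' h
          where
            succ-case : ∀ x → Rep x i → ∀ i' r' → K * i ≡ i' → Pair t lo hi i' r' → H g t (i' ∷ r' ∷ us) r → DN (Result (prec f g) (x ∷ xs) r)
            -- Here i is t, and the alleged predecessor K t exceeds t, which `Pair` forbids.
            succ-case zero rep i' r' e (l , _) h = ⊥-elim (pr₄ i' K t (trans (cong (K *_) (trans (sym rep) (*-identityʳ i))) e) l t≥1 K≥2)
            succ-case (suc x) rep i' r' e p' h = do
              let rep' = pr₃ i K i' (K ^ x) t rep e
              (y' , ry' , ev') ← go x i' r' rep' p'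
              (y , ry , ev) ← H-sound g (x ∷ y' ∷ xs) (i' ∷ r' ∷ us) r (rep' , ry' , rs) h
              ret (y , ry , e-precS ev' ev)
    H-sound (mu f) xs us u rs ((pu , u≤t) , h , below) = do
      let (y , y≤τ , u≡ , ry) = num-rep u pu u≤t
      (y₀ , r₀ , ev) ← H-sound f (y ∷ xs) (u ∷ us) t (ry , rs) h
      evs ← dn-< y λ z z<y → smaller y u≡ z z<y (≤-trans (<⇒≤ z<y) y≤τ) y≤τ
      ret (y , ry , e-mu (subst (Eval f (y ∷ xs)) (rep-top r₀) ev) evs)
      where
        smaller : ∀ y → u ≡ K ^ (τ ∸ y) → ∀ z → z < y → z ≤ τ → y ≤ τ → DN (∃ λ w → Eval f (z ∷ xs) (suc w))
        smaller y u≡ z z<y z≤τ y≤τ = do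
          b ← below (K ^ (τ ∸ z))
          (w , w<t , hw) ← b (((τ ∸ z , refl) , mono (m∸n≤m τ z)) , subst (_< K ^ (τ ∸ z)) (sym u≡) (^-monoʳ-< K K≥2 (∸-monoʳ-< z<y y≤τ)))
          (v , rv , ev) ← H-sound f (z ∷ xs) (K ^ (τ ∸ z) ∷ us) w (rep-exact z z≤τ , rs) hw
          ret (positive v w<t rv ev)
          where
            positive : ∀ v {w} → w < t → Rep v w → Eval f (z ∷ xs) v → ∃ λ w → Eval f (z ∷ xs) (suc w)
            positive zero {w} w<t rv ev = ⊥-elim (<⇒≢ w<t (trans (sym (*-identityʳ w)) rv))
            positive (suc v) _ _ ev = v , ev
    Hs-sound [] xs us [] rs _ = ret ([] , tt , ea-nil)
    Hs-sound (g ∷ gs) xs us (w ∷ ws) rs (h , hs) = do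
      (y , r , e) ← H-sound g xs us w rs h
      (ys , rs' , es) ← Hs-sound gs xs us ws rs hs
      ret (y ∷ ys , (r , rs') , ea-cons e es)

    Window : List (ℕ × ℕ) → ℕ → ℕ → Set
    Window w lo hi = ∀ i r → Iff (Pair t lo hi i r) (∃ λ x → ∃ λ y → (x , y) ∈ w × Rep x i × Rep y r)

    seg-≤ : ∀ vs {x₀ x'} → Seg t x₀ vs x' → x₀ ≤ x'
    seg-≤ [] refl = ≤-refl
    seg-≤ (v ∷ vs) (x₁ , l , _ , _ , _ , _ , rest) = ≤-trans (<⇒≤ l) (seg-≤ vs rest)

    rep-suc : ∀ {x u u⁺} → Rep x u → Rep (suc x) u⁺ → K * u⁺ ≡ u
    rep-suc {x} {u} {u⁺} r r⁺ = *-cancelʳ-≡ (K * u⁺) u (K ^ x) {{>-nonZero (1≤^ K x K≥1)}} (trans (swap K u⁺ (K ^ x)) (trans r⁺ (sym r)))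
      where
        swap : ∀ a b c → a * b * c ≡ b * (a * c)
        swap = solve-∀

    marker : ∀ {q} → (∃ λ u → Value t q u × Rep 0 u) → Value t q t
    marker {q} (u , v , r) = subst (Value t q) (trans (sym (*-identityʳ u)) r) v

    next : ∀ {p q} → p < q → (∀ x → p < x → x < q → ¬ Position t x) → Next t p q
    next l none = l , λ z z<q → ret λ (p<z , pz) → none z p<z z<q pz

    write-in : ∀ w {x₀ x'} → Seg t x₀ (encode w) x' → ∀ {lo hi} → lo ≤ x₀ → x' ≤ hi → ∀ {x y i r} →
      (x , y) ∈ w → Rep x i → Rep y r → Pair t lo hi i r
    write-in ((x , y) ∷ w) (q₁ , l₁ , n₁ , k₁ , m , _ , q₂ , l₂ , n₂ , k₂ , (i⁺ , vi , ri) , _ , q₃ , l₃ , n₃ , k₃ , (r⁺ , vr , rr) , _ , rest)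
      {lo} {hi} lo≤ ≤hi {i = i} {r} (here refl) rx ry =
      subst (_≤ t) (sym (rep-unique {x} rx)) (mono (m∸n≤m τ x)) , q₁ , q₂ , q₃ , ≤-<-trans lo≤ l₁ , next l₂ n₂ , next l₃ n₃ ,
      ≤-trans (seg-≤ (encode w) rest) ≤hi , (k₁ , marker m) , (k₂ , i⁺ , rep-suc {x} rx ri , vi) , (k₃ , r⁺ , rep-suc {y} ry rr , vr)
    write-in (_ ∷ w) (q₁ , l₁ , _ , _ , _ , _ , q₂ , l₂ , _ , _ , _ , _ , q₃ , l₃ , _ , _ , _ , _ , rest) lo≤ ≤hi (there i∈) rx ry =
      write-in w rest (≤-trans lo≤ (<⇒≤ (<-trans l₁ (<-trans l₂ l₃)))) ≤hi i∈ rx ry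

    same-next : ∀ {p q q'} → Next t p q → Position t q → p < q' → (∀ x → p < x → x < q' → ¬ Position t x) → Position t q' → q ≡ q'
    same-next {p} {q} {q'} (p<q , gap) pq p<q' none pq' with <-cmp q q'
    ... | tri≈ _ e _ = e
    ... | tri< l _ _ = ⊥-elim (none q p<q l pq)
    ... | tri> _ _ l = ⊥-elim (gap q' l λ n → n (p<q' , pq'))

    rep-pred : ∀ {x i i⁺} → K * i⁺ ≡ i → Rep (suc x) i⁺ → Rep x i
    rep-pred {x} {.(K * i⁺)} {i⁺} refl r = trans (swap K i⁺ (K ^ x)) r
      where
        swap : ∀ a b c → a * b * c ≡ b * (a * c)
        swap = solve-∀

    not-marker : ∀ {x q} → (∀ u → Value t q u → Rep (suc x) u) → ¬ Value t q t
    not-marker {x} h v = 1+n≢0 (rep-top {suc x} (h t v))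

    -- A pair begins at an entry with value 0. The other two entries of an encoded pair are
    -- successors, so a reading cannot get out of step.
    read-out : ∀ w {x₀ x'} → Seg t x₀ (encode w) x' → ∀ {i r p₁ p₂ p₃} → x₀ < p₁ → Next t p₁ p₂ → Next t p₂ p₃ → p₃ ≤ x' →
      Power K p₁ × Value t p₁ t → Power K p₂ × Shifted t p₂ i → Power K p₃ × Shifted t p₃ r →
      ∃ λ x → ∃ λ y → (x , y) ∈ w × Rep x i × Rep y r
    read-out [] refl x₀<p₁ (l , _) (l' , _) p₃≤ _ _ _ = ⊥-elim (<⇒≱ (<-trans x₀<p₁ (<-trans l l')) p₃≤)
    read-out ((x , y) ∷ w) (q₁ , l₁ , n₁ , k₁ , m , _ , q₂ , l₂ , n₂ , k₂ , (i⁺ , vi , _) , ui , q₃ , l₃ , n₃ , k₃ , (r⁺ , vr , _) , ur , rest)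
      {p₁ = p₁} x₀<p₁ N₁ N₂ p₃≤ (kp₁ , vp₁) (kp₂ , i' , ei , vp₂) (kp₃ , r' , er , vp₃) with <-cmp p₁ q₁
    ... | tri< l _ _ = ⊥-elim (n₁ p₁ x₀<p₁ l (kp₁ , t , vp₁))
    ... | tri≈ _ refl _ with same-next N₁ (kp₂ , i' , vp₂) l₂ n₂ (k₂ , i⁺ , vi)
    ... | refl with same-next N₂ (kp₃ , r' , vp₃) l₃ n₃ (k₃ , r⁺ , vr)
    ... | refl = x , y , here refl , rep-pred {x} ei (ui i' vp₂) , rep-pred {y} er (ur r' vp₃)
    read-out ((x , y) ∷ w) (q₁ , l₁ , n₁ , k₁ , m , _ , q₂ , l₂ , n₂ , k₂ , (i⁺ , vi , _) , ui , q₃ , l₃ , n₃ , k₃ , (r⁺ , vr , _) , ur , rest)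
      {p₁ = p₁} x₀<p₁ N₁ N₂ p₃≤ P₁@(kp₁ , vp₁) P₂ P₃ | tri> _ _ l with <-cmp p₁ q₂
    ... | tri< l' _ _ = ⊥-elim (n₂ p₁ l l' (kp₁ , t , vp₁))
    ... | tri≈ _ refl _ = ⊥-elim (not-marker {x} ui vp₁)
    ... | tri> _ _ l' with <-cmp p₁ q₃
    ... | tri< l'' _ _ = ⊥-elim (n₃ p₁ l' l'' (kp₁ , t , vp₁))
    ... | tri≈ _ refl _ = ⊥-elim (not-marker {y} ur vp₁)
    ... | tri> _ _ l'' with read-out w rest l'' N₁ N₂ p₃≤ P₁ P₂ P₃
    ... | a , b , ab∈ , ra , rb = a , b , there ab∈ , ra , rb

    window : ∀ w {x₀ x'} → Seg t x₀ (encode w) x' → Window w x₀ x'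
    window w seg i r =
      (λ (_ , p₁ , p₂ , p₃ , l , N₁ , N₂ , l' , P₁ , P₂ , P₃) → ret (read-out w seg l N₁ N₂ l' P₁ P₂ P₃)) ,
      λ (x , y , xy∈ , rx , ry) → ret (write-in w seg ≤-refl ≤-refl xy∈ rx ry)

    Windows : List (List (ℕ × ℕ)) → Set
    Windows W = ∀ w → w ∈ W → ∃ λ lo → ∃ λ hi → Window w lo hi

    seg-++ : ∀ as {bs x₀ x'} → Seg t x₀ (as List.++ bs) x' → ∃ λ x₁ → Seg t x₀ as x₁ × Seg t x₁ bs x'
    seg-++ [] s = _ , refl , s
    seg-++ (a ∷ as) (x₁ , l , n , k , m , u , rest) = let (x₂ , s , s') = seg-++ as rest in x₂ , (x₁ , l , n , k , m , u , s) , s'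

    windows : ∀ W {x₀ x'} → Seg t x₀ (List.concatMap encode W) x' → Windows W
    windows (w ∷ W) seg with seg-++ (encode w) seg
    ... | x₁ , s , s' = λ { .w (here refl) → _ , _ , window w s ; w' (there w'∈) → windows W s' w' w'∈ }

  open Semantics using (Windows; Window; rep-exact; rep-unique; Rep)

  -- Tables needed by a terminating computation

  rp : ℕ → ℕ → ℕ
  rp τ x = K ^ (τ ∸ x)

  rp-suc : ∀ τ x → suc x ≤ τ → K * rp τ (suc x) ≡ rp τ x
  rp-suc τ x l = cong (K ^_) (sym (trans (cong (_∸ x) (sym (m+[n∸m]≡n l))) (trans (cong (_∸ x) (sym (+-suc x (τ ∸ suc x)))) (m+n∸m≡n x _))))

  -- A computation uses finitely many tables, which do not depend on τ. They are collected
  -- beforehand so that one coded sequence, with τ large enough, can contain them all.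
  record Plan {n} (f : Code n) (xs : Vec ℕ n) (y : ℕ) : Set where
    field
      needed : List (List (ℕ × ℕ))
      bound : ℕ
      works : ∀ τ → bound ≤ τ → Windows τ needed → DN (H f (K ^ τ) (Vec.map (rp τ) xs) (rp τ y))

  record Plans {n k} (gs : Vec (Code n) k) (xs : Vec ℕ n) (ys : Vec ℕ k) : Set where
    field
      needed : List (List (ℕ × ℕ))
      bound : ℕ
      works : ∀ τ → bound ≤ τ → Windows τ needed → DN (Hs gs (K ^ τ) (Vec.map (rp τ) xs) (Vec.map (rp τ) ys))

  private
    windowsˡ : ∀ τ {W W'} → Windows τ (W List.++ W') → Windows τ W
    windowsˡ τ h w w∈ = h w (Mem.∈-++⁺ˡ w∈)
    windowsʳ : ∀ τ W {W'} → Windows τ (W List.++ W') → Windows τ W'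
    windowsʳ τ W h w w∈ = h w (Mem.∈-++⁺ʳ W w∈)

  Justified : ∀ {n} → Code n → Code (suc (suc n)) → Vec ℕ n → ℕ → List (ℕ × ℕ) → ℕ → ℕ → Set
  Justified f g xs τ w i r = (i ≡ 0 × H f (K ^ τ) (Vec.map (rp τ) xs) (rp τ r)) ⊎
    ∃ λ i' → ∃ λ r' → i ≡ suc i' × (i' , r') ∈ w × H g (K ^ τ) (rp τ i' ∷ rp τ r' ∷ Vec.map (rp τ) xs) (rp τ r)

  record Chain {n} (f : Code n) (g : Code (suc (suc n))) (xs : Vec ℕ n) (x y : ℕ) : Set where
    field
      table : List (ℕ × ℕ)
      final : (x , y) ∈ table
      needed : List (List (ℕ × ℕ))
      bound : ℕ
      justified : ∀ τ → bound ≤ τ → Windows τ needed → ∀ i r → (i , r) ∈ table →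
        i ≤ τ × r ≤ τ × DN (Justified f g xs τ table i r)

  chain-plan : ∀ {n} {f : Code n} {g xs x y} → Chain f g xs x y → Plan (prec f g) (x ∷ xs) y
  chain-plan {f = f} {g} {xs} {x} {y} c = record { needed = table ∷ needed ; bound = bound ; works = works }
    where
      open Chain c
      works : ∀ τ → bound ≤ τ → Windows τ (table ∷ needed) → DN (H (prec f g) (K ^ τ) (Vec.map (rp τ) (x ∷ xs)) (rp τ y))
      works τ b ws with ws table (here refl)
      ... | lo , hi , win = do
        p ← pair-of (x , y) final
        ret (lo , hi , p , λ i → ret λ r → ret λ p → do
          (x' , y' , xy∈ , rx , ry) ← proj₁ (win i r) p
          j ← proj₂ (proj₂ (ok x' y' xy∈))
          convert x' y' i r xy∈ (rep-unique τ {x'} rx) (rep-unique τ {y'} ry) j)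
        where
          ok : ∀ i r → (i , r) ∈ table → i ≤ τ × r ≤ τ × DN (Justified f g xs τ table i r)
          ok = justified τ b λ w w∈ → ws w (there w∈)
          pair-of : ∀ ((a , c) : ℕ × ℕ) → (a , c) ∈ table → DN (Pair (K ^ τ) lo hi (rp τ a) (rp τ c))
          pair-of (a , c) ac∈ = let (a≤ , c≤ , _) = ok a c ac∈ in
            proj₂ (win (rp τ a) (rp τ c)) (a , c , ac∈ , rep-exact τ a a≤ , rep-exact τ c c≤)
          convert : ∀ x' y' i r → (x' , y') ∈ table → i ≡ rp τ x' → r ≡ rp τ y' → Justified f g xs τ table x' y' →
            DN ((i ≡ K ^ τ × H f (K ^ τ) (Vec.map (rp τ) xs) r) ⊎ ∃ λ i' → ∃ λ r' → K * i ≡ i' × Pair (K ^ τ) lo hi i' r' ×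
              H g (K ^ τ) (i' ∷ r' ∷ Vec.map (rp τ) xs) r)
          convert .0 y' i r _ refl refl (inj₁ (refl , h)) = ret (inj₁ (refl , h))
          convert .(suc i') y' i r xy∈ refl refl (inj₂ (i' , r' , refl , ir∈ , h)) = do
            p ← pair-of (i' , r') ir∈
            ret (inj₂ (rp τ i' , rp τ r' , rp-suc τ i' (proj₁ (ok (suc i') y' xy∈)) , p , h))

  collect : ∀ {n} (f : Code (suc n)) xs y → (∀ z → z < y → ∃ λ w → Plan f (z ∷ xs) (suc w)) →
    ∃ λ W → ∃ λ B → ∀ τ → B ≤ τ → Windows τ W → ∀ z → z < y →
      ∃ λ w → suc w ≤ τ × DN (H f (K ^ τ) (rp τ z ∷ Vec.map (rp τ) xs) (rp τ (suc w)))
  collect f xs zero h = [] , 0 , λ _ _ _ _ ()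
  collect f xs (suc y) h with collect f xs y (λ z l → h z (m≤n⇒m≤1+n l)) | h y ≤-refl
  ... | W , B , works | w , p = Plan.needed p List.++ W , suc w + Plan.bound p + B , λ τ b ws z l → case m≤n⇒m<n∨m≡n (≤-pred l) of λ where
    (inj₁ l') → works τ (≤-trans (m≤n+m B _) b) (windowsʳ τ (Plan.needed p) ws) z l'
    (inj₂ refl) → w , ≤-trans (≤-trans (m≤m+n (suc w) _) (m≤m+n _ B)) b ,
      Plan.works p τ (≤-trans (≤-trans (m≤n+m (Plan.bound p) (suc w)) (m≤m+n _ B)) b) (windowsˡ τ ws)

  plan : ∀ {n} (f : Code n) xs y → Eval f xs y → Plan f xs y
  plans : ∀ {n k} (gs : Vec (Code n) k) xs ys → EvalAll gs xs ys → Plans gs xs ys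
  plan zer xs .0 e-zer = record { needed = [] ; bound = 0 ; works = λ τ _ _ → ret refl }
  plan succ (x ∷ []) .(suc x) e-succ = record { needed = [] ; bound = suc x ; works = λ τ b _ → ret ((τ ∸ suc x , refl) , rp-suc τ x b) }
  plan (proj i) xs .(lookup xs i) e-proj = record { needed = [] ; bound = 0 ; works = λ τ _ _ → ret (sym (Vec.lookup-map i (rp τ) xs)) }
  plan (comp f gs) xs y (e-comp {ys = ys} es e) = record
    { needed = Plans.needed ps List.++ Plan.needed p ; bound = Plans.bound ps + Plan.bound p
    ; works = λ τ b ws → do
        hs ← Plans.works ps τ (≤-trans (m≤m+n _ (Plan.bound p)) b) (windowsˡ τ ws)
        h ← Plan.works p τ (≤-trans (m≤n+m _ (Plans.bound ps)) b) (windowsʳ τ (Plans.needed ps) ws)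
        ret (Vec.map (rp τ) ys , hs , h) }
    where
      ps = plans gs xs ys es
      p = plan f ys y e
  plan (prec f g) (x ∷ xs) y e = chain-plan (chain x y e)
    where
      chain : ∀ x y → Eval (prec f g) (x ∷ xs) y → Chain f g xs x y
      chain zero y (e-prec0 e) = record
        { table = (0 , y) ∷ [] ; final = here refl ; needed = Plan.needed p ; bound = y + Plan.bound p
        ; justified = λ { τ b ws _ _ (here refl) → z≤n , ≤-trans (m≤m+n y _) b ,
            (Plan.works p τ (≤-trans (m≤n+m _ y) b) ws >>= λ h → ret (inj₁ (refl , h))) } }
        where
          p = plan f xs y e
      chain (suc x) y (e-precS {r = r} e e') = record
        { table = (suc x , y) ∷ Chain.table c ; final = here refl ; needed = Plan.needed p List.++ Chain.needed c
        ; bound = suc x + y + (Plan.bound p + Chain.bound c)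
        ; justified = λ where
            τ b ws _ _ (here refl) → ≤-trans (≤-trans (m≤m+n (suc x) y) (m≤m+n _ _)) b , ≤-trans (≤-trans (m≤n+m y (suc x)) (m≤m+n _ _)) b ,
              (Plan.works p τ (≤-trans (≤-trans (m≤m+n _ (Chain.bound c)) (m≤n+m _ (suc x + y))) b) (windowsˡ τ ws) >>= λ h →
                ret (inj₂ (x , r , refl , there (Chain.final c) , h)))
            τ b ws i r' (there ir∈) → let (i≤ , r≤ , j) = Chain.justified c τ (≤-trans (≤-trans (m≤n+m _ (Plan.bound p)) (m≤n+m _ (suc x + y))) b)
                                            (windowsʳ τ (Plan.needed p) ws) i r' ir∈
              in i≤ , r≤ , (j >>= λ { (inj₁ a) → ret (inj₁ a) ; (inj₂ (i' , r'' , e , m , h)) → ret (inj₂ (i' , r'' , e , there m , h)) }) }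
        where
          c = chain x r e
          p = plan g (x ∷ r ∷ xs) y e'
  plan (mu f) xs y (e-mu e h) = record
    { needed = Plan.needed p List.++ proj₁ col ; bound = y + (Plan.bound p + proj₁ (proj₂ col))
    ; works = λ τ b ws → do
        h₀ ← Plan.works p τ (≤-trans (≤-trans (m≤m+n _ _) (m≤n+m _ y)) b) (windowsˡ τ ws)
        ret (((τ ∸ y , refl) , mono (m∸n≤m τ y)) , h₀ , λ z → ret (below τ (≤-trans (m≤m+n y _) b)
          (proj₂ (proj₂ col) τ (≤-trans (≤-trans (m≤n+m _ (Plan.bound p)) (m≤n+m _ y)) b) (windowsʳ τ (Plan.needed p) ws)) z)) }
    where
      p = plan f (y ∷ xs) 0 e
      col = collect f xs y λ z l → let (w , e) = h z l in w , plan f (z ∷ xs) (suc w) e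
      below : ∀ τ → y ≤ τ → (∀ z → z < y → ∃ λ w → suc w ≤ τ × DN (H f (K ^ τ) (rp τ z ∷ Vec.map (rp τ) xs) (rp τ (suc w)))) →
        ∀ z → (Power K z × z ≤ K ^ τ) × rp τ y < z → DN (∃ λ w → w < K ^ τ × H f (K ^ τ) (z ∷ Vec.map (rp τ) xs) w)
      below τ y≤τ hz .(K ^ i) (((i , refl) , z≤) , l) = do
        let i≤τ = power≤ {i} {τ} z≤
            z<y : τ ∸ i < y
            z<y = +-cancelʳ-< i _ _ (subst (_< y + i) (sym (m∸n+n≡m i≤τ)) (subst (_< y + i) (m+[n∸m]≡n y≤τ) (+-monoʳ-< y (power<' {τ ∸ y} {i} l))))
            (w , w≤ , hw) = hz (τ ∸ i) z<y
        h ← hw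
        ret (rp τ (suc w) , ^-monoʳ-< K K≥2 (∸-monoʳ-< {τ} (s≤s z≤n) w≤) ,
          subst (λ z → H f (K ^ τ) (K ^ z ∷ Vec.map (rp τ) xs) (rp τ (suc w))) (m∸[m∸n]≡n i≤τ) h)
  plans [] xs [] ea-nil = record { needed = [] ; bound = 0 ; works = λ _ _ _ → ret tt }
  plans (g ∷ gs) xs (y ∷ ys) (ea-cons e es) = record
    { needed = Plan.needed p List.++ Plans.needed ps ; bound = Plan.bound p + Plans.bound ps
    ; works = λ τ b ws → do
        h ← Plan.works p τ (≤-trans (m≤m+n _ (Plans.bound ps)) b) (windowsˡ τ ws)
        hs ← Plans.works ps τ (≤-trans (m≤n+m _ (Plan.bound p)) b) (windowsʳ τ (Plan.needed p) ws)
        ret (h , hs) }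
    where
      p = plan g xs y e
      ps = plans gs xs ys es

  Accepts : Code 1 → ℕ → Set
  Accepts f e = ∃ λ t → Power K t × ∃ λ u → u * K ^ e ≡ t × H f t (u ∷ []) t

  accepts-sound : ∀ f e → Accepts f e → DN (Eval f (e ∷ []) 0)
  accepts-sound f e (.(K ^ τ) , (τ , refl) , u , r , h) = do
    (y , ry , ev) ← Semantics.H-sound τ f (e ∷ []) (u ∷ []) (K ^ τ) (r , tt) h
    ret (subst (Eval f (e ∷ [])) (Semantics.rep-top τ {y} ry) ev)

  accepts-complete : ∀ f e → Eval f (e ∷ []) 0 → DN (Accepts f e)
  accepts-complete f e ev = do
    let p = plan f (e ∷ []) 0 ev
    (τ , b , x₀ , x' , seg) ← coded (List.concatMap encode (Plan.needed p)) (e + Plan.bound p)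
    h ← Plan.works p τ (≤-trans (m≤n+m _ e) b) (Semantics.windows τ (Plan.needed p) seg)
    ret (K ^ τ , (τ , refl) , rp τ e , rep-exact τ e (≤-trans (m≤m+n e _) b) , h)

-- Gödel numbers and diagonalization

tri-mono : ∀ {a b} → a ≤ b → tri a ≤ tri b
tri-mono z≤n = z≤n
tri-mono (s≤s l) = s≤s (+-mono-≤ l (tri-mono l))

pair-sum : ∀ a b c d → pair a b ≡ pair c d → ¬ a + b < c + d
pair-sum a b c d e l = <⇒≢ (≤-trans (s≤s (≤-trans (≤-reflexive (+-comm (tri (a + b)) b)) (+-monoˡ-≤ (tri (a + b)) (m≤n+m b a))))
  (≤-trans (tri-mono l) (m≤m+n (tri (c + d)) d))) e

pair-injective : ∀ a b c d → pair a b ≡ pair c d → a ≡ c × b ≡ d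
pair-injective a b c d e = +-cancelʳ-≡ b a c (trans sums (cong (c +_) (sym b≡d))) , b≡d
  where
    sums : a + b ≡ c + d
    sums = ≤-antisym (≮⇒≥ (pair-sum c d a b (sym e))) (≮⇒≥ (pair-sum a b c d e))
    b≡d : b ≡ d
    b≡d = +-cancelˡ-≡ (tri (a + b)) b d (trans e (cong (λ s → tri s + d) (sym sums)))

codeT-injective : ∀ {v} (s t : Term v) → codeT s ≡ codeT t → s ≡ t
codeT-injective (var i) (var j) e = cong var (Fin.toℕ-injective (proj₂ (pair-injective 0 (toℕ i) 0 (toℕ j) e)))
codeT-injective (var i) (plus t t') e with () ← proj₁ (pair-injective 0 (toℕ i) 1 (pair (codeT t) (codeT t')) e)
codeT-injective (plus s s') (var j) e with () ← proj₁ (pair-injective 1 (pair (codeT s) (codeT s')) 0 (toℕ j) e)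
codeT-injective (plus s s') (plus t t') e =
  let (a , b) = pair-injective (codeT s) (codeT s') (codeT t) (codeT t')
                  (proj₂ (pair-injective 1 (pair (codeT s) (codeT s')) 1 (pair (codeT t) (codeT t')) e))
  in cong₂ plus (codeT-injective s t a) (codeT-injective s' t' b)

codeTs-injective : ∀ {v n} (ss ts : Vec (Term v) n) → codeTs ss ≡ codeTs ts → ss ≡ ts
codeTs-injective [] [] _ = refl
codeTs-injective (s ∷ ss) (t ∷ ts) e =
  let (a , b) = pair-injective (codeT s) (codeTs ss) (codeT t) (codeTs ts) (suc-injective e)
  in cong₂ _∷_ (codeT-injective s t a) (codeTs-injective ss ts b)

tag body : ∀ {rels v} → Formula rels v → ℕ
tag (eq _ _) = 0
tag (rel _ _) = 1
tag (neg _) = 2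
tag (conj _ _) = 3
tag (ex _) = 4
body (eq s t) = pair (codeT s) (codeT t)
body (rel i ts) = pair (toℕ i) (codeTs ts)
body (neg φ) = codeF φ
body (conj φ ψ) = pair (codeF φ) (codeF ψ)
body (ex φ) = codeF φ

code-tag : ∀ {rels v} (φ : Formula rels v) → codeF φ ≡ pair (tag φ) (body φ)
code-tag (eq s t) = refl
code-tag (rel i ts) = refl
code-tag (neg φ) = refl
code-tag (conj φ ψ) = refl
code-tag (ex φ) = refl

codeF-injective : ∀ {rels v} (φ ψ : Formula rels v) → codeF φ ≡ codeF ψ → φ ≡ ψ
same-body : ∀ {rels v} (φ ψ : Formula rels v) → tag φ ≡ tag ψ → body φ ≡ body ψ → φ ≡ ψ
codeF-injective φ ψ e =
  let (a , b) = pair-injective (tag φ) (body φ) (tag ψ) (body ψ) (trans (sym (code-tag φ)) (trans e (code-tag ψ)))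
  in same-body φ ψ a b
same-body (eq s t) (eq s' t') _ e = let (a , b) = pair-injective (codeT s) (codeT t) (codeT s') (codeT t') e in
  cong₂ eq (codeT-injective s s' a) (codeT-injective t t' b)
same-body (rel i ts) (rel j us) _ e with pair-injective (toℕ i) (codeTs ts) (toℕ j) (codeTs us) e
... | a , b with Fin.toℕ-injective a
... | refl = cong (rel i) (codeTs-injective ts us b)
same-body (neg φ) (neg ψ) _ e = cong neg (codeF-injective φ ψ e)
same-body (conj φ ψ) (conj φ' ψ') _ e = let (a , b) = pair-injective (codeF φ) (codeF ψ) (codeF φ') (codeF ψ') e in
  cong₂ conj (codeF-injective φ φ' a) (codeF-injective ψ ψ' b)
same-body (ex φ) (ex ψ) _ e = cong ex (codeF-injective φ ψ e)

-- Recursive functions on Gödel numbers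

eval-unique : ∀ {n} (f : Code n) {xs y y'} → Eval f xs y → Eval f xs y' → y ≡ y'
evals-unique : ∀ {n k} (gs : Vec (Code n) k) {xs ys ys'} → EvalAll gs xs ys → EvalAll gs xs ys' → ys ≡ ys'
eval-unique zer e-zer e-zer = refl
eval-unique succ e-succ e-succ = refl
eval-unique (proj i) e-proj e-proj = refl
eval-unique (comp f gs) (e-comp as a) (e-comp bs b) with evals-unique gs as bs
... | refl = eval-unique f a b
eval-unique (prec f g) (e-prec0 a) (e-prec0 b) = eval-unique f a b
eval-unique (prec f g) (e-precS a a') (e-precS b b') with eval-unique (prec f g) a b
... | refl = eval-unique g a' b'
eval-unique (mu f) {y = y} {y'} (e-mu a below) (e-mu b below') with <-cmp y y'
... | tri≈ _ e _ = e
... | tri< l _ _ with () ← eval-unique f a (proj₂ (below' y l))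
... | tri> _ _ l with () ← eval-unique f b (proj₂ (below y' l))
evals-unique [] ea-nil ea-nil = refl
evals-unique (g ∷ gs) (ea-cons a as) (ea-cons b bs) = cong₂ _∷_ (eval-unique g a b) (evals-unique gs as bs)

Computes : ∀ {n} → Code n → (Vec ℕ n → ℕ) → Set
Computes f F = ∀ xs → Eval f xs (F xs)

constant : ∀ {n} → ℕ → Code n
constant zero = zer
constant (suc c) = comp succ (constant c ∷ [])

constant-computes : ∀ {n} c → Computes {n} (constant c) (λ _ → c)
constant-computes zero xs = e-zer
constant-computes (suc c) xs = e-comp (ea-cons (constant-computes c xs) ea-nil) e-succ

comp₁ : ∀ {n} → Code 1 → Code n → Code n
comp₁ f g = comp f (g ∷ [])

comp₂ : ∀ {n} → Code 2 → Code n → Code n → Code n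
comp₂ f g h = comp f (g ∷ h ∷ [])

add-code : Code 2
add-code = prec (proj fz) (comp₁ succ (proj (fs fz)))

add-computes : Computes add-code (λ xs → head xs + head (tail xs))
add-computes (zero ∷ y ∷ []) = e-prec0 e-proj
add-computes (suc x ∷ y ∷ []) = e-precS (add-computes (x ∷ y ∷ [])) (e-comp (ea-cons e-proj ea-nil) e-succ)

tri-code : Code 1
tri-code = prec zer (comp₂ add-code (comp₁ succ (proj fz)) (proj (fs fz)))

tri-computes : Computes tri-code (λ xs → tri (head xs))
tri-computes (zero ∷ []) = e-prec0 e-zer
tri-computes (suc x ∷ []) = e-precS (tri-computes (x ∷ [])) (e-comp (ea-cons (e-comp (ea-cons e-proj ea-nil) e-succ)
  (ea-cons e-proj ea-nil)) (add-computes (suc x ∷ tri x ∷ [])))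

pair-code : Code 2
pair-code = comp₂ add-code (comp₁ tri-code add-code) (proj (fs fz))

pair-computes : Computes pair-code (λ xs → pair (head xs) (head (tail xs)))
pair-computes (a ∷ b ∷ []) = e-comp (ea-cons (e-comp (ea-cons (add-computes (a ∷ b ∷ [])) ea-nil) (tri-computes (a + b ∷ [])))
  (ea-cons e-proj ea-nil)) (add-computes (tri (a + b) ∷ b ∷ []))

-- Codes of ∃∃(δ ∧ χ), as a function of the code of χ.
block : ℕ → ℕ → ℕ
block δ x = pair 4 (pair 4 (pair 3 (pair δ x)))

block-code : ∀ {n} → ℕ → Code n → Code n
block-code δ f = comp₂ pair-code (constant 4) (comp₂ pair-code (constant 4) (comp₂ pair-code (constant 3) (comp₂ pair-code (constant δ) f)))

pair-constant : ∀ {n} c {f : Code n} {F} → Computes f F → Computes (comp₂ pair-code (constant c) f) (λ xs → pair c (F xs))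
pair-constant c {F = F} cf xs = e-comp (ea-cons (constant-computes c xs) (ea-cons (cf xs) ea-nil)) (pair-computes (c ∷ F xs ∷ []))

block-computes : ∀ {n} δ {f : Code n} {F} → Computes f F → Computes (block-code δ f) (λ xs → block δ (F xs))
block-computes δ {F = F} c = pair-constant 4 {F = λ xs → pair 4 (pair 3 (pair δ (F xs)))}
  (pair-constant 4 {F = λ xs → pair 3 (pair δ (F xs))} (pair-constant 3 {F = λ xs → pair δ (F xs)} (pair-constant δ {F = F} c)))

code-block : ∀ {rels v} (φ ψ : Formula rels (2 + v)) {a b} → codeF φ ≡ a → codeF ψ ≡ b →
  codeF (ex (ex (conj φ ψ))) ≡ block a b
code-block φ ψ refl refl = refl

blocks : ℕ → ℕ → ℕ → ℕ
blocks δ zero z = z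
blocks δ (suc i) z = block δ (blocks δ i z)

blocks-code : ℕ → Code 2
blocks-code δ = prec (proj fz) (block-code δ (proj (fs fz)))

blocks-computes : ∀ δ → Computes (blocks-code δ) (λ xs → blocks δ (head xs) (head (tail xs)))
blocks-computes δ (zero ∷ z ∷ []) = e-prec0 e-proj
blocks-computes δ (suc i ∷ z ∷ []) = e-precS (blocks-computes δ (i ∷ z ∷ []))
  (block-computes δ {proj (fs fz)} {λ xs → lookup xs (fs fz)} (λ _ → e-proj) (i ∷ blocks δ i z ∷ z ∷ []))

-- Codes record de Bruijn indices but not the length of the context. A substitution that keeps the
-- indices therefore keeps the code, and one formula can be used at every quantifier depth with the
-- same code.
Keeps : ∀ {v w} → (Fin w → Term v) → Set
Keeps σ = ∀ i → ∃ λ j → σ i ≡ var j × toℕ j ≡ toℕ i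

keeps-lift : ∀ {v w} {σ : Fin w → Term v} → Keeps σ → Keeps (lift σ)
keeps-lift k fz = fz , refl , refl
keeps-lift k (fs i) = let (j , e , e') = k i in fs j , cong weaken e , cong suc e'

codeT-sub : ∀ {v w} {σ : Fin w → Term v} → Keeps σ → ∀ t → codeT (subT σ t) ≡ codeT t
codeT-sub k (var i) = let (j , e , e') = k i in trans (cong codeT e) (cong (pair 0) e')
codeT-sub k (plus s t) = cong₂ (λ a b → pair 1 (pair a b)) (codeT-sub k s) (codeT-sub k t)

codeTs-sub : ∀ {v w n} {σ : Fin w → Term v} → Keeps σ → ∀ (ts : Vec (Term w) n) → codeTs (subTs σ ts) ≡ codeTs ts
codeTs-sub k [] = refl
codeTs-sub k (t ∷ ts) = cong₂ (λ a b → suc (pair a b)) (codeT-sub k t) (codeTs-sub k ts)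

codeF-sub : ∀ {rels v w} {σ : Fin w → Term v} → Keeps σ → ∀ (φ : Formula rels w) → codeF (subF σ φ) ≡ codeF φ
codeF-sub k (eq s t) = cong₂ (λ a b → pair 0 (pair a b)) (codeT-sub k s) (codeT-sub k t)
codeF-sub k (rel i ts) = cong (λ a → pair 1 (pair (toℕ i) a)) (codeTs-sub k ts)
codeF-sub k (neg φ) = cong (pair 2) (codeF-sub k φ)
codeF-sub k (conj φ ψ) = cong₂ (λ a b → pair 3 (pair a b)) (codeF-sub k φ) (codeF-sub k ψ)
codeF-sub k (ex φ) = cong (pair 4) (codeF-sub (keeps-lift k) φ)

pad : ∀ w v → Fin w → Term (w + v)
pad w v i = var (i Fin.↑ˡ v)

keeps-pad : ∀ w v → Keeps (pad w v)
keeps-pad w v i = i Fin.↑ˡ v , refl , Fin.toℕ-↑ˡ i v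

Start Step : ∀ {v} → ℕ → Vec ℕ v → Set
Start {suc (suc v)} K ρ = Power K (lookup ρ v1) × lookup ρ v0 ≡ lookup ρ v1
Start K ρ = ⊥
Step {suc (suc (suc (suc v)))} K ρ = lookup ρ v1 ≡ lookup ρ v3 × K * lookup ρ v0 ≡ lookup ρ v2
Step K ρ = ⊥

-- The formulas are module parameters so that their (astronomical) codes are
-- never evaluated.
module Diagonal (rels : List ℕ) (I : Interp rels) (K : ℕ)
  (def-Start : Definability.Def rels I {v = 2} (Start K)) (def-Step : Definability.Def rels I {v = 4} (Step K))
  (A : Code 1 → ℕ → ℕ → Set) (def-A : ∀ f → Definability.Def rels I {v = 2} (λ ρ → A f (lookup ρ v0) (lookup ρ v1)))
  (sound-A : ∀ f e → (∃ λ t → Power K t × ∃ λ u → u * K ^ e ≡ t × A f u t) → DN (Eval f (e ∷ []) 0))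
  (complete-A : ∀ f e → Eval f (e ∷ []) 0 → DN (∃ λ t → Power K t × ∃ λ u → u * K ^ e ≡ t × A f u t)) where

  open Definability rels I

  step-code start-code : ℕ
  step-code = codeF (formula def-Step)
  start-code = codeF (formula def-Start)

  -- In the context u , t: the number represented by u relative to t, after i
  -- further divisions by K, is accepted by f.
  Descend : Code 1 → ℕ → ℕ → ℕ → Set
  Descend f zero u t = A f u t
  Descend f (suc i) u t = ∃ λ t' → ∃ λ u' → (t' ≡ t × K * u' ≡ u) × Descend f i u' t'

  -- The numeral i is built in as i nested blocks, each dividing by K, instead of being substituted.
  -- The code is thus an iterate of `block`, and the diagonal function requires no arithmetized
  -- substitution.
  descend-formula : Code 1 → ℕ → ∀ v → Formula rels (2 + v)
  descend-formula f zero v = subF (pad 2 v) (formula (def-A f))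
  descend-formula f (suc i) v = ex (ex (conj (subF (pad 4 v) (formula def-Step)) (descend-formula f i (2 + v))))

  pad₂ : ∀ {v} u t (ρ : Vec ℕ v) → Matches (pad 2 v) (u ∷ t ∷ ρ) (u ∷ t ∷ [])
  pad₂ u t ρ fz = refl
  pad₂ u t ρ (fs fz) = refl

  pad₄ : ∀ {v} a b c d (ρ : Vec ℕ v) → Matches (pad 4 v) (a ∷ b ∷ c ∷ d ∷ ρ) (a ∷ b ∷ c ∷ d ∷ [])
  pad₄ a b c d ρ fz = refl
  pad₄ a b c d ρ (fs fz) = refl
  pad₄ a b c d ρ (fs (fs fz)) = refl
  pad₄ a b c d ρ (fs (fs (fs fz))) = refl

  sat-pad₂ : ∀ {v} (φ : Formula rels 2) u t (ρ : Vec ℕ v) →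
    (Sat {rels} I (u ∷ t ∷ ρ) (subF (pad 2 v) φ) → Sat {rels} I (u ∷ t ∷ []) φ) × (Sat {rels} I (u ∷ t ∷ []) φ → Sat {rels} I (u ∷ t ∷ ρ) (subF (pad 2 v) φ))
  sat-pad₂ {v} φ u t ρ = Sat-sub {I = I} (pad 2 v) {u ∷ t ∷ ρ} {u ∷ t ∷ []} (pad₂ u t ρ) φ

  sat-pad₄ : ∀ {v} (φ : Formula rels 4) a b c d (ρ : Vec ℕ v) →
    (Sat {rels} I (a ∷ b ∷ c ∷ d ∷ ρ) (subF (pad 4 v) φ) → Sat {rels} I (a ∷ b ∷ c ∷ d ∷ []) φ) ×
    (Sat {rels} I (a ∷ b ∷ c ∷ d ∷ []) φ → Sat {rels} I (a ∷ b ∷ c ∷ d ∷ ρ) (subF (pad 4 v) φ))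
  sat-pad₄ {v} φ a b c d ρ = Sat-sub {I = I} (pad 4 v) {a ∷ b ∷ c ∷ d ∷ ρ} {a ∷ b ∷ c ∷ d ∷ []} (pad₄ a b c d ρ) φ

  descend-sat : ∀ f i {v} u t (ρ : Vec ℕ v) → Iff (Sat {rels} I (u ∷ t ∷ ρ) (descend-formula f i v)) (Descend f i u t)
  descend-sat f zero {v} u t ρ =
    (λ s → sound (def-A f) (u ∷ t ∷ []) (proj₁ (sat-pad₂ (formula (def-A f)) u t ρ) s)) ,
    λ h → dn-map (proj₂ (sat-pad₂ (formula (def-A f)) u t ρ)) (complete (def-A f) (u ∷ t ∷ []) h)
  descend-sat f (suc i) {v} u t ρ =
    (λ (t' , u' , s , d) → do
      st ← sound def-Step (u' ∷ t' ∷ u ∷ t ∷ []) (proj₁ (sat-pad₄ (formula def-Step) u' t' u t ρ) s)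
      d' ← proj₁ (descend-sat f i u' t' (u ∷ t ∷ ρ)) d
      ret (t' , u' , st , d')) ,
    λ (t' , u' , st , d) → do
      s ← complete def-Step (u' ∷ t' ∷ u ∷ t ∷ []) st
      d' ← proj₂ (descend-sat f i u' t' (u ∷ t ∷ ρ)) d
      ret (t' , u' , proj₂ (sat-pad₄ (formula def-Step) u' t' u t ρ) s , d')

  accept-code : Code 1 → ℕ
  accept-code f = codeF (formula (def-A f))

  descend-code : ∀ f i v → codeF (descend-formula f i v) ≡ blocks step-code i (accept-code f)
  descend-code f zero v = codeF-sub (keeps-pad 2 v) (formula (def-A f))
  descend-code f (suc i) v = code-block (subF (pad 4 v) (formula def-Step)) (descend-formula f i (2 + v))
    (codeF-sub (keeps-pad 4 v) (formula def-Step)) (descend-code f i (2 + v))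

  descend-to : ∀ f i u t → Descend f i u t → ∃ λ w → w * K ^ i ≡ u × A f w t
  descend-to f zero u t h = u , *-identityʳ u , h
  descend-to f (suc i) u t (.t , u' , (refl , e) , d) = let (w , e' , h) = descend-to f i u' t d in
    w , trans (swap w K (K ^ i)) (trans (cong (K *_) e') e) , h
    where
      swap : ∀ a b c → a * (b * c) ≡ b * (a * c)
      swap = solve-∀

  descend-from : ∀ f i w t → A f w t → Descend f i (w * K ^ i) t
  descend-from f zero w t h = subst (λ w → A f w t) (sym (*-identityʳ w)) h
  descend-from f (suc i) w t h = t , w * K ^ i , (refl , swap w K (K ^ i)) , descend-from f i w t h
    where
      swap : ∀ a b c → b * (a * c) ≡ a * (b * c)
      swap = solve-∀

  sentence : Code 1 → ℕ → Sentence rels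
  sentence f e = ex (ex (conj (formula def-Start) (descend-formula f e 0)))

  sentence-accepts : ∀ f e → Iff (Sat {rels} I [] (sentence f e)) (∃ λ t → Power K t × ∃ λ u → u * K ^ e ≡ t × A f u t)
  sentence-accepts f e =
    (λ (t , u , s , d) → do
      (pt , u≡t) ← sound def-Start (u ∷ t ∷ []) s
      d' ← proj₁ (descend-sat f e u t []) d
      let (w , e' , h) = descend-to f e u t d'
      ret (t , pt , w , trans e' u≡t , h)) ,
    λ (t , pt , w , e' , h) → do
      s ← complete def-Start (t ∷ t ∷ []) (pt , refl)
      d ← proj₂ (descend-sat f e t t []) (subst (λ u → Descend f e u t) e' (descend-from f e w t h))
      ret (t , t , s , d)

  -- Sends the code of an acceptance formula to the code of the sentence that applies this formula
  -- to its own code.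
  diagonal-code : Code 1
  diagonal-code = block-code start-code (comp₂ (blocks-code step-code) (proj fz) (proj fz))

  diagonal-computes : ∀ e → Eval diagonal-code (e ∷ []) (block start-code (blocks step-code e e))
  diagonal-computes e = block-computes start-code {comp₂ (blocks-code step-code) (proj fz) (proj fz)}
    {λ xs → blocks step-code (head xs) (head xs)} (λ { (x ∷ []) → e-comp (ea-cons e-proj (ea-cons e-proj ea-nil)) (blocks-computes step-code (x ∷ x ∷ [])) }) (e ∷ [])

  -- The sentence of f at its own code says that the decision procedure
  -- answers 0 on that very sentence.
  undecidable : ¬ TheoryDecidable {rels} I
  undecidable (c , decides) = (do
      no ¬sat ← em (Sat {rels} I [] D) where
        yes sat → do
          acc ← proj₁ (sentence-accepts f e) sat
          ev ← sound-A f e acc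
          ⊥-elim (1+n≢0 (eval-unique c (proj₁ (decides (codeF D)) (D , refl , sat)) (answer ev)))
      acc ← complete-A f e (ask (proj₂ (decides (codeF D)) λ { (φ , e' , sat) → ¬sat (subst (Sat {rels} I []) (codeF-injective φ D e') sat) }))
      sat ← proj₂ (sentence-accepts f e) acc
      ret (¬sat sat)) id
    where
      f : Code 1
      f = comp₁ c diagonal-code
      e : ℕ
      e = accept-code f
      D : Sentence rels
      D = sentence f e
      code-D : block start-code (blocks step-code e e) ≡ codeF D
      code-D = sym (code-block (formula def-Start) (descend-formula f e 0) refl (descend-code f e 0))
      ask : Eval c (codeF D ∷ []) 0 → Eval f (e ∷ []) 0
      ask ev = e-comp (ea-cons (subst (Eval diagonal-code (e ∷ [])) code-D (diagonal-computes e)) ea-nil) ev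
      answer : Eval f (e ∷ []) 0 → Eval c (codeF D ∷ []) 0
      answer (e-comp (ea-cons d ea-nil) ev) = subst (λ y → Eval c (y ∷ []) 0)
        (eval-unique diagonal-code d (subst (Eval diagonal-code (e ∷ [])) code-D (diagonal-computes e))) ev

-- The criterion for Presburger definability

-- The equation α · x = β · x + c, with a pair (f , g) standing for the integer
-- vector f − g.
record Con (m : ℕ) : Set where
  constructor con
  field
    α β : Vec ℕ m
    c : ℕ
    f g : Vec ℕ m
open Con

Sol : Con m → Vec ℕ m → Set
Sol e x = dot (α e) x ≡ dot (β e) x + c e

-- The linear form α - β vanishes on f - g, stated without subtraction.
Zero : Con m → Vec ℕ m → Vec ℕ m → Set
Zero e f g = dot (α e) f + dot (β e) g ≡ dot (β e) f + dot (α e) g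

Flat : List (Con m) → Vec ℕ m → Set
Flat cs x = ∀ e → e ∈ cs → Sol e x

-- The equations are independent, witnessed by directions: that of an equation lies in the linear
-- part of all older equations but not in its own.
TriangularCons : List (Con m) → Set
TriangularCons [] = ⊤
TriangularCons (e ∷ cs) = ¬ Zero e (f e) (g e) × (∀ e' → e' ∈ cs → Zero e' (f e) (g e)) × TriangularCons cs

diff : Vec ℕ m → Vec ℕ m → Vec ℤ m
diff = Vec.zipWith λ a b → ℤ.+ a ℤ.- ℤ.+ b

diff-· : ∀ (α β f g : Vec ℕ m) →
  diff α β · diff f g ≡ ℤ.+ (dot α f + dot β g) ℤ.- ℤ.+ (dot β f + dot α g)
diff-· [] [] [] [] = refl
diff-· (a ∷ α) (b ∷ β) (x ∷ f) (y ∷ g) = trans (cong (λ z → (ℤ.+ a ℤ.- ℤ.+ b) ℤ.* (ℤ.+ x ℤ.- ℤ.+ y) ℤ.+ z)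
    (trans (diff-· α β f g) (cong₂ ℤ._-_ (ℤ.pos-+ (dot α f) _) (ℤ.pos-+ (dot β f) _))))
  (trans (expand (ℤ.+ a) (ℤ.+ b) (ℤ.+ x) (ℤ.+ y) (ℤ.+ dot α f) (ℤ.+ dot β g) (ℤ.+ dot β f) (ℤ.+ dot α g))
    (sym (cong₂ ℤ._-_ (pos a x b y (dot α f) (dot β g)) (pos b x a y (dot β f) (dot α g)))))
  where
    pos : ∀ a x b y p q → ℤ.+ (a * x + p + (b * y + q)) ≡ ℤ.+ a ℤ.* ℤ.+ x ℤ.+ ℤ.+ p ℤ.+ (ℤ.+ b ℤ.* ℤ.+ y ℤ.+ ℤ.+ q)
    pos a x b y p q = trans (ℤ.pos-+ (a * x + p) _) (cong₂ ℤ._+_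
      (trans (ℤ.pos-+ (a * x) p) (cong (λ z → z ℤ.+ ℤ.+ p) (ℤ.pos-* a x)))
      (trans (ℤ.pos-+ (b * y) q) (cong (λ z → z ℤ.+ ℤ.+ q) (ℤ.pos-* b y))))
    expand : ∀ a b x y p q r s → (a ℤ.- b) ℤ.* (x ℤ.- y) ℤ.+ (p ℤ.+ q ℤ.- (r ℤ.+ s)) ≡
      a ℤ.* x ℤ.+ p ℤ.+ (b ℤ.* y ℤ.+ q) ℤ.- (b ℤ.* x ℤ.+ r ℤ.+ (a ℤ.* y ℤ.+ s))
    expand = ℤ-Ring.solve-∀

triangular-cons-length : ∀ (cs : List (Con m)) → TriangularCons cs → List.length cs ≤ m
triangular-cons-length {m} cs t = subst (_≤ m) (List.length-map toℤ cs) (triangular-length m (List.map toℤ cs) (convert cs t))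
  where
    toℤ : Con m → Vec ℤ m × Vec ℤ m
    toℤ e = diff (α e) (β e) , diff (f e) (g e)
    kills : ∀ cs f g → (∀ e' → e' ∈ cs → Zero e' f g) → Kills (List.map toℤ cs) (diff f g)
    kills [] f g z = tt
    kills (e ∷ cs) f g z = trans (diff-· (α e) (β e) f g) (ℤ.i≡j⇒i-j≡0 (cong ℤ.+_ (z e (here refl)))) ,
      kills cs f g λ e' e'∈ → z e' (there e'∈)
    convert : ∀ cs → TriangularCons cs → Triangular (List.map toℤ cs)
    convert [] _ = tt
    convert (e ∷ cs) (nz , z , t) =
      (λ p → nz (ℤ.+-injective (ℤ.i-j≡0⇒i≡j _ _ (trans (sym (diff-· (α e) (β e) (f e) (g e))) p)))) ,
      kills cs (f e) (g e) z , convert cs t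

-- Bounds |α · n - β · n| when the cell of side 3 q at n meets the hyperplane: the remainder w
-- contributes at most 3 q times the coefficient sums, and c at most c q.
reach : Con m → ℕ
reach e = 3 * dot (α e) ones + 3 * dot (β e) ones + c e

level : Con m → ℕ → Vec ℕ m → Set
level e i n = dot (α e) n + i ≡ dot (β e) n + reach e

levels : List (Con m) → List (Vec ℕ m → Set)
levels [] = []
levels (e ∷ cs) = List.map (level e) (List.upTo (suc (2 * reach e))) List.++ levels cs

Near : Con m → Vec ℕ m → Set
Near e n = ∃ λ i → i < suc (2 * reach e) × level e i n

mu₁ : ∀ an bn an' bn' i C → an + i ≡ bn + C → an' + i ≡ bn' + C → an' + bn ≡ bn' + an
mu₁ an bn an' bn' i C h0 h1 =
  ≤-antisym (lin₀ 0 (≤-reflexive (sym h0) ⊕ ≤-reflexive h1)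
    (S.solve 6 (λ an bn an' bn' i C → bn' :+ an :+ (bn :+ C :+ (an' :+ i)) :=
      an' :+ bn :+ (an :+ i :+ (bn' :+ C) :+ # 0)) refl an bn an' bn' i C))
  (lin₀ 0 (≤-reflexive h0 ⊕ ≤-reflexive (sym h1))
    (S.solve 6 (λ an bn an' bn' i C → an' :+ bn :+ (an :+ i :+ (bn' :+ C)) :=
      bn' :+ an :+ (bn :+ C :+ (an' :+ i) :+ # 0)) refl an bn an' bn' i C))

mu₂ : ∀ q an aw bn bw c S S' → q * an + aw ≡ q * bn + bw + c → bw ≤ 3 * q * S → 1 ≤ q → q * an ≤ q * (bn + (3 * S' + 3 * S + c))
mu₂ q an aw bn bw c S S' h0 h1 h2 =
  lin₀ (3 * S' * q + aw) (≤-reflexive h0 ⊕ h1 ⊕ scale c h2)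
    (S.solve 8 (λ q an aw bn bw c S S' → q :* (bn :+ (# 3 :* S' :+ # 3 :* S :+ c)) :+ (q :* an :+ aw :+ bw :+ c :* # 1) :=
      q :* an :+ (q :* bn :+ bw :+ c :+ # 3 :* q :* S :+ c :* q :+ (# 3 :* S' :* q :+ aw))) refl q an aw bn bw c S S')

mu₃ : ∀ q an aw bn bw c S S' → q * an + aw ≡ q * bn + bw + c → aw ≤ 3 * q * S' → 1 ≤ q → q * bn ≤ q * (an + (3 * S' + 3 * S + c))
mu₃ q an aw bn bw c S S' h0 h1 h2 =
  lin₀ (3 * S * q + c * q + bw + c) (≤-reflexive (sym h0) ⊕ h1)
    (S.solve 8 (λ q an aw bn bw c S S' → q :* (an :+ (# 3 :* S' :+ # 3 :* S :+ c)) :+ (q :* bn :+ bw :+ c :+ aw) :=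
      q :* bn :+ (q :* an :+ aw :+ # 3 :* q :* S' :+ (# 3 :* S :* q :+ c :* q :+ bw :+ c))) refl q an aw bn bw c S S')

mu₄ : ∀ an bn i C → an + i ≡ bn + C → bn ≤ an + C → i < suc (2 * C)
mu₄ an bn i C h0 h1 =
  lin₀ 0 (≤-reflexive h0 ⊕ h1)
    (S.solve 4 (λ an bn i C → (# 1 :+ (# 2 :* C)) :+ (an :+ i :+ bn) :=
      # 1 :+ i :+ (bn :+ C :+ (an :+ C) :+ # 0)) refl an bn i C)

mu₅ : ∀ af bg bf ag p → af + bg ≡ bf + ag → p * af + p * bg ≡ p * bf + p * ag
mu₅ af bg bf ag p h0 =
  ≤-antisym (lin₀ 0 (scale p (≤-reflexive h0))
    (S.solve 5 (λ af bg bf ag p → p :* bf :+ p :* ag :+ p :* (af :+ bg) :=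
      p :* af :+ p :* bg :+ (p :* (bf :+ ag) :+ # 0)) refl af bg bf ag p))
  (lin₀ 0 (scale p (≤-reflexive (sym h0)))
    (S.solve 5 (λ af bg bf ag p → p :* af :+ p :* bg :+ p :* (bf :+ ag) :=
      p :* bf :+ p :* ag :+ (p :* (af :+ bg) :+ # 0)) refl af bg bf ag p))

mu₆ : ∀ x q e → suc e * q ≤ x → q * e ≤ x
mu₆ x q e h0 =
  lin₀ q h0
    (S.solve 3 (λ x q e → x :+ (# 1 :+ e) :* q :=
      q :* e :+ (x :+ q)) refl x q e)

mu₇ : ∀ x q e w → q * e + w ≡ x → x < suc e * q + q → w < 3 * q
mu₇ x q e w h0 h1 =
  lin₀ q (≤-reflexive h0 ⊕ h1)
    (S.solve 4 (λ x q e w → # 3 :* q :+ (q :* e :+ w :+ (# 1 :+ x)) :=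
      # 1 :+ w :+ (x :+ ((# 1 :+ e) :* q :+ q) :+ q)) refl x q e w)

mu₉ : ∀ l u xi xj q → l * q ≤ xi → xj < u * q → l * xj ≤ u * xi
mu₉ l u xi xj q h0 h1 =
  lin₀ l (scale u h0 ⊕ scale l h1)
    (S.solve 5 (λ l u xi xj q → u :* xi :+ (u :* (l :* q) :+ l :* (# 1 :+ xj)) :=
      l :* xj :+ (u :* xi :+ l :* (u :* q) :+ l)) refl l u xi xj q)

mu₁₀ : ∀ q A n x → q * (2 + A) ≤ x → x < (2 + n) * q → (2 + A) * q < (2 + n) * q
mu₁₀ q A n x h0 h1 =
  lin₀ 0 (h0 ⊕ h1)
    (S.solve 4 (λ q A n x → (# 2 :+ n) :* q :+ (q :* (# 2 :+ A) :+ (# 1 :+ x)) :=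
      # 1 :+ (# 2 :+ A) :* q :+ (x :+ (# 2 :+ n) :* q :+ # 0)) refl q A n x)

mu₁₁ : ∀ q n w x M B → q * n + w ≡ x → x ≤ M → M < q * B → q * n < q * B
mu₁₁ q n w x M B h0 h1 h2 =
  lin₀ w (≤-reflexive h0 ⊕ h1 ⊕ h2)
    (S.solve 6 (λ q n w x M B → q :* B :+ (q :* n :+ w :+ x :+ (# 1 :+ M)) :=
      # 1 :+ q :* n :+ (x :+ M :+ q :* B :+ w)) refl q n w x M B)

mu₁₂ : ∀ x q w n → q * n + w ≡ x → x < q → w < 3 * q
mu₁₂ x q w n h0 h1 =
  lin₀ (n * q + 2 * q) (≤-reflexive h0 ⊕ h1)
    (S.solve 4 (λ x q w n → # 3 :* q :+ (q :* n :+ w :+ (# 1 :+ x)) :=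
      # 1 :+ w :+ (x :+ q :+ (n :* q :+ # 2 :* q))) refl x q w n)

near-cell : ∀ (e : Con m) q n w → 1 ≤ q → w ≪ 3 * q → Sol e (q ⊠ n ⊞ w) → Near e n
near-cell e q@(suc _) n w q≥1 w< sol = i , mu₄ (dot (α e) n) (dot (β e) n) i (reach e) lev b≤ , lev
  where
    sol' : q * dot (α e) n + dot (α e) w ≡ q * dot (β e) n + dot (β e) w + c e
    sol' = trans (sym (dot-blk (α e) q n w)) (trans sol (cong (_+ c e) (dot-blk (β e) q n w)))
    a≤ : dot (α e) n ≤ dot (β e) n + reach e
    a≤ = *-cancelˡ-≤ q (mu₂ q (dot (α e) n) (dot (α e) w) (dot (β e) n) (dot (β e) w) (c e) (dot (β e) ones) (dot (α e) ones)
      sol' (dot-bound (β e) w λ i → <⇒≤ (w< i)) q≥1)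
    b≤ : dot (β e) n ≤ dot (α e) n + reach e
    b≤ = *-cancelˡ-≤ q (mu₃ q (dot (α e) n) (dot (α e) w) (dot (β e) n) (dot (β e) w) (c e) (dot (β e) ones) (dot (α e) ones)
      sol' (dot-bound (α e) w λ i → <⇒≤ (w< i)) q≥1)
    i = dot (β e) n + reach e ∸ dot (α e) n
    lev : level e i n
    lev = m+[n∸m]≡n a≤

-- Near the flat, the value of α - β at n is one of finitely many levels. Agreement gives n' the
-- same level, so the direction n' - n is parallel to the flat.
near-zero : ∀ (cs : List (Con m)) {n n'} → agree (levels cs) n n' → (∀ e → e ∈ cs → Near e n) →
  ∀ e → e ∈ cs → Zero e n' n
near-zero (e ∷ cs) {n} {n'} ag near .e (here refl) with near e (here refl)
... | i , i< , lev = decidable-stable (_ ≟ _) do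
  lev' ← proj₁ (agree-∈ (Mem.∈-map⁺ (level e) (Mem.∈-upTo⁺ i<)) (proj₁ (agree-++ (List.map (level e) _) (levels cs) ag))) lev
  ret (mu₁ (dot (α e) n) (dot (β e) n) (dot (α e) n') (dot (β e) n') i (reach e) lev lev')
near-zero (e ∷ cs) ag near e' (there e'∈) =
  near-zero cs (proj₂ (agree-++ (List.map (level e) _) (levels cs) ag)) (λ e e∈ → near e (there e∈)) e' e'∈

cell-coordinate : ∀ q x → 1 ≤ q → ∃ λ n → ∃ λ w → q * n + w ≡ x × w < 3 * q × lo n * q ≤ x × x < hi n * q
cell-coordinate q x q≥1 with div-floor x q q≥1
... | zero , a , b = 0 , x , cong (_+ x) (*-zeroʳ q) , mu₁₂ x q x 0 (cong (_+ x) (*-zeroʳ q)) b , z≤n , ≤-trans b (m≤m+n q _)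
... | suc e , a , b = e , x ∸ q * e , w≡ , mu₇ x q e (x ∸ q * e) w≡ b , ≤-trans (*-monoˡ-≤ q (lo≤ e)) a , subst (x <_) (cc q e) b
  where
    w≡ : q * e + (x ∸ q * e) ≡ x
    w≡ = m+[n∸m]≡n (mu₆ x q e a)
    lo≤ : ∀ e → lo e ≤ suc e
    lo≤ zero = z≤n
    lo≤ (suc e) = ≤-refl
    cc : ∀ q e → suc e * q + q ≡ (2 + e) * q
    cc = solve-∀

mm₄ : ∀ a af b bf ag bg c → b + c ≤ a → a + af + bg < b + bf + ag + c → af + bg < bf + ag
mm₄ a af b bf ag bg c h0 h1 =
  lin₀ 0 (h0 ⊕ h1)
    (S.solve 7 (λ a af b bf ag bg c → bf :+ ag :+ (b :+ c :+ (# 1 :+ a :+ af :+ bg)) :=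
      # 1 :+ af :+ bg :+ (a :+ (b :+ bf :+ ag :+ c) :+ # 0)) refl a af b bf ag bg c)

module Presburger-criterion (k : ℕ) (k≥2 : k ≥ 2) (X : Vec ℕ m → Set) (reg : Regular k X)
  (tame : Periodicity.Tame (m ∷ []) (interp₁ X)) where

  open Cell k k≥2 X reg
  open Regular reg
  open Definability [] noRels
  open Ineq
  open Con

  Presburger-on : List (Con m) → Set
  Presburger-on cs = Def (λ x → X x × Flat cs x)

  VecFun : ∀ {v} → (Vec ℕ v → Vec ℕ m) → Set
  VecFun ζ = ∀ i → DefFun (λ ρ → lookup (ζ ρ) i)

  fun-sel : ∀ {v} (ι : Fin m → Fin v) → VecFun (λ ρ → sel ρ ι)
  fun-sel ι i = fun-map (λ ρ → sym (lookup-sel ρ ι i)) (fun-var (ι i))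

  fun-dot : ∀ {v m} (α : Vec ℕ m) {ζ : Vec ℕ v → Vec ℕ m} → (∀ i → DefFun (λ ρ → lookup (ζ ρ) i)) →
    DefFun (λ ρ → dot α (ζ ρ))
  fun-dot [] {ζ} d = fun-map (λ ρ → nil (ζ ρ)) fun-zero
    where
      nil : (z : Vec ℕ 0) → 0 ≡ dot [] z
      nil [] = refl
  fun-dot (a ∷ α) {ζ} d = fun-map (λ ρ → step (ζ ρ))
    (fun-+ (fun-scale a (d fz)) (fun-dot α {λ ρ → tail (ζ ρ)} λ i → fun-map (λ ρ → lookup-tail (ζ ρ) i) (d (fs i))))
    where
      step : ∀ z → a * lookup z fz + dot α (tail z) ≡ dot (a ∷ α) z
      step (x ∷ z) = refl
      lookup-tail : ∀ {n} (z : Vec ℕ (suc n)) i → lookup z (fs i) ≡ lookup (tail z) i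
      lookup-tail (x ∷ z) i = refl

  def-In : ∀ {v} Γ {ζ : Vec ℕ v → Vec ℕ m} → VecFun ζ → Def (λ ρ → In Γ (ζ ρ))
  def-In Γ d = def-every Γ λ q _ → def-≤ (fun-+ (fun-dot (small q) d) (fun-const (gap q))) (fun-dot (big q) d)

  def-Flat : ∀ {v} cs {ζ : Vec ℕ v → Vec ℕ m} → VecFun ζ → Def (λ ρ → Flat cs (ζ ρ))
  def-Flat cs d = def-every cs λ e _ → def-≡ (fun-dot (α e) d) (fun-+ (fun-dot (β e) d) (fun-const (c e)))

  fun-id : VecFun (λ ρ → ρ)
  fun-id i = fun-var i

  def-dec : ∀ {v} {A : Set} → Dec A → Def {v = v} (λ _ → A)
  def-dec (yes a) = def-map (λ ρ → (λ _ → ret a) , λ _ → ret tt) def-⊤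
  def-dec (no na) = def-map (λ ρ → (λ ()) , λ a → ⊥-elim (na a)) def-⊥

  -- Translation by p (n' - n) keeps the flat and lowers coordinate i₀, so every point of the cone
  -- eventually reaches an exit. The last point inside lies on one of finitely many hyperplanes
  -- transverse to the direction, hence on a flat of smaller dimension, where membership in `X` is
  -- Presburger definable by induction.
  module Piece (cs : List (Con m)) {n : Vec ℕ m} (P : Partner n)
    (zero-cs : ∀ e → e ∈ cs → Zero e (Partner.n' P) n) (i₀ : Fin m) (n'<n : lookup (Partner.n' P) i₀ < lookup n i₀)
    (T : ℕ) (T≥ : threshold P ≤ T) where
    open Partner P
    open Invariance P

    private
      f₀ g₀ : Vec ℕ m
      f₀ = p ⊠ n'
      g₀ = p ⊠ n
      Γ : List (Ineq m)
      Γ = cone n T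

    f<g : lookup f₀ i₀ < lookup g₀ i₀
    f<g = subst₂ _<_ (sym (lookup-⊠ p n' i₀)) (sym (lookup-⊠ p n i₀)) (mul< p p≥1)
      where
        mul< : ∀ p → 1 ≤ p → p * lookup n' i₀ < p * lookup n i₀
        mul< (suc p) _ = *-monoʳ-< (suc p) n'<n

    open Sliding X Γ (coordinate∈cone n T) f₀ g₀ i₀ f<g
      (λ z z' hz hz' sh → Iff-sym (invariant T≥ z' z hz' λ i →
        sym (subst₂ (λ a b → lookup z' i + a ≡ lookup z i + b) (lookup-⊠ p n i) (lookup-⊠ p n' i) (sh i))))

    zero-fg : ∀ e → e ∈ cs → Zero e f₀ g₀
    zero-fg e e∈ = subst₂ _≡_ (cong₂ _+_ (sym (dot-⊠ (α e) p n')) (sym (dot-⊠ (β e) p n)))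
      (cong₂ _+_ (sym (dot-⊠ (β e) p n')) (sym (dot-⊠ (α e) p n)))
      (mu₅ (dot (α e) n') (dot (β e) n) (dot (β e) n') (dot (α e) n) p (zero-cs e e∈))

    layer : Ineq m → ℕ → Con m
    layer q i = con (big q) (small q) (gap q + i) f₀ g₀

    width : Ineq m → ℕ
    width q = dot (small q) f₀ + dot (big q) g₀

    Layer : Ineq m → ℕ → Vec ℕ m → Set
    Layer q i z = ¬ Zero (layer q i) f₀ g₀ × X z × Flat (layer q i ∷ cs) z

    Body : Vec ℕ m → ℕ → Vec ℕ m → Set
    Body z j z' = Shift j z z' × In Γ z' × ∃ λ q → q ∈ Γ × ∃ λ i → i ∈ List.upTo (width q) × Layer q i z'

    flat-shift : ∀ j z z' → Shift j z z' → Flat cs z → Flat cs z'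
    flat-shift j z z' sh h e e∈ = sl₁₀ (dot (α e) z) (dot (α e) f₀) (dot (α e) z') (dot (α e) g₀) (dot (β e) z) (dot (β e) f₀)
      (dot (β e) z') (dot (β e) g₀) (c e) j (dot-shift (α e) {z} {z'} {f₀} {g₀} j sh) (dot-shift (β e) {z} {z'} {f₀} {g₀} j sh) (h e e∈) (zero-fg e e∈)

    to-body : ∀ z → X z → Flat cs z → In Γ z → DN (∃ λ j → ∃ λ z' → Body z j z')
    to-body z x h hz with slide (suc (lookup z i₀)) z ≤-refl hz
    ... | j , z' , sh , hz' , e , q , q∈ , nst = do
      x' ← proj₁ e x
      ret (j , z' , sh , hz' , q , q∈ , i , Mem.∈-upTo⁺ i< , nz , x' , λ where
        .(layer q i) (here refl) → sol
        e' (there e'∈) → flat-shift j z z' sh h e' e'∈)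
      where
        viol : dot (big q) z' + dot (big q) f₀ + dot (small q) g₀ < dot (small q) z' + dot (small q) f₀ + dot (big q) g₀ + gap q
        viol = ≰⇒> nst
        i = dot (big q) z' ∸ (dot (small q) z' + gap q)
        i≡ : dot (small q) z' + gap q + i ≡ dot (big q) z'
        i≡ = m+[n∸m]≡n (hz' q q∈)
        i< : i < width q
        i< = sl₈ (dot (big q) z') (dot (big q) f₀) (dot (small q) z') (dot (small q) f₀) (dot (big q) g₀) (dot (small q) g₀) (gap q) i viol i≡
        nz : ¬ Zero (layer q i) f₀ g₀
        nz z = <-irrefl z (mm₄ (dot (big q) z') (dot (big q) f₀) (dot (small q) z') (dot (small q) f₀) (dot (big q) g₀) (dot (small q) g₀) (gap q) (hz' q q∈) viol)
        sol : dot (big q) z' ≡ dot (small q) z' + (gap q + i)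
        sol = trans (sym i≡) (+-assoc (dot (small q) z') (gap q) i)

    -- The point z' need not be the exit reached by `slide`: `connect` gives the equivalence for any
    -- translate inside the cone.
    from-body : ∀ z j z' → In Γ z → Body z j z' → DN (X z)
    from-body z j z' hz (sh , hz' , q , _ , i , _ , _ , x' , _) = proj₂ (connect j z z' hz hz' sh) x'

    def-layer : (∀ e → (∀ e' → e' ∈ cs → Zero e' (f e) (g e)) → ¬ Zero e (f e) (g e) → DN (Presburger-on (e ∷ cs))) →
      ∀ q i → DN (Def (Layer q i))
    def-layer ih q i with dot (big q) f₀ + dot (small q) g₀ ≟ dot (small q) f₀ + dot (big q) g₀
    ... | yes z = ret (def-map (λ ρ → (λ ()) , λ (nz , _) → ⊥-elim (nz z)) def-⊥)
    ... | no nz = do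
      d ← ih (layer q i) zero-fg nz
      ret (def-map (λ ρ → (λ r → ret (nz , r)) , λ (_ , r) → ret r) d)

    def-Body : (∀ q → q ∈ Γ → ∀ i → i ∈ List.upTo (width q) → Def (Layer q i)) →
      Def (λ z → ∃ λ j → ∃ λ z' → Body z j z')
    def-Body d = def-∃ (def-map conv (def-∃Vec m
      (def-∧ (def-∀Fin m λ i → def-≡ (fun-+ (fun-sel ι₁ i) (times-j (lookup g₀ i))) (fun-+ (fun-sel ι₃ i) (times-j (lookup f₀ i))))
      (def-∧ (def-In Γ {λ ρ → sel ρ ι₁} (fun-sel ι₁))
        (def-any Γ λ q q∈ → def-any (List.upTo (width q)) λ i i∈ →
          def-sub (d q q∈ i i∈) (λ i → var (ι₁ i)) (λ ρ → sel ρ ι₁) λ ρ i → sym (lookup-sel ρ ι₁ i))))))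
      where
        ι₁ ι₃ : Fin m → Fin (m + suc m)
        ι₁ = Fin._↑ˡ suc m
        ι₃ i = m Fin.↑ʳ fs i
        ι₂ : Fin (m + suc m)
        ι₂ = m Fin.↑ʳ fz
        times-j : ∀ a → DefFun (λ ρ → lookup ρ ι₂ * a)
        times-j a = fun-map (λ ρ → *-comm a (lookup ρ ι₂)) (fun-scale a (fun-var ι₂))
        body≡ : ∀ {z z₁ j j₁ w w₁} → z ≡ z₁ → j ≡ j₁ → w ≡ w₁ → Iff (Body z j w) (Body z₁ j₁ w₁)
        body≡ refl refl refl = Iff-refl
        conv : ∀ ρ → Iff (∃ λ w → Body (sel (w Vec.++ ρ) ι₃) (lookup (w Vec.++ ρ) ι₂) (sel (w Vec.++ ρ) ι₁))
          (∃ λ w → Body (tail ρ) (lookup ρ fz) w)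
        conv (j ∷ z) = (λ (w , b) → proj₁ (eqv w) b >>= λ b' → ret (w , b')) , λ (w , b) → proj₂ (eqv w) b >>= λ b' → ret (w , b')
          where
            eqv : ∀ w → Iff (Body (sel (w Vec.++ j ∷ z) ι₃) (lookup (w Vec.++ j ∷ z) ι₂) (sel (w Vec.++ j ∷ z) ι₁)) (Body z j w)
            eqv w = body≡ {z = sel (w Vec.++ j ∷ z) ι₃} {z₁ = z} (vec-ext λ i → trans (lookup-sel (w Vec.++ j ∷ z) ι₃ i) (Vec.lookup-++ʳ w (j ∷ z) (fs i)))
              (Vec.lookup-++ʳ w (j ∷ z) fz) (sel-↑ˡ w (j ∷ z))

    def-piece : (∀ e → (∀ e' → e' ∈ cs → Zero e' (f e) (g e)) → ¬ Zero e (f e) (g e) → DN (Presburger-on (e ∷ cs))) →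
      DN (Def (λ x → X x × Flat cs x × In Γ x))
    def-piece ih = do
      d ← dn-List Γ λ q q∈ → dn-List (List.upTo (width q)) λ i _ → def-layer ih q i
      ret (def-map (λ z → (λ (h , hz , j , z' , b) → from-body z j z' hz b >>= λ x → ret (x , h , hz)) ,
          λ (x , h , hz) → to-body z x h hz >>= λ b → ret (h , hz , b))
        (def-∧ (def-Flat cs {λ ρ → ρ} fun-id) (def-∧ (def-In Γ {λ ρ → ρ} fun-id) (def-Body d))))

  -- The three conditions under which a representative of n can serve as its partner: its cells of
  -- side 3 k ^ r look like those at n, it vanishes wherever n does, and the direction between them
  -- is parallel to the flat.
  classes : List (Con m) → List (Vec ℕ m → Set)
  classes cs = List.cartesianProductWith (λ ε p n → p (n ⊞ ε)) (allVecs m 3) preds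
    List.++ List.map (λ i n → lookup n i ≡ 0) (List.allFin m) List.++ levels cs

  classes-preds : ∀ cs {n n'} → agree (classes cs) n n' → ∀ ε → ε ≪ 3 → agree preds (n' ⊞ ε) (n ⊞ ε)
  classes-preds cs ag ε ε< = agree-sym preds (agree-intro preds λ p p∈ →
    agree-∈ (Mem.∈-cartesianProductWith⁺ (λ ε p n → p (n ⊞ ε)) (∈-allVecs ε ε<) p∈) (proj₁ (agree-++ _ _ ag)))

  classes-zero : ∀ cs {n n'} → agree (classes cs) n n' → ∀ i → lookup n i ≡ 0 → lookup n' i ≡ 0
  classes-zero cs ag i e = decidable-stable (_ ≟ _) (proj₁ (agree-∈ (Mem.∈-map⁺ (λ i n → lookup n i ≡ 0) (Mem.∈-allFin i))
    (proj₁ (agree-++ _ _ (proj₂ (agree-++ (List.cartesianProductWith (λ ε p n → p (n ⊞ ε)) (allVecs m 3) preds) _ ag))))) e)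

  classes-levels : ∀ cs {n n'} → agree (classes cs) n n' → agree (levels cs) n n'
  classes-levels cs ag = proj₂ (agree-++ (List.map (λ i n → lookup n i ≡ 0) (List.allFin m)) _
    (proj₂ (agree-++ (List.cartesianProductWith (λ ε p n → p (n ⊞ ε)) (allVecs m 3) preds) _ ag)))

  Good : List (Con m) → ℕ → Vec ℕ m → Set
  Good cs Bd n = (∃ λ i → Bd < lookup n i) × (∀ e → e ∈ cs → Near e n)

  record Cell-data (cs : List (Con m)) (n : Vec ℕ m) : Set where
    field
      partner-of : Partner n
      zero-of : ∀ e → e ∈ cs → Zero e (Partner.n' partner-of) n
      drop : Fin m
      drops : lookup (Partner.n' partner-of) drop < lookup n drop

  -- The partner is a representative; its coordinates are at most Bd, so coordinate i drops.
  cell-data : ∀ cs rs → (∀ n → DN (∃ λ r → r ∈ rs × agree (classes cs) n r)) →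
    ∀ Bd → (∀ r → r ∈ rs → ∀ i → lookup r i ≤ Bd) → ∀ n → Good cs Bd n → DN (Cell-data cs n)
  cell-data cs rs cover Bd bd n ((i , l) , near) = do
    (r , r∈ , ag) ← cover n
    (P , refl) ← partner tame n r (classes-preds cs ag) (classes-zero cs ag)
    ret (record { partner-of = P ; zero-of = near-zero cs (classes-levels cs ag) near ; drop = i
                ; drops = ≤-<-trans (bd (Partner.n' P) r∈ i) l })

  -- The scale q is the power of k for which the largest coordinate lies between q (2 + Bd) and q k
  -- (2 + Bd). The leading part is one less than the quotient there, so it still exceeds Bd, while
  -- all leading parts stay in a finite box.
  covering : ∀ cs Bd T x i → 2 + Bd ≤ T → T ≤ lookup x i → Flat cs x →
    ∃ λ n → n ∈ allVecs m (k * (2 + Bd)) × Good cs Bd n × In (cone n T) x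
  covering cs Bd T x i Bd≤T T≤x flat = n , ∈-allVecs n n< , ((j , big-j) , near) , in-cone {n = n}
      (≤-trans T≤x (lookup≤sum x i)) λ i j → subst₂ (λ a b → lo a * lookup x j ≤ hi b * lookup x i) (sym (n≡ i)) (sym (n≡ j))
        (mu₉ (lo (proj₁ (at i))) (hi (proj₁ (at j))) (lookup x i) (lookup x j) q
          (proj₁ (proj₂ (proj₂ (proj₂ (proj₂ (at i)))))) (proj₂ (proj₂ (proj₂ (proj₂ (proj₂ (at j)))))))
    where
      j = proj₁ (argmax x i)
      max : ∀ i → lookup x i ≤ lookup x j
      max = proj₂ (argmax x i)
      scaled : ∃ λ r → k ^ r * (2 + Bd) ≤ lookup x j × lookup x j < k ^ r * (k * (2 + Bd))
      scaled = power-scale k (2 + Bd) (lookup x j) k≥2 (s≤s z≤n) (≤-trans Bd≤T (≤-trans T≤x (max i)))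
      r = proj₁ scaled
      low : k ^ r * (2 + Bd) ≤ lookup x j
      low = proj₁ (proj₂ scaled)
      high : lookup x j < k ^ r * (k * (2 + Bd))
      high = proj₂ (proj₂ scaled)
      q = k ^ r
      q≥1 : 1 ≤ q
      q≥1 = 1≤^ k r (≤-trans (s≤s z≤n) k≥2)
      at : ∀ i → ∃ λ n → ∃ λ w → q * n + w ≡ lookup x i × w < 3 * q × lo n * q ≤ lookup x i × lookup x i < hi n * q
      at i = cell-coordinate q (lookup x i) q≥1
      n w : Vec ℕ m
      n = Vec.tabulate λ i → proj₁ (at i)
      w = Vec.tabulate λ i → proj₁ (proj₂ (at i))
      n≡ : ∀ i → lookup n i ≡ proj₁ (at i)
      n≡ i = Vec.lookup∘tabulate _ i
      w≡ : ∀ i → lookup w i ≡ proj₁ (proj₂ (at i))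
      w≡ i = Vec.lookup∘tabulate _ i
      x≡ : q ⊠ n ⊞ w ≡ x
      x≡ = vec-ext λ i → trans (lookup-blk q n w i) (trans (cong₂ (λ a b → q * a + b) (n≡ i) (w≡ i)) (proj₁ (proj₂ (proj₂ (at i)))))
      n< : n ≪ k * (2 + Bd)
      n< i = subst (_< k * (2 + Bd)) (sym (n≡ i)) (*-cancelˡ-< q _ _
        (mu₁₁ q (proj₁ (at i)) (proj₁ (proj₂ (at i))) (lookup x i) (lookup x j) (k * (2 + Bd)) (proj₁ (proj₂ (proj₂ (at i)))) (max i) high))
      big-j : Bd < lookup n j
      big-j = subst (Bd <_) (sym (n≡ j)) (+-cancelˡ-< 2 Bd _ (*-cancelʳ-< q _ _
        (mu₁₀ q Bd (proj₁ (at j)) (lookup x j) low (proj₂ (proj₂ (proj₂ (proj₂ (proj₂ (at j)))))))))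
      near : ∀ e → e ∈ cs → Near e n
      near e e∈ = near-cell e q n w q≥1 (λ i → subst (_< 3 * q) (sym (w≡ i)) (proj₁ (proj₂ (proj₂ (proj₂ (at i))))))
        (subst (Sol e) (sym x≡) (flat e e∈))

  bound-∃ : ∀ {A : Set} (xs : List A) {R : A → ℕ → Set} → (∀ x → x ∈ xs → ∃ (R x)) →
    ∃ λ B → ∀ x → x ∈ xs → ∃ λ t → t ≤ B × R x t
  bound-∃ [] h = 0 , λ _ ()
  bound-∃ (x ∷ xs) h = let (B , b) = bound-∃ xs (λ y y∈ → h y (there y∈)) ; (t , r) = h x (here refl) in
    t + B , λ { y (here refl) → t , m≤m+n t B , r ; y (there y∈) → let (s , l , r') = b y y∈ in s , ≤-trans l (m≤n+m B t) , r' }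

  decide-good : ∀ cs rs → (∀ n → DN (∃ λ r → r ∈ rs × agree (classes cs) n r)) →
    ∀ Bd → (∀ r → r ∈ rs → ∀ i → lookup r i ≤ Bd) → ∀ n →
    DN (∃ λ t → ¬ Good cs Bd n ⊎ ∃ λ (d : Cell-data cs n) → threshold (Cell-data.partner-of d) ≡ t)
  decide-good cs rs cover Bd bd n = do
    yes g ← em (Good cs Bd n) where
      no ng → ret (0 , inj₁ ng)
    d ← cell-data cs rs cover Bd bd n g
    ret (_ , inj₂ (d , refl))

  piece : ∀ cs Bd n T {t} → t ≤ T → ¬ Good cs Bd n ⊎ (∃ λ (d : Cell-data cs n) → threshold (Cell-data.partner-of d) ≡ t) →
    (∀ e → (∀ e' → e' ∈ cs → Zero e' (f e) (g e)) → ¬ Zero e (f e) (g e) → DN (Presburger-on (e ∷ cs))) →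
    DN (Def (λ x → Good cs Bd n × X x × Flat cs x × In (cone n T) x))
  piece cs Bd n T l (inj₁ ng) ih = ret (def-map (λ ρ → (λ ()) , λ (g , _) → ⊥-elim (ng g)) def-⊥)
  piece cs Bd n T l (inj₂ (d , refl)) ih = do
    g ← em (Good cs Bd n)
    r ← Piece.def-piece cs (Cell-data.partner-of d) (Cell-data.zero-of d) (Cell-data.drop d) (Cell-data.drops d) T l ih
    ret (def-∧ (def-dec g) r)

  Small : List (Con m) → ℕ → Vec ℕ m → Set
  Small cs T x = ∃ λ y → y ∈ allVecs m T × (∀ i → lookup x i ≡ lookup y i) × X y × Flat cs y

  Large : List (Con m) → ℕ → ℕ → Vec ℕ m → Set
  Large cs Bd T x = ∃ λ n → n ∈ allVecs m (k * (2 + Bd)) × Good cs Bd n × X x × Flat cs x × In (cone n T) x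

  from-small : ∀ cs T x → Small cs T x → X x × Flat cs x
  from-small cs T x (y , _ , x≡y , p) = subst (λ x → X x × Flat cs x) (sym (vec-ext x≡y)) p

  to-large : ∀ cs Bd T → 2 + Bd ≤ T → ∀ x i → ¬ lookup x i < T → X x → Flat cs x → Large cs Bd T x
  to-large cs Bd T l x i ni xx fl =
    let (n , n∈ , g , hn) = covering cs Bd T x i l (≮⇒≥ ni) fl in n , n∈ , g , xx , fl , hn

  split : ∀ cs Bd T → 2 + Bd ≤ T → ∀ x → X x → Flat cs x → Small cs T x ⊎ Large cs Bd T x
  split cs Bd T l x xx fl with Fin.all? (λ i → lookup x i <? T)
  ... | yes small = inj₁ (x , ∈-allVecs x small , (λ _ → refl) , xx , fl)
  ... | no ¬small = let (i , ni) = Fin.¬∀⟶∃¬ m (λ i → lookup x i < T) (λ i → lookup x i <? T) ¬small in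
    inj₂ (to-large cs Bd T l x i ni xx fl)

  def-Small : ∀ cs T → (∀ y → y ∈ allVecs m T → Dec (X y × Flat cs y)) → Def (Small cs T)
  def-Small cs T near = def-any (allVecs m T) λ y y∈ →
    def-∧ (def-∀Fin m λ i → def-≡ (fun-var i) (fun-const (lookup y i))) (def-dec (near y y∈))

  def-Large : ∀ cs Bd T → (∀ n → n ∈ allVecs m (k * (2 + Bd)) → Def (λ x → Good cs Bd n × X x × Flat cs x × In (cone n T) x)) →
    Def (Large cs Bd T)
  def-Large cs Bd T pieces = def-any (allVecs m (k * (2 + Bd))) pieces

  union : ∀ cs Bd T → 2 + Bd ≤ T → Def (Small cs T) → Def (Large cs Bd T) → Presburger-on cs
  union cs Bd T l a b = def-map (λ x →
      (λ { (inj₁ s) → ret (from-small cs T x s) ; (inj₂ (_ , _ , _ , xx , fl , _)) → ret (xx , fl) }) ,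
      λ (xx , fl) → ret (split cs Bd T l x xx fl))
    (def-∨ a b)

  -- Induction on the codimension; exhausted fuel would mean more than m independent equations. The
  -- points with all coordinates below T are finite in number and are listed; T is chosen only after
  -- the partners of the finitely many cones are known, since it must exceed all their thresholds.
  on-flats : ∀ fuel cs → TriangularCons cs → List.length cs + fuel ≡ suc m → DN (Presburger-on cs)
  on-flats zero cs tri e = ⊥-elim (<⇒≱ (≤-reflexive (trans (sym e) (+-identityʳ _))) (triangular-cons-length cs tri))
  on-flats (suc fuel) cs tri e = do
    (rs , cover) ← representatives (classes cs)
    let (Bd , bd) = bound-all rs (dot ones)
        Box = allVecs m (k * (2 + Bd))
    data-at ← dn-List Box λ n _ → decide-good cs rs cover Bd (λ r r∈ i → ≤-trans (lookup≤sum r i) (bd r r∈)) n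
    let (B , thr) = bound-∃ Box data-at
        T = 2 + Bd + B
    pieces ← dn-List Box λ n n∈ → piece cs Bd n T (≤-trans (proj₁ (proj₂ (thr n n∈))) (m≤n+m B (2 + Bd))) (proj₂ (proj₂ (thr n n∈))) ih
    near ← dn-List (allVecs m T) λ y _ → em (X y × Flat cs y)
    ret (union cs Bd T (m≤m+n (2 + Bd) B) (def-Small cs T near) (def-Large cs Bd T pieces))
    where
      ih : ∀ e → (∀ e' → e' ∈ cs → Zero e' (f e) (g e)) → ¬ Zero e (f e) (g e) → DN (Presburger-on (e ∷ cs))
      ih e' z nz = on-flats fuel (e' ∷ cs) (nz , z , tri) (trans (sym (+-suc (List.length cs) fuel)) e)

  presburger : DN (Def X)
  presburger = do
    d ← on-flats (suc m) [] tt refl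
    ret (def-map (λ x → (λ (xx , _) → ret xx) , λ xx → ret (xx , λ _ ())) d)

-- From undefinable sets to powers, and the conclusion

undefinable-expands : ∀ k → k ≥ 2 → ∀ (X : Vec ℕ m → Set) → Recognizable k m X → ¬ DefinableInPresburger m X →
  DN (∃ λ L → Periodicity.DefSet (m ∷ []) (interp₁ X) L × Expanding L)
undefinable-expands {m} k k≥2 X rec ¬def none = Presburger-criterion.presburger k k≥2 X
  (regular-recognizable k k≥2 X rec) (λ L d ex → none (L , d , ex)) definable
  where
    definable : ¬ Definability.Def [] noRels X
    -- The double negation within the formula absorbs the one in `complete`; stability of `X`
    -- removes the one in `sound`.
    definable d = ¬def (neg (neg φ) , λ x → mk⇔
        (λ s → recognizable-stable k k≥2 X rec x (s >>= Definability.sound d x))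
        (λ Xx → Definability.complete d x Xx))
      where
        φ : Formula [] m
        φ = Definability.formula d

module _ (k : ℕ) (k≥2 : k ≥ 2) (X : Vec ℕ m → Set) (reg : Regular k X) where
  open Periodicity (m ∷ []) (interp₁ X)

  finitely-many-classes : ∀ {R} → DefSet R →
    DN (∃ λ N → ∀ (f : ℕ → ℕ) → DN (∃ λ i → ∃ λ j → i < j × j ≤ N × Nerode k R (f i) (f j)))
  finitely-many-classes {R} dR = do
    r ← regular-definable k k≥2 X reg {R = λ ρ → R (lookup ρ v0)} dR
    (N , h) ← pigeonhole-agree (Regular.preds r)
    ret (N , λ f → do
      (i , j , i<j , j≤N , ag) ← h (λ i → f i ∷ [])
      ret (i , j , i<j , j≤N , λ s w w< → Regular.nerode r (f i ∷ []) (f j ∷ []) ag s (w ∷ []) λ { fz → w< }))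

  powers-from-progressions : ∀ {R} → DefSet R → (∀ b → DN (∃ λ x → b ≤ x × R x)) → ∀ M κ → suc κ ≡ k ^ M → 1 ≤ κ →
    ∀ fam bound → (∀ e D → (e , D) ∈ fam → 1 ≤ D × (∀ q → DN (R (e + D * rep (suc κ) q)))) →
    (∀ x → R x → bound ≤ x → DN (∃ λ e → ∃ λ D → (e , D) ∈ fam × ∃ λ q → x ≡ e + D * rep (suc κ) q)) →
    DN (∃ λ a → 1 ≤ a × DefSet (Power (k ^ a)))
  powers-from-progressions {R} dR infinite M κ e κ≥1 fam bound members cover = do
    (x , l , Rx) ← infinite bound
    (c , D , cD∈ , _) ← cover x Rx l
    let open Define-powers (m ∷ []) (interp₁ X) R dR κ κ≥1 fam bound members cover c D cD∈
        exp≡ = trans (cong (_^ exponent) e) (^-*-assoc k M exponent)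
    ret (M * exponent , positive exponent exponent≥1 , subst (λ K → DefSet (Power K)) exp≡ def-powers)
    where
      M≢0 : M ≢ 0
      M≢0 refl = <⇒≢ κ≥1 (sym (suc-injective e))
      positive : ∀ L → 1 ≤ L → 1 ≤ M * L
      positive L l = n≢0⇒n>0 M≢0 ⊗ l

  powers-from-gaps : ∀ {R} → DefSet R → (∀ b → DN (∃ λ x → b ≤ x × R x)) → Gaps-grow R →
    DN (∃ λ a → 1 ≤ a × DefSet (Power (k ^ a)))
  powers-from-gaps {R} dR infinite gaps = do
    (N , finite) ← finitely-many-classes {R} dR
    (fam , bound , members , cover) ← Progressions.progressions k k≥2 R N finite gaps
    from N finite (k ^ all-div N) refl (Progressions.K≥2 k k≥2 R N finite gaps) fam bound members cover
    where
      -- The base is generalized to `K` so that it can be matched with `suc κ`.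
      from : ∀ N (finite : ∀ (f : ℕ → ℕ) → DN (∃ λ i → ∃ λ j → i < j × j ≤ N × Nerode k R (f i) (f j))) K →
        K ≡ k ^ all-div N → 2 ≤ K → ∀ fam bound →
        (∀ e D → (e , D) ∈ fam → 1 ≤ D × (∀ q → DN (R (e + D * rep K q)))) →
        (∀ x → R x → bound ≤ x → DN (∃ λ e → ∃ λ D → (e , D) ∈ fam × ∃ λ q → x ≡ e + D * rep K q)) →
        DN (∃ λ a → 1 ≤ a × DefSet (Power (k ^ a)))
      from N finite (suc κ) e (s≤s κ≥1) = powers-from-progressions {R} dR infinite (all-div N) κ e κ≥1

  powers-from-expanding : ∀ {L} → DefSet L → Expanding L → DN (∃ λ a → 1 ≤ a × DefSet (Power (k ^ a)))
  powers-from-expanding {L} dL expanding = powers-from-gaps {First} def-First first-infinite first-gaps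
    where
      open First-after-gap (m ∷ []) (interp₁ X) L dL expanding

-- Bès, Michaux–Villemaire: k-recognizable and not Presburger definable implies
-- that the powers of some k ^ a are definable.
definable-powers : ∀ k → k ≥ 2 → ∀ (X : Vec ℕ m → Set) → Recognizable k m X → ¬ DefinableInPresburger m X →
  DN (∃ λ a → 1 ≤ a × Periodicity.DefSet (m ∷ []) (interp₁ X) (Power (k ^ a)))
definable-powers k k≥2 X rec ¬def = do
  (L , dL , expanding) ← undefinable-expands k k≥2 X rec ¬def
  powers-from-expanding k k≥2 X (regular-recognizable k k≥2 X rec) {L} dL expanding

module _ {rels : List ℕ} (I : Interp rels) (X : Vec ℕ m → Set) (ξ : ∀ {v} → Vec (Term v) m → Formula rels v)
  (sat-ξ : ∀ {v} (ρ : Vec ℕ v) ts → Iff (Sat {rels} I ρ (ξ ts)) (X (evalTs ρ ts))) where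

  embed : Formula (m ∷ []) v → Formula rels v
  embed (eq s t) = eq s t
  embed (rel fz ts) = ξ ts
  embed (neg φ) = neg (embed φ)
  embed (conj φ ψ) = conj (embed φ) (embed ψ)
  embed (ex φ) = ex (embed φ)

  sat-embed : ∀ (φ : Formula (m ∷ []) v) ρ → Iff (Sat {rels} I ρ (embed φ)) (Sat {m ∷ []} (interp₁ X) ρ φ)
  sat-embed (eq s t) ρ = Iff-refl
  sat-embed (rel fz ts) ρ = sat-ξ ρ ts
  sat-embed (neg φ) ρ = (λ n → ret λ s → proj₂ (sat-embed φ ρ) s n) , λ n → ret λ s → proj₁ (sat-embed φ ρ) s n
  sat-embed (conj φ ψ) ρ =
    (λ (a , b) → proj₁ (sat-embed φ ρ) a >>= λ a' → proj₁ (sat-embed ψ ρ) b >>= λ b' → ret (a' , b')) ,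
    λ (a , b) → proj₂ (sat-embed φ ρ) a >>= λ a' → proj₂ (sat-embed ψ ρ) b >>= λ b' → ret (a' , b')
  sat-embed (ex φ) ρ =
    (λ (x , s) → proj₁ (sat-embed φ (x ∷ ρ)) s >>= λ s' → ret (x , s')) ,
    λ (x , s) → proj₂ (sat-embed φ (x ∷ ρ)) s >>= λ s' → ret (x , s')

  def-embed : ∀ {R : Vec ℕ v → Set} → Definability.Def (m ∷ []) (interp₁ X) R → Definability.Def rels I R
  def-embed (Definability.mkDef φ s c) = Definability.mkDef (embed φ)
    (λ ρ x → proj₁ (sat-embed φ ρ) x >>= s ρ) (λ ρ r → c ρ r >>= proj₂ (sat-embed φ ρ))

independent-powers : ∀ {k ℓ} → MultIndep k ℓ → ∀ {a b} → 1 ≤ a → 1 ≤ b →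
  ∀ i j → 1 ≤ i → 1 ≤ j → (k ^ a) ^ i ≢ (ℓ ^ b) ^ j
independent-powers {k} {ℓ} indep {a} {b} a≥1 b≥1 i j i≥1 j≥1 e = indep (a * i) (b * j) (a≥1 ⊗ i≥1) (b≥1 ⊗ j≥1)
  (trans (sym (^-*-assoc k a i)) (trans e (^-*-assoc ℓ b j)))

2≤power : ∀ k a → k ≥ 2 → 1 ≤ a → 2 ≤ k ^ a
2≤power k a k≥2 a≥1 = ≤-trans k≥2 (≤-trans (≤-reflexive (sym (*-identityʳ k))) (^-monoʳ-≤ k {{>-nonZero (≤-trans (s≤s z≤n) k≥2)}} a≥1))

two-powers-undecidable : ∀ (rels : List ℕ) (I : Interp rels) K Λ → 2 ≤ K → 2 ≤ Λ →
  (∀ a b → 1 ≤ a → 1 ≤ b → K ^ a ≢ Λ ^ b) →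
  Periodicity.DefSet rels I (Power K) → Periodicity.DefSet rels I (Power Λ) → ¬ TheoryDecidable {rels} I
two-powers-undecidable rels I K Λ K≥2 Λ≥2 indep dK dΛ =
  Diagonal.undecidable rels I K
    (def-∧ (def-app₁ {P = Power K} dK (fun-var v1)) (def-≡ (fun-var v0) (fun-var v1)))
    (def-∧ (def-≡ (fun-var v1) (fun-var v3)) (def-≡ (fun-scale K (fun-var v0)) (fun-var v2)))
    (λ f u t → H f t (u ∷ []) t)
    (λ f → def-H f {2} v1 (v0 ∷ []) v1)
    accepts-sound accepts-complete
  where
    open Programs rels I K Λ K≥2 Λ≥2 indep dK dΛ
    open Periodicity rels I

theoremA : (k ℓ m n : ℕ) → k ≥ 2 → ℓ ≥ 2 → MultIndep k ℓ →
  (X : Vec ℕ m → Set) → (Y : Vec ℕ n → Set) →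
  Recognizable k m X → Recognizable ℓ n Y →
  ¬ DefinableInPresburger m X → ¬ DefinableInPresburger n Y →
  ¬ TheoryDecidable (interpXY X Y)
theoremA k ℓ m n k≥2 ℓ≥2 indep X Y recX recY ¬defX ¬defY decidable = (do
  (a , a≥1 , dX) ← definable-powers k k≥2 X recX ¬defX
  (b , b≥1 , dY) ← definable-powers ℓ ℓ≥2 Y recY ¬defY
  ⊥-elim (two-powers-undecidable (sigXY m n) (interpXY X Y) (k ^ a) (ℓ ^ b) (2≤power k a k≥2 a≥1) (2≤power ℓ b ℓ≥2 b≥1)
    (independent-powers indep a≥1 b≥1)
    (def-embed (interpXY X Y) X (rel fz) (λ _ _ → Iff-refl) dX)
    (def-embed (interpXY X Y) Y (rel (fs fz)) (λ _ _ → Iff-refl) dY) decidable)) id
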